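{- Let $p$ be a prime with $p\equiv 1 \pmod 4$, and let $\mathcal{C}(p)$ be the family of graphs defined in the context. (a) A graph $\Gamma$ belongs to $\mathcal{C}(p)$ if and only if $\Gamma$ is a connected non-bipartite antipodal double cover of the complete graph $K_{p+1}$ and $\operatorname{Aut}\Gamma \cong PSL(2,p)\times Z_2$. (b) All graphs in $\mathcal{C}(p)$ are isomorphic to each other, are geodesic transitive, and have diameter $3$.
   Context: All graphs are finite, simple and undirected. For a finite group $G$, a core-free subgroup $H$ and $g\in G$ with $G=\langle H,g\rangle$ and $HgH=Hg^{ -1}H$, the coset graph $\mathrm{Cos}(G,H,HgH)$ has vertex set the right cosets $\{Hx : x\in G\}$, with $Hx$ adjacent to $Hy$ iff $yx^{ -1}\in HgH$. The family $\mathcal{C}(p)$: $\mathcal{C}(5)$ consists only of the icosahedron. For a prime $p>5$ with $p\equiv 1\pmod 4$, $\mathcal{C}(p)$ consists of the coset graphs $\mathrm{Cos}(G,H,HgH)$ obtained as follows: $G=PSL(2,p)$; choose $a\in G$ of order $p$, so that $N_G(\langle a\rangle)=\langle a\rangle{:}\langle b\rangle\cong Z_p{:}Z_{(p-1)/2}$ for some $b\in G$ of order $(p-1)/2$; then $N_G(\langle b^2\rangle)=\langle b\rangle{:}\langle c\rangle\cong D_{p-1}$ (dihedral of order $p-1$) for some $c\in G$ of order $2$; let $H=\langle a\rangle{:}\langle b^2\rangle$ and $g=cb^{2i}$ for some integer $i$. For a graph $\Gamma$ of diameter $d\ge 2$, $\Gamma$ is antipodal if the relation "equal or at distance $d$"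 is an equivalence relation on vertices, i.e. the vertex set is partitioned into fibres such that distinct vertices in the same fibre are at distance $d$ and vertices in different fibres are at distance less than $d$. The antipodal quotient has the fibres as vertices, two fibres adjacent iff some vertex of one is adjacent to some vertex of the other. $\Gamma$ is an antipodal cover of its quotient $\Sigma$ if for every edge $\{B,B'\}$ of $\Sigma$ and every $v\in B$, $v$ has exactly one neighbour in $B'$; it is a double cover if fibres have size $2$. An $i$-geodesic is a shortest path between two vertices at distance $i$; $\Gamma$ is geodesic transitive if $\operatorname{Aut}\Gamma$ is transitive on the set of $i$-geodesics for every $1\le i\le \operatorname{diam}(\Gamma)$. -}

module Defs where

open import Data.Nat as ℕ using (ℕ; zero; suc; _≤_; _<_; _≡ᵇ_; _<ᵇ_)
open import Data.Integer as ℤ using (ℤ; +_; -_; _-_) renaming (_+_ to _+ℤ_; _*_ to _*ℤ_)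
open import Data.Integer.Divisibility using () renaming (_∣_ to _∣ℤ_)
open import Data.Fin using (Fin; toℕ)
open import Data.Bool using (Bool; true; false; _∧_; _∨_; _xor_; T)
open import Data.Bool.Properties using (∨-comm)
open import Data.List using (List; []; _∷_)
open import Data.Bool.ListAction using (any)
open import Data.Product using (Σ; ∃; ∃-syntax; _×_; _,_)
open import Data.Sum using (_⊎_)
open import Data.Unit using (⊤)
open import Relation.Nullary using (¬_)
open import Relation.Binary.PropositionalEquality using (_≡_; _≢_; refl)
open import Function.Bundles using (_⇔_)

record Graph : Set where
  field
    n      : ℕ
    adj    : Fin n → Fin n → Bool
    sym    : ∀ u v → adj u v ≡ adj v u
    irrefl : ∀ u → adj u u ≡ false
open Graph public

Adj : (Γ : Graph) → Fin (n Γ) → Fin (n Γ) → Set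
Adj Γ u v = adj Γ u v ≡ true

data Walk (Γ : Graph) : Fin (n Γ) → Fin (n Γ) → ℕ → Set where
  here : ∀ {u} → Walk Γ u u 0
  step : ∀ {u v w k} → Adj Γ u v → Walk Γ v w k → Walk Γ u w (suc k)

Dist : (Γ : Graph) → Fin (n Γ) → Fin (n Γ) → ℕ → Set
Dist Γ u v k = Walk Γ u v k × (∀ m → Walk Γ u v m → k ≤ m)

Connected : Graph → Set
Connected Γ = ∀ u v → ∃[ k ] Walk Γ u v k

Diameter : Graph → ℕ → Set
Diameter Γ d =
  (∀ u v → ∃[ k ] (k ≤ d × Walk Γ u v k)) × (∃[ u ] ∃[ v ] Dist Γ u v d)

Bipartite : Graph → Set
Bipartite Γ = Σ (Fin (n Γ) → Bool) λ col → ∀ u v → Adj Γ u v → col u ≢ col v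

record Iso (Γ Δ : Graph) : Set where
  field
    to      : Fin (n Γ) → Fin (n Δ)
    from    : Fin (n Δ) → Fin (n Γ)
    from-to : ∀ u → from (to u) ≡ u
    to-from : ∀ v → to (from v) ≡ v
    pres    : ∀ u v → adj Δ (to u) (to v) ≡ adj Γ u v

record Aut (Γ : Graph) : Set where
  field
    fun     : Fin (n Γ) → Fin (n Γ)
    inv     : Fin (n Γ) → Fin (n Γ)
    inv-fun : ∀ u → inv (fun u) ≡ u
    fun-inv : ∀ v → fun (inv v) ≡ v
    pres    : ∀ u v → adj Γ (fun u) (fun v) ≡ adj Γ u v
open Aut public

AntiRel : (Γ : Graph) → ℕ → Fin (n Γ) → Fin (n Γ) → Set
AntiRel Γ d u v = u ≡ v ⊎ Dist Γ u v d

Antipodal : Graph → Set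
Antipodal Γ = Σ ℕ λ d → Diameter Γ d × 2 ≤ d ×
  ((∀ u → AntiRel Γ d u u) ×
   (∀ u v → AntiRel Γ d u v → AntiRel Γ d v u) ×
   (∀ u v w → AntiRel Γ d u v → AntiRel Γ d v w → AntiRel Γ d u w))

-- Γ is an antipodal double cover of K_m. The fibres are labelled by Fin m via
-- π (a bijection between the fibres and Fin m); the antipodal quotient is the
-- complete graph K_m (distinct fibres are adjacent); every fibre has size 2;
-- and each vertex has exactly one neighbour in every fibre adjacent to its own.
AntipodalDoubleCoverOfK : Graph → ℕ → Set
AntipodalDoubleCoverOfK Γ m = Σ ℕ λ d → Diameter Γ d × 2 ≤ d ×
  ((∀ u → AntiRel Γ d u u) ×
   (∀ u v → AntiRel Γ d u v → AntiRel Γ d v u) ×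
   (∀ u v w → AntiRel Γ d u v → AntiRel Γ d v w → AntiRel Γ d u w)) ×
  Σ (Fin (n Γ) → Fin m) λ π →
    (∀ u v → (π u ≡ π v) ⇔ AntiRel Γ d u v) ×
    (∀ x → ∃[ u ] ∃[ v ] (u ≢ v × π u ≡ x × π v ≡ x ×
                          (∀ w → π w ≡ x → w ≡ u ⊎ w ≡ v))) ×
    (∀ x y → (x ≢ y) ⇔
       (∃[ u ] ∃[ v ] (π u ≡ x × π v ≡ y × Adj Γ u v))) ×
    (∀ u y → (∃[ u' ] ∃[ v' ] (π u' ≡ π u × π v' ≡ y × Adj Γ u' v')) →
       ∃[ w ] (Adj Γ u w × π w ≡ y ×
               (∀ w' → Adj Γ u w' → π w' ≡ y → w' ≡ w)))

record Geodesic (Γ : Graph) (i : ℕ) : Set where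
  field
    vert : Fin (suc i) → Fin (n Γ)
    adjacent : ∀ (j : Fin i) →
      Adj Γ (vert (Data.Fin.inject₁ j)) (vert (Data.Fin.suc j))
    geod : Dist Γ (vert Data.Fin.zero) (vert (Data.Fin.fromℕ i)) i
open Geodesic public

GeodesicTransitive : Graph → Set
GeodesicTransitive Γ = ∀ d → Diameter Γ d → ∀ i → 1 ≤ i → i ≤ d →
  (P Q : Geodesic Γ i) →
  Σ (Aut Γ) λ σ → ∀ j → fun σ (vert P j) ≡ vert Q j

-- PSL(2,p): 2×2 integer matrices of determinant ≡ 1 (mod p),
-- modulo congruence mod p and the centre {±I}.

record M2 : Set where
  constructor mat
  field
    m11 m12 m21 m22 : ℤ

_⊗_ : M2 → M2 → M2
mat a b c d ⊗ mat a' b' c' d' =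
  mat (a *ℤ a' +ℤ b *ℤ c') (a *ℤ b' +ℤ b *ℤ d')
      (c *ℤ a' +ℤ d *ℤ c') (c *ℤ b' +ℤ d *ℤ d')
infixl 7 _⊗_

I₂ : M2
I₂ = mat (+ 1) (+ 0) (+ 0) (+ 1)

-- inverse of a determinant-1 matrix
inv₂ : M2 → M2
inv₂ (mat a b c d) = mat d (- b) (- c) a

_^_ : M2 → ℕ → M2
x ^ zero = I₂
x ^ suc k = x ⊗ (x ^ k)

det : M2 → ℤ
det (mat a b c d) = a *ℤ d - b *ℤ c

_≡[_]_ : ℤ → ℕ → ℤ → Set
x ≡[ p ] y = (+ p) ∣ℤ (x - y)

InSL : ℕ → M2 → Set
InSL p x = det x ≡[ p ] (+ 1)

-- equality in PSL(2,p) = SL(2,p)/{±I}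
_≈[_]_ : M2 → ℕ → M2 → Set
mat a b c d ≈[ p ] mat a' b' c' d' =
  (a ≡[ p ] a' × b ≡[ p ] b' × c ≡[ p ] c' × d ≡[ p ] d') ⊎
  (a ≡[ p ] (- a') × b ≡[ p ] (- b') × c ≡[ p ] (- c') × d ≡[ p ] (- d'))

HasOrder : ℕ → M2 → ℕ → Set
HasOrder p x k = 1 ≤ k × (x ^ k) ≈[ p ] I₂ ×
  (∀ j → 1 ≤ j → j < k → ¬ ((x ^ j) ≈[ p ] I₂))

InCyc : ℕ → M2 → M2 → Set
InCyc p x y = ∃[ j ] y ≈[ p ] (x ^ j)

InProd : ℕ → M2 → M2 → M2 → Set
InProd p x z y = ∃[ j ] ∃[ k ] y ≈[ p ] ((x ^ j) ⊗ (z ^ k))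

Normalises : ℕ → (M2 → Set) → M2 → Set
Normalises p K x =
  (∀ y → InSL p y → K y → K (x ⊗ y ⊗ inv₂ x)) ×
  (∀ y → InSL p y → K y → Σ M2 λ z → InSL p z × K z × (y ≈[ p ] (x ⊗ z ⊗ inv₂ x)))

NormaliserIs : ℕ → M2 → M2 → M2 → Set
NormaliserIs p x y z = ∀ w → InSL p w → Normalises p (InCyc p x) w ⇔ InProd p y z w

data Word (p : ℕ) (S : M2 → Set) : M2 → Set where
  empty : Word p S I₂
  consS : ∀ {s w} → S s → Word p S w → Word p S (s ⊗ w)
  consI : ∀ {s w} → S s → Word p S w → Word p S (inv₂ s ⊗ w)

InGen : ℕ → (M2 → Set) → M2 → Set
InGen p S x = Σ M2 λ w → Word p S w × (x ≈[ p ] w)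

-- the icosahedron on Fin 12 (0 top, 1..5 upper ring, 6..10 lower ring, 11 bottom)
icoEdges : List (ℕ × ℕ)
icoEdges =
  (0 , 1) ∷ (0 , 2) ∷ (0 , 3) ∷ (0 , 4) ∷ (0 , 5) ∷
  (1 , 2) ∷ (2 , 3) ∷ (3 , 4) ∷ (4 , 5) ∷ (1 , 5) ∷
  (1 , 6) ∷ (1 , 7) ∷ (2 , 7) ∷ (2 , 8) ∷ (3 , 8) ∷
  (3 , 9) ∷ (4 , 9) ∷ (4 , 10) ∷ (5 , 10) ∷ (5 , 6) ∷
  (6 , 7) ∷ (7 , 8) ∷ (8 , 9) ∷ (9 , 10) ∷ (6 , 10) ∷
  (6 , 11) ∷ (7 , 11) ∷ (8 , 11) ∷ (9 , 11) ∷ (10 , 11) ∷ []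

isEdge : ℕ → ℕ → Bool
isEdge i j = (i <ᵇ j) ∧ any (λ e → (Data.Product.proj₁ e ≡ᵇ i) ∧ (Data.Product.proj₂ e ≡ᵇ j)) icoEdges

private
  <ᵇ-irrefl : ∀ i → (i <ᵇ i) ≡ false
  <ᵇ-irrefl zero = refl
  <ᵇ-irrefl (suc zero) = refl
  <ᵇ-irrefl (suc (suc i)) = <ᵇ-irrefl (suc i)

  isEdge-irrefl : ∀ i → isEdge i i ≡ false
  isEdge-irrefl i rewrite <ᵇ-irrefl i = refl

  or-self-false : ∀ {b} → b ≡ false → (b ∨ b) ≡ false
  or-self-false refl = refl

icosahedron : Graph
icosahedron = record
  { n = 12
  ; adj = λ u v → isEdge (toℕ u) (toℕ v) ∨ isEdge (toℕ v) (toℕ u)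
  ; sym = λ u v → ∨-comm (isEdge (toℕ u) (toℕ v)) (isEdge (toℕ v) (toℕ u))
  ; irrefl = λ u → or-self-false (isEdge-irrefl (toℕ u))
  }

-- Γ is (isomorphic to) a coset graph Cos(G,H,HgH) of the family C(p), p > 5:
-- G = PSL(2,p), a of order p, N_G(⟨a⟩) = ⟨a⟩:⟨b⟩ with b of order (p-1)/2,
-- N_G(⟨b²⟩) = ⟨b⟩:⟨c⟩ with c of order 2, H = ⟨a⟩:⟨b²⟩, g = c b^{2i};
-- H core-free, G = ⟨H,g⟩, HgH = Hg⁻¹H.  The vertex v of Γ corresponds to
-- the right coset H ψ(v), and this is a bijection onto the set of right cosets.
IsCosetGraphC : ℕ → Graph → Set
IsCosetGraphC p Γ =
  Σ M2 λ a → Σ M2 λ b → Σ M2 λ c → Σ ℕ λ i →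
  InSL p a × InSL p b × InSL p c ×
  HasOrder p a p ×
  HasOrder p b (ℕ._/_ (ℕ._∸_ p 1) 2) ×
  NormaliserIs p a a b ×
  HasOrder p c 2 ×
  NormaliserIs p (b ⊗ b) b c ×
  let H : M2 → Set
      H = InProd p a (b ⊗ b)
      g = c ⊗ ((b ⊗ b) ^ i)
      HgH : M2 → Set
      HgH x = Σ M2 λ h₁ → Σ M2 λ h₂ → H h₁ × H h₂ × x ≈[ p ] (h₁ ⊗ g ⊗ h₂)
      Hg⁻¹H : M2 → Set
      Hg⁻¹H x = Σ M2 λ h₁ → Σ M2 λ h₂ → H h₁ × H h₂ × x ≈[ p ] (h₁ ⊗ inv₂ g ⊗ h₂)
  in
  (∀ x → InSL p x → (∀ y → InSL p y → H (y ⊗ x ⊗ inv₂ y)) → x ≈[ p ] I₂) ×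
  (∀ x → InSL p x → InGen p (λ s → H s ⊎ s ≈[ p ] g) x) ×
  (∀ x → InSL p x → HgH x ⇔ Hg⁻¹H x) ×
  Σ (Fin (n Γ) → M2) λ ψ →
    (∀ v → InSL p (ψ v)) ×
    (∀ x → InSL p x → ∃[ v ] H (x ⊗ inv₂ (ψ v))) ×
    (∀ v w → H (ψ v ⊗ inv₂ (ψ w)) → v ≡ w) ×
    (∀ v w → Adj Γ v w ⇔ HgH (ψ w ⊗ inv₂ (ψ v)))

InC : ℕ → Graph → Set
InC p Γ = (p ≡ 5 × Iso Γ icosahedron) ⊎ (5 < p × IsCosetGraphC p Γ)

-- Aut Γ ≅ PSL(2,p) × Z₂ : a bijective homomorphism Aut Γ → PSL(2,p) × Z₂
-- (Z₂ = Bool under xor); automorphisms are compared pointwise.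

AutIsoPSL×Z2 : ℕ → Graph → Set
AutIsoPSL×Z2 p Γ =
  Σ (Aut Γ → M2 × Bool) λ φ →
    let φ₁ = λ σ → Data.Product.proj₁ (φ σ)
        φ₂ = λ σ → Data.Product.proj₂ (φ σ)
        _≈A_ : Aut Γ → Aut Γ → Set
        σ ≈A τ = ∀ u → fun σ u ≡ fun τ u
    in
    (∀ σ → InSL p (φ₁ σ)) ×
    (∀ σ τ → σ ≈A τ → φ₁ σ ≈[ p ] φ₁ τ × φ₂ σ ≡ φ₂ τ) ×
    (∀ σ τ ρ → (∀ u → fun ρ u ≡ fun σ (fun τ u)) →
       (φ₁ ρ ≈[ p ] (φ₁ σ ⊗ φ₁ τ)) × φ₂ ρ ≡ (φ₂ σ xor φ₂ τ)) ×
    (∀ σ τ → φ₁ σ ≈[ p ] φ₁ τ → φ₂ σ ≡ φ₂ τ → σ ≈A τ) ×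
    (∀ x e → InSL p x → Σ (Aut Γ) λ σ → φ₁ σ ≈[ p ] x × φ₂ σ ≡ e)

-- Every graph in question is the graph Γ(p) on the nonzero vectors of F_p² modulo nonzero squares, two
-- classes being adjacent when their determinant is a nonzero square (-1 is a square as p ≡ 1 mod 4).
--
-- A coset graph is Γ(p): H is the stabiliser in PSL(2,p) of a class of vectors v, and Hx ↦ x⁻¹v turns HgH into
-- the condition that det(v, xv) lie in a fixed square class. In Γ(p), distances are read off from the
-- determinant, matrices of square determinant give geodesic transitivity, and an automorphism fixing ∞
-- permutes the neighbours ⟨ x , 1 ⟩ of ∞ by a permutation f of F_p preserving squares of differences;
-- by Carlitz's theorem f is affine, so that Aut Γ(p) consists of matrices. Conversely, in a double cover of K_{p+1}
-- with this group, the unipotent elements fix one fibre and permute the others cyclically, so that the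
-- graph is given by a connection set S ⊆ F_p*, which the diagonal elements show to be invariant under
-- squares. If S is empty the cover is bipartite, if S is everything it is disconnected, and the squares and
-- the nonsquares both give Γ(p).

module Submission where

open import Data.Bool.Base using (Bool; _xor_; false; true)
open import Data.Empty using (⊥; ⊥-elim)
open import Data.Fin.Base as Fin using (Fin; fromℕ<; suc; toℕ; zero)
open import Data.Fin.Properties using (_≟_; any?; pigeonhole; toℕ-fromℕ<; toℕ-injective; toℕ<n)
open import Data.Integer.Base using (+_; -_; _*_; _+_; _-_; _^_; ℤ)
import Data.Integer.Properties as ℤₚ
open import Data.Integer.Tactic.RingSolver using (solve-∀)
open import Data.Nat.Base as ℕ using (NonZero; suc; zero; ℕ)
open import Data.Nat.DivMod using (_%_; _/_; m%n<n; m≡m%n+[m/n]*n)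
open import Data.Nat.Divisibility as ℕ∣ using (_∣_)
open import Data.Nat.Primality using (Prime; prime⇒nonTrivial)
import Data.Nat.Properties as ℕₚ
open import Data.Product.Base using (_,_; _×_; proj₁; proj₂; Σ; ∃)
open import Data.Sum.Base as Sum using (_⊎_; inj₁; inj₂)
open import Function.Bundles using (_⇔_; mk⇔)
open import Relation.Binary.PropositionalEquality using (_≡_; _≢_; cong; cong₂; refl; subst; sym; trans)
open import Relation.Nullary using (Dec; contradiction; no; yes; ¬?; ¬_)
open import Relation.Nullary.Decidable using (decidable-stable)

-- Every graph is compared with Γ(p) through a labelling by square classes of vectors (`Model`). Any
-- two labellings give isomorphic graphs by the identity matrix, so the choices of a, b, c and i in
-- a coset graph never have to be compared with one another. The Z₂ factor is a fixed nonsquare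
-- scalar ν: it swaps the two classes on each line and is the antipodal map. A matrix of determinant
-- r² is r times a unimodular one, and the square class of r is its Z₂ coordinate. Counting takes
-- the place of subgroup theory: an element of order p that moves one of the p + 1 lines or fibres
-- has an orbit of length p, so the one left over is fixed. Carlitz's theorem rests on the leading
-- coefficient of a polynomial of degree below p being determined by its values; polynomials can
-- therefore be handled as functions with a degree bound. The case p = 5 stands apart because b² is
-- then trivial in PSL(2,5) and its normaliser is the whole group; the icosahedron is labelled
-- explicitly instead.

-- The prime field, as integers up to congruence.

module PrimeField (p : ℕ) (prime : Prime p) where

  open import Defs using (_≡[_]_)
  open import Data.Nat.Primality using (prime⇒nonZero; euclidsLemma)
  open import Data.Nat.Coprimality using (prime⇒coprime; coprime-Bézout)
  open import Data.Nat.GCD using (module Bézout)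
  open import Data.Integer.Base using (∣_∣)
  open import Data.Integer.Properties using (abs-*; pos-*; pos-+)
  open import Data.Integer.Divisibility.Signed using (divides; ∣ᵤ⇒∣; ∣⇒∣ᵤ)
  open import Data.Integer.DivMod using (_%ℕ_; _/ℕ_; n%ℕd<d; a≡a%ℕn+[a/ℕn]*n)
  open import Relation.Nullary.Decidable using (map′)
  open import Relation.Binary.PropositionalEquality

  private instance
    p≢0 : NonZero p
    p≢0 = prime⇒nonZero prime

  infix 4 _≋_ _≉_ _≋?_

  -- A record, because `x ≡[ p ] y` unfolds to a divisibility statement about an absolute value,
  -- from which unification cannot recover `x` and `y`.
  record _≋_ (x y : ℤ) : Set where
    constructor congruent
    field congruence : x ≡[ p ] y
  open _≋_ public

  _≉_ : ℤ → ℤ → Set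
  x ≉ y = ¬ (x ≋ y)

  abstract
    mod-intro : ∀ {x y} k → x - y ≡ k * + p → x ≋ y
    mod-intro k eq = congruent (∣⇒∣ᵤ (divides k eq))

    mod-elim : ∀ {x y} → x ≋ y → ∃ λ k → x - y ≡ k * + p
    mod-elim (congruent d) with ∣ᵤ⇒∣ d
    ... | divides k eq = k , eq

    lin₀ : ∀ {x y} → x ≡ y → x ≋ y
    lin₀ {x} refl = mod-intro (+ 0) (lem x)
      where lem : ∀ x → x - x ≡ + 0
            lem = solve-∀

    -- Certificates for congruences: once the difference of the two sides is written as a
    -- combination of the differences in the hypotheses, what remains is an identity of integer
    -- polynomials, which the ring solver proves.
    lin₁ : ∀ {x y a b} (c : ℤ) → a ≋ b → x - y ≡ c * (a - b) → x ≋ y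
    lin₁ {a = a} {b} c h eq with mod-elim h
    ... | k , e = mod-intro (c * k) (trans eq (trans (cong (c *_) e) (sym (ℤₚ.*-assoc c k (+ p)))))

    lin₂ : ∀ {x y a b a′ b′} (c : ℤ) → a ≋ b → (c′ : ℤ) → a′ ≋ b′ →
           x - y ≡ c * (a - b) + c′ * (a′ - b′) → x ≋ y
    lin₂ c h c′ h′ eq with mod-elim h | mod-elim h′
    ... | k , e | k′ , e′ = mod-intro (c * k + c′ * k′)
      (trans eq (trans (cong₂ (λ s t → c * s + c′ * t) e e′) (lem c k c′ k′ (+ p))))
      where lem : ∀ c k c′ k′ q → c * (k * q) + c′ * (k′ * q) ≡ (c * k + c′ * k′) * q
            lem = solve-∀

    lin₃ : ∀ {x y a b a′ b′ a″ b″} (c : ℤ) → a ≋ b → (c′ : ℤ) → a′ ≋ b′ → (c″ : ℤ) → a″ ≋ b″ →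
           x - y ≡ c * (a - b) + c′ * (a′ - b′) + c″ * (a″ - b″) → x ≋ y
    lin₃ c h c′ h′ c″ h″ eq with mod-elim h | mod-elim h′ | mod-elim h″
    ... | k , e | k′ , e′ | k″ , e″ = mod-intro (c * k + c′ * k′ + c″ * k″)
      (trans eq (trans (cong₂ (λ s t → s + c″ * t) (cong₂ (λ s t → c * s + c′ * t) e e′) e″)
        (lem c k c′ k′ c″ k″ (+ p))))
      where lem : ∀ c k c′ k′ c″ k″ q →
                  c * (k * q) + c′ * (k′ * q) + c″ * (k″ * q) ≡ (c * k + c′ * k′ + c″ * k″) * q
            lem = solve-∀

    lin₄ : ∀ {x y a b a′ b′ a″ b″ a‴ b‴} (c : ℤ) → a ≋ b → (c′ : ℤ) → a′ ≋ b′ →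
           (c″ : ℤ) → a″ ≋ b″ → (c‴ : ℤ) → a‴ ≋ b‴ →
           x - y ≡ c * (a - b) + c′ * (a′ - b′) + c″ * (a″ - b″) + c‴ * (a‴ - b‴) → x ≋ y
    lin₄ c h c′ h′ c″ h″ c‴ h‴ eq with mod-elim h | mod-elim h′ | mod-elim h″ | mod-elim h‴
    ... | k , e | k′ , e′ | k″ , e″ | k‴ , e‴ = mod-intro (c * k + c′ * k′ + c″ * k″ + c‴ * k‴)
      (trans eq (trans (cong₂ (λ s t → s + c‴ * t)
         (cong₂ (λ s t → s + c″ * t) (cong₂ (λ s t → c * s + c′ * t) e e′) e″) e‴)
        (lem c k c′ k′ c″ k″ c‴ k‴ (+ p))))
      where lem : ∀ c k c′ k′ c″ k″ c‴ k‴ q →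
                  c * (k * q) + c′ * (k′ * q) + c″ * (k″ * q) + c‴ * (k‴ * q)
                    ≡ (c * k + c′ * k′ + c″ * k″ + c‴ * k‴) * q
            lem = solve-∀

  ≋-refl : ∀ {x} → x ≋ x
  ≋-refl = lin₀ refl

  abstract
    ≋-sym : ∀ {x y} → x ≋ y → y ≋ x
    ≋-sym {x} {y} h = lin₁ (- + 1) h (lem x y)
      where lem : ∀ x y → y - x ≡ (- + 1) * (x - y)
            lem = solve-∀

    ≋-trans : ∀ {x y z} → x ≋ y → y ≋ z → x ≋ z
    ≋-trans {x} {y} {z} h k = lin₂ (+ 1) h (+ 1) k (lem x y z)
      where lem : ∀ x y z → x - z ≡ (+ 1) * (x - y) + (+ 1) * (y - z)
            lem = solve-∀

    +-cong : ∀ {x y u v} → x ≋ y → u ≋ v → x + u ≋ y + v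
    +-cong {x} {y} {u} {v} h k = lin₂ (+ 1) h (+ 1) k (lem x y u v)
      where lem : ∀ x y u v → (x + u) - (y + v) ≡ (+ 1) * (x - y) + (+ 1) * (u - v)
            lem = solve-∀

    *-cong : ∀ {x y u v} → x ≋ y → u ≋ v → x * u ≋ y * v
    *-cong {x} {y} {u} {v} h k = lin₂ u h y k (lem x y u v)
      where lem : ∀ x y u v → (x * u) - (y * v) ≡ u * (x - y) + y * (u - v)
            lem = solve-∀

    neg-cong : ∀ {x y} → x ≋ y → - x ≋ - y
    neg-cong {x} {y} h = lin₁ (- + 1) h (lem x y)
      where lem : ∀ x y → (- x) - (- y) ≡ (- + 1) * (x - y)
            lem = solve-∀

  *-congˡ : ∀ x {u v} → u ≋ v → x * u ≋ x * v
  *-congˡ x = *-cong (≋-refl {x})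

  *-congʳ : ∀ {x y} u → x ≋ y → x * u ≋ y * u
  *-congʳ u h = *-cong h (≋-refl {u})

  ^-cong : ∀ {x y} k → x ≋ y → x ^ k ≋ y ^ k
  ^-cong zero h = ≋-refl
  ^-cong {x} {y} (suc k) h = *-cong {x} {y} {x ^ k} {y ^ k} h (^-cong k h)

  abstract
    _≋?_ : ∀ x y → Dec (x ≋ y)
    x ≋? y = map′ congruent congruence (p ℕ∣.∣? ∣ x - y ∣)

    private
      ≋0⇒∣ : ∀ {x} → x ≋ + 0 → p ℕ∣.∣ ∣ x ∣
      ≋0⇒∣ {x} h = subst (λ z → p ℕ∣.∣ ∣ z ∣) (lem x) (congruence h)
        where lem : ∀ x → x - + 0 ≡ x
              lem = solve-∀

      ∣⇒≋0 : ∀ {x} → p ℕ∣.∣ ∣ x ∣ → x ≋ + 0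
      ∣⇒≋0 {x} h = congruent (subst (λ z → p ℕ∣.∣ ∣ z ∣) (sym (lem x)) h)
        where lem : ∀ x → x - + 0 ≡ x
              lem = solve-∀

    zero-product : ∀ x y → x * y ≋ + 0 → x ≋ + 0 ⊎ y ≋ + 0
    zero-product x y h with euclidsLemma ∣ x ∣ ∣ y ∣ prime (subst (p ℕ∣.∣_) (abs-* x y) (≋0⇒∣ h))
    ... | inj₁ d = inj₁ (∣⇒≋0 d)
    ... | inj₂ d = inj₂ (∣⇒≋0 d)

    small≉0 : ∀ {k} → 1 ℕ.≤ k → k ℕ.< p → + k ≉ + 0
    small≉0 {suc k} _ k<p h = ℕₚ.<⇒≱ k<p (ℕ∣.∣⇒≤ (≋0⇒∣ h))

    1≉0 : + 1 ≉ + 0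
    1≉0 = small≉0 ℕₚ.≤-refl (ℕ.nonTrivial⇒n>1 p {{prime⇒nonTrivial prime}})

    p≋0 : + p ≋ + 0
    p≋0 = mod-intro (+ 1) (lem (+ p))
      where lem : ∀ x → x - + 0 ≡ + 1 * x
            lem = solve-∀

    residue : ℤ → Fin p
    residue x = fromℕ< (n%ℕd<d x p)

    residue-≋ : ∀ x → + toℕ (residue x) ≋ x
    residue-≋ x = mod-intro (- (x /ℕ p)) (trans (cong (λ k → + k - x) (toℕ-fromℕ< (n%ℕd<d x p)))
      (trans (cong (λ z → + (x %ℕ p) - z) (a≡a%ℕn+[a/ℕn]*n x p)) (lem (+ (x %ℕ p)) (x /ℕ p) (+ p))))
      where lem : ∀ r q n → r - (r + q * n) ≡ (- q) * n
            lem = solve-∀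

    private
      ∸-collapse : ∀ {m n} → m ℕ.≤ n → n ℕ.< p → + n ≋ + m → n ℕ.∸ m ≡ 0
      ∸-collapse {m} {n} m≤n n<p h with n ℕ.∸ m in eq
      ... | zero = refl
      ... | suc k = contradiction
        (lin₁ {a = + n} {+ m} (+ 1) h
          (trans (cong (λ z → z - + 0) (trans (cong +_ (sym eq)) (trans (sym (ℤₚ.⊖-≥ m≤n)) (sym (ℤₚ.m-n≡m⊖n n m)))))
                 (lem (+ n - + m))))
        (small≉0 (ℕ.s≤s ℕ.z≤n) (ℕₚ.≤-<-trans (subst (ℕ._≤ n) eq (ℕₚ.m∸n≤m n m)) n<p))
        where lem : ∀ x → x - + 0 ≡ + 1 * x
              lem = solve-∀

    toℕ-≋-injective : ∀ {i j : Fin p} → + toℕ i ≋ + toℕ j → i ≡ j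
    toℕ-≋-injective {i} {j} h with ℕₚ.≤-total (toℕ i) (toℕ j)
    ... | inj₁ i≤j = toℕ-injective (ℕₚ.≤-antisym i≤j (ℕₚ.m∸n≡0⇒m≤n (∸-collapse i≤j (toℕ<n j) (≋-sym h))))
    ... | inj₂ j≤i = toℕ-injective (ℕₚ.≤-antisym (ℕₚ.m∸n≡0⇒m≤n (∸-collapse j≤i (toℕ<n i) h)) j≤i)

  *-≉0 : ∀ {x y} → x ≉ + 0 → y ≉ + 0 → x * y ≉ + 0
  *-≉0 {x} {y} hx hy h with zero-product x y h
  ... | inj₁ z = hx z
  ... | inj₂ z = hy z

  ^-≉0 : ∀ {x} k → x ≉ + 0 → x ^ k ≉ + 0
  ^-≉0 zero h = 1≉0
  ^-≉0 {x} (suc k) h = *-≉0 {x} {x ^ k} h (^-≉0 k h)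

  ≉0-resp : ∀ {x y} → x ≋ y → x ≉ + 0 → y ≉ + 0
  ≉0-resp h x≉0 y≋0 = x≉0 (≋-trans h y≋0)

  abstract
    *-cancelˡ : ∀ z {x y} → z ≉ + 0 → z * x ≋ z * y → x ≋ y
    *-cancelˡ z {x} {y} hz h with zero-product z (x - y) (lin₁ (+ 1) h (lem x y z))
      where lem : ∀ x y z → z * (x - y) - + 0 ≡ + 1 * (z * x - z * y)
            lem = solve-∀
    ... | inj₁ z≋0 = contradiction z≋0 hz
    ... | inj₂ d = lin₁ (+ 1) d (lem x y)
      where lem : ∀ x y → x - y ≡ + 1 * ((x - y) - + 0)
            lem = solve-∀

    inverse : ∀ {x} → x ≉ + 0 → ∃ λ y → x * y ≋ + 1
    inverse {x} x≉0 with toℕ (residue x) in eq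
    ... | zero = contradiction (≋-trans (≋-sym (residue-≋ x)) (lin₀ (cong +_ eq))) x≉0
    -- The residue lies strictly between 0 and `p`, hence is coprime to `p`. Its Bézout coefficient,
    -- with the sign belonging to whichever identity holds, is the inverse.
    ... | suc r = go (coprime-Bézout (prime⇒coprime prime (subst (ℕ._< p) eq (toℕ<n (residue x)))))
      where
      r≋x : + suc r ≋ x
      r≋x = ≋-trans (lin₀ (cong +_ (sym eq))) (residue-≋ x)
      go : Bézout.Identity 1 p (suc r) → ∃ λ y → x * y ≋ + 1
      go (Bézout.+- s t e) = - + t , lin₂ {a = + suc r} {x} {+ p} {+ 0} (+ t) r≋x (- + s) p≋0
        (trans (lem₁ x (+ t)) (trans (cong (λ z → - (x * + t) - z) e′) (lem₂ x (+ t) (+ s) (+ p) (+ suc r))))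
        where
        e′ : + 1 ≡ + s * + p - + t * + suc r
        e′ = trans (lem₃ (+ 1) (+ t * + suc r)) (cong (λ z → z - + t * + suc r)
               (trans (cong (λ z → + 1 + z) (sym (pos-* t (suc r)))) (trans (sym (pos-+ 1 (t ℕ.* suc r))) (trans (cong +_ e) (pos-* s p)))))
          where lem₃ : ∀ u v → u ≡ (u + v) - v
                lem₃ = solve-∀
        lem₁ : ∀ x t → x * (- t) - + 1 ≡ - (x * t) - + 1
        lem₁ = solve-∀
        lem₂ : ∀ x t s q r → - (x * t) - (s * q - t * r) ≡ t * (r - x) + (- s) * (q - + 0)
        lem₂ = solve-∀
      go (Bézout.-+ s t e) = + t , lin₂ {a = + suc r} {x} {+ p} {+ 0} (- + t) r≋x (+ s) p≋0
        (trans (cong (λ z → x * + t - z) e′) (lem₂ x (+ t) (+ s) (+ p) (+ suc r)))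
        where
        e′ : + 1 ≡ + t * + suc r - + s * + p
        e′ = trans (lem₃ (+ 1) (+ s * + p)) (cong (λ z → z - + s * + p)
               (trans (cong (λ z → + 1 + z) (sym (pos-* s p))) (trans (sym (pos-+ 1 (s ℕ.* p))) (trans (cong +_ e) (pos-* t (suc r))))))
          where lem₃ : ∀ u v → u ≡ (u + v) - v
                lem₃ = solve-∀
        lem₂ : ∀ x t s q r → x * t - (t * r - s * q) ≡ (- t) * (r - x) + s * (q - + 0)
        lem₂ = solve-∀

  ^-+ : ∀ x m n → x ^ (m ℕ.+ n) ≡ x ^ m * x ^ n
  ^-+ x m n = ℤₚ.^-distribˡ-+-* x m n

  1^ : ∀ n → (+ 1) ^ n ≡ + 1
  1^ = ℤₚ.^-zeroˡ

-- Polynomial functions with degree bounds.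

module Polynomials (p : ℕ) (prime : Prime p) where

  open PrimeField p prime
  open import Data.Integer.Properties using (pos-+)
  open import Data.Sum.Base using ([_,_]′)

  -- h agrees on F_p with a polynomial of degree < d.
  data Poly : ℕ → (ℤ → ℤ) → Set

  -- h agrees on F_p with c xᵈ plus a polynomial of degree < d.
  record Leading (d : ℕ) (c : ℤ) (h : ℤ → ℤ) : Set

  data Poly where
    vanish : ∀ {h} → (∀ x → h x ≋ + 0) → Poly 0 h
    lead   : ∀ {d h} c → Leading d c h → Poly (suc d) h

  record Leading d c h where
    inductive
    constructor leading
    field
      lower    : ℤ → ℤ
      isPoly   : Poly d lower
      expand   : ∀ x → h x ≋ c * x ^ d + lower x

  Leading-resp : ∀ {d c h k} → (∀ x → k x ≋ h x) → Leading d c h → Leading d c k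
  Leading-resp eq (leading g G e) = leading g G λ x → ≋-trans (eq x) (e x)

  Poly-resp : ∀ {d h k} → (∀ x → k x ≋ h x) → Poly d h → Poly d k
  Poly-resp eq (vanish z) = vanish λ x → ≋-trans (eq x) (z x)
  Poly-resp eq (lead c L) = lead c (Leading-resp eq L)

  abstract
    Poly-+ : ∀ {d h k} → Poly d h → Poly d k → Poly d (λ x → h x + k x)
    Poly-+ {h = h} {k} (vanish z) (vanish w) = vanish λ x → lin₂ (+ 1) (z x) (+ 1) (w x) (lem (h x) (k x))
      where lem : ∀ a b → a + b - + 0 ≡ + 1 * (a - + 0) + + 1 * (b - + 0)
            lem = solve-∀
    Poly-+ {suc d} {h} {k} (lead c (leading g G e)) (lead c′ (leading g′ G′ e′)) =
      lead (c + c′) (leading _ (Poly-+ G G′) λ x → lin₂ (+ 1) (e x) (+ 1) (e′ x) (lem c c′ (x ^ d) (h x) (k x) (g x) (g′ x)))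
      where
      lem : ∀ c c′ y h k g g′ → (h + k) - ((c + c′) * y + (g + g′)) ≡ + 1 * (h - (c * y + g)) + + 1 * (k - (c′ * y + g′))
      lem = solve-∀

    Poly-scale : ∀ {d h} s → Poly d h → Poly d (λ x → s * h x)
    Poly-scale {h = h} s (vanish z) = vanish λ x → lin₁ s (z x) (lem s (h x))
      where lem : ∀ s h → s * h - + 0 ≡ s * (h - + 0)
            lem = solve-∀
    Poly-scale {suc d} {h} s (lead c (leading g G e)) =
      lead (s * c) (leading _ (Poly-scale s G) λ x → lin₁ s (e x) (lem s c (x ^ d) (h x) (g x)))
      where
      lem : ∀ s c y h g → s * h - (s * c * y + s * g) ≡ s * (h - (c * y + g))
      lem = solve-∀

    Poly-suc : ∀ {d h} → Poly d h → Poly (suc d) h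
    Poly-suc {d} {h} H = lead (+ 0) (leading h H λ x → lin₀ (lem (x ^ d) (h x)))
      where lem : ∀ y h → h ≡ + 0 * y + h
            lem = solve-∀

    Poly-weaken : ∀ {d e h} → d ℕ.≤ e → Poly d h → Poly e h
    Poly-weaken d≤e H = go (ℕₚ.≤⇒≤′ d≤e) H
      where
      go : ∀ {d e h} → d ℕ.≤′ e → Poly d h → Poly e h
      go (ℕ.≤′-reflexive refl) H = H
      go (ℕ.≤′-step le) H = Poly-suc (go le H)

    Poly-const : ∀ c → Poly 1 (λ _ → c)
    Poly-const c = lead c (leading (λ _ → + 0) (vanish λ _ → ≋-refl) λ x → lin₀ (lem c))
      where lem : ∀ c → c ≡ c * + 1 + + 0
            lem = solve-∀

    Leading-suc : ∀ {d c h} → Leading d c h → Leading (suc d) c (λ x → x * h x)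
    Poly-X : ∀ {d h} → Poly d h → Poly (suc d) (λ x → x * h x)

    Leading-suc {d} {c} {h} (leading g G e) =
      leading _ (Poly-X G) λ x → lin₁ x (e x) (lem c x (x ^ d) (h x) (g x))
      where
      lem : ∀ c x y h g → x * h - (c * (x * y) + x * g) ≡ x * (h - (c * y + g))
      lem = solve-∀

    Poly-X {h = h} (vanish z) = Poly-suc (vanish λ x → lin₁ x (z x) (lem x (h x)))
      where lem : ∀ s h → s * h - + 0 ≡ s * (h - + 0)
            lem = solve-∀
    Poly-X (lead c L) = lead c (Leading-suc L)

    Poly-0 : ∀ d → Poly d (λ _ → + 0)
    Poly-0 d = Poly-weaken ℕ.z≤n (vanish λ _ → ≋-refl)

    Leading-^ : ∀ d → Leading d (+ 1) (λ x → x ^ d)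
    Leading-^ d = leading (λ _ → + 0) (Poly-0 d) λ x → lin₀ (lem (x ^ d))
      where
      lem : ∀ y → y ≡ + 1 * y + + 0
      lem = solve-∀

    Leading-+ : ∀ {d c h k} → Leading d c h → Poly d k → Leading d c (λ x → h x + k x)
    Leading-+ {d} {c} {h} {k} (leading g G e) K =
      leading _ (Poly-+ G K) λ x → lin₁ (+ 1) (e x) (lem (h x) (k x) (c * x ^ d) (g x))
      where
      lem : ∀ h k y g → h + k - (y + (g + k)) ≡ + 1 * (h - (y + g))
      lem = solve-∀

    Leading-scale : ∀ {d c h} s → Leading d c h → Leading d (s * c) (λ x → s * h x)
    Leading-scale {d} {c} {h} s (leading g G e) =
      leading _ (Poly-scale s G) λ x → lin₁ s (e x) (lem s c (x ^ d) (h x) (g x))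
      where
      lem : ∀ s c y h g → s * h - (s * c * y + s * g) ≡ s * (h - (c * y + g))
      lem = solve-∀

  -- The forward difference plays the part of the derivative: it lowers the degree by one and
  -- multiplies the leading coefficient by the old degree, and it is defined from values alone.
  Δ : (ℤ → ℤ) → ℤ → ℤ
  Δ h x = h (x + + 1) - h x

  abstract
    -- With y = x^(d+1) and z = (x+1)^(d+1), the difference for the exponent d + 2 is x(z - y) + y +
    -- (z - y). The leading coefficients d + 1 and 1 of the first two terms add up, and the third
    -- has lower degree.
    Δ-power : ∀ d → Leading d (+ suc d) (Δ (λ x → x ^ suc d))
    Δ-power zero = leading _ (Poly-0 0) λ x → lin₀ (lem x)
      where lem : ∀ x → ((x + + 1) * + 1) - x * + 1 ≡ + 1 * + 1 + + 0
            lem = solve-∀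
    Δ-power (suc d) with Δ-power d
    ... | L = subst (λ c → Leading (suc d) c (Δ (λ x → x ^ suc (suc d)))) (trans (sym (pos-+ (suc d) 1)) (cong +_ (ℕₚ.+-comm (suc d) 1)))
      (Leading-resp (λ x → lin₀ (lem x (x ^ suc d) ((x + + 1) ^ suc d)))
        (Leading-sum (Leading-suc L) (Leading-+ (Leading-^ (suc d)) (lead _ L))))
      where
      lem : ∀ x y z → ((x + + 1) * z) - x * y ≡ x * (z - y) + (y + (z - y))
      lem = solve-∀
      Leading-sum : ∀ {d c c′ h k} → Leading d c h → Leading d c′ k → Leading d (c + c′) (λ x → h x + k x)
      Leading-sum {d} {c} {c′} {h} {k} (leading g G e) (leading g′ G′ e′) =
        leading _ (Poly-+ G G′) λ x → lin₂ (+ 1) (e x) (+ 1) (e′ x) (lem′ c c′ (x ^ d) (h x) (k x) (g x) (g′ x))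
        where
        lem′ : ∀ c c′ y h k g g′ → (h + k) - ((c + c′) * y + (g + g′)) ≡ + 1 * (h - (c * y + g)) + + 1 * (k - (c′ * y + g′))
        lem′ = solve-∀

    private
      Δ-expand : ∀ c y y′ h h′ g g′ → h′ - h - (c * (y′ - y) + (g′ - g))
                 ≡ + 1 * (h′ - (c * y′ + g′)) + (- + 1) * (h - (c * y + g))
      Δ-expand = solve-∀

    Δ-Poly : ∀ {d h} → Poly (suc d) h → Poly d (Δ h)
    Δ-Poly {zero} {h} (lead c (leading g (vanish z) e)) =
      vanish λ x → lin₄ (+ 1) (e (x + + 1)) (- + 1) (e x) (+ 1) (z (x + + 1)) (- + 1) (z x)
        (lem c (h x) (h (x + + 1)) (g x) (g (x + + 1)))
      where
      lem : ∀ c h h′ g g′ → h′ - h - + 0 ≡ + 1 * (h′ - (c * + 1 + g′)) + (- + 1) * (h - (c * + 1 + g)) + + 1 * (g′ - + 0) + (- + 1) * (g - + 0)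
      lem = solve-∀
    Δ-Poly {suc d} {h} (lead c (leading g G e)) =
      Poly-resp (λ x → lin₂ (+ 1) (e (x + + 1)) (- + 1) (e x)
          (Δ-expand c (x ^ suc d) ((x + + 1) ^ suc d) (h x) (h (x + + 1)) (g x) (g (x + + 1))))
        (Poly-+ (Poly-scale c (lead (+ suc d) (Δ-power d))) (Poly-suc (Δ-Poly G)))

    Δ-Leading : ∀ {d c h} → Leading (suc d) c h → Leading d (c * + suc d) (Δ h)
    Δ-Leading {d} {c} {h} (leading g G e) =
      Leading-resp (λ x → lin₂ (+ 1) (e (x + + 1)) (- + 1) (e x)
          (Δ-expand c (x ^ suc d) ((x + + 1) ^ suc d) (h x) (h (x + + 1)) (g x) (g (x + + 1))))
        (Leading-+ (Leading-scale c (Δ-power d)) (Δ-Poly G))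

    -- k differences turn c xᵏ + … into the constant k! c, and p does not divide k!.
    leading-unique : ∀ {k c h} → k ℕ.< p → Poly k h → Leading k c h → c ≋ + 0
    leading-unique {zero} {c} {h} k<p (vanish z) (leading g (vanish w) e) =
      lin₃ (- + 1) (e (+ 0)) (+ 1) (z (+ 0)) (- + 1) (w (+ 0)) (lem c (h (+ 0)) (g (+ 0)))
      where
      lem : ∀ c h g → c - + 0 ≡ (- + 1) * (h - (c * + 1 + g)) + + 1 * (h - + 0) + (- + 1) * (g - + 0)
      lem = solve-∀
    leading-unique {suc k} {c} k<p H L =
      [ (λ z → z) , (λ z → contradiction z (small≉0 (ℕ.s≤s ℕ.z≤n) k<p)) ]′
        (zero-product c (+ suc k) (leading-unique (ℕₚ.<-trans ℕₚ.≤-refl k<p) (Δ-Poly H) (Δ-Leading L)))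

    Poly-X^ : ∀ {d h} e → Poly d h → Poly (e ℕ.+ d) (λ x → x ^ e * h x)
    Poly-X^ {h = h} zero H = Poly-resp (λ x → lin₀ (lem (h x))) H
      where lem : ∀ y → + 1 * y ≡ y
            lem = solve-∀
    Poly-X^ {h = h} (suc e) H = Poly-resp (λ x → lin₀ (lem x (x ^ e) (h x))) (Poly-X (Poly-X^ e H))
      where lem : ∀ x y z → x * y * z ≡ x * (y * z)
            lem = solve-∀

    -- The bounds are strict: degree below d times degree at most e has degree below d + e, hence
    -- the single `suc`.
    Poly-* : ∀ {d e h k} → Poly d h → Poly (suc e) k → Poly (d ℕ.+ e) (λ x → h x * k x)
    Poly-* {h = h} {k} (vanish z) K = Poly-weaken ℕ.z≤n (vanish λ x → lin₁ (k x) (z x) (lem (h x) (k x)))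
      where lem : ∀ h k → h * k - + 0 ≡ k * (h - + 0)
            lem = solve-∀
    Poly-* {suc d} {e} {h} {k} (lead c (leading g G ex)) K =
      Poly-resp (λ x → lin₁ (k x) (ex x) (lem (h x) (k x) c (x ^ d) (g x)))
        (Poly-+ (Poly-scale c (subst (λ n → Poly n (λ x → x ^ d * k x)) (ℕₚ.+-suc d e) (Poly-X^ d K)))
                (Poly-suc (Poly-* G K)))
      where lem : ∀ h k c y g → h * k - (c * (y * k) + g * k) ≡ k * (h - (c * y + g))
            lem = solve-∀

    Leading-* : ∀ {d e c c′ h k} → Leading d c h → Leading e c′ k → Leading (d ℕ.+ e) (c * c′) (λ x → h x * k x)
    Leading-* {d} {e} {c} {c′} {h} {k} (leading g G ex) K@(leading g′ G′ ex′) =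
      leading _ (Poly-+ (Poly-scale c (Poly-X^ d G′)) (Poly-* G (lead c′ K)))
        λ x → ≋-trans (lin₂ (k x) (ex x) (c * x ^ d) (ex′ x) (lem c c′ (x ^ d) (x ^ e) (h x) (k x) (g x) (g′ x)))
          (lin₀ (cong (λ z → c * c′ * z + (c * (x ^ d * g′ x) + g x * k x)) (sym (^-+ x d e))))
      where
      lem : ∀ c c′ y y′ h k g g′ → h * k - (c * c′ * (y * y′) + (c * (y * g′) + g * k))
            ≡ k * (h - (c * y + g)) + c * y * (k - (c′ * y′ + g′))
      lem = solve-∀

    Leading-power : ∀ {d c h} j → Leading d c h → Leading (j ℕ.* d) (c ^ j) (λ x → h x ^ j)
    Leading-power zero L = Leading-^ 0
    Leading-power (suc j) L = Leading-* L (Leading-power j L)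

-- Multiplicative orders and the existence of a primitive root.

module PrimitiveRoot (p : ℕ) (prime : Prime p) where

  open PrimeField p prime
  open Polynomials p prime
  open import Data.Nat.Divisibility using (divides; _∣?_)
  open import Data.Nat.GCD using (gcd; gcd[m,n]∣m; gcd[m,n]∣n; gcd[m,n]≢0)
  open import Data.Nat.Coprimality as Coprimality using (Coprime; coprime-divisor; coprime-/gcd)
  open import Data.Nat.Primality using (prime⇒irreducible)
  open import Data.Nat.Primality.Factorisation using (factorise)
  open import Data.Nat.Induction using (<-rec)
  open import Data.Nat.ListAction using (product)
  open import Data.List.Base using ([]; _∷_)
  open import Data.List.Relation.Unary.All using ([]; _∷_)
  open import Relation.Nullary using (_×-dec_)
  open import Relation.Binary.PropositionalEquality

  record Order (x : ℤ) (n : ℕ) : Set where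
    constructor order
    field
      positive : 1 ℕ.≤ n
      power    : x ^ n ≋ + 1
      minimal  : ∀ k → x ^ k ≋ + 1 → n ∣ k
  open Order public

  abstract
    1^≋ : ∀ {x} n → x ≋ + 1 → x ^ n ≋ + 1
    1^≋ {x} n h = ≋-trans (^-cong {x} {+ 1} n h) (lin₀ (1^ n))

    ^-*≋ : ∀ {x} m n → x ^ m ≋ + 1 → x ^ (m ℕ.* n) ≋ + 1
    ^-*≋ {x} m n h = ≋-trans (lin₀ (sym (ℤₚ.^-*-assoc x m n))) (1^≋ {x ^ m} n h)

    ^-∣≋ : ∀ {x} m n → m ∣ n → x ^ m ≋ + 1 → x ^ n ≋ + 1
    ^-∣≋ {x} m n (divides q e) h = subst (λ n → x ^ n ≋ + 1) (trans (ℕₚ.*-comm m q) (sym e)) (^-*≋ {x} m q h)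

    ^-cancel : ∀ {x} i j → x ≉ + 0 → i ℕ.≤ j → x ^ i ≋ x ^ j → x ^ (j ℕ.∸ i) ≋ + 1
    ^-cancel {x} i j x≉0 i≤j h = *-cancelˡ (x ^ i) {x ^ (j ℕ.∸ i)} {+ 1} (^-≉0 i x≉0)
      (≋-trans (lin₀ (trans (sym (^-+ x i (j ℕ.∸ i))) (cong (x ^_) (ℕₚ.m+[n∸m]≡n i≤j))))
        (≋-trans (≋-sym h) (lin₀ (sym (ℤₚ.*-identityʳ (x ^ i))))))

    ^-* : ∀ x y n → (x * y) ^ n ≡ x ^ n * y ^ n
    ^-* x y zero = refl
    ^-* x y (suc n) = trans (cong (x * y *_) (^-* x y n)) (lem x y (x ^ n) (y ^ n))
      where lem : ∀ x y a b → x * y * (a * b) ≡ x * a * (y * b)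
            lem = solve-∀

    -- The powers with exponents 0 to p - 1 fall into p - 1 nonzero residues, so two of them agree;
    -- cancelling the smaller leaves an exponent below `p`.
    positive-exponent : ∀ {x} → x ≉ + 0 → ∃ λ n → 1 ℕ.≤ n × n ℕ.< p × x ^ n ≋ + 1
    positive-exponent {x} x≉0 = result (pigeonhole p∸1<p index)
      where
      p>1 : 1 ℕ.< p
      p>1 = ℕ.nonTrivial⇒n>1 p {{prime⇒nonTrivial prime}}
      p∸1<p : p ℕ.∸ 1 ℕ.< p
      p∸1<p = ℕₚ.∸-monoʳ-< {p} {1} {0} (ℕ.s≤s ℕ.z≤n) (ℕₚ.<⇒≤ p>1)
      res : Fin p → ℕ
      res i = toℕ (residue (x ^ toℕ i))
      res>0 : ∀ i → 1 ℕ.≤ res i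
      res>0 i = ℕₚ.n≢0⇒n>0 λ e → ^-≉0 {x} (toℕ i) x≉0 (≋-trans (≋-sym (residue-≋ (x ^ toℕ i))) (lin₀ (cong +_ e)))
      index : Fin p → Fin (p ℕ.∸ 1)
      index i = fromℕ< (ℕₚ.∸-monoˡ-< (toℕ<n (residue (x ^ toℕ i))) (res>0 i))
      result : (∃ λ i → ∃ λ j → i Fin.< j × index i ≡ index j) → ∃ λ n → 1 ℕ.≤ n × n ℕ.< p × x ^ n ≋ + 1
      result (i , j , i<j , e) = toℕ j ℕ.∸ toℕ i , ℕₚ.m<n⇒0<n∸m i<j ,
        ℕₚ.≤-<-trans (ℕₚ.m∸n≤m (toℕ j) (toℕ i)) (toℕ<n j) ,
        ^-cancel {x} (toℕ i) (toℕ j) x≉0 (ℕₚ.<⇒≤ i<j)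
          (≋-trans (≋-sym (residue-≋ (x ^ toℕ i))) (≋-trans (lin₀ (cong +_ same)) (residue-≋ (x ^ toℕ j))))
        where
        same : res i ≡ res j
        same = ℕₚ.∸-cancelʳ-≡ (res>0 i) (res>0 j)
          (trans (sym (toℕ-fromℕ< _)) (trans (cong toℕ e) (toℕ-fromℕ< _)))

    least-exponent : ∀ {x} n → 1 ℕ.≤ n → x ^ n ≋ + 1 →
      ∃ λ m → m ℕ.≤ n × 1 ℕ.≤ m × x ^ m ≋ + 1 × (∀ k → 1 ℕ.≤ k → k ℕ.< m → x ^ k ≉ + 1)
    least-exponent {x} = <-rec _ go
      where
      go : ∀ n → (∀ {k} → k ℕ.< n → 1 ℕ.≤ k → x ^ k ≋ + 1 →
          ∃ λ m → m ℕ.≤ k × 1 ℕ.≤ m × x ^ m ≋ + 1 × (∀ k → 1 ℕ.≤ k → k ℕ.< m → x ^ k ≉ + 1)) → 1 ℕ.≤ n → x ^ n ≋ + 1 →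
        ∃ λ m → m ℕ.≤ n × 1 ℕ.≤ m × x ^ m ≋ + 1 × (∀ k → 1 ℕ.≤ k → k ℕ.< m → x ^ k ≉ + 1)
      go n rec 1≤n h with ℕₚ.anyUpTo? (λ k → (1 ℕₚ.≤? k) ×-dec (x ^ k ≋? + 1)) n
      ... | no none = n , ℕₚ.≤-refl , 1≤n , h , λ k 1≤k k<n e → none (k , k<n , 1≤k , e)
      ... | yes (k , k<n , 1≤k , e) with rec k<n 1≤k e
      ...   | m , m≤k , rest = m , ℕₚ.≤-trans m≤k (ℕₚ.<⇒≤ k<n) , rest

    order-exists : ∀ {x} → x ≉ + 0 → ∃ λ n → n ℕ.< p × Order x n
    order-exists {x} x≉0 with positive-exponent x≉0
    ... | n , 1≤n , n<p , h with least-exponent {x} n 1≤n h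
    ...   | zero , _ , () , _
    ...   | m@(suc _) , m≤n , 1≤m , e , least = m , ℕₚ.≤-<-trans m≤n n<p , order 1≤m e dvd
      where
      dvd : ∀ k → x ^ k ≋ + 1 → m ∣ k
      dvd k h′ with k % m in eq
      ... | zero = divides (k / m) (trans (m≡m%n+[m/n]*n k m) (cong (ℕ._+ (k / m) ℕ.* m) eq))
      ... | suc r = contradiction rem (least (suc r) (ℕ.s≤s ℕ.z≤n) (subst (ℕ._< m) eq (m%n<n k m)))
        where
        k≡ : k ≡ suc r ℕ.+ m ℕ.* (k / m)
        k≡ = trans (m≡m%n+[m/n]*n k m) (cong₂ ℕ._+_ eq (ℕₚ.*-comm (k / m) m))
        rem : x ^ suc r ≋ + 1
        rem = ≋-trans (≋-trans (lin₀ (sym (ℤₚ.*-identityʳ (x ^ suc r)))) (*-congˡ (x ^ suc r) (≋-sym (^-*≋ {x} m (k / m) e))))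
              (≋-trans (lin₀ (trans (sym (^-+ x (suc r) (m ℕ.* (k / m)))) (cong (x ^_) (sym k≡)))) h′)

    order⇒≉0 : ∀ {x n} → Order x n → x ≉ + 0
    order⇒≉0 {x} {suc n} (order _ e _) x≋0 = 1≉0 (≋-trans (≋-sym e) (lin₁ (x ^ n) x≋0 (lem x (x ^ n))))
      where lem : ∀ x y → x * y - + 0 ≡ y * (x - + 0)
            lem = solve-∀
    order⇒≉0 {x} {zero} (order () _ _)

    order-power : ∀ {x} a b → Order x (a ℕ.* b) → Order (x ^ a) b
    order-power {x} a b (order 1≤ab e min) with ℕₚ.m<n⇒n≢0 1≤ab
    ... | ab≢0 = order (ℕₚ.n≢0⇒n>0 λ { refl → ab≢0 (ℕₚ.*-zeroʳ a) })
      (≋-trans (lin₀ (ℤₚ.^-*-assoc x a b)) e)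
      λ k h → ℕ∣.*-cancelˡ-∣ a {{ℕ.≢-nonZero λ { refl → ab≢0 refl }}} (min (a ℕ.* k) (≋-trans (lin₀ (sym (ℤₚ.^-*-assoc x a k))) h))

    coprime-product-∣ : ∀ {m n k} → Coprime m n → m ∣ k → n ∣ k → m ℕ.* n ∣ k
    coprime-product-∣ {m} {n} c (divides q refl) n∣ with coprime-divisor (Coprimality.sym c) (subst (n ∣_) (ℕₚ.*-comm q m) n∣)
    ... | divides r refl = divides r (trans (ℕₚ.*-assoc r n m) (cong (r ℕ.*_) (ℕₚ.*-comm n m)))

    -- If (xy)^k = 1, raising to the n-th power removes y and gives m ∣ nk, hence m ∣ k by
    -- coprimality; symmetrically n ∣ k.
    order-* : ∀ {x y m n} → Coprime m n → Order x m → Order y n → Order (x * y) (m ℕ.* n)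
    order-* {x} {y} {m} {n} c X Y = order (ℕₚ.*-mono-≤ (positive X) (positive Y))
      (≋-trans (lin₀ (^-* x y (m ℕ.* n)))
        (*-cong {x ^ (m ℕ.* n)} {+ 1} {y ^ (m ℕ.* n)} {+ 1} (^-*≋ {x} m n (power X)) (^-∣≋ {y} n (m ℕ.* n) (ℕ∣.n∣m*n m) (power Y))))
      λ k h → coprime-product-∣ c
        (coprime-divisor c (minimal X (n ℕ.* k) (killY k h)))
        (coprime-divisor (Coprimality.sym c) (minimal Y (m ℕ.* k) (killX k h)))
      where
      killX : ∀ k → (x * y) ^ k ≋ + 1 → y ^ (m ℕ.* k) ≋ + 1
      killX k h = ≋-trans (≋-trans (lin₀ (sym (ℤₚ.*-identityˡ (y ^ (m ℕ.* k)))))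
         (*-congʳ (y ^ (m ℕ.* k)) (≋-sym (^-*≋ {x} m k (power X)))))
        (≋-trans (lin₀ (sym (^-* x y (m ℕ.* k)))) (^-∣≋ {x * y} k (m ℕ.* k) (ℕ∣.n∣m*n m) h))
      killY : ∀ k → (x * y) ^ k ≋ + 1 → x ^ (n ℕ.* k) ≋ + 1
      killY k h = ≋-trans (≋-trans (lin₀ (sym (ℤₚ.*-identityʳ (x ^ (n ℕ.* k)))))
         (*-congˡ (x ^ (n ℕ.* k)) (≋-sym (^-*≋ {y} n k (power Y)))))
        (≋-trans (lin₀ (sym (^-* x y (n ℕ.* k)))) (^-∣≋ {x * y} k (n ℕ.* k) (ℕ∣.n∣m*n n) h))

  prime-divisor : ∀ {n} → 2 ℕ.≤ n → ∃ λ q → Prime q × q ∣ n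
  prime-divisor {n@(suc _)} 2≤n with factorise n
  ... | record { factors = [] ; isFactorisation = e } = contradiction (subst (2 ℕ.≤_) e 2≤n) λ { (ℕ.s≤s ()) }
  ... | record { factors = q ∷ qs ; isFactorisation = e ; factorsPrime = pr ∷ _ } =
    q , pr , divides (product qs) (trans e (ℕₚ.*-comm q (product qs)))

  split-power : ∀ {q} → Prime q → ∀ n → 1 ℕ.≤ n → ∃ λ i → ∃ λ m → n ≡ q ℕ.^ i ℕ.* m × ¬ (q ∣ m)
  split-power {q} pr = <-rec _ go
    where
    q>1 : 1 ℕ.< q
    q>1 = ℕ.nonTrivial⇒n>1 q {{prime⇒nonTrivial pr}}
    go : ∀ n → (∀ {k} → k ℕ.< n → 1 ℕ.≤ k → ∃ λ i → ∃ λ m → k ≡ q ℕ.^ i ℕ.* m × ¬ (q ∣ m)) → 1 ℕ.≤ n →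
      ∃ λ i → ∃ λ m → n ≡ q ℕ.^ i ℕ.* m × ¬ (q ∣ m)
    go n rec 1≤n with q ∣? n
    ... | no q∤n = 0 , n , sym (ℕₚ.+-identityʳ n) , q∤n
    ... | yes (divides zero refl) = contradiction 1≤n λ ()
    ... | yes (divides k@(suc _) refl) with rec (ℕₚ.m<m*n k q q>1) (ℕ.s≤s ℕ.z≤n)
    ...   | i , m , e , q∤m = suc i , m , trans (ℕₚ.*-comm k q) (trans (cong (q ℕ.*_) e) (sym (ℕₚ.*-assoc q (q ℕ.^ i) m))) , q∤m

  prime-coprime : ∀ {q m} → Prime q → ¬ (q ∣ m) → Coprime q m
  prime-coprime {q} pr q∤m {d} (d∣q , d∣m) with prime⇒irreducible pr d∣q
  ... | inj₁ d≡1 = d≡1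
  ... | inj₂ refl = contradiction d∣m q∤m

  power-coprime : ∀ {q m} i → Coprime q m → Coprime (q ℕ.^ i) m
  power-coprime zero c (d∣1 , _) = ℕ∣.∣1⇒≡1 d∣1
  power-coprime {q} {m} (suc i) c {d} (d∣ , d∣m) = power-coprime i c (coprime-divisor dq d∣ , d∣m)
    where
    dq : Coprime d q
    dq (e∣d , e∣q) = c (e∣q , ℕ∣.∣-trans e∣d d∣m)

  -- If q is a prime with v_q(n) > v_q(m), the q-part of n and the prime-to-q part of m combine to a larger order.
  larger-order-split : ∀ {m n} → 1 ℕ.≤ m → ¬ (n ∣ m) → 1 ℕ.≤ n →
    ∃ λ q → Prime q × ∃ λ i → ∃ λ m′ → m ≡ q ℕ.^ i ℕ.* m′ × ¬ (q ∣ m′) × q ℕ.^ suc i ∣ n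
  larger-order-split {m} {n} 1≤m n∤m 1≤n with gcd[m,n]∣m m n | gcd[m,n]∣n m n
  -- Here s and r are the quotients of m and n by their gcd, and r is at least 2 because n does not
  -- divide m. A prime q of r does not divide s, so the full power q^i of q in m divides the gcd,
  -- and q · q^i divides r · gcd = n.
  ... | divides s m≡ | divides r n≡ = go (prime-divisor r≥2)
    where
    g = gcd m n
    instance
      g≢0 : NonZero g
      g≢0 = ℕ.≢-nonZero (gcd[m,n]≢0 m n (inj₁ (ℕₚ.m<n⇒n≢0 1≤m)))
    at-least-two : ∀ r → n ≡ r ℕ.* g → 2 ℕ.≤ r
    at-least-two zero e = contradiction (subst (1 ℕ.≤_) e 1≤n) λ ()
    at-least-two (suc zero) e = contradiction (subst (_∣ m) (trans (sym (ℕₚ.+-identityʳ g)) (sym e)) (gcd[m,n]∣m m n)) n∤m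
    at-least-two (suc (suc _)) _ = ℕ.s≤s (ℕ.s≤s ℕ.z≤n)
    r≥2 : 2 ℕ.≤ r
    r≥2 = at-least-two r n≡
    s⊥r : Coprime s r
    s⊥r = subst₂ Coprime (quot m≡) (quot n≡) (coprime-/gcd m n)
      where
      open import Data.Nat.DivMod using (m*n/n≡m)
      quot : ∀ {x y} → x ≡ y ℕ.* g → x / g ≡ y
      quot {y = y} refl = m*n/n≡m y g
    go : (∃ λ q → Prime q × q ∣ r) →
      ∃ λ q → Prime q × ∃ λ i → ∃ λ m′ → m ≡ q ℕ.^ i ℕ.* m′ × ¬ (q ∣ m′) × q ℕ.^ suc i ∣ n
    go (q , pr , q∣r) with split-power pr m 1≤m
    ... | i , m′ , e , q∤m′ = q , pr , i , m′ , e , q∤m′ ,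
        subst (q ℕ.^ suc i ∣_) (sym n≡) (ℕ∣.*-pres-∣ q∣r qi∣g)
      where
      q∤s : ¬ (q ∣ s)
      q∤s q∣s = contradiction (s⊥r (q∣s , q∣r)) λ { refl → contradiction (ℕ.nonTrivial⇒n>1 q {{prime⇒nonTrivial pr}}) λ { (ℕ.s≤s ()) } }
      qi∣g : q ℕ.^ i ∣ g
      qi∣g = coprime-divisor (power-coprime i (prime-coprime pr q∤s)) (subst (q ℕ.^ i ∣_) m≡ (divides m′ (trans e (ℕₚ.*-comm (q ℕ.^ i) m′))))

  abstract
    larger-order : ∀ {x m y} → Order x m → y ≉ + 0 → y ^ m ≉ + 1 → ∃ λ z → ∃ λ n → m ℕ.< n × Order z n
    larger-order {x} {m} {y} X y≉0 ym≉1 =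
      let n , _ , Y = order-exists y≉0
          q , pr , i , m′ , m≡ , q∤m′ , d = larger-order-split {m} {n} (positive X) (λ n∣m → ym≉1 (^-∣≋ {y} n m n∣m (power Y))) (positive Y)
      in combine q i m′ n Y pr m≡ q∤m′ d
      where
      combine : ∀ q i m′ n → Order y n → Prime q → m ≡ q ℕ.^ i ℕ.* m′ → ¬ (q ∣ m′) → q ℕ.^ suc i ∣ n →
        ∃ λ z → ∃ λ n → m ℕ.< n × Order z n
      combine q i m′ n Y pr m≡ q∤m′ (divides r n≡) =
        x ^ (q ℕ.^ i) * y ^ r , m′ ℕ.* q ℕ.^ suc i , bigger ,
          order-* (Coprimality.sym (power-coprime (suc i) (prime-coprime pr q∤m′)))
            (order-power (q ℕ.^ i) m′ (subst (Order x) m≡ X)) (order-power r (q ℕ.^ suc i) (subst (Order y) n≡ Y))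
        where
        bigger : m ℕ.< m′ ℕ.* q ℕ.^ suc i
        bigger = subst₂ ℕ._<_ (sym m≡)
          (trans (ℕₚ.*-assoc (q ℕ.^ i) m′ q) (trans (ℕₚ.*-comm (q ℕ.^ i) (m′ ℕ.* q)) (ℕₚ.*-assoc m′ q (q ℕ.^ i))))
          (ℕₚ.m<m*n (q ℕ.^ i ℕ.* m′) q {{ℕ.>-nonZero (subst (1 ℕ.≤_) m≡ (positive X))}} (ℕ.nonTrivial⇒n>1 q {{prime⇒nonTrivial pr}}))

    -- Otherwise x^(m+1) - x would be the zero function.
    exponent-bound : ∀ m → 1 ℕ.≤ m → (∀ x → x ≉ + 0 → x ^ m ≋ + 1) → p ℕ.≤ suc m
    exponent-bound m@(suc _) 1≤m h = ℕₚ.≮⇒≥ λ m+1<p →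
      1≉0 (leading-unique m+1<p (Poly-weaken ℕ.z≤n (vanish zero-fun)) L)
      where
      L : Leading (suc m) (+ 1) (λ x → x ^ suc m + (- + 1) * x)
      L = Leading-+ (Leading-^ (suc m)) (Poly-weaken (ℕ.s≤s 1≤m) (Poly-scale (- + 1) X¹))
        where X¹ : Poly 2 (λ x → x)
              X¹ = Poly-resp (λ x → lin₀ (sym (ℤₚ.*-identityʳ x))) (lead (+ 1) (Leading-^ 1))
      zero-fun : ∀ x → x ^ suc m + (- + 1) * x ≋ + 0
      zero-fun x with x ≋? + 0
      ... | yes x≋0 = lin₁ (x ^ m - + 1) x≋0 (lem x (x ^ m))
        where lem : ∀ x y → x * y + (- + 1) * x - + 0 ≡ (y - + 1) * (x - + 0)
              lem = solve-∀
      ... | no x≉0 = lin₁ x (h x x≉0) (lem x (x ^ m))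
        where lem : ∀ x y → x * y + (- + 1) * x - + 0 ≡ x * (y - + 1)
              lem = solve-∀

    order<p : ∀ {x n} → Order x n → n ℕ.< p
    order<p {x} {n} X with order-exists (order⇒≉0 X)
    ... | k , k<p , K = ℕₚ.≤-<-trans (ℕ∣.∣⇒≤ {{ℕ.>-nonZero (positive K)}} (minimal X k (power K))) k<p

    exponent-or-larger : ∀ {x m} → Order x m → (∀ y → y ≉ + 0 → y ^ m ≋ + 1) ⊎ (∃ λ z → ∃ λ n → m ℕ.< n × Order z n)
    exponent-or-larger {x} {m} X = decide (any? λ i → ¬? (+ toℕ {p} i ≋? + 0) ×-dec ¬? ((+ toℕ i) ^ m ≋? + 1))
      where
      decide : Dec (∃ λ i → ¬ (+ toℕ {p} i ≋ + 0) × ¬ ((+ toℕ i) ^ m ≋ + 1)) →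
        (∀ y → y ≉ + 0 → y ^ m ≋ + 1) ⊎ (∃ λ z → ∃ λ n → m ℕ.< n × Order z n)
      decide (yes (i , i≉0 , ne)) = inj₂ (larger-order X i≉0 ne)
      decide (no none) = inj₁ λ y y≉0 → decidable-stable (y ^ m ≋? + 1) λ ne →
        none (residue y , ≉0-resp (≋-sym (residue-≋ y)) y≉0 ,
              λ e → ne (≋-trans (^-cong {y} {+ toℕ (residue y)} m (≋-sym (residue-≋ y))) e))

    -- If m is the order of an element and some m-th power is not 1, a larger order exists. Orders
    -- stay below `p`, so the climb from the element 1 ends at an m that is an exponent of the whole
    -- group, and `exponent-bound` forces m = p - 1. The fuel bounds the room left.
    primitive-root : ∃ λ t → Order t (p ℕ.∸ 1)
    primitive-root = climb p (+ 1) 1 (order ℕₚ.≤-refl ≋-refl λ k _ → ℕ∣.1∣ k) (ℕₚ.≤-reflexive (ℕₚ.+-comm 1 p))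
      where
      climb : ∀ fuel x m → Order x m → suc p ℕ.≤ fuel ℕ.+ m → ∃ λ t → Order t (p ℕ.∸ 1)
      climb zero x m X bound = contradiction bound (ℕₚ.<⇒≱ (ℕₚ.m<n⇒m<1+n (order<p X)))
      climb (suc fuel) x m X bound with exponent-or-larger X
      ... | inj₁ all-one = x , subst (Order x) (ℕₚ.≤-antisym (ℕₚ.∸-monoˡ-≤ 1 (order<p X))
                             (ℕₚ.∸-monoˡ-≤ 1 (exponent-bound m (positive X) all-one))) X
      ... | inj₂ (z , n , m<n , Z) = climb fuel z n Z
        (ℕₚ.≤-trans bound (subst (ℕ._≤ fuel ℕ.+ n) (ℕₚ.+-suc fuel m) (ℕₚ.+-monoʳ-≤ fuel m<n)))

    -- Obtained from the primitive root: an element violating it would yield an order above p - 1.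
    fermat : ∀ x → x ≉ + 0 → x ^ (p ℕ.∸ 1) ≋ + 1
    fermat = let t , T = primitive-root in result (exponent-or-larger T)
      where
      result : (∀ y → y ≉ + 0 → y ^ (p ℕ.∸ 1) ≋ + 1) ⊎ (∃ λ z → ∃ λ n → p ℕ.∸ 1 ℕ.< n × Order z n) →
        ∀ y → y ≉ + 0 → y ^ (p ℕ.∸ 1) ≋ + 1
      result (inj₁ all-one) = all-one
      result (inj₂ (z , k , m<k , Z)) = contradiction (order<p Z) (ℕₚ.≤⇒≯ (ℕₚ.≤-trans (ℕₚ.m≤n+m∸n p 1) m<k))

-- Quadratic residues and Euler's criterion.

module Squares (p : ℕ) (prime : Prime p) (p%4≡1 : p % 4 ≡ 1) where

  open PrimeField p prime
  open PrimitiveRoot p prime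
  open import Data.Nat.Divisibility using (divides)
  open import Data.Nat.DivMod using (m*n/n≡m)
  open import Data.Fin.Base using (splitAt)
  open import Data.Fin.Properties using (<⇒≢)
  open import Relation.Nullary.Decidable using (map′)
  open import Relation.Binary.PropositionalEquality hiding (_≡_)

  half : ℕ
  half = (p ℕ.∸ 1) / 2

  quarter : ℕ
  quarter = p / 4

  abstract
    private
      p∸1≡ : p ℕ.∸ 1 ≡ quarter ℕ.* 4
      p∸1≡ = trans (cong (ℕ._∸ 1) (m≡m%n+[m/n]*n p 4)) (cong (λ k → k ℕ.+ quarter ℕ.* 4 ℕ.∸ 1) p%4≡1)

    half≡ : half ≡ quarter ℕ.* 2
    half≡ = trans (cong (_/ 2) (trans p∸1≡ (sym (ℕₚ.*-assoc quarter 2 2)))) (m*n/n≡m (quarter ℕ.* 2) 2)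

    half*2 : half ℕ.* 2 ≡ p ℕ.∸ 1
    half*2 = trans (cong (ℕ._* 2) half≡) (trans (ℕₚ.*-assoc quarter 2 2) (sym p∸1≡))

    p>1 : 1 ℕ.< p
    p>1 = ℕ.nonTrivial⇒n>1 p {{prime⇒nonTrivial prime}}

    suc-p∸1 : suc (p ℕ.∸ 1) ≡ p
    suc-p∸1 = ℕₚ.m+[n∸m]≡n (ℕₚ.<⇒≤ p>1)

    half≥1 : 1 ℕ.≤ half
    half≥1 = ℕₚ.n≢0⇒n>0 λ e → contradiction (trans (sym suc-p∸1) (cong suc (trans (sym half*2) (cong (ℕ._* 2) e)))) λ q → ℕₚ.<⇒≢ p>1 (sym q)

    half<p : half ℕ.< p
    half<p = subst (half ℕ.<_) suc-p∸1 (ℕ.s≤s (subst (half ℕ.≤_) half*2 (ℕₚ.m≤m*n half 2)))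

    p≥5 : 5 ℕ.≤ p
    p≥5 = subst (5 ℕ.≤_) (trans (cong suc (sym p∸1≡)) suc-p∸1) (ℕ.s≤s (at-least-four quarter half≡))
      where
      at-least-four : ∀ q → half ≡ q ℕ.* 2 → 4 ℕ.≤ q ℕ.* 4
      at-least-four zero e = contradiction half≥1 (ℕₚ.<⇒≱ (ℕ.s≤s (ℕₚ.≤-reflexive e)))
      at-least-four (suc q) e = ℕₚ.m≤m+n 4 (q ℕ.* 4)

    2≉0 : + 2 ≉ + 0
    2≉0 = small≉0 (ℕ.s≤s ℕ.z≤n) (ℕₚ.≤-trans (ℕ.s≤s (ℕ.s≤s (ℕ.s≤s ℕ.z≤n))) p≥5)

    square-roots : ∀ x y → x * x ≋ y * y → x ≋ y ⊎ x ≋ - y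
    square-roots x y h with zero-product (x - y) (x + y) (lin₁ (+ 1) h (lem x y))
      where lem : ∀ x y → (x - y) * (x + y) - + 0 ≡ + 1 * (x * x - y * y)
            lem = solve-∀
    ... | inj₁ z = inj₁ (lin₁ (+ 1) z (lem x y))
      where lem : ∀ x y → x - y ≡ + 1 * (x - y - + 0)
            lem = solve-∀
    ... | inj₂ z = inj₂ (lin₁ (+ 1) z (lem x y))
      where lem : ∀ x y → x - - y ≡ + 1 * (x + y - + 0)
            lem = solve-∀

    -- If `y` were missed, then 0, `y` and the values of `T` would be n + 2 > p pairwise incongruent
    -- integers.
    exhaust : ∀ {n} (T : Fin n → ℤ) → (∀ i j → T i ≋ T j → i ≡ j) → (∀ i → T i ≉ + 0) → p ℕ.≤ suc n →
      ∀ y → y ≉ + 0 → ∃ λ i → T i ≋ y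
    exhaust {n} T inj T≉0 p≤ y y≉0 = decide (any? λ i → T i ≋? y)
      where
      decide : Dec (∃ λ i → T i ≋ y) → ∃ λ i → T i ≋ y
      decide (yes found) = found
      decide (no none) = ⊥-elim (clash (pigeonhole (ℕ.s≤s p≤) (λ i → residue (U i))))
        where
        U : Fin (suc (suc n)) → ℤ
        U zero = + 0
        U (suc zero) = y
        U (suc (suc i)) = T i
        U-inj : ∀ i j → U i ≋ U j → i ≡ j
        U-inj zero zero h = refl
        U-inj zero (suc zero) h = contradiction (≋-sym h) y≉0
        U-inj zero (suc (suc j)) h = contradiction (≋-sym h) (T≉0 j)
        U-inj (suc zero) zero h = contradiction h y≉0
        U-inj (suc zero) (suc zero) h = refl
        U-inj (suc zero) (suc (suc j)) h = contradiction (j , ≋-sym h) none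
        U-inj (suc (suc i)) zero h = contradiction h (T≉0 i)
        U-inj (suc (suc i)) (suc zero) h = contradiction (i , h) none
        U-inj (suc (suc i)) (suc (suc j)) h = cong (λ k → suc (suc k)) (inj i j h)
        clash : (∃ λ i → ∃ λ j → i Fin.< j × residue (U i) ≡ residue (U j)) → ⊥
        clash (i , j , i<j , e) = <⇒≢ i<j (U-inj i j (≋-trans (≋-sym (residue-≋ (U i))) (≋-trans (lin₀ (cong (λ k → + toℕ k) e)) (residue-≋ (U j)))))

    powers-distinct : ∀ {x n} → Order x n → ∀ (i j : Fin n) → x ^ toℕ i ≋ x ^ toℕ j → i ≡ j
    powers-distinct {x} {n} X i j h with ℕₚ.≤-total (toℕ i) (toℕ j)
    ... | inj₁ i≤j = toℕ-injective (sym (go (toℕ j) (toℕ i) i≤j (toℕ<n j) h))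
      where
      go : ∀ j i → i ℕ.≤ j → j ℕ.< n → x ^ i ≋ x ^ j → j ≡ i
      go j i i≤j j<n h with j ℕ.∸ i in eq | minimal X (j ℕ.∸ i) (^-cancel {x} i j (order⇒≉0 X) i≤j h)
      ... | zero | _ = ℕₚ.≤-antisym (ℕₚ.m∸n≡0⇒m≤n eq) i≤j
      ... | suc k | d = contradiction (ℕ∣.∣⇒≤ d) (ℕₚ.<⇒≱ (ℕₚ.≤-<-trans (subst (ℕ._≤ j) eq (ℕₚ.m∸n≤m j i)) j<n))
    ... | inj₂ j≤i = toℕ-injective (go (toℕ i) (toℕ j) j≤i (toℕ<n i) (≋-sym h))
      where
      go : ∀ j i → i ℕ.≤ j → j ℕ.< n → x ^ i ≋ x ^ j → j ≡ i
      go j i i≤j j<n h with j ℕ.∸ i in eq | minimal X (j ℕ.∸ i) (^-cancel {x} i j (order⇒≉0 X) i≤j h)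
      ... | zero | _ = ℕₚ.≤-antisym (ℕₚ.m∸n≡0⇒m≤n eq) i≤j
      ... | suc k | d = contradiction (ℕ∣.∣⇒≤ d) (ℕₚ.<⇒≱ (ℕₚ.≤-<-trans (subst (ℕ._≤ j) eq (ℕₚ.m∸n≤m j i)) j<n))

    -- The chosen primitive root doubles as the nonsquare that separates the two classes of vectors
    -- on a line.
    ν : ℤ
    ν = proj₁ primitive-root

    ν-order : Order ν (p ℕ.∸ 1)
    ν-order = proj₂ primitive-root

    ν≉0 : ν ≉ + 0
    ν≉0 = order⇒≉0 ν-order

    discrete-log : ∀ y → y ≉ + 0 → ∃ λ k → ν ^ k ≋ y
    discrete-log y y≉0 =
      let i , e = exhaust {p ℕ.∸ 1} (λ i → ν ^ toℕ i) (powers-distinct ν-order) (λ i → ^-≉0 {ν} (toℕ i) ν≉0)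
                    (ℕₚ.≤-reflexive (sym suc-p∸1)) y y≉0
      in toℕ i , e

  record Sq (x : ℤ) : Set where
    constructor square
    field
      root    : ℤ
      root≉0  : root ≉ + 0
      squared : x ≋ root * root

  abstract
    Sq-resp : ∀ {x y} → x ≋ y → Sq x → Sq y
    Sq-resp h (square s s≉0 e) = square s s≉0 (≋-trans (≋-sym h) e)

    Sq⇒≉0 : ∀ {x} → Sq x → x ≉ + 0
    Sq⇒≉0 (square s s≉0 e) h = *-≉0 {s} {s} s≉0 s≉0 (≋-trans (≋-sym e) h)

    euler : ∀ {x} → Sq x → x ^ half ≋ + 1
    euler {x} (square s s≉0 e) = ≋-trans (^-cong {x} {s * s} half e)
      (≋-trans (lin₀ (trans (^-* s s half) (trans (sym (^-+ s half half)) (cong (s ^_) double)))) (fermat s s≉0))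
      where
      double : half ℕ.+ half ≡ p ℕ.∸ 1
      double = trans (cong (half ℕ.+_) (sym (ℕₚ.+-identityʳ half))) (trans (ℕₚ.*-comm 2 half) half*2)

    -- Writing x = ν^k, the hypothesis says that p - 1 = 2 · `half` divides k · `half`, so k is
    -- even.
    euler⁻¹ : ∀ {x} → x ≉ + 0 → x ^ half ≋ + 1 → Sq x
    euler⁻¹ {x} x≉0 h =
      let k , e = discrete-log x x≉0
      in go k e (minimal ν-order (k ℕ.* half) (≋-trans (lin₀ (sym (ℤₚ.^-*-assoc ν k half))) (≋-trans (^-cong {ν ^ k} {x} half e) h)))
      where
      go : ∀ k → ν ^ k ≋ x → p ℕ.∸ 1 ∣ k ℕ.* half → Sq x
      go k e d = even (ℕ∣.*-cancelʳ-∣ half {{ℕ.>-nonZero half≥1}} (subst (_∣ k ℕ.* half) (trans (sym half*2) (ℕₚ.*-comm half 2)) d))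
        where
        even : 2 ∣ k → Sq x
        even (divides j refl) = square (ν ^ j) (^-≉0 {ν} j ν≉0)
          (≋-trans (≋-sym e) (lin₀ (trans (cong (ν ^_) (trans (ℕₚ.*-comm j 2) (cong (j ℕ.+_) (ℕₚ.+-identityʳ j)))) (^-+ ν j j))))

    ν-nonsquare : ¬ Sq ν
    ν-nonsquare s = contradiction (ℕ∣.∣⇒≤ {{ℕ.>-nonZero half≥1}} (minimal ν-order half (euler s)))
      (ℕₚ.<⇒≱ (subst (half ℕ.<_) half*2 (ℕₚ.m<m*n half 2 {{ℕ.>-nonZero half≥1}} (ℕ.s≤s (ℕ.s≤s ℕ.z≤n)))))

    half-power : ∀ {x} → x ≉ + 0 → x ^ half ≋ + 1 ⊎ x ^ half ≋ - + 1
    half-power {x} x≉0 = square-roots (x ^ half) (+ 1) (≋-trans (lin₀ (trans (sym (^-* x x half)) refl)) (euler (square x x≉0 ≋-refl)))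

    nonsquare-power : ∀ {x} → x ≉ + 0 → ¬ Sq x → x ^ half ≋ - + 1
    nonsquare-power {x} x≉0 ns with half-power {x} x≉0
    ... | inj₁ e = contradiction (euler⁻¹ x≉0 e) ns
    ... | inj₂ e = e

    Sq? : ∀ x → Dec (Sq x)
    Sq? x with x ≋? + 0
    ... | yes z = no λ s → Sq⇒≉0 s z
    ... | no nz = map′ (euler⁻¹ nz) euler (x ^ half ≋? + 1)

    Sq-* : ∀ {x y} → Sq x → Sq y → Sq (x * y)
    Sq-* {x} {y} (square s s≉0 e) (square t t≉0 f) = square (s * t) (*-≉0 {s} {t} s≉0 t≉0)
      (lin₂ y e (s * s) f (lem x y s t))
      where lem : ∀ x y s t → x * y - s * t * (s * t) ≡ y * (x - s * s) + s * s * (y - t * t)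
            lem = solve-∀

    nonsquare-* : ∀ {x y} → x ≉ + 0 → y ≉ + 0 → ¬ Sq x → ¬ Sq y → Sq (x * y)
    nonsquare-* {x} {y} x≉0 y≉0 nx ny = euler⁻¹ (*-≉0 {x} {y} x≉0 y≉0)
      (≋-trans (lin₀ (^-* x y half)) (*-cong {x ^ half} { - + 1} {y ^ half} { - + 1} (nonsquare-power x≉0 nx) (nonsquare-power y≉0 ny)))

    Sq-cancel : ∀ {x y} → Sq x → Sq (x * y) → Sq y
    Sq-cancel {x} {y} X XY = euler⁻¹ y≉0
      (≋-trans (≋-trans (lin₀ (sym (ℤₚ.*-identityˡ (y ^ half)))) (*-congʳ (y ^ half) (≋-sym (euler X))))
        (≋-trans (lin₀ (sym (^-* x y half))) (euler XY)))
      where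
      y≉0 : y ≉ + 0
      y≉0 h = Sq⇒≉0 XY (lin₁ x h (lem x y))
        where lem : ∀ x y → x * y - + 0 ≡ x * (y - + 0)
              lem = solve-∀

    Sq-one : Sq (+ 1)
    Sq-one = square (+ 1) 1≉0 ≋-refl

    -- Euler's criterion with an even exponent: `half` is twice `quarter`.
    Sq-minus-one : Sq (- + 1)
    Sq-minus-one = euler⁻¹ (λ h → 1≉0 (lin₁ (- + 1) h refl))
      (subst (λ k → (- + 1) ^ k ≋ + 1) (sym (trans half≡ (ℕₚ.*-comm quarter 2))) (^-*≋ { - + 1} 2 quarter ≋-refl))

    Sq-neg : ∀ {x} → Sq x → Sq (- x)
    Sq-neg {x} X = Sq-resp (lin₀ (lem x)) (Sq-* Sq-minus-one X)
      where lem : ∀ x → (- + 1) * x ≡ - x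
            lem = solve-∀

    Sq-ν : ∀ {x} → x ≉ + 0 → ¬ Sq x → Sq (ν * x)
    Sq-ν x≉0 ns = nonsquare-* ν≉0 x≉0 ν-nonsquare ns

    Sq-ν-exclusive : ∀ {x} → Sq x → ¬ Sq (ν * x)
    Sq-ν-exclusive {x} X νX = ν-nonsquare (Sq-cancel X (Sq-resp (lin₀ (ℤₚ.*-comm ν x)) νX))

    -- Half of the nonzero residues are squares, so the powers of a square of order (p-1)/2 exhaust them.
    square-powers : ∀ {x} → Sq x → Order x half → ∀ y → Sq y → ∃ λ k → x ^ k ≋ y
    square-powers {x} X O y Y = found (exhaust T T-inj T≉0 bound y (Sq⇒≉0 Y))
      where
      Xk : ∀ k → Sq (x ^ k)
      Xk zero = Sq-one
      Xk (suc k) = Sq-* X (Xk k)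
      V : Fin half ⊎ Fin half → ℤ
      V (inj₁ i) = x ^ toℕ i
      V (inj₂ i) = ν * x ^ toℕ i
      V-inj : ∀ a b → V a ≋ V b → a ≡ b
      V-inj (inj₁ i) (inj₁ j) h = cong inj₁ (powers-distinct O i j h)
      V-inj (inj₁ i) (inj₂ j) h = contradiction (Sq-resp h (Xk (toℕ i))) (Sq-ν-exclusive (Xk (toℕ j)))
      V-inj (inj₂ i) (inj₁ j) h = contradiction (Sq-resp (≋-sym h) (Xk (toℕ j))) (Sq-ν-exclusive (Xk (toℕ i)))
      V-inj (inj₂ i) (inj₂ j) h = cong inj₂ (powers-distinct O i j (*-cancelˡ ν {x ^ toℕ i} {x ^ toℕ j} ν≉0 h))
      V≉0 : ∀ a → V a ≉ + 0
      V≉0 (inj₁ i) = Sq⇒≉0 (Xk (toℕ i))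
      V≉0 (inj₂ i) = *-≉0 {ν} {x ^ toℕ i} ν≉0 (Sq⇒≉0 (Xk (toℕ i)))
      T : Fin (half ℕ.+ half) → ℤ
      T i = V (splitAt half i)
      split-inj : ∀ (i j : Fin (half ℕ.+ half)) → splitAt half i ≡ splitAt half j → i ≡ j
      split-inj i j e = trans (sym (Fin-join i)) (trans (cong (Fin.join half half) e) (Fin-join j))
        where
        open import Data.Fin.Properties using (join-splitAt)
        Fin-join : ∀ i → Fin.join half half (splitAt half i) ≡ i
        Fin-join = join-splitAt half half
      T-inj : ∀ i j → T i ≋ T j → i ≡ j
      T-inj i j h = split-inj i j (V-inj (splitAt half i) (splitAt half j) h)
      T≉0 : ∀ i → T i ≉ + 0
      T≉0 i = V≉0 (splitAt half i)
      bound : p ℕ.≤ suc (half ℕ.+ half)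
      bound = ℕₚ.≤-reflexive (trans (sym suc-p∸1) (cong suc (trans (sym half*2) (trans (ℕₚ.*-comm half 2) (cong (half ℕ.+_) (ℕₚ.+-identityʳ half))))))
      found : (∃ λ i → T i ≋ y) → ∃ λ k → x ^ k ≋ y
      found (i , e) = pick (splitAt half i) e
        where
        pick : ∀ a → V a ≋ y → ∃ λ k → x ^ k ≋ y
        pick (inj₁ k) e = toℕ k , e
        pick (inj₂ k) e = contradiction (Sq-resp (≋-sym e) Y) (Sq-ν-exclusive (Xk (toℕ k)))

-- Carlitz's theorem on permutations preserving the quadratic character of differences.

module Carlitz (p : ℕ) (prime : Prime p) where

  open PrimeField p prime
  open Polynomials p prime
  open import Relation.Binary.PropositionalEquality

  -- Carlitz: if (f x - f y)ᵐ = (x - y)ᵐ with 2m < p, then every power fʲ (j ≤ m) has degree at most m,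
  -- which for deg f ≥ 2 fails for the first j with m < j deg f.
  module _ (m : ℕ) (1≤m : 1 ℕ.≤ m) (2m<p : m ℕ.+ m ℕ.< p) (f : ℤ → ℤ)
           (translates : ∀ u → Poly (suc m) (λ x → (f x + u) ^ m)) where

    private
      m<p : m ℕ.< p
      m<p = ℕₚ.≤-<-trans (ℕₚ.m≤m+n m m) 2m<p

      -- A polynomial `q` of exact degree j whose composite with every translate of `f` keeps degree
      -- at most m. Quantifying over all translates `u` is what makes the notion stable under
      -- differences of `q`.
      record Adapted (j : ℕ) : Set where
        constructor adapted
        field
          c       : ℤ
          q       : ℤ → ℤ
          c≉0     : c ≉ + 0
          leads   : Leading j c q
          closed  : ∀ u → Poly (suc m) (λ x → q (f x + u))

      -- Each difference of x^m multiplies the leading coefficient by the current degree, which lies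
      -- between 1 and m < p, so the coefficient stays nonzero.
      differences : ∀ i j → i ℕ.+ j ≡ m → Adapted j
      differences zero j refl = adapted (+ 1) (λ x → x ^ m) 1≉0 (Leading-^ m) translates
      differences (suc i) j e with differences i (suc j) (trans (ℕₚ.+-suc i j) e)
      ... | adapted c q c≉0 L cl = adapted (c * + suc j) (Δ q)
        (*-≉0 {c} {+ suc j} c≉0 (small≉0 (ℕ.s≤s ℕ.z≤n) (ℕₚ.≤-<-trans j<m m<p))) (Δ-Leading L)
        λ u → Poly-resp (λ x → lin₀ (trans (cong (λ z → q z - q (f x + u)) (ℤₚ.+-assoc (f x) u (+ 1))) (lem (q (f x + (u + + 1))) (q (f x + u)))))
          (Poly-+ (cl (u + + 1)) (Poly-scale (- + 1) (cl u)))
        where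
        j<m : suc j ℕ.≤ m
        j<m = subst (suc j ℕ.≤_) (trans (ℕₚ.+-suc i j) e) (ℕₚ.m≤n+m (suc j) i)
        lem : ∀ a b → a - b ≡ a + (- + 1) * b
        lem = solve-∀

      -- By induction on the degree. An adapted polynomial q = c y^j + r gives f^j = (q(f) - r(f)) /
      -- c; here q(f) has degree at most m by construction and r(f) by induction.
      powers : ∀ j → j ℕ.≤ suc m → ∀ g → Poly j g → Poly (suc m) (λ x → g (f x))
      powers zero _ g (vanish z) = Poly-weaken ℕ.z≤n (vanish λ x → z (f x))
      powers (suc j) (ℕ.s≤s j≤m) g (lead s (leading g′ G′ e)) =
        Poly-resp (λ x → e (f x)) (Poly-+ (Poly-scale s fʲ) (powers j (ℕₚ.m≤n⇒m≤1+n j≤m) g′ G′))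
        where
        fʲ : Poly (suc m) (λ x → f x ^ j)
        module _ (A : Adapted j) where
          open Adapted A
          open Leading leads renaming (lower to r; isPoly to R; expand to q-expand)
          d : ℤ
          d = proj₁ (inverse c≉0)
          eq : ∀ x → f x ^ j ≋ d * (q (f x + + 0) + (- + 1) * r (f x))
          eq x = lin₂ (- (f x ^ j)) (proj₂ (inverse c≉0)) (- d) (q-expand (f x))
            (trans (cong (λ z → f x ^ j - d * (q z + (- + 1) * r (f x))) (ℤₚ.+-identityʳ (f x)))
              (lem c d (f x ^ j) (q (f x)) (r (f x))))
            where
            lem : ∀ c d y q r → y - d * (q + (- + 1) * r) ≡ (- y) * (c * d - + 1) + (- d) * (q - (c * y + r))
            lem = solve-∀
          from-adapted : Poly (suc m) (λ x → f x ^ j)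
          from-adapted = Poly-resp eq
            (Poly-scale d (Poly-+ (closed (+ 0)) (Poly-scale (- + 1) (powers j (ℕₚ.m≤n⇒m≤1+n j≤m) r R))))
        fʲ = from-adapted (differences (m ℕ.∸ j) j (ℕₚ.m∸n+n≡m j≤m))

      degree : ∀ {d h} → Poly d h → (∀ x → h x ≋ + 0) ⊎ (∃ λ k → ∃ λ c → k ℕ.< d × c ≉ + 0 × Leading k c h)
      degree (vanish z) = inj₁ z
      degree {suc d} {h} (lead c L@(leading g G e)) = decide (c ≋? + 0)
        where
        step : c ≋ + 0 → ∀ x → g x ≋ h x
        step c≋0 x = lin₂ (- + 1) (e x) (- (x ^ d)) c≋0 (lem (h x) c (x ^ d) (g x))
          where lem : ∀ h c y g → g - h ≡ (- + 1) * (h - (c * y + g)) + (- y) * (c - + 0)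
                lem = solve-∀
        decide : Dec (c ≋ + 0) → (∀ x → h x ≋ + 0) ⊎ (∃ λ k → ∃ λ c → k ℕ.< suc d × c ≉ + 0 × Leading k c h)
        decide (no c≉0) = inj₂ (d , c , ℕₚ.≤-refl , c≉0 , L)
        decide (yes c≋0) with degree G
        ... | inj₁ z = inj₁ λ x → ≋-trans (≋-sym (step c≋0 x)) (z x)
        ... | inj₂ (k , c′ , k<d , c′≉0 , L′) =
          inj₂ (k , c′ , ℕₚ.m<n⇒m<1+n k<d , c′≉0 , Leading-resp (λ x → ≋-sym (step c≋0 x)) L′)

      f-Poly : Poly (suc m) f
      f-Poly = Poly-resp (λ x → lin₀ (sym (ℤₚ.*-identityʳ (f x)))) (powers 2 (ℕ.s≤s 1≤m) (λ x → x ^ 1) (lead (+ 1) (Leading-^ 1)))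

      -- With j = m / n + 1 the power f^j has degree jn > m, although `powers` bounds it by m, since
      -- n ≥ 2 gives j ≤ m. The two are incompatible because jn ≤ m + n ≤ 2m < p, and below `p`
      -- leading coefficients are determined by values.
      no-degree≥2 : ∀ n c → 2 ℕ.≤ n → n ℕ.≤ m → c ≉ + 0 → ¬ Leading n c f
      no-degree≥2 (suc zero) c (ℕ.s≤s ()) _ _ _
      no-degree≥2 n@(suc (suc _)) c 2≤n n≤m c≉0 L = ^-≉0 {c} j c≉0
        (leading-unique {j ℕ.* n} jn<p (Poly-weaken m<jn (powers (suc j) (ℕ.s≤s j≤m) (λ x → x ^ j) (lead (+ 1) (Leading-^ j)))) (Leading-power j L))
        where
        k j : ℕ
        k = m / n
        j = suc k
        m≡ : m ≡ m % n ℕ.+ k ℕ.* n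
        m≡ = m≡m%n+[m/n]*n m n
        kn≤m : k ℕ.* n ℕ.≤ m
        kn≤m = subst (k ℕ.* n ℕ.≤_) (sym m≡) (ℕₚ.m≤n+m (k ℕ.* n) (m % n))
        m<jn : m ℕ.< j ℕ.* n
        m<jn = subst (ℕ._< j ℕ.* n) (sym m≡) (ℕₚ.+-monoˡ-< (k ℕ.* n) (m%n<n m n))
        jn<p : j ℕ.* n ℕ.< p
        jn<p = ℕₚ.≤-<-trans (ℕₚ.+-mono-≤ n≤m kn≤m) 2m<p
        j≤m : j ℕ.≤ m
        j≤m with k in eq
        ... | zero = 1≤m
        ... | suc k′ = ℕₚ.≤-trans (ℕₚ.≤-trans (subst (suc (suc k′) ℕ.≤_) (sym (trans (ℕₚ.*-comm (suc k′) 2) (cong (suc k′ ℕ.+_) (ℕₚ.+-identityʳ (suc k′)))))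
              (ℕₚ.+-monoˡ-≤ (suc k′) (ℕ.s≤s ℕ.z≤n))) (ℕₚ.*-monoʳ-≤ (suc k′) 2≤n)) (subst (λ k → k ℕ.* n ℕ.≤ m) eq kn≤m)

    abstract
      affine : ¬ (f (+ 1) ≋ f (+ 0)) → ∃ λ a → ∃ λ b → ∀ x → f x ≋ a * x + b
      affine f1≉f0 = classify (degree f-Poly)
        where
        classify : (∀ x → f x ≋ + 0) ⊎ (∃ λ k → ∃ λ c → k ℕ.< suc m × c ≉ + 0 × Leading k c f) →
          ∃ λ a → ∃ λ b → ∀ x → f x ≋ a * x + b
        classify (inj₁ z) = contradiction (≋-trans (z (+ 1)) (≋-sym (z (+ 0)))) f1≉f0
        classify (inj₂ (zero , c , _ , _ , leading g (vanish z) e)) =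
            contradiction (≋-trans (const (+ 1)) (≋-sym (const (+ 0)))) f1≉f0
            where
            const : ∀ x → f x ≋ c
            const x = lin₂ (+ 1) (e x) (+ 1) (z x) (lem (f x) c (g x))
              where lem : ∀ f c g → f - c ≡ + 1 * (f - (c * + 1 + g)) + + 1 * (g - + 0)
                    lem = solve-∀
        classify (inj₂ (suc zero , c , _ , _ , leading g (lead b (leading g′ (vanish z) e′)) e)) = c , b , λ x →
            lin₃ (+ 1) (e x) (+ 1) (e′ x) (+ 1) (z x) (lem (f x) c x b (g x) (g′ x))
            where lem : ∀ f c x b g g′ → f - (c * x + b) ≡ + 1 * (f - (c * (x * + 1) + g)) + + 1 * (g - (b * + 1 + g′)) + + 1 * (g′ - + 0)
                  lem = solve-∀
        classify (inj₂ (n@(suc (suc _)) , c , n≤m , c≉0 , L)) = contradiction L (no-degree≥2 n c (ℕ.s≤s (ℕ.s≤s ℕ.z≤n)) (ℕₚ.≤-pred n≤m) c≉0)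

  abstract
    translate-Poly : ∀ m y → Poly (suc m) (λ x → (x - y) ^ m)
    translate-Poly m y = subst (λ k → Poly (suc k) (λ x → (x - y) ^ m)) (ℕₚ.*-identityʳ m) (lead ((+ 1) ^ m) (Leading-power m x-y))
      where
      x-y : Leading 1 (+ 1) (λ x → x - y)
      x-y = leading (λ _ → - y) (Poly-const (- y)) λ x → lin₀ (lem x y)
        where lem : ∀ x y → x - y ≡ + 1 * (x * + 1) + - y
              lem = solve-∀

    -- Surjectivity turns the hypothesis on differences into one on translates: if f y = -u, then (f
    -- x + u)^m = (x - y)^m, which has degree m in x.
    carlitz : ∀ m → 1 ℕ.≤ m → m ℕ.+ m ℕ.< p → (f : ℤ → ℤ) → (∀ u → ∃ λ y → f y ≋ u) →
      (∀ x y → (f x - f y) ^ m ≋ (x - y) ^ m) → ∃ λ a → ∃ λ b → ∀ x → f x ≋ a * x + b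
    carlitz m@(suc m′) 1≤m 2m<p f onto h = affine m 1≤m 2m<p f translates f1≉f0
      where
      translates : ∀ u → Poly (suc m) (λ x → (f x + u) ^ m)
      translates u = Poly-resp same (translate-Poly m y)
        where
        y : ℤ
        y = proj₁ (onto (- u))
        same : ∀ x → (f x + u) ^ m ≋ (x - y) ^ m
        same x = ≋-trans {(f x + u) ^ m} {(f x - f y) ^ m} {(x - y) ^ m}
          (^-cong {f x + u} {f x - f y} m (lin₁ (+ 1) (proj₂ (onto (- u))) (lem (f x) u (f y)))) (h x y)
          where lem : ∀ a u b → a + u - (a - b) ≡ + 1 * (b - - u)
                lem = solve-∀
      f1≉f0 : ¬ (f (+ 1) ≋ f (+ 0))
      f1≉f0 e = 1≉0 (≋-trans {+ 1} {(+ 1 - + 0) ^ m} {+ 0} (lin₀ (sym (1^ m)))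
        (≋-trans {(+ 1 - + 0) ^ m} {(f (+ 1) - f (+ 0)) ^ m} {+ 0} (≋-sym (h (+ 1) (+ 0)))
          (lin₁ {a = f (+ 1)} {f (+ 0)} ((f (+ 1) - f (+ 0)) ^ m′) e (lem (f (+ 1)) (f (+ 0)) ((f (+ 1) - f (+ 0)) ^ m′)))))
        where lem : ∀ a b c → (a - b) * c - + 0 ≡ c * (a - b)
              lem = solve-∀

-- The plane over the prime field: matrices, determinants and square classes of vectors.

module Plane (p : ℕ) (prime : Prime p) (p%4≡1 : p % 4 ≡ 1) where

  open import Defs using (M2; mat; _⊗_; I₂; inv₂; det)
  open PrimeField p prime
  open Squares p prime p%4≡1

  infix 4 _≐_ _~_ _≐ᴹ_
  infixr 7 _·_ _∙_
  infixl 6 _⊕_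

  record V2 : Set where
    constructor ⟨_,_⟩
    field v₁ v₂ : ℤ
  open V2 public

  record _≐_ (v w : V2) : Set where
    constructor _,,_
    field
      eq₁ : v₁ v ≋ v₁ w
      eq₂ : v₂ v ≋ v₂ w
  open _≐_ public

  record _≐ᴹ_ (A B : M2) : Set where
    constructor entries
    field
      eq₁₁ : M2.m11 A ≋ M2.m11 B
      eq₁₂ : M2.m12 A ≋ M2.m12 B
      eq₂₁ : M2.m21 A ≋ M2.m21 B
      eq₂₂ : M2.m22 A ≋ M2.m22 B
  open _≐ᴹ_ public

  𝟎 e₁ e₂ : V2
  𝟎 = ⟨ + 0 , + 0 ⟩
  e₁ = ⟨ + 1 , + 0 ⟩
  e₂ = ⟨ + 0 , + 1 ⟩

  opaque
    _·_ : M2 → V2 → V2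
    mat a b c d · ⟨ x , y ⟩ = ⟨ a * x + b * y , c * x + d * y ⟩

    _∙_ : ℤ → V2 → V2
    s ∙ ⟨ x , y ⟩ = ⟨ s * x , s * y ⟩

    _⊕_ : V2 → V2 → V2
    ⟨ x , y ⟩ ⊕ ⟨ z , w ⟩ = ⟨ x + z , y + w ⟩

    D : V2 → V2 → ℤ
    D ⟨ a , b ⟩ ⟨ c , d ⟩ = a * d - b * c

  NonZeroVector : V2 → Set
  NonZeroVector v = ¬ (v ≐ 𝟎)

  record _~_ (v w : V2) : Set where
    constructor scaled
    field
      factor   : ℤ
      isSquare : Sq factor
      scale-eq : w ≐ factor ∙ v
  open _~_ public

  ≐-refl : ∀ {v} → v ≐ v
  ≐-refl = ≋-refl ,, ≋-refl

  ≐-sym : ∀ {v w} → v ≐ w → w ≐ v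
  ≐-sym (e ,, f) = ≋-sym e ,, ≋-sym f

  ≐-trans : ∀ {u v w} → u ≐ v → v ≐ w → u ≐ w
  ≐-trans (e ,, f) (g ,, h) = ≋-trans e g ,, ≋-trans f h

  ≡⇒≐ : ∀ {v w} → v₁ v ≡ v₁ w → v₂ v ≡ v₂ w → v ≐ w
  ≡⇒≐ e f = lin₀ e ,, lin₀ f

  opaque
    unfolding _·_ _∙_ _⊕_ D

    ·-cong : ∀ A {v w} → v ≐ w → A · v ≐ A · w
    ·-cong (mat a b c d) {⟨ x , y ⟩} {⟨ z , w ⟩} (e ,, f) = lin₂ a e b f (lem a b x y z w) ,, lin₂ c e d f (lem c d x y z w)
      where lem : ∀ a b x y z w → a * x + b * y - (a * z + b * w) ≡ a * (x - z) + b * (y - w)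
            lem = solve-∀

    ·-congᴹ : ∀ {A B} v → A ≐ᴹ B → A · v ≐ B · v
    ·-congᴹ {mat a b c d} {mat a′ b′ c′ d′} ⟨ x , y ⟩ (entries e f g h) =
      lin₂ x e y f (lem a b a′ b′ x y) ,, lin₂ x g y h (lem c d c′ d′ x y)
      where lem : ∀ a b a′ b′ x y → a * x + b * y - (a′ * x + b′ * y) ≡ x * (a - a′) + y * (b - b′)
            lem = solve-∀

    ∙-cong : ∀ s {v w} → v ≐ w → s ∙ v ≐ s ∙ w
    ∙-cong s (e ,, f) = *-congˡ s e ,, *-congˡ s f

    ∙-congˢ : ∀ {s t} v → s ≋ t → s ∙ v ≐ t ∙ v
    ∙-congˢ ⟨ x , y ⟩ e = *-congʳ x e ,, *-congʳ y e

    ∙-∙ : ∀ s t v → s ∙ (t ∙ v) ≐ (s * t) ∙ v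
    ∙-∙ s t ⟨ x , y ⟩ = ≡⇒≐ (lem s t x) (lem s t y)
      where lem : ∀ s t x → s * (t * x) ≡ s * t * x
            lem = solve-∀

    1∙ : ∀ v → + 1 ∙ v ≐ v
    1∙ ⟨ x , y ⟩ = ≡⇒≐ (ℤₚ.*-identityˡ x) (ℤₚ.*-identityˡ y)

    ·-∙ : ∀ A s v → A · (s ∙ v) ≐ s ∙ (A · v)
    ·-∙ (mat a b c d) s ⟨ x , y ⟩ = ≡⇒≐ (lem a b s x y) (lem c d s x y)
      where lem : ∀ a b s x y → a * (s * x) + b * (s * y) ≡ s * (a * x + b * y)
            lem = solve-∀

    ·-⊗ : ∀ A B v → (A ⊗ B) · v ≐ A · (B · v)
    ·-⊗ (mat a b c d) (mat a′ b′ c′ d′) ⟨ x , y ⟩ = ≡⇒≐ (lem a b a′ b′ c′ d′ x y) (lem c d a′ b′ c′ d′ x y)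
      where lem : ∀ a b a′ b′ c′ d′ x y → (a * a′ + b * c′) * x + (a * b′ + b * d′) * y ≡ a * (a′ * x + b′ * y) + b * (c′ * x + d′ * y)
            lem = solve-∀

    I₂· : ∀ v → I₂ · v ≐ v
    I₂· ⟨ x , y ⟩ = ≡⇒≐ (lem x y) (lem′ x y)
      where lem : ∀ x y → + 1 * x + + 0 * y ≡ x
            lem = solve-∀
            lem′ : ∀ x y → + 0 * x + + 1 * y ≡ y
            lem′ = solve-∀

    inv₂·· : ∀ A v → inv₂ A · (A · v) ≐ det A ∙ v
    inv₂·· (mat a b c d) ⟨ x , y ⟩ = ≡⇒≐ (lem a b c d x y) (lem′ a b c d x y)
      where lem : ∀ a b c d x y → d * (a * x + b * y) + (- b) * (c * x + d * y) ≡ (a * d - b * c) * x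
            lem = solve-∀
            lem′ : ∀ a b c d x y → (- c) * (a * x + b * y) + a * (c * x + d * y) ≡ (a * d - b * c) * y
            lem′ = solve-∀

    ·inv₂· : ∀ A v → A · (inv₂ A · v) ≐ det A ∙ v
    ·inv₂· (mat a b c d) ⟨ x , y ⟩ = ≡⇒≐ (lem a b c d x y) (lem′ a b c d x y)
      where lem : ∀ a b c d x y → a * (d * x + (- b) * y) + b * ((- c) * x + a * y) ≡ (a * d - b * c) * x
            lem = solve-∀
            lem′ : ∀ a b c d x y → c * (d * x + (- b) * y) + d * ((- c) * x + a * y) ≡ (a * d - b * c) * y
            lem′ = solve-∀

    det-⊗ : ∀ A B → det (A ⊗ B) ≡ det A * det B
    det-⊗ (mat a b c d) (mat a′ b′ c′ d′) = lem a b c d a′ b′ c′ d′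
      where lem : ∀ a b c d a′ b′ c′ d′ → (a * a′ + b * c′) * (c * b′ + d * d′) - (a * b′ + b * d′) * (c * a′ + d * c′)
                  ≡ (a * d - b * c) * (a′ * d′ - b′ * c′)
            lem = solve-∀

    det-inv₂ : ∀ A → det (inv₂ A) ≡ det A
    det-inv₂ (mat a b c d) = lem a b c d
      where lem : ∀ a b c d → d * a - (- b) * (- c) ≡ a * d - b * c
            lem = solve-∀

    D-cong : ∀ {v v′ w w′} → v ≐ v′ → w ≐ w′ → D v w ≋ D v′ w′
    D-cong {⟨ a , b ⟩} {⟨ a′ , b′ ⟩} {⟨ c , d ⟩} {⟨ c′ , d′ ⟩} (e ,, f) (g ,, h) =
      lin₄ d e (- c) f (- b′) g a′ h (lem a b c d a′ b′ c′ d′)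
      where lem : ∀ a b c d a′ b′ c′ d′ → a * d - b * c - (a′ * d′ - b′ * c′)
                  ≡ d * (a - a′) + (- c) * (b - b′) + (- b′) * (c - c′) + a′ * (d - d′)
            lem = solve-∀

    D-scaleˡ : ∀ s v w → D (s ∙ v) w ≡ s * D v w
    D-scaleˡ s ⟨ a , b ⟩ ⟨ c , d ⟩ = lem s a b c d
      where lem : ∀ s a b c d → s * a * d - s * b * c ≡ s * (a * d - b * c)
            lem = solve-∀

    D-scaleʳ : ∀ s v w → D v (s ∙ w) ≡ s * D v w
    D-scaleʳ s ⟨ a , b ⟩ ⟨ c , d ⟩ = lem s a b c d
      where lem : ∀ s a b c d → a * (s * d) - b * (s * c) ≡ s * (a * d - b * c)
            lem = solve-∀

    D-antisym : ∀ v w → D w v ≡ - D v w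
    D-antisym ⟨ a , b ⟩ ⟨ c , d ⟩ = lem a b c d
      where lem : ∀ a b c d → c * b - d * a ≡ - (a * d - b * c)
            lem = solve-∀

    D-self : ∀ v → D v v ≡ + 0
    D-self ⟨ a , b ⟩ = lem a b
      where lem : ∀ a b → a * b - b * a ≡ + 0
            lem = solve-∀

    D-· : ∀ A v w → D (A · v) (A · w) ≡ det A * D v w
    D-· (mat a b c d) ⟨ x , y ⟩ ⟨ z , w ⟩ = lem a b c d x y z w
      where lem : ∀ a b c d x y z w → (a * x + b * y) * (c * z + d * w) - (c * x + d * y) * (a * z + b * w)
                  ≡ (a * d - b * c) * (x * w - y * z)
            lem = solve-∀

    D-⊕ʳ : ∀ u v w → D u (v ⊕ w) ≡ D u v + D u w
    D-⊕ʳ ⟨ a , b ⟩ ⟨ x , y ⟩ ⟨ z , w ⟩ = lem a b x y z w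
      where lem : ∀ a b x y z w → a * (y + w) - b * (x + z) ≡ a * y - b * x + (a * w - b * z)
            lem = solve-∀

    ·-⊕ : ∀ A v w → A · (v ⊕ w) ≐ (A · v) ⊕ (A · w)
    ·-⊕ (mat a b c d) ⟨ x , y ⟩ ⟨ z , w ⟩ = ≡⇒≐ (lem a b x y z w) (lem c d x y z w)
      where lem : ∀ a b x y z w → a * (x + z) + b * (y + w) ≡ a * x + b * y + (a * z + b * w)
            lem = solve-∀

    cramer : ∀ v w u → D v w ∙ u ≐ (D u w ∙ v) ⊕ (D v u ∙ w)
    cramer ⟨ a , b ⟩ ⟨ c , d ⟩ ⟨ x , y ⟩ = ≡⇒≐ (lem a b c d x y) (lem′ a b c d x y)
      where lem : ∀ a b c d x y → (a * d - b * c) * x ≡ (x * d - y * c) * a + (a * y - b * x) * c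
            lem = solve-∀
            lem′ : ∀ a b c d x y → (a * d - b * c) * y ≡ (x * d - y * c) * b + (a * y - b * x) * d
            lem′ = solve-∀

    ∙-cancel : ∀ s {v w} → s ≉ + 0 → s ∙ v ≐ s ∙ w → v ≐ w
    ∙-cancel s s≉0 (e ,, f) = *-cancelˡ s s≉0 e ,, *-cancelˡ s s≉0 f

    ∙-zero : ∀ {s v} → s ≋ + 0 → s ∙ v ≐ 𝟎
    ∙-zero {s} {⟨ x , y ⟩} h = lin₁ x h (lem s x) ,, lin₁ y h (lem s y)
      where lem : ∀ s x → s * x - + 0 ≡ x * (s - + 0)
            lem = solve-∀

    D-nonzeroˡ : ∀ {v w} → D v w ≉ + 0 → NonZeroVector v
    D-nonzeroˡ {⟨ a , b ⟩} {⟨ c , d ⟩} h (e ,, f) = h (lin₂ d e (- c) f (lem a b c d))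
      where lem : ∀ a b c d → a * d - b * c - + 0 ≡ d * (a - + 0) + (- c) * (b - + 0)
            lem = solve-∀

    D-nonzeroʳ : ∀ {v w} → D v w ≉ + 0 → NonZeroVector w
    D-nonzeroʳ {⟨ a , b ⟩} {⟨ c , d ⟩} h (e ,, f) = h (lin₂ (- b) e a f (lem a b c d))
      where lem : ∀ a b c d → a * d - b * c - + 0 ≡ (- b) * (c - + 0) + a * (d - + 0)
            lem = solve-∀

    -- Completes `v` to a basis of determinant one; such bases are the usual input of `transition`
    -- and the usual test for comparing multiples of `v`.
    partner : ∀ {v} → NonZeroVector v → ∃ λ w → D v w ≋ + 1
    partner {⟨ a , b ⟩} v≉0 with a ≋? + 0
    ... | no a≉0 with inverse a≉0
    ...   | c , ac≋1 = ⟨ + 0 , c ⟩ , lin₁ (+ 1) ac≋1 (lem a b c)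
      where lem : ∀ a b c → a * c - b * + 0 - + 1 ≡ + 1 * (a * c - + 1)
            lem = solve-∀
    partner {⟨ a , b ⟩} v≉0 | yes a≋0 with b ≋? + 0
    ... | yes b≋0 = contradiction (a≋0 ,, b≋0) v≉0
    ... | no b≉0 with inverse b≉0
    ...   | c , bc≋1 = ⟨ - c , + 0 ⟩ , lin₁ (+ 1) bc≋1 (lem a b c)
      where lem : ∀ a b c → a * + 0 - b * (- c) - + 1 ≡ + 1 * (b * c - + 1)
            lem = solve-∀

    ∙-nonzero : ∀ {s v} → s ≉ + 0 → NonZeroVector v → NonZeroVector (s ∙ v)
    ∙-nonzero {s} {⟨ x , y ⟩} s≉0 v≉0 (e ,, f) = v≉0 (cancel x e ,, cancel y f)
      where
      cancel : ∀ x → s * x ≋ + 0 → x ≋ + 0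
      cancel x h with zero-product s x h
      ... | inj₁ z = contradiction z s≉0
      ... | inj₂ z = z

    ·-nonzero : ∀ {A v} → det A ≉ + 0 → NonZeroVector v → NonZeroVector (A · v)
    ·-nonzero {A} {v} dA v≉0 =
      let w , e = partner v≉0
      in D-nonzeroˡ {A · v} {A · w} (≉0-resp (≋-sym (lin₀ (D-· A v w))) (*-≉0 {det A} {D v w} dA (≉0-resp (≋-sym e) 1≉0)))

    -- Cramer's rule in a basis v, u of determinant one: the u-coordinate of `w` is `D v w`, which
    -- vanishes, and its v-coordinate is `D w u`.
    proportional : ∀ {v w} → NonZeroVector v → D v w ≋ + 0 → ∃ λ s → w ≐ s ∙ v
    proportional {v} {w} v≉0 h =
      let u , e = partner v≉0
      in D w u , go u e
      where
      go : ∀ u → D v u ≋ + 1 → w ≐ D w u ∙ v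
      go u e =
        component (v₁ w) (v₁ v) (v₁ u) (D v u) (D w u) (D v w) e h (eq₁ (cramer v u w)) ,,
        component (v₂ w) (v₂ v) (v₂ u) (D v u) (D w u) (D v w) e h (eq₂ (cramer v u w))
        where
        component : ∀ x a b d t z → d ≋ + 1 → z ≋ + 0 → d * x ≋ t * a + z * b → x ≋ t * a
        component x a b d t z d≋1 z≋0 h = lin₃ (- x) d≋1 b z≋0 (+ 1) h (lem x a b d t z)
          where lem : ∀ x a b d t z → x - t * a ≡ (- x) * (d - + 1) + b * (z - + 0) + + 1 * (d * x - (t * a + z * b))
                lem = solve-∀

    proportional≉0 : ∀ {v w s} → NonZeroVector w → w ≐ s ∙ v → s ≉ + 0
    proportional≉0 {v} {w} {s} w≉0 e s≋0 = w≉0 (≐-trans e (∙-zero {s} {v} s≋0))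

    D-proportional : ∀ {v w s} → w ≐ s ∙ v → D v w ≋ + 0
    D-proportional {v} {w} {s} e = ≋-trans (D-cong {v} {v} {w} {s ∙ v} ≐-refl e)
      (≋-trans (lin₀ (D-scaleʳ s v v)) (≋-trans (*-congˡ s (lin₀ (D-self v))) (lin₀ (ℤₚ.*-zeroʳ s))))

    transition : ∀ v w v′ w′ → D v w ≉ + 0 → ∃ λ A → (A · v ≐ v′) × (A · w ≐ w′) × (det A * D v w ≋ D v′ w′)
    transition v@(⟨ a , b ⟩) w@(⟨ c , d ⟩) v′@(⟨ a′ , b′ ⟩) w′@(⟨ c′ , d′ ⟩) h = A , Av , Aw ,
        ≋-trans (lin₀ (sym (D-· A v w))) (D-cong {A · v} {v′} {A · w} {w′} Av Aw)
      where
      open import Relation.Binary.PropositionalEquality using (sym)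
      i : ℤ
      i = proj₁ (inverse h)
      A : M2
      -- The matrix with columns `v′`, `w′` times the inverse of the matrix with columns `v`, `w`.
      A = mat (i * (d * a′ - b * c′)) (i * (a * c′ - c * a′)) (i * (d * b′ - b * d′)) (i * (a * d′ - c * b′))
      Av : A · v ≐ v′
      Av = lin₁ a′ (proj₂ (inverse h)) (lem i a b c d a′ c′) ,, lin₁ b′ (proj₂ (inverse h)) (lem i a b c d b′ d′)
        where lem : ∀ i a b c d a′ c′ → i * (d * a′ - b * c′) * a + i * (a * c′ - c * a′) * b - a′ ≡ a′ * ((a * d - b * c) * i - + 1)
              lem = solve-∀
      Aw : A · w ≐ w′
      Aw = lin₁ c′ (proj₂ (inverse h)) (lem i a b c d a′ c′) ,, lin₁ d′ (proj₂ (inverse h)) (lem i a b c d b′ d′)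
        where lem : ∀ i a b c d a′ c′ → i * (d * a′ - b * c′) * c + i * (a * c′ - c * a′) * d - c′ ≡ c′ * ((a * d - b * c) * i - + 1)
              lem = solve-∀

    matrix-ext : ∀ {A B v w} → D v w ≉ + 0 → A · v ≐ B · v → A · w ≐ B · w → A ≐ᴹ B
    matrix-ext {mat a b c d} {mat a′ b′ c′ d′} {⟨ x , y ⟩} {⟨ z , w ⟩} h (e ,, f) (g ,, k) =
      entries (fst a b a′ b′ e g) (snd a b a′ b′ e g) (fst c d c′ d′ f k) (snd c d c′ d′ f k)
      where
      δ : ℤ
      δ = x * w - y * z
      fst : ∀ a b a′ b′ → a * x + b * y ≋ a′ * x + b′ * y → a * z + b * w ≋ a′ * z + b′ * w → a ≋ a′
      fst a b a′ b′ e g = *-cancelˡ δ h (lin₂ w e (- y) g (lem a b a′ b′ x y z w))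
        where lem : ∀ a b a′ b′ x y z w → (x * w - y * z) * a - (x * w - y * z) * a′
                    ≡ w * (a * x + b * y - (a′ * x + b′ * y)) + (- y) * (a * z + b * w - (a′ * z + b′ * w))
              lem = solve-∀
      snd : ∀ a b a′ b′ → a * x + b * y ≋ a′ * x + b′ * y → a * z + b * w ≋ a′ * z + b′ * w → b ≋ b′
      snd a b a′ b′ e g = *-cancelˡ δ h (lin₂ (- z) e x g (lem a b a′ b′ x y z w))
        where lem : ∀ a b a′ b′ x y z w → (x * w - y * z) * b - (x * w - y * z) * b′
                    ≡ (- z) * (a * x + b * y - (a′ * x + b′ * y)) + x * (a * z + b * w - (a′ * z + b′ * w))
              lem = solve-∀

    ≐⇒~ : ∀ {v w} → v ≐ w → v ~ w
    ≐⇒~ {v} h = scaled (+ 1) Sq-one (≐-trans (≐-sym h) (≐-sym (1∙ v)))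

    ~-refl : ∀ {v} → v ~ v
    ~-refl {v} = ≐⇒~ {v} ≐-refl

    ~-trans : ∀ {u v w} → u ~ v → v ~ w → u ~ w
    ~-trans {u} {v} {w} (scaled s S e) (scaled t T f) = scaled (t * s) (Sq-* T S) (≐-trans f (≐-trans (∙-cong t e) (∙-∙ t s u)))

    ~-sym : ∀ {v w} → v ~ w → w ~ v
    ~-sym {v} {w} (scaled s S e) =
      let t , st≋1 = inverse (Sq⇒≉0 S)
          ts≋1 = ≋-trans (lin₀ (ℤₚ.*-comm t s)) st≋1
      in scaled t (Sq-cancel S (Sq-resp (≋-sym st≋1) Sq-one))
           (≐-sym (≐-trans (∙-cong t e) (≐-trans (∙-∙ t s v) (≐-trans (∙-congˢ v ts≋1) (1∙ v)))))

    ·-~ : ∀ A {v w} → v ~ w → A · v ~ A · w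
    ·-~ A {v} {w} (scaled s S e) = scaled s S (≐-trans (·-cong A e) (·-∙ A s v))

    ∙-~ : ∀ t {v w} → v ~ w → t ∙ v ~ t ∙ w
    ∙-~ t {v} {w} (scaled s S e) = scaled s S (≐-trans (∙-cong t e) (≐-trans (∙-∙ t s v) (≐-trans (∙-congˢ v (lin₀ (ℤₚ.*-comm t s))) (≐-sym (∙-∙ s t v)))))

    Sq-∙ : ∀ {s v} → Sq s → v ~ s ∙ v
    Sq-∙ {s} {v} S = scaled s S ≐-refl

    Sq-D-resp : ∀ {v v′ w w′} → v ~ v′ → w ~ w′ → Sq (D v w) → Sq (D v′ w′)
    Sq-D-resp {v} {v′} {w} {w′} (scaled s S e) (scaled t T f) h =
      Sq-resp (≋-sym (≋-trans (D-cong {v′} {s ∙ v} {w′} {t ∙ w} e f)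
        (≋-trans (lin₀ (D-scaleˡ s v (t ∙ w))) (*-congˡ s (lin₀ (D-scaleʳ t v w)))))) (Sq-* S (Sq-* T h))

    D≋0-resp : ∀ {v v′ w w′} → v ~ v′ → w ~ w′ → D v w ≋ + 0 → D v′ w′ ≋ + 0
    D≋0-resp {v} {v′} {w} {w′} (scaled s S e) (scaled t T f) h =
      ≋-trans (D-cong {v′} {s ∙ v} {w′} {t ∙ w} e f)
        (≋-trans (lin₀ (D-scaleˡ s v (t ∙ w))) (≋-trans (*-congˡ s (lin₀ (D-scaleʳ t v w)))
          (lin₁ (s * t) h (lem s t (D v w)))))
      where lem : ∀ s t x → s * (t * x) - + 0 ≡ s * t * (x - + 0)
            lem = solve-∀

    Sq-D-sym : ∀ {v w} → Sq (D v w) → Sq (D w v)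
    Sq-D-sym {v} {w} h = Sq-resp (lin₀ (sym (D-antisym v w))) (Sq-neg h)
      where open import Relation.Binary.PropositionalEquality using (sym)

    e₁-nonzero : NonZeroVector e₁
    e₁-nonzero (e ,, _) = 1≉0 e
    e₂-nonzero : NonZeroVector e₂
    e₂-nonzero (_ ,, e) = 1≉0 e

-- The graph Γ(p): labellings by square classes, isomorphisms, distances and the covering of the
-- complete graph.

module SquareClassModels (p : ℕ) (prime : Prime p) (p%4≡1 : p % 4 ≡ 1) where

  open import Defs hiding (_^_; sym; inv; pres)
  open PrimeField p prime
  open Squares p prime p%4≡1
  open Plane p prime p%4≡1

  abstract
    D≋0-sym : ∀ {v w} → D v w ≋ + 0 → D w v ≋ + 0
    D≋0-sym {v} {w} h = ≋-trans (lin₀ (D-antisym v w)) (neg-cong h)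

    D≋0-trans : ∀ {u v w} → NonZeroVector v → D u v ≋ + 0 → D v w ≋ + 0 → D u w ≋ + 0
    D≋0-trans {u} {v} {w} v≉0 h k =
      let s , e = proportional v≉0 (D≋0-sym h)
      in ≋-trans (D-cong {u} {s ∙ v} {w} {w} e ≐-refl) (≋-trans (lin₀ (D-scaleˡ s v w)) (lin₁ s k (lem s (D v w))))
      where lem : ∀ s x → s * x - + 0 ≡ s * (x - + 0)
            lem = solve-∀

    ν-inverse-nonsquare : ∀ {i} → ν * i ≋ + 1 → ¬ Sq i
    ν-inverse-nonsquare {i} νi≋1 S = ν-nonsquare (Sq-cancel S (Sq-resp (≋-trans (≋-sym νi≋1) (lin₀ (ℤₚ.*-comm ν i))) Sq-one))

    -- Squares have index two among the nonzero scalars: a nonsquare s is s / ν times ν, and s / ν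
    -- is a square.
    line-classes : ∀ {v w} → NonZeroVector v → NonZeroVector w → D v w ≋ + 0 → v ~ w ⊎ ν ∙ v ~ w
    line-classes {v} {w} v≉0 w≉0 h =
      let s , e = proportional v≉0 h
          i , νi≋1 = inverse ν≉0
      in decide s i e νi≋1 (Sq? s)
      where
      decide : ∀ s i → w ≐ s ∙ v → ν * i ≋ + 1 → Dec (Sq s) → v ~ w ⊎ ν ∙ v ~ w
      decide s i e νi≋1 (yes S) = inj₁ (scaled s S e)
      decide s i e νi≋1 (no ¬S) = inj₂ (scaled (s * i)
        (nonsquare-* (proportional≉0 w≉0 e) i≉0 ¬S (ν-inverse-nonsquare νi≋1))
        (≐-trans e (≐-trans
          (∙-congˢ {s} {s * i * ν} v (lin₁ (- s) νi≋1 (lem s i ν))) (≐-sym (∙-∙ (s * i) ν v)))))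
        where
        i≉0 : i ≉ + 0
        i≉0 i≋0 = 1≉0 (≋-trans (≋-sym νi≋1) (lin₁ ν i≋0 (lem₀ ν i)))
          where lem₀ : ∀ n i → n * i - + 0 ≡ n * (i - + 0)
                lem₀ = solve-∀
        lem : ∀ s i n → s - s * i * n ≡ (- s) * (n * i - + 1)
        lem = solve-∀

    -- The determinant against a `partner` of `v` is 1 for the one vector and ν for the other, and
    -- its square class depends only on the class of the vector.
    ν∙-not~ : ∀ {v} → NonZeroVector v → ¬ (ν ∙ v ~ v)
    ν∙-not~ {v} v≉0 r =
      let w , e = partner v≉0
      in Sq-ν-exclusive (Sq-resp (≋-sym e) Sq-one)
           (Sq-resp (lin₀ (D-scaleˡ ν v w)) (Sq-D-resp (~-sym {ν ∙ v} {v} r) (~-refl) (Sq-resp (≋-sym e) Sq-one)))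

    D-ν∙ : ∀ v w → D v (ν ∙ w) ≋ ν * D v w
    D-ν∙ v w = lin₀ (D-scaleʳ ν v w)

    ν∙ν∙ : ∀ v → v ~ ν ∙ (ν ∙ v)
    ν∙ν∙ v = scaled (ν * ν) (square ν ν≉0 ≋-refl) (∙-∙ ν ν v)

    square-neighbour : ∀ {v w} → D v w ≉ + 0 → ¬ Sq (D v w) → Sq (D v (ν ∙ w))
    square-neighbour {v} {w} h ns = Sq-resp (≋-sym (D-ν∙ v w)) (Sq-ν h ns)

  -- Points of the projective line: zero is the line of e₁ and suc i the line of ⟨ i , 1 ⟩.
  point : Fin (suc p) → V2
  point zero = e₁
  point (suc i) = ⟨ + toℕ i , + 1 ⟩

  opaque
    unfolding D

    point-nonzero : ∀ x → NonZeroVector (point x)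
    point-nonzero zero (e ,, _) = 1≉0 e
    point-nonzero (suc i) (_ ,, e) = 1≉0 e

    point-injective : ∀ {x y} → D (point x) (point y) ≋ + 0 → x ≡ y
    point-injective {zero} {zero} h = refl
    point-injective {zero} {suc j} h = contradiction (≋-trans (lin₀ (lem (+ toℕ j))) h) 1≉0
      where lem : ∀ j → + 1 ≡ + 1 * + 1 - + 0 * j
            lem = solve-∀
    point-injective {suc i} {zero} h = contradiction (lin₁ (- + 1) h (lem (+ toℕ i))) 1≉0
      where lem : ∀ j → + 1 - + 0 ≡ (- + 1) * (j * + 0 - + 1 * + 1 - + 0)
            lem = solve-∀
    point-injective {suc i} {suc j} h = cong suc (toℕ-≋-injective {i} {j} (lin₁ (+ 1) h (lem (+ toℕ i) (+ toℕ j))))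
      where lem : ∀ i j → i - j ≡ + 1 * (i * + 1 - + 1 * j - + 0)
            lem = solve-∀

    slope-exists : ∀ v → ∃ λ x → D v (point x) ≋ + 0
    slope-exists ⟨ a , b ⟩ = decide (b ≋? + 0)
      where
      decide : Dec (b ≋ + 0) → ∃ λ x → D ⟨ a , b ⟩ (point x) ≋ + 0
      decide (yes b≋0) = zero , lin₁ (- + 1) b≋0 (lem a b)
        where lem : ∀ a b → a * + 0 - b * + 1 - + 0 ≡ (- + 1) * (b - + 0)
              lem = solve-∀
      decide (no b≉0) = let c , bc≋1 = inverse b≉0 in suc (residue (a * c)) ,
          lin₂ (- b) (residue-≋ (a * c)) (- a) bc≋1 (lem a b c (+ toℕ (residue (a * c))))
        where lem : ∀ a b c r → a * + 1 - b * r - + 0 ≡ (- b) * (r - a * c) + (- a) * (b * c - + 1)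
              lem = solve-∀

    slope : V2 → Fin (suc p)
    slope v = proj₁ (slope-exists v)

    slope-point : ∀ v → D v (point (slope v)) ≋ + 0
    slope-point v = proj₂ (slope-exists v)

    slope⇒ : ∀ {v w} → slope v ≡ slope w → D v w ≋ + 0
    slope⇒ {v} {w} e = D≋0-trans {v} {point (slope v)} {w} (point-nonzero (slope v)) (slope-point v)
      (subst (λ x → D (point x) w ≋ + 0) (sym e) (D≋0-sym {w} {point (slope w)} (slope-point w)))

    slope-unique : ∀ {v x} → NonZeroVector v → D v (point x) ≋ + 0 → slope v ≡ x
    slope-unique {v} {x} v≉0 h = point-injective (D≋0-trans {point (slope v)} {v} {point x} v≉0
      (D≋0-sym {v} {point (slope v)} (slope-point v)) h)

    slope⇐ : ∀ {v w} → NonZeroVector v → NonZeroVector w → D v w ≋ + 0 → slope v ≡ slope w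
    slope⇐ {v} {w} v≉0 w≉0 h = slope-unique {v} {slope w} v≉0 (D≋0-trans {v} {w} {point (slope w)} w≉0 h (slope-point w))

  -- The vertices of Γ are the nonzero vectors of F_p² up to square factors, adjacent when their determinant is a nonzero square.
  record Model (Γ : Graph) : Set where
    field
      V           : Fin (n Γ) → V2
      V-nonzero   : ∀ u → NonZeroVector (V u)
      V-injective : ∀ {u v} → V u ~ V v → u ≡ v
      vertex      : ∀ x → NonZeroVector x → Fin (n Γ)
      V-vertex    : ∀ x (x≉0 : NonZeroVector x) → V (vertex x x≉0) ~ x
      adj⇒        : ∀ {u v} → Adj Γ u v → Sq (D (V u) (V v))
      adj⇐        : ∀ {u v} → Sq (D (V u) (V v)) → Adj Γ u v

  true-iff : ∀ {b c : Bool} → (b ≡ true → c ≡ true) → (c ≡ true → b ≡ true) → b ≡ c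
  true-iff {true} {true} f g = refl
  true-iff {true} {false} f g = sym (f refl)
  true-iff {false} {true} f g = g refl
  true-iff {false} {false} f g = refl

  -- A matrix of square determinant preserves the square class of determinants. The adjugate serves
  -- as its inverse: the product of the two is the scalar `det A`, a square, which leaves every
  -- class unchanged. With two models this yields isomorphisms, with one model automorphisms.
  module LinearIso {Γ Δ : Graph} (M : Model Γ) (N : Model Δ) (A : M2) (detA : Sq (det A)) where
    private
      module M = Model M
      module N = Model N

    image-nonzero : ∀ u → NonZeroVector (A · M.V u)
    image-nonzero u = ·-nonzero (Sq⇒≉0 detA) (M.V-nonzero u)

    preimage-nonzero : ∀ v → NonZeroVector (inv₂ A · N.V v)
    preimage-nonzero v = ·-nonzero (≉0-resp (≋-sym (lin₀ (det-inv₂ A))) (Sq⇒≉0 detA)) (N.V-nonzero v)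

    to : Fin (n Γ) → Fin (n Δ)
    to u = N.vertex (A · M.V u) (image-nonzero u)

    from : Fin (n Δ) → Fin (n Γ)
    from v = M.vertex (inv₂ A · N.V v) (preimage-nonzero v)

    abstract
      V-to : ∀ u → N.V (to u) ~ A · M.V u
      V-to u = N.V-vertex (A · M.V u) (image-nonzero u)

      V-from : ∀ v → M.V (from v) ~ inv₂ A · N.V v
      V-from v = M.V-vertex (inv₂ A · N.V v) (preimage-nonzero v)

      from-to : ∀ u → from (to u) ≡ u
      from-to u = M.V-injective (~-trans (V-from (to u))
        (~-trans (·-~ (inv₂ A) (V-to u))
          (~-sym {M.V u} {inv₂ A · (A · M.V u)} (scaled (det A) detA (inv₂·· A (M.V u))))))

      to-from : ∀ v → to (from v) ≡ v
      to-from v = N.V-injective (~-trans (V-to (from v))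
        (~-trans (·-~ A (V-from v))
          (~-sym {N.V v} {A · (inv₂ A · N.V v)} (scaled (det A) detA (·inv₂· A (N.V v))))))

      to-adj : ∀ u v → adj Δ (to u) (to v) ≡ adj Γ u v
      to-adj u v = true-iff
        (λ h → M.adj⇐ (Sq-cancel detA (Sq-resp (lin₀ (D-· A (M.V u) (M.V v)))
          (Sq-D-resp (V-to u) (V-to v) (N.adj⇒ h)))))
        (λ h → N.adj⇐ (Sq-D-resp (~-sym (V-to u)) (~-sym (V-to v))
          (Sq-resp (≋-sym (lin₀ (D-· A (M.V u) (M.V v)))) (Sq-* detA (M.adj⇒ h)))))

    linear-iso : Iso Γ Δ
    linear-iso = record { to = to ; from = from ; from-to = from-to ; to-from = to-from ; pres = to-adj }

  module Automorphism {Γ : Graph} (M : Model Γ) (A : M2) (detA : Sq (det A)) where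
    open LinearIso M M A detA public

    linear-aut : Aut Γ
    linear-aut = record { fun = to ; inv = from ; inv-fun = from-to ; fun-inv = to-from ; pres = to-adj }

  models-isomorphic : ∀ {Γ Δ} → Model Γ → Model Δ → Iso Γ Δ
  models-isomorphic M N = LinearIso.linear-iso M N I₂ Sq-one

  transport-model : ∀ {Γ Δ} → Iso Γ Δ → Model Δ → Model Γ
  transport-model {Γ} {Δ} f N = record
    { V = λ u → N.V (to u)
    ; V-nonzero = λ u → N.V-nonzero (to u)
    ; V-injective = λ {u} {v} h → trans (sym (from-to u)) (trans (cong from (N.V-injective h)) (from-to v))
    ; vertex = λ x x≉0 → from (N.vertex x x≉0)
    ; V-vertex = λ x x≉0 → subst (λ v → N.V v ~ x) (sym (to-from (N.vertex x x≉0))) (N.V-vertex x x≉0)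
    ; adj⇒ = λ {u} {v} h → N.adj⇒ (trans (pres u v) h)
    ; adj⇐ = λ {u} {v} h → trans (sym (pres u v)) (N.adj⇐ h)
    }
    where
    module N = Model N
    open Iso f

  module Metric {Γ : Graph} (M : Model Γ) where
    open Model M

    Antipodes : Fin (n Γ) → Fin (n Γ) → Set
    Antipodes u v = ν ∙ V u ~ V v

    -- The four cases are the distances 0, 3, 1 and 2, in this order.
    data Position (u v : Fin (n Γ)) : Set where
      same : u ≡ v → Position u v
      anti : Antipodes u v → Position u v
      near : Sq (D (V u) (V v)) → Position u v
      far  : Sq (ν * D (V u) (V v)) → Position u v

    antipode : Fin (n Γ) → Fin (n Γ)
    antipode u = vertex (ν ∙ V u) (∙-nonzero ν≉0 (V-nonzero u))

    abstract
      antipode-spec : ∀ u → Antipodes u (antipode u)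
      antipode-spec u = ~-sym (V-vertex (ν ∙ V u) (∙-nonzero ν≉0 (V-nonzero u)))

      antipodes-unique : ∀ {u v w} → Antipodes u v → Antipodes u w → v ≡ w
      antipodes-unique {u} {v} {w} h k = V-injective (~-trans (~-sym h) k)

      antipodes-sym : ∀ {u v} → Antipodes u v → Antipodes v u
      antipodes-sym {u} {v} h = ~-trans (∙-~ ν (~-sym h)) (~-sym (ν∙ν∙ (V u)))

      antipodes-D : ∀ {u v} → Antipodes u v → D (V u) (V v) ≋ + 0
      antipodes-D {u} {v} h = D≋0-resp (~-refl) h (D-proportional ≐-refl)

      antipodes-≢ : ∀ {u v} → Antipodes u v → u ≢ v
      antipodes-≢ {u} h refl = ν∙-not~ {V u} (V-nonzero u) h

      line-cases : ∀ {u v} → D (V u) (V v) ≋ + 0 → u ≡ v ⊎ Antipodes u v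
      line-cases {u} {v} h with line-classes {V u} {V v} (V-nonzero u) (V-nonzero v) h
      ... | inj₁ r = inj₁ (V-injective r)
      ... | inj₂ r = inj₂ r

      position : ∀ u v → Position u v
      position u v = decide (D (V u) (V v) ≋? + 0) (Sq? (D (V u) (V v)))
        where
        decide : Dec (D (V u) (V v) ≋ + 0) → Dec (Sq (D (V u) (V v))) → Position u v
        decide (yes z) _ with line-cases z
        ... | inj₁ e = same e
        ... | inj₂ r = anti r
        decide (no _) (yes S) = near S
        decide (no nz) (no ¬S) = far (Sq-ν nz ¬S)

      -- If D(u,v) = d is not a square, d(u + v) is a common neighbour.
      common-neighbour : ∀ {u v} → Sq (ν * D (V u) (V v)) → ∃ λ w → Adj Γ u w × Adj Γ w v
      common-neighbour {u} {v} h = vertex x x≉0 ,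
          adj⇐ (Sq-D-resp (~-refl) (~-sym (V-vertex x x≉0)) Sux) ,
          adj⇐ (Sq-D-resp (~-sym (V-vertex x x≉0)) (~-refl) Sxv)
        where
        d : ℤ
        d = D (V u) (V v)
        d≉0 : d ≉ + 0
        d≉0 z = Sq⇒≉0 h (lin₁ ν z (lem ν d))
          where lem : ∀ s x → s * x - + 0 ≡ s * (x - + 0)
                lem = solve-∀
        x : V2
        x = d ∙ (V u ⊕ V v)
        dd : Sq (d * d)
        dd = square d d≉0 ≋-refl
        Sux : Sq (D (V u) x)
        Sux = Sq-resp (lin₀ (sym (trans (D-scaleʳ d (V u) (V u ⊕ V v)) (cong (d *_)
          (trans (D-⊕ʳ (V u) (V u) (V v)) (trans (cong (λ z → z + d) (D-self (V u))) (ℤₚ.+-identityˡ d))))))) dd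
        Svx : Sq (D (V v) x)
        Svx = Sq-resp (lin₀ (sym (trans (D-scaleʳ d (V v) (V u ⊕ V v)) (trans (cong (d *_)
          (trans (D-⊕ʳ (V v) (V u) (V v)) (trans (cong₂ _+_ (D-antisym (V u) (V v)) (D-self (V v))) (ℤₚ.+-identityʳ (- d))))) (lem d))))) (Sq-neg dd)
          where lem : ∀ d → d * - d ≡ - (d * d)
                lem = solve-∀
        Sxv : Sq (D x (V v))
        Sxv = Sq-D-sym Svx
        x≉0 : NonZeroVector x
        x≉0 = D-nonzeroʳ (Sq⇒≉0 Sux)

      -- Passing to the antipode multiplies determinants by ν up to squares, so the antipode of a
      -- neighbour is at distance two.
      near-antipode : ∀ {u w v} → Sq (D (V u) (V w)) → Antipodes u v → Sq (ν * D (V w) (V v))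
      near-antipode {u} {w} {v} S A = Sq-cancel (square ν ν≉0 ≋-refl)
        (Sq-resp (lin₀ (sym (ℤₚ.*-assoc ν ν (ν * D (V w) (V v))))) (Sq-cancel-back S′))
        where
        S′ : Sq (D (V w) (ν ∙ V v))
        S′ = Sq-D-resp (~-refl)
               (~-trans (ν∙ν∙ (V u)) (∙-~ ν A)) (Sq-D-sym S)
        Sq-cancel-back : Sq (D (V w) (ν ∙ V v)) → Sq (ν * (ν * (ν * D (V w) (V v))))
        Sq-cancel-back h = Sq-resp (lin₀ (trans (cong ((ν * ν) *_) (D-scaleʳ ν (V w) (V v))) (ℤₚ.*-assoc ν ν (ν * D (V w) (V v)))))
          (Sq-* (square ν ν≉0 ≋-refl) h)

      neighbour-exists : ∀ u → ∃ λ w → Adj Γ u w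
      neighbour-exists u =
        let x , e = partner (V-nonzero u)
            x≉0 = D-nonzeroʳ (≉0-resp (≋-sym e) 1≉0)
        in vertex x x≉0 , adj⇐ (Sq-D-resp (~-refl) (~-sym (V-vertex x x≉0)) (Sq-resp (≋-sym e) Sq-one))

      walk-within-3 : ∀ {u v} → Position u v → ∃ λ k → k ℕ.≤ 3 × Walk Γ u v k
      walk-within-3 (same refl) = 0 , ℕ.z≤n , here
      walk-within-3 (near S) = 1 , ℕ.s≤s ℕ.z≤n , step (adj⇐ S) here
      walk-within-3 {u} {v} (far S) = let w , a , b = common-neighbour S in 2 , ℕ.s≤s (ℕ.s≤s ℕ.z≤n) , step a (step b here)
      walk-within-3 {u} {v} (anti A) =
        let w , a = neighbour-exists u
            x , b , c = common-neighbour (near-antipode (adj⇒ a) A)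
        in 3 , ℕₚ.≤-refl , step a (step b (step c here))

      antipodes-walk : ∀ {u v} → Antipodes u v → ∀ m → Walk Γ u v m → 3 ℕ.≤ m
      antipodes-walk {u} A .0 here = contradiction refl (antipodes-≢ A)
      antipodes-walk {u} {v} A .1 (step a here) = contradiction (antipodes-D A) (Sq⇒≉0 (adj⇒ a))
      antipodes-walk {u} {v} A .2 (step {v = w} a (step b here)) =
        contradiction (near-antipode (adj⇒ a) A) (Sq-ν-exclusive (adj⇒ b))
      antipodes-walk A _ (step _ (step _ (step _ _))) = ℕ.s≤s (ℕ.s≤s (ℕ.s≤s ℕ.z≤n))

      antipodes⇒dist : ∀ {u v} → Antipodes u v → Dist Γ u v 3
      antipodes⇒dist {u} {v} A = exact (walk-within-3 (anti {u} {v} A)) , antipodes-walk A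
        where
        exact : (∃ λ k → k ℕ.≤ 3 × Walk Γ u v k) → Walk Γ u v 3
        exact (k , k≤3 , w) = subst (Walk Γ u v) (ℕₚ.≤-antisym k≤3 (antipodes-walk A k w)) w

      dist⇒antipodes : ∀ {u v} → Dist Γ u v 3 → Antipodes u v
      dist⇒antipodes {u} {v} (_ , min) = classify (position u v)
        where
        classify : Position u v → Antipodes u v
        classify (same refl) = contradiction (min 0 here) λ ()
        classify (anti A) = A
        classify (near S) = contradiction (min 1 (step (adj⇐ S) here)) λ { (ℕ.s≤s ()) }
        classify (far S) = let w , a , b = common-neighbour S in contradiction (min 2 (step a (step b here))) λ { (ℕ.s≤s (ℕ.s≤s ())) }

      dist2⇒far : ∀ {u v} → Dist Γ u v 2 → Sq (ν * D (V u) (V v))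
      dist2⇒far {u} {v} (w , min) = classify (position u v)
        where
        classify : Position u v → Sq (ν * D (V u) (V v))
        classify (same refl) = contradiction (min 0 here) λ ()
        classify (anti A) = contradiction (antipodes-walk A 2 w) λ { (ℕ.s≤s (ℕ.s≤s ())) }
        classify (near S) = contradiction (min 1 (step (adj⇐ S) here)) λ { (ℕ.s≤s ()) }
        classify (far S) = S

      base : Fin (n Γ)
      base = vertex e₁ e₁-nonzero

      diameter-3 : Diameter Γ 3
      diameter-3 = (λ u v → walk-within-3 (position u v)) , base , antipode base , antipodes⇒dist (antipode-spec base)

      connected : Connected Γ
      connected u v = let k , _ , w = walk-within-3 (position u v) in k , w

      antirel⇔ : ∀ u v → D (V u) (V v) ≋ + 0 ⇔ AntiRel Γ 3 u v
      antirel⇔ u v = mk⇔ to from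
        where
        to : D (V u) (V v) ≋ + 0 → AntiRel Γ 3 u v
        to h with line-cases h
        ... | inj₁ e = inj₁ e
        ... | inj₂ A = inj₂ (antipodes⇒dist A)
        from : AntiRel Γ 3 u v → D (V u) (V v) ≋ + 0
        from (inj₁ refl) = lin₀ (D-self (V u))
        from (inj₂ d) = antipodes-D (dist⇒antipodes d)

    opaque
      unfolding D

      -- The vectors (1,0), (0,1) and (1,1) form a triangle: the three determinants, in suitable
      -- order, are all 1.
      not-bipartite : ¬ Bipartite Γ
      not-bipartite (col , proper) = three (col a) (col b) (col c)
          (proper a b (edge e₁ e₂ e₁-nonzero e₂-nonzero Sq-one))
          (proper a c (edge e₁ e₃ e₁-nonzero e₃-nonzero Sq-one))
          (proper c b (edge e₃ e₂ e₃-nonzero e₂-nonzero Sq-one))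
        where
        e₃ : V2
        e₃ = ⟨ + 1 , + 1 ⟩
        e₃-nonzero : NonZeroVector e₃
        e₃-nonzero (e ,, _) = 1≉0 e
        a b c : Fin (n Γ)
        a = vertex e₁ e₁-nonzero
        b = vertex e₂ e₂-nonzero
        c = vertex e₃ e₃-nonzero
        edge : ∀ x y x≉0 y≉0 → Sq (D x y) → Adj Γ (vertex x x≉0) (vertex y y≉0)
        edge x y x≉0 y≉0 S = adj⇐ (Sq-D-resp (~-sym (V-vertex x x≉0)) (~-sym (V-vertex y y≉0)) S)
        three : ∀ (x y z : Bool) → x ≢ y → x ≢ z → z ≢ y → ⊥
        three false false z h k l = h refl
        three false true false h k l = k refl
        three false true true h k l = l refl
        three true true z h k l = h refl
        three true false true h k l = k refl
        three true false false h k l = l refl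

    π : Fin (n Γ) → Fin (suc p)
    π u = slope (V u)

    abstract
      -- The two classes on the line have determinants differing by the factor ν, so one of them is
      -- a square.
      neighbour-on-line : ∀ u y → π u ≢ y → ∃ λ w → Adj Γ u w × π w ≡ y
      neighbour-on-line u y πu≢y = decide (Sq? (D (V u) (point y)))
        where
        d≉0 : D (V u) (point y) ≉ + 0
        d≉0 h = πu≢y (slope-unique (V-nonzero u) h)
        take : ∀ x → NonZeroVector x → Sq (D (V u) x) → D x (point y) ≋ + 0 → ∃ λ w → Adj Γ u w × π w ≡ y
        take x x≉0 S h = vertex x x≉0 ,
          adj⇐ (Sq-D-resp (~-refl) (~-sym (V-vertex x x≉0)) S) ,
          slope-unique (V-nonzero _)
            (D≋0-resp (~-sym (V-vertex x x≉0)) (~-refl) h)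
        decide : Dec (Sq (D (V u) (point y))) → ∃ λ w → Adj Γ u w × π w ≡ y
        decide (yes S) = take (point y) (point-nonzero y) S (lin₀ (D-self (point y)))
        decide (no ¬S) = take (ν ∙ point y) (∙-nonzero ν≉0 (point-nonzero y)) (square-neighbour {V u} {point y} d≉0 ¬S)
          (D≋0-sym (D-proportional ≐-refl))

      neighbour-unique : ∀ {u w w′} → Adj Γ u w → Adj Γ u w′ → π w ≡ π w′ → w′ ≡ w
      neighbour-unique a b e with line-cases (slope⇒ e)
      ... | inj₁ e = sym e
      ... | inj₂ A = contradiction (near-antipode (Sq-D-sym (adj⇒ a)) A) (Sq-ν-exclusive (adj⇒ b))

      adj⇒π≢ : ∀ {u v} → Adj Γ u v → π u ≢ π v
      adj⇒π≢ {u} {v} a e = Sq⇒≉0 (adj⇒ a) (slope⇒ e)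

      antipodal-cover : AntipodalDoubleCoverOfK Γ (suc p)
      antipodal-cover = 3 , diameter-3 , ℕ.s≤s (ℕ.s≤s ℕ.z≤n) ,
        ((λ u → inj₁ refl) ,
         (λ u v h → anti-to {v} {u} (D≋0-sym (anti-from {u} {v} h))) ,
         (λ u v w h k → anti-to {u} {w} (D≋0-trans (V-nonzero v) (anti-from {u} {v} h) (anti-from {v} {w} k)))) ,
        π ,
        (λ u v → mk⇔ (λ e → anti-to {u} {v} (slope⇒ e)) (λ h → slope⇐ (V-nonzero u) (V-nonzero v) (anti-from {u} {v} h))) ,
        fibre ,
        (λ x y → mk⇔ (joined x y) (λ { (u , v , refl , refl , a) → adj⇒π≢ a })) ,
        (λ { u y (u′ , v′ , e , refl , a) →
             let w , b , f = neighbour-on-line u (π v′) (λ g → adj⇒π≢ a (trans e g))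
             in w , b , f , λ w′ b′ f′ → neighbour-unique b b′ (trans f (sym f′)) })
        where
        open import Function.Bundles using (module Equivalence)
        anti-to : ∀ {u v} → D (V u) (V v) ≋ + 0 → AntiRel Γ 3 u v
        anti-to {u} {v} = Equivalence.to (antirel⇔ u v)
        anti-from : ∀ {u v} → AntiRel Γ 3 u v → D (V u) (V v) ≋ + 0
        anti-from {u} {v} = Equivalence.from (antirel⇔ u v)
        on : Fin (suc p) → Fin (n Γ)
        on x = vertex (point x) (point-nonzero x)
        π-on : ∀ x → π (on x) ≡ x
        π-on x = slope-unique (V-nonzero (on x))
          (D≋0-resp (~-sym (V-vertex (point x) (point-nonzero x))) (~-refl) (lin₀ (D-self (point x))))
        fibre : ∀ x → ∃ λ u → ∃ λ v → u ≢ v × π u ≡ x × π v ≡ x × (∀ w → π w ≡ x → w ≡ u ⊎ w ≡ v)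
        fibre x = u , v , antipodes-≢ A , π-on x , trans (sym πu≡πv) (π-on x) , cover
          where
          u v : Fin (n Γ)
          u = on x
          v = antipode u
          A : Antipodes u v
          A = antipode-spec u
          πu≡πv : π u ≡ π v
          πu≡πv = slope⇐ (V-nonzero u) (V-nonzero v) (antipodes-D A)
          cover : ∀ w → π w ≡ x → w ≡ u ⊎ w ≡ v
          cover w e with line-cases (slope⇒ (trans (π-on x) (sym e)))
          ... | inj₁ f = inj₁ (sym f)
          ... | inj₂ B = inj₂ (antipodes-unique B A)
        joined : ∀ x y → x ≢ y → ∃ λ u → ∃ λ v → π u ≡ x × π v ≡ y × Adj Γ u v
        joined x y x≢y = let w , a , e = neighbour-on-line (on x) y (λ e → x≢y (trans (sym (π-on x)) e)) in on x , w , π-on x , e , a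

-- Equality of matrices up to sign.

module PSL (p : ℕ) (prime : Prime p) (p%4≡1 : p % 4 ≡ 1) where

  open import Defs hiding (sym; inv; pres)
  open PrimeField p prime
  open Squares p prime p%4≡1
  open Plane p prime p%4≡1

  record Sign (ε : ℤ) : Set where
    constructor sign
    field
      squared-one : ε * ε ≋ + 1
      plus-minus  : ε ≋ + 1 ⊎ ε ≋ - + 1
  open Sign public

  abstract
    sign+ : Sign (+ 1)
    sign+ = sign ≋-refl (inj₁ ≋-refl)

    sign- : Sign (- + 1)
    sign- = sign ≋-refl (inj₂ ≋-refl)

    root-of-one : ∀ {ε} → ε * ε ≋ + 1 → Sign ε
    root-of-one {ε} h = sign h (square-roots ε (+ 1) h)

    Sign-Sq : ∀ {ε} → Sign ε → Sq ε
    Sign-Sq (sign _ (inj₁ h)) = Sq-resp (≋-sym h) Sq-one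
    Sign-Sq (sign _ (inj₂ h)) = Sq-resp (≋-sym h) Sq-minus-one

    Sign-* : ∀ {ε δ} → Sign ε → Sign δ → Sign (ε * δ)
    Sign-* {ε} {δ} (sign e _) (sign d _) = root-of-one (lin₂ (δ * δ) e (+ 1) d (lem ε δ))
      where lem : ∀ e d → e * d * (e * d) - + 1 ≡ d * d * (e * e - + 1) + + 1 * (d * d - + 1)
            lem = solve-∀

  -- Equality in PSL(2,p), through the action on vectors.
  record _≃_ (A B : M2) : Set where
    constructor upto
    field
      ε      : ℤ
      isSign : Sign ε
      acts   : ∀ v → A · v ≐ ε ∙ (B · v)
  open _≃_ public

  infix 4 _≃_

  opaque
    unfolding _·_ _∙_ D

    det-D : ∀ A → det A ≡ D (A · e₁) (A · e₂)
    det-D (mat a b c d) = lem a b c d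
      where lem : ∀ a b c d → a * d - b * c ≡ (a * + 1 + b * + 0) * (c * + 0 + d * + 1) - (c * + 1 + d * + 0) * (a * + 0 + b * + 1)
            lem = solve-∀

    private
      pick₁ : ∀ a b s a′ b′ → a * + 1 + b * + 0 ≋ s * (a′ * + 1 + b′ * + 0) → a ≋ s * a′
      pick₁ a b s a′ b′ h = lin₁ (+ 1) h (lem a b s a′ b′)
        where lem : ∀ a b s a′ b′ → a - s * a′ ≡ + 1 * (a * + 1 + b * + 0 - s * (a′ * + 1 + b′ * + 0))
              lem = solve-∀
      pick₂ : ∀ a b s a′ b′ → a * + 0 + b * + 1 ≋ s * (a′ * + 0 + b′ * + 1) → b ≋ s * b′
      pick₂ a b s a′ b′ h = lin₁ (+ 1) h (lem a b s a′ b′)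
        where lem : ∀ a b s a′ b′ → b - s * b′ ≡ + 1 * (a * + 0 + b * + 1 - s * (a′ * + 0 + b′ * + 1))
              lem = solve-∀
      with+ : ∀ {x y ε} → ε ≋ + 1 → x ≋ ε * y → x ≋ y
      with+ {x} {y} {ε} e h = lin₂ (+ 1) h y e (lem x y ε)
        where lem : ∀ x y e → x - y ≡ + 1 * (x - e * y) + y * (e - + 1)
              lem = solve-∀
      with- : ∀ {x y ε} → ε ≋ - + 1 → x ≋ ε * y → x ≋ - y
      with- {x} {y} {ε} e h = lin₂ (+ 1) h y e (lem x y ε)
        where lem : ∀ x y e → x - - y ≡ + 1 * (x - e * y) + y * (e - - + 1)
              lem = solve-∀

    ≃⇒≈-bases : ∀ {A B ε} → Sign ε → A · e₁ ≐ ε ∙ (B · e₁) → A · e₂ ≐ ε ∙ (B · e₂) → A ≈[ p ] B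
    ≃⇒≈-bases {mat a b c d} {mat a′ b′ c′ d′} {ε} (sign _ s) (f₁ ,, f₂) (g₁ ,, g₂) = result s
      where
      result : ε ≋ + 1 ⊎ ε ≋ - + 1 → mat a b c d ≈[ p ] mat a′ b′ c′ d′
      result (inj₁ e) = inj₁ (congruence (with+ e (pick₁ a b ε a′ b′ f₁)) , congruence (with+ e (pick₂ a b ε a′ b′ g₁)) ,
                              congruence (with+ e (pick₁ c d ε c′ d′ f₂)) , congruence (with+ e (pick₂ c d ε c′ d′ g₂)))
      result (inj₂ e) = inj₂ (congruence (with- e (pick₁ a b ε a′ b′ f₁)) , congruence (with- e (pick₂ a b ε a′ b′ g₁)) ,
                              congruence (with- e (pick₁ c d ε c′ d′ f₂)) , congruence (with- e (pick₂ c d ε c′ d′ g₂)))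

    ≃⇒≈ : ∀ {A B} → A ≃ B → A ≈[ p ] B
    ≃⇒≈ {A} {B} (upto ε s h) = ≃⇒≈-bases {A} {B} {ε} s (h e₁) (h e₂)

    ≈⇒≃ : ∀ A B → A ≈[ p ] B → A ≃ B
    ≈⇒≃ (mat a b c d) (mat a′ b′ c′ d′) (inj₁ (e , f , g , h)) = upto (+ 1) sign+ λ { ⟨ x , y ⟩ →
        lin₂ x (congruent {a} {a′} e) y (congruent {b} {b′} f) (lem a b a′ b′ x y) ,, lin₂ x (congruent {c} {c′} g) y (congruent {d} {d′} h) (lem c d c′ d′ x y) }
      where lem : ∀ a b a′ b′ x y → a * x + b * y - + 1 * (a′ * x + b′ * y) ≡ x * (a - a′) + y * (b - b′)
            lem = solve-∀
    ≈⇒≃ (mat a b c d) (mat a′ b′ c′ d′) (inj₂ (e , f , g , h)) = upto (- + 1) sign- λ { ⟨ x , y ⟩ →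
        lin₂ x (congruent {a} { - a′} e) y (congruent {b} { - b′} f) (lem a b a′ b′ x y) ,, lin₂ x (congruent {c} { - c′} g) y (congruent {d} { - d′} h) (lem c d c′ d′ x y) }
      where lem : ∀ a b a′ b′ x y → a * x + b * y - (- + 1) * (a′ * x + b′ * y) ≡ x * (a - - a′) + y * (b - - b′)
            lem = solve-∀

    ⊕-cong : ∀ {u v u′ v′} → u ≐ u′ → v ≐ v′ → u ⊕ v ≐ u′ ⊕ v′
    ⊕-cong (h ,, k) (h′ ,, k′) = +-cong h h′ ,, +-cong k k′

    scaleᴹ : ℤ → M2 → M2
    scaleᴹ s (mat a b c d) = mat (s * a) (s * b) (s * c) (s * d)

    scaleᴹ-· : ∀ s A v → scaleᴹ s A · v ≐ s ∙ (A · v)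
    scaleᴹ-· s (mat a b c d) ⟨ x , y ⟩ = ≡⇒≐ (lem s a b x y) (lem s c d x y)
      where lem : ∀ s a b x y → s * a * x + s * b * y ≡ s * (a * x + b * y)
            lem = solve-∀

    det-scaleᴹ : ∀ s A → det (scaleᴹ s A) ≡ s * s * det A
    det-scaleᴹ s (mat a b c d) = lem s a b c d
      where lem : ∀ s a b c d → s * a * (s * d) - s * b * (s * c) ≡ s * s * (a * d - b * c)
            lem = solve-∀

    -- A linear map with every vector an eigenvector is scalar, stated for the pencil of A and B.
    pencil : ∀ {A B s t r} → D (A · e₁) (A · e₂) ≉ + 0 → B · e₁ ≐ s ∙ (A · e₁) → B · e₂ ≐ t ∙ (A · e₂) →
      B · (e₁ ⊕ e₂) ≐ r ∙ (A · (e₁ ⊕ e₂)) → s ≋ t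
    pencil {A} {B} {s} {t} {r} h hs ht hr = ≋-trans (*-cancelˡ (D x y) h s≋r) (≋-sym (*-cancelˡ (D x y) h t≋r))
      where
      x y : V2
      x = A · e₁
      y = A · e₂
      sum : (s ∙ x) ⊕ (t ∙ y) ≐ r ∙ (x ⊕ y)
      sum = ≐-trans (⊕-cong (≐-sym hs) (≐-sym ht))
        (≐-trans (≐-sym (·-⊕ B e₁ e₂))
          (≐-trans hr (∙-cong r (·-⊕ A e₁ e₂))))
      s≋r : D x y * s ≋ D x y * r
      s≋r = lin₂ (v₂ y) (eq₁ sum) (- v₁ y) (eq₂ sum) (lem (v₁ x) (v₂ x) (v₁ y) (v₂ y) s t r)
        where lem : ∀ a b c d s t r → (a * d - b * c) * s - (a * d - b * c) * r
                    ≡ d * (s * a + t * c - r * (a + c)) + (- c) * (s * b + t * d - r * (b + d))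
              lem = solve-∀
      t≋r : D x y * t ≋ D x y * r
      t≋r = lin₂ (- v₂ x) (eq₁ sum) (v₁ x) (eq₂ sum) (lem (v₁ x) (v₂ x) (v₁ y) (v₂ y) s t r)
        where lem : ∀ a b c d s t r → (a * d - b * c) * t - (a * d - b * c) * r
                    ≡ (- b) * (s * a + t * c - r * (a + c)) + a * (s * b + t * d - r * (b + d))
              lem = solve-∀

    D-e₁e₂ : D e₁ e₂ ≡ + 1
    D-e₁e₂ = refl

    D-e₁ : ∀ v → D e₁ v ≡ v₂ v
    D-e₁ ⟨ x , y ⟩ = lem x y
      where lem : ∀ x y → + 1 * y - + 0 * x ≡ y
            lem = solve-∀

    e₁⊕e₂-nonzero : NonZeroVector (e₁ ⊕ e₂)
    e₁⊕e₂-nonzero (h ,, _) = 1≉0 h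

  abstract
    ≃-refl : ∀ {A} → A ≃ A
    ≃-refl {A} = upto (+ 1) sign+ λ v → ≐-sym (1∙ (A · v))

    ≃-sym : ∀ {A B} → A ≃ B → B ≃ A
    ≃-sym {A} {B} (upto ε s h) = upto ε s λ v → ≐-trans (≐-sym (1∙ (B · v)))
      (≐-trans (∙-congˢ (B · v) (≋-sym (squared-one s))) (≐-trans (≐-sym (∙-∙ ε ε (B · v))) (∙-cong ε (≐-sym (h v)))))

    ≃-trans : ∀ {A B C} → A ≃ B → B ≃ C → A ≃ C
    ≃-trans {A} {B} {C} (upto ε s h) (upto δ t k) = upto (ε * δ) (Sign-* s t) λ v →
      ≐-trans (h v) (≐-trans (∙-cong ε (k v)) (∙-∙ ε δ (C · v)))

    ⊗-cong : ∀ {A A′ B B′} → A ≃ A′ → B ≃ B′ → A ⊗ B ≃ A′ ⊗ B′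
    ⊗-cong {A} {A′} {B} {B′} (upto ε s h) (upto δ t k) = upto (ε * δ) (Sign-* s t) λ v →
      ≐-trans (·-⊗ A B v) (≐-trans (h (B · v)) (≐-trans (∙-cong ε (≐-trans (·-cong A′ (k v)) (·-∙ A′ δ (B′ · v))))
        (≐-trans (∙-∙ ε δ (A′ · (B′ · v))) (∙-cong (ε * δ) (≐-sym (·-⊗ A′ B′ v))))))

    ≃-~ : ∀ {A B} → A ≃ B → ∀ v → A · v ~ B · v
    ≃-~ {A} {B} (upto ε s h) v = ~-sym (scaled ε (Sign-Sq s) (h v))

    -- The factor s / t differs from st by the square of t.
    cross-~ : ∀ {s t a b} → s ∙ a ≐ t ∙ b → Sq (s * t) → a ~ b
    cross-~ {s} {t} {a} {b} h S =
      let t≉0 = λ (z : t ≋ + 0) → Sq⇒≉0 S (lin₁ s z (lem₀ s t))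
          i , ti≋1 = inverse {t} t≉0
      in scaled (s * i) (go i ti≋1)
        (≐-trans (≐-sym (1∙ b)) (≐-trans (∙-congˢ b (≋-trans (≋-sym ti≋1) (lin₀ (ℤₚ.*-comm t i))))
          (≐-trans (≐-sym (∙-∙ i t b)) (≐-trans (∙-cong i (≐-sym h)) (≐-trans (∙-∙ i s a) (∙-congˢ a (lin₀ (ℤₚ.*-comm i s))))))))
      where
      lem₀ : ∀ s t → s * t - + 0 ≡ s * (t - + 0)
      lem₀ = solve-∀
      go : ∀ i → t * i ≋ + 1 → Sq (s * i)
      go i e = Sq-resp (lin₁ (s * i) e (lem s t i)) (Sq-* S (square i i≉0 ≋-refl))
        where
        i≉0 : i ≉ + 0
        i≉0 z = 1≉0 (≋-trans (≋-sym e) (lin₁ t z (lem₀ t i)))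
        lem : ∀ s t i → s * t * (i * i) - s * i ≡ s * i * (t * i - + 1)
        lem = solve-∀

    Sq-inverse : ∀ {x} → Sq x → ∃ λ i → Sq i × x * i ≋ + 1
    Sq-inverse {x} X = let i , e = inverse (Sq⇒≉0 X) in i , Sq-cancel X (Sq-resp (≋-sym e) Sq-one) , e

    det-nonzero-D : ∀ {A} → det A ≋ + 1 → D (A · e₁) (A · e₂) ≉ + 0
    det-nonzero-D {A} h = ≉0-resp (≋-trans (≋-sym h) (lin₀ (det-D A))) 1≉0

    -- The images under `A` and `B` of the two basis vectors and of their sum are proportional;
    -- `pencil` makes the factors on the basis equal, and comparing determinants gives that factor
    -- the square 1.
    same-lines : ∀ {A B} → det A ≋ + 1 → det B ≋ + 1 → (∀ v → NonZeroVector v → D (A · v) (B · v) ≋ + 0) → B ≃ A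
    same-lines {A} {B} dA dB h =
      let s , hs = prop e₁ e₁-nonzero
          t , ht = prop e₂ e₂-nonzero
          r , hr = prop (e₁ ⊕ e₂) e₁⊕e₂-nonzero
          s≋t = pencil {A} {B} {s} {t} {r} (det-nonzero-D {A} dA) hs ht hr
      in conclude s hs (≐-trans ht (∙-congˢ (A · e₂) (≋-sym s≋t)))
      where
      prop : ∀ v → NonZeroVector v → ∃ λ s → B · v ≐ s ∙ (A · v)
      prop v v≉0 = proportional (·-nonzero (≉0-resp (≋-sym dA) 1≉0) v≉0) (h v v≉0)
      conclude : ∀ s → B · e₁ ≐ s ∙ (A · e₁) → B · e₂ ≐ s ∙ (A · e₂) → B ≃ A
      conclude s f g = ≈⇒≃ B A (≃⇒≈-bases {B} {A} {s} (root-of-one ss) f g)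
        where
        ss : s * s ≋ + 1
        ss = ≋-trans (≋-sym (lin₁ (s * s) (≋-trans (≋-sym (lin₀ (det-D A))) dA) (lem (s * s) (D (A · e₁) (A · e₂)))))
          (≋-trans (lin₀ (trans (ℤₚ.*-assoc s s (D (A · e₁) (A · e₂)))
              (sym (trans (D-scaleˡ s (A · e₁) (s ∙ (A · e₂))) (cong (s *_) (D-scaleʳ s (A · e₁) (A · e₂)))))))
            (≋-trans (≋-sym (D-cong f g)) (≋-trans (≋-sym (lin₀ (det-D B))) dB)))
          where lem : ∀ s d → s * d - s ≡ s * (d - + 1)
                lem = solve-∀

-- Automorphisms, walks and distances in an arbitrary graph.

module GraphAutomorphisms where

  open import Defs hiding (_^_; sym)
  open import Relation.Binary.PropositionalEquality using (subst₂)

  module _ {Γ : Graph} where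

    fun-injective : (σ : Aut Γ) → ∀ {u v} → fun σ u ≡ fun σ v → u ≡ v
    fun-injective σ {u} {v} e = trans (sym (inv-fun σ u)) (trans (cong (inv σ) e) (inv-fun σ v))

    inverse-aut : Aut Γ → Aut Γ
    inverse-aut σ = record
      { fun = inv σ ; inv = fun σ ; inv-fun = fun-inv σ ; fun-inv = inv-fun σ
      ; pres = λ u v → trans (sym (pres σ (inv σ u) (inv σ v))) (cong₂ (adj Γ) (fun-inv σ u) (fun-inv σ v)) }

    _∘ᴬ_ : Aut Γ → Aut Γ → Aut Γ
    σ ∘ᴬ τ = record
      { fun = λ u → fun σ (fun τ u) ; inv = λ u → inv τ (inv σ u)
      ; inv-fun = λ u → trans (cong (inv τ) (inv-fun σ (fun τ u))) (inv-fun τ u)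
      ; fun-inv = λ u → trans (cong (fun σ) (fun-inv τ (inv σ u))) (fun-inv σ u)
      ; pres = λ u v → trans (pres σ (fun τ u) (fun τ v)) (pres τ u v) }

    map-adj : (σ : Aut Γ) → ∀ {u v} → Adj Γ u v → Adj Γ (fun σ u) (fun σ v)
    map-adj σ {u} {v} a = trans (pres σ u v) a

    unmap-adj : (σ : Aut Γ) → ∀ {u v} → Adj Γ (fun σ u) (fun σ v) → Adj Γ u v
    unmap-adj σ {u} {v} a = trans (sym (pres σ u v)) a

    map-walk : (σ : Aut Γ) → ∀ {u v k} → Walk Γ u v k → Walk Γ (fun σ u) (fun σ v) k
    map-walk σ here = here
    map-walk σ (step a w) = step (map-adj σ a) (map-walk σ w)

    map-dist : (σ : Aut Γ) → ∀ {u v k} → Dist Γ u v k → Dist Γ (fun σ u) (fun σ v) k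
    map-dist σ {u} {v} (w , min) = map-walk σ w , λ m x → min m
      (subst₂ (λ a b → Walk Γ a b m) (inv-fun σ u) (inv-fun σ v) (map-walk (inverse-aut σ) x))

    diameter-≤ : ∀ {d e} → Diameter Γ d → Diameter Γ e → d ℕ.≤ e
    diameter-≤ (_ , u , v , _ , min) (bound , _) = let k , k≤e , w = bound u v in ℕₚ.≤-trans (min k w) k≤e

    -- Geodesic transitivity is quantified over every `d` that is a diameter; this reduces it to one
    -- value.
    diameter-unique : ∀ {d e} → Diameter Γ d → Diameter Γ e → d ≡ e
    diameter-unique X Y = ℕₚ.≤-antisym (diameter-≤ X Y) (diameter-≤ Y X)

-- Geodesic transitivity of Γ(p).

module Geodesics (p : ℕ) (prime : Prime p) (p%4≡1 : p % 4 ≡ 1) where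

  open import Defs hiding (_^_; sym; inv; pres)
  open GraphAutomorphisms
  open PrimeField p prime
  open Squares p prime p%4≡1
  open Plane p prime p%4≡1
  open SquareClassModels p prime p%4≡1
  open PSL p prime p%4≡1

  module _ {Γ : Graph} (M : Model Γ) where
    open Model M
    open Metric M

    record Linear : Set where
      field
        A    : M2
        detA : Sq (det A)
      open Automorphism M A detA public

      sends : ∀ {u u′} → A · V u ~ V u′ → to u ≡ u′
      sends {u} {u′} h = V-injective (~-trans (V-to u) h)

      sends-antipode : ∀ {u u′ v v′} → Antipodes u v → Antipodes u′ v′ → A · V u ~ V u′ → A · V v ~ V v′
      sends-antipode {u} {u′} {v} {v′} h h′ k = ~-trans (·-~ A (~-sym h))
        (~-trans (≐⇒~ (·-∙ A ν (V u)))
          (~-trans (∙-~ ν k) h′))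

    open Linear

    abstract
      -- The matrix matching the representatives has determinant D(u′,v′) / D(u,v), a quotient of
      -- two squares.
      arc-map : ∀ {u v u′ v′} → Adj Γ u v → Adj Γ u′ v′ → Σ Linear λ L → A L · V u ~ V u′ × A L · V v ~ V v′
      arc-map {u} {v} {u′} {v′} a a′ =
        let T , Tu , Tv , e = transition (V u) (V v) (V u′) (V v′) (Sq⇒≉0 (adj⇒ a))
        in record { A = T ; detA = Sq-cancel (adj⇒ a) (Sq-resp (≋-trans (≋-sym e) (lin₀ (ℤₚ.*-comm (det T) (D (V u) (V v))))) (adj⇒ a′)) } ,
           ≐⇒~ Tu , ≐⇒~ Tv

      -- The map is prescribed on the end points u, v, the scalars being chosen so that Cramer's rule gives the right image of w.
      path-map : ∀ {u w v u′ w′ v′} → Adj Γ u w → Adj Γ w v → Sq (ν * D (V u) (V v)) →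
        Adj Γ u′ w′ → Adj Γ w′ v′ → Sq (ν * D (V u′) (V v′)) →
        Σ Linear λ L → A L · V u ~ V u′ × A L · V w ~ V w′ × A L · V v ~ V v′
      path-map {u} {w} {v} {u′} {w′} {v′} uw wv uv u′w′ w′v′ u′v′ =
        let i , Si , ei = Sq-inverse (adj⇒ wv)
            j , Sj , ej = Sq-inverse (adj⇒ uw)
        in build i Si ei j Sj ej
        where
        d d′ : ℤ
        d = D (V u) (V v)
        d′ = D (V u′) (V v′)
        ν-nonzero : ∀ {x} → Sq (ν * x) → x ≉ + 0
        ν-nonzero {x} S z = Sq⇒≉0 S (lin₁ ν z (lem ν x))
          where lem : ∀ s x → s * x - + 0 ≡ s * (x - + 0)
                lem = solve-∀
        dd′ : Sq (d * d′)
        dd′ = Sq-cancel (square ν ν≉0 ≋-refl) (Sq-resp (lin₀ (lem ν d d′)) (Sq-* uv u′v′))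
          where lem : ∀ n d e → n * d * (n * e) ≡ n * n * (d * e)
                lem = solve-∀
        build : ∀ i → Sq i → D (V w) (V v) * i ≋ + 1 → ∀ j → Sq j → D (V u) (V w) * j ≋ + 1 →
          Σ Linear λ L → A L · V u ~ V u′ × A L · V w ~ V w′ × A L · V v ~ V v′
        build i Si ei j Sj ej =
          let T , Tu , Tv , e = transition (V u) (V v) (x ∙ V u′) (y ∙ V v′) (ν-nonzero uv)
          in result T Tu Tv e
          where
          x y : ℤ
          -- The ratios D(w′,v′) / D(w,v) and D(u′,w′) / D(u,w) are squares, so scaling by them
          -- keeps the classes of `u′` and `v′`. Applied to d w = D(w,v) u + D(u,w) v, the map then
          -- gives d times the image of w as D(w′,v′) u′ + D(u′,w′) v′ = d′ w′, and dd′ is a square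
          -- because d and d′ are both nonsquares.
          x = D (V w′) (V v′) * i
          y = D (V u′) (V w′) * j
          Sx : Sq x
          Sx = Sq-* (adj⇒ w′v′) Si
          Sy : Sq y
          Sy = Sq-* (adj⇒ u′w′) Sj
          result : ∀ T → T · V u ≐ x ∙ V u′ → T · V v ≐ y ∙ V v′ → det T * d ≋ D (x ∙ V u′) (y ∙ V v′) →
            Σ Linear λ L → A L · V u ~ V u′ × A L · V w ~ V w′ × A L · V v ~ V v′
          result T Tu Tv e = record { A = T ; detA = SdetT } , ~-sym (scaled x Sx Tu) , cross-~ Tw dd′ , ~-sym (scaled y Sy Tv)
            where
            SdetT : Sq (det T)
            SdetT = Sq-cancel dd′ (Sq-resp (≋-sym (lin₁ d′ e′ (lem (det T) d d′ x y))) (Sq-* (Sq-* Sx Sy) (square d′ (ν-nonzero u′v′) ≋-refl)))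
              where
              e′ : det T * d ≋ x * (y * d′)
              e′ = ≋-trans e (lin₀ (trans (D-scaleˡ x (V u′) (y ∙ V v′)) (cong (x *_) (D-scaleʳ y (V u′) (V v′)))))
              lem : ∀ t d e x y → d * e * t - (x * y * (e * e)) ≡ e * (t * d - x * (y * e))
              lem = solve-∀
            coefficient : ∀ a b i → a * i ≋ + 1 → a * (b * i) ≋ b
            coefficient a b i h = lin₁ b h (lem a b i)
              where lem : ∀ a b i → a * (b * i) - b ≡ b * (a * i - + 1)
                    lem = solve-∀
            part : ∀ s {z} a b i → a * i ≋ + 1 → T · V s ≐ (b * i) ∙ z → T · (a ∙ V s) ≐ b ∙ z
            part s {z} a b i h k = ≐-trans (·-∙ T a (V s)) (≐-trans (∙-cong a k) (≐-trans (∙-∙ a (b * i) z) (∙-congˢ z (coefficient a b i h))))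
            Tw : d ∙ (T · V w) ≐ d′ ∙ V w′
            Tw = ≐-trans (≐-sym (·-∙ T d (V w))) (≐-trans (·-cong T (cramer (V u) (V v) (V w)))
              (≐-trans (·-⊕ T (D (V w) (V v) ∙ V u) (D (V u) (V w) ∙ V v))
                (≐-trans (⊕-cong (part u {V u′} (D (V w) (V v)) (D (V w′) (V v′)) i ei Tu) (part v {V v′} (D (V u) (V w)) (D (V u′) (V w′)) j ej Tv))
                  (≐-sym (cramer (V u′) (V v′) (V w′))))))

      geodesic-transitive : GeodesicTransitive Γ
      geodesic-transitive d diam i 1≤i i≤d P Q = cases i 1≤i (subst (i ℕ.≤_) (diameter-unique diam diameter-3) i≤d) P Q
        where
        cases : ∀ i → 1 ℕ.≤ i → i ℕ.≤ 3 → (P Q : Geodesic Γ i) → Σ (Aut Γ) λ σ → ∀ j → fun σ (vert P j) ≡ vert Q j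
        cases 0 () _ P Q
        cases 1 _ _ P Q =
          let L , a , b = arc-map (adjacent P zero) (adjacent Q zero)
          in linear-aut L , λ { zero → sends L a ; (suc zero) → sends L b }
        cases 2 _ _ P Q =
          let L , a , b , c = path-map (adjacent P zero) (adjacent P (suc zero)) (dist2⇒far (geod P))
                                       (adjacent Q zero) (adjacent Q (suc zero)) (dist2⇒far (geod Q))
          in linear-aut L , λ { zero → sends L a ; (suc zero) → sends L b ; (suc (suc zero)) → sends L c }
        -- The end of a 3-geodesic is the antipode of its start, so matching three vertices matches
        -- all four. The third vertex is adjacent to that antipode, hence far from the start, and
        -- `path-map` applies.
        cases 3 _ _ P Q =
          let L , a , b , c = path-map (adjacent P zero) (adjacent P (suc zero)) (third-far P)
                                       (adjacent Q zero) (adjacent Q (suc zero)) (third-far Q)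
          in linear-aut L , λ { zero → sends L a ; (suc zero) → sends L b ; (suc (suc zero)) → sends L c
                              ; (suc (suc (suc zero))) → sends L (sends-antipode L (ends P) (ends Q) a) }
          where
          ends : (R : Geodesic Γ 3) → Antipodes (vert R zero) (vert R (suc (suc (suc zero))))
          ends R = dist⇒antipodes (geod R)
          third-far : (R : Geodesic Γ 3) → Sq (ν * D (V (vert R zero)) (V (vert R (suc (suc zero)))))
          third-far R = Sq-resp (lin₀ (trans (cong (λ z → - (ν * z)) (D-antisym (V (vert R zero)) (V (vert R (suc (suc zero)))))) (lem ν (D (V (vert R zero)) (V (vert R (suc (suc zero))))))))
            (Sq-neg (near-antipode
              (Sq-D-sym (adj⇒ (adjacent R (suc (suc zero)))))
              (antipodes-sym (ends R))))
            where lem : ∀ n x → - (n * - x) ≡ n * x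
                  lem = solve-∀
        cases (suc (suc (suc (suc _)))) _ (ℕ.s≤s (ℕ.s≤s (ℕ.s≤s ()))) P Q

-- The automorphism group of Γ(p).

module Automorphisms (p : ℕ) (prime : Prime p) (p%4≡1 : p % 4 ≡ 1) where

  open import Defs hiding (_^_; sym; pres)
  open GraphAutomorphisms
  open PrimeField p prime
  open Squares p prime p%4≡1
  open Carlitz p prime
  open Plane p prime p%4≡1
  open SquareClassModels p prime p%4≡1
  open PSL p prime p%4≡1

  affine-vector : ℤ → V2
  affine-vector x = ⟨ x , + 1 ⟩

  opaque
    unfolding _·_ _∙_ D

    affine-nonzero : ∀ x → NonZeroVector (affine-vector x)
    affine-nonzero x (_ ,, e) = 1≉0 e

    D-affine : ∀ x y → D (affine-vector x) (affine-vector y) ≡ x - y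
    D-affine x y = lem x y
      where lem : ∀ x y → x * + 1 - + 1 * y ≡ x - y
            lem = solve-∀

    ~-affine : ∀ {v} → Sq (v₂ v) → ∃ λ x → affine-vector x ~ v
    ~-affine {⟨ a , b ⟩} S =
      let i , e = inverse (Sq⇒≉0 S)
      in a * i , scaled b S (lin₁ (- a) e (lem a b i) ,, lin₀ (sym (ℤₚ.*-identityʳ b)))
      where lem : ∀ a b i → a - b * (a * i) ≡ (- a) * (b * i - + 1)
            lem = solve-∀

    affine~⇒≋ : ∀ {x y} → affine-vector x ~ affine-vector y → x ≋ y
    affine~⇒≋ {x} {y} (scaled s S (e ,, f)) = lin₂ (- + 1) e x f (lem x y s)
      where lem : ∀ x y s → x - y ≡ (- + 1) * (y - s * x) + x * (+ 1 - s * + 1)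
            lem = solve-∀

    upper : ℤ → ℤ → M2
    upper a b = mat a b (+ 0) (+ 1)

    upper-affine : ∀ a b x → upper a b · affine-vector x ≐ affine-vector (a * x + b)
    upper-affine a b x = ≡⇒≐ (lem a b x) (lem′ x)
      where lem : ∀ a b x → a * x + b * + 1 ≡ a * x + b
            lem = solve-∀
            lem′ : ∀ x → + 0 * x + + 1 * + 1 ≡ + 1
            lem′ = solve-∀

    upper-e₁ : ∀ a b → upper a b · e₁ ≐ a ∙ e₁
    upper-e₁ a b = ≡⇒≐ (lem a b) (lem′ a)
      where lem : ∀ a b → a * + 1 + b * + 0 ≡ a * + 1
            lem = solve-∀
            lem′ : ∀ a → + 0 * + 1 + + 1 * + 0 ≡ a * + 0
            lem′ = solve-∀

    det-upper : ∀ a b → det (upper a b) ≡ a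
    det-upper a b = lem a b
      where lem : ∀ a b → a * + 1 - b * + 0 ≡ a
            lem = solve-∀

    line-normal-form : ∀ v → D v e₁ ≋ + 0 ⊎ ∃ λ x → D v (affine-vector x) ≋ + 0
    line-normal-form v with slope v | slope-point v
    ... | zero | h = inj₁ h
    ... | suc i | h = inj₂ (_ , h)

  -- The Z₂ factor as a scalar: multiplication by ν is the antipodal map, and an involution on
  -- classes because ν² is a square.
  twist : Bool → ℤ
  twist false = + 1
  twist true = ν

  abstract
    twist≉0 : ∀ e → twist e ≉ + 0
    twist≉0 false = 1≉0
    twist≉0 true = ν≉0

    twist-injective : ∀ {e e′ v} → NonZeroVector v → twist e ∙ v ~ twist e′ ∙ v → e ≡ e′
    twist-injective {false} {false} _ _ = refl
    twist-injective {true} {true} _ _ = refl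
    twist-injective {true} {false} {v} v≉0 h = contradiction (~-trans h (≐⇒~ (1∙ v))) (ν∙-not~ {v} v≉0)
    twist-injective {false} {true} {v} v≉0 h = contradiction (~-trans (~-sym h) (≐⇒~ (1∙ v))) (ν∙-not~ {v} v≉0)

    twist-xor : ∀ e e′ v → twist e ∙ (twist e′ ∙ v) ~ twist (e xor e′) ∙ v
    twist-xor false e′ v = ≐⇒~ (1∙ (twist e′ ∙ v))
    twist-xor true false v = ≐⇒~ (∙-cong ν (1∙ v))
    twist-xor true true v = ~-sym (~-trans (≐⇒~ (1∙ v)) (ν∙ν∙ v))

    -- The power x ^ half is the quadratic character, with value 0, 1 or -1 on zero, squares and
    -- nonsquares. This converts preservation of classes into the power identity that `carlitz`
    -- takes.
    half-power-by-class : ∀ {a b} → (a ≋ + 0 → b ≋ + 0) → (b ≋ + 0 → a ≋ + 0) → (Sq a → Sq b) → (Sq b → Sq a) → b ^ half ≋ a ^ half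
    half-power-by-class {a} {b} z z⁻¹ s s⁻¹ = decide (a ≋? + 0) (Sq? a)
      where
      zero-power : ∀ {x} → x ≋ + 0 → x ^ half ≋ + 0
      zero-power {x} h = go half half≥1
        where
        go : ∀ k → 1 ℕ.≤ k → x ^ k ≋ + 0
        go (suc k) _ = lin₁ (x ^ k) h (lem x (x ^ k))
          where lem : ∀ x y → x * y - + 0 ≡ y * (x - + 0)
                lem = solve-∀
      decide : Dec (a ≋ + 0) → Dec (Sq a) → b ^ half ≋ a ^ half
      decide (yes h) _ = ≋-trans (zero-power (z h)) (≋-sym (zero-power h))
      decide (no _) (yes S) = ≋-trans (euler (s S)) (≋-sym (euler S))
      decide (no nz) (no ¬S) = ≋-trans (nonsquare-power (λ h → nz (z⁻¹ h)) (λ S → ¬S (s⁻¹ S))) (≋-sym (nonsquare-power nz ¬S))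

    half+half<p : half ℕ.+ half ℕ.< p
    half+half<p = subst (half ℕ.+ half ℕ.<_) suc-p∸1 (ℕ.s≤s (ℕₚ.≤-reflexive
      (trans (cong (half ℕ.+_) (sym (ℕₚ.+-identityʳ half))) (trans (ℕₚ.*-comm 2 half) half*2))))

  module _ {Γ : Graph} (M : Model Γ) where
    open Model M
    open Metric M

    record Representation (σ : Aut Γ) (A : M2) (e : Bool) : Set where
      constructor rep
      field
        unimodular : det A ≋ + 1
        action     : ∀ u → V (fun σ u) ~ twist e ∙ (A · V u)
    open Representation public

    abstract
      map-antipodes : (σ : Aut Γ) → ∀ {u v} → Antipodes u v → Antipodes (fun σ u) (fun σ v)
      map-antipodes σ h = dist⇒antipodes (map-dist σ (antipodes⇒dist h))

      on-vectors : ∀ {σ A e} → Representation σ A e → ∀ x (x≉0 : NonZeroVector x) → V (fun σ (vertex x x≉0)) ~ twist e ∙ (A · x)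
      on-vectors {σ} {A} {e} R x x≉0 = ~-trans
        (action R (vertex x x≉0)) (∙-~ (twist e) (·-~ A (V-vertex x x≉0)))

      representation-unique : ∀ {σ τ A B e f} → (∀ u → fun σ u ≡ fun τ u) → Representation σ A e → Representation τ B f → A ≃ B × e ≡ f
      representation-unique {σ} {τ} {A} {B} {e} {f} eq R S = A≃B , twist-injective Be₁≉0
          (~-trans (∙-~ (twist e) (~-sym (≃-~ A≃B e₁))) (agree e₁ e₁-nonzero))
        where
        agree : ∀ x → NonZeroVector x → twist e ∙ (A · x) ~ twist f ∙ (B · x)
        agree x x≉0 = ~-trans
          (subst (λ w → twist e ∙ (A · x) ~ V w) (eq (vertex x x≉0)) (~-sym (on-vectors R x x≉0))) (on-vectors S x x≉0)
        Be₁≉0 : NonZeroVector (B · e₁)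
        Be₁≉0 = ·-nonzero (≉0-resp (≋-sym (unimodular S)) 1≉0) e₁-nonzero
        A≃B : A ≃ B
        A≃B = same-lines {B} {A} (unimodular S) (unimodular R) λ v v≉0 → D-unscale v (agree v v≉0)
          where
          D-unscale : ∀ v → twist e ∙ (A · v) ~ twist f ∙ (B · v) → D (B · v) (A · v) ≋ + 0
          D-unscale v h with zero-product (twist f) (D (B · v) (A · v))
            (≋-trans (lin₀ (sym (D-scaleˡ (twist f) (B · v) (A · v))))
              (D≋0-resp h (~-refl)
                (≋-trans (lin₀ (D-scaleˡ (twist e) (A · v) (A · v))) (≋-trans (*-congˡ (twist e) (lin₀ (D-self (A · v)))) (lin₀ (ℤₚ.*-zeroʳ (twist e)))))))
          ... | inj₁ z = contradiction z (twist≉0 f)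
          ... | inj₂ z = z

      representation-∘ : ∀ {σ τ ρ A B e f} → (∀ u → fun ρ u ≡ fun σ (fun τ u)) → Representation σ A e → Representation τ B f →
        Representation ρ (A ⊗ B) (e xor f)
      representation-∘ {σ} {τ} {ρ} {A} {B} {e} {f} eq R S = rep
        (≋-trans (lin₀ (det-⊗ A B)) (lin₂ (det B) (unimodular R) (+ 1) (unimodular S) (lem (det A) (det B))))
        λ u → subst (λ w → V w ~ twist (e xor f) ∙ ((A ⊗ B) · V u)) (sym (eq u))
          (~-trans
            (~-trans
              (action R (fun τ u)) (∙-~ (twist e) (·-~ A (action S u))))
            (~-trans
              (≐⇒~ (∙-cong (twist e) (≐-trans (·-∙ A (twist f) (B · V u)) (∙-cong (twist f) (≐-sym (·-⊗ A B (V u)))))))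
              (twist-xor e f ((A ⊗ B) · V u))))
        where lem : ∀ a b → a * b - + 1 ≡ b * (a - + 1) + + 1 * (b - + 1)
              lem = solve-∀

      representation-faithful : ∀ {σ τ A B e} → A ≃ B → Representation σ A e → Representation τ B e → ∀ u → fun σ u ≡ fun τ u
      representation-faithful {σ} {τ} {A} {B} {e} A≃B R S u = V-injective
        (~-trans (action R u)
          (~-trans (∙-~ (twist e) (≃-~ A≃B (V u))) (~-sym (action S u))))

      -- Scaling the unimodular matrix by `twist e` makes the determinant the square of `twist e`,
      -- so the scaled matrix is a linear automorphism.
      representation-onto : ∀ A e → det A ≋ + 1 → Σ (Aut Γ) λ σ → Representation σ A e
      representation-onto A e dA = L.linear-aut , rep dA λ u →
          ~-trans (L.V-to u) (≐⇒~ (scaleᴹ-· (twist e) A (V u)))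
        where
        detS : Sq (det (scaleᴹ (twist e) A))
        detS = Sq-resp (≋-sym (≋-trans (lin₀ (det-scaleᴹ (twist e) A)) (lin₁ (twist e * twist e) dA (lem (twist e * twist e) (det A)))))
                       (square (twist e) (twist≉0 e) ≋-refl)
          where lem : ∀ t d → t * d - t ≡ t * (d - + 1)
                lem = solve-∀
        module L = Automorphism M (scaleᴹ (twist e) A) detS

      -- A matrix of determinant r² is r times a unimodular one, and the scalar r acts on classes as
      -- 1 or as ν according to its own class.
      normalise : ∀ {σ A} → Sq (det A) → (∀ u → V (fun σ u) ~ A · V u) → ∃ λ B → ∃ λ e → Representation σ B e
      normalise {σ} {A} (square r r≉0 d≋rr) h =
        let i , ri≋1 = inverse r≉0
        in scaleᴹ i A , result i ri≋1 (Sq? r)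
        where
        result : ∀ i → r * i ≋ + 1 → Dec (Sq r) → ∃ λ e → Representation σ (scaleᴹ i A) e
        result i ri≋1 dec = choose dec
          where
          dB : det (scaleᴹ i A) ≋ + 1
          dB = ≋-trans (lin₀ (det-scaleᴹ i A)) (lin₂ (i * i) d≋rr (r * i + + 1) ri≋1 (lem i r (det A)))
            where lem : ∀ i r d → i * i * d - + 1 ≡ i * i * (d - r * r) + (r * i + + 1) * (r * i - + 1)
                  lem = solve-∀
          back : ∀ u → A · V u ≐ r ∙ (scaleᴹ i A · V u)
          back u = ≐-sym (≐-trans (∙-cong r (scaleᴹ-· i A (V u))) (≐-trans (∙-∙ r i (A · V u)) (≐-trans (∙-congˢ (A · V u) ri≋1) (1∙ (A · V u)))))
          choose : Dec (Sq r) → ∃ λ e → Representation σ (scaleᴹ i A) e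
          choose (yes S) = false , rep dB λ u → ~-trans (h u)
            (cross-~ (≐-trans (1∙ (A · V u)) (≐-trans (back u) (∙-cong r (≐-sym (1∙ (scaleᴹ i A · V u)))))) (Sq-* Sq-one S))
          choose (no ¬S) = true , rep dB λ u → ~-trans (h u)
            (cross-~ (≐-trans (∙-cong ν (back u)) (≐-trans (∙-∙ ν r (scaleᴹ i A · V u)) (≐-trans (∙-congˢ (scaleᴹ i A · V u) (lin₀ (ℤₚ.*-comm ν r))) (≐-sym (∙-∙ r ν (scaleᴹ i A · V u)))))) (Sq-ν r≉0 ¬S))

    -- After moving σ(∞) back to ∞, σ permutes the neighbours ⟨ x , 1 ⟩ of ∞, and Carlitz's theorem applies.
    module _ (σ : Aut Γ) where
      private
        ∞ : Fin (n Γ)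
        ∞ = vertex e₁ e₁-nonzero

        V∞ : V ∞ ~ e₁
        V∞ = V-vertex e₁ e₁-nonzero

        aff : ℤ → Fin (n Γ)
        aff x = vertex (affine-vector x) (affine-nonzero x)

        V-aff : ∀ x → V (aff x) ~ affine-vector x
        V-aff x = V-vertex (affine-vector x) (affine-nonzero x)

        abstract
          return : ∃ λ B → det B ≋ + 1 × B · V (fun σ ∞) ≐ e₁
          return =
            let y , e = partner (V-nonzero (fun σ ∞))
                B , Bx , By , eB = transition (V (fun σ ∞)) y e₁ e₂ (≉0-resp (≋-sym e) 1≉0)
            in B , finish B y e eB , Bx
            where
            finish : ∀ B y → D (V (fun σ ∞)) y ≋ + 1 → det B * D (V (fun σ ∞)) y ≋ D e₁ e₂ → det B ≋ + 1
            finish B y e eB = lin₂ (+ 1) (≋-trans eB (lin₀ D-e₁e₂)) (- det B) e (lem (det B) (D (V (fun σ ∞)) y))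
              where lem : ∀ b d → b - + 1 ≡ + 1 * (b * d - + 1) + (- b) * (d - + 1)
                    lem = solve-∀

        B : M2
        B = proj₁ return

        dB : det B ≋ + 1
        dB = proj₁ (proj₂ return)

        W : Fin (n Γ) → V2
        W u = B · V (fun σ u)

        abstract
          W∞ : W ∞ ≐ e₁
          W∞ = proj₂ (proj₂ return)

          D-W : ∀ u v → D (W u) (W v) ≋ D (V (fun σ u)) (V (fun σ v))
          D-W u v = ≋-trans (lin₀ (D-· B (V (fun σ u)) (V (fun σ v)))) (lin₁ (D (V (fun σ u)) (V (fun σ v))) dB (lem (det B) (D (V (fun σ u)) (V (fun σ v)))))
            where lem : ∀ b d → b * d - d ≡ d * (b - + 1)
                  lem = solve-∀

          W⇒ : ∀ {u v} → Sq (D (V u) (V v)) → Sq (D (W u) (W v))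
          W⇒ {u} {v} S = Sq-resp (≋-sym (D-W u v)) (adj⇒ (map-adj σ (adj⇐ S)))

          W⇐ : ∀ {u v} → Sq (D (W u) (W v)) → Sq (D (V u) (V v))
          W⇐ {u} {v} S = adj⇒ (unmap-adj σ (adj⇐ (Sq-resp (D-W u v) S)))

          inv₂B : ∀ v → v ~ inv₂ B · (B · v)
          inv₂B v = scaled (det B) (Sq-resp (≋-sym dB) Sq-one) (inv₂·· B v)

          W-injective : ∀ {u v} → W u ~ W v → u ≡ v
          W-injective {u} {v} h = fun-injective σ (V-injective (~-trans
            (~-trans (inv₂B (V (fun σ u))) (·-~ (inv₂ B) h)) (~-sym (inv₂B (V (fun σ v))))))

          affine-by-neighbour : ∀ {v} → Sq (D e₁ v) → ∃ λ x → affine-vector x ~ v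
          affine-by-neighbour {v} S = ~-affine (Sq-resp (lin₀ (D-e₁ v)) S)

          ∞~aff : ∀ x → Sq (D (V ∞) (V (aff x)))
          ∞~aff x = Sq-D-resp (~-sym V∞) (~-sym (V-aff x)) (Sq-resp (lin₀ (sym (D-e₁ (affine-vector x)))) Sq-one)

          f-exists : ∀ x → ∃ λ y → affine-vector y ~ W (aff x)
          f-exists x = affine-by-neighbour {W (aff x)} (Sq-D-resp (≐⇒~ W∞) (~-refl) (W⇒ (∞~aff x)))

        f : ℤ → ℤ
        f x = proj₁ (f-exists x)

        abstract
          f-spec : ∀ x → affine-vector (f x) ~ W (aff x)
          f-spec x = proj₂ (f-exists x)

          -- The vertex that the normalised σ sends to ⟨u, 1⟩ is found with the inverse of σ; it is
          -- adjacent to ∞ because its image is, so it is itself of the form ⟨y, 1⟩.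
          f-onto : ∀ u → ∃ λ y → f y ≋ u
          f-onto u = finish (affine-by-neighbour {V z} (Sq-D-resp V∞ (~-refl) (W⇐ near-∞)))
            where
            target≉0 : NonZeroVector (inv₂ B · affine-vector u)
            target≉0 = ·-nonzero (≉0-resp (≋-trans (≋-sym dB) (lin₀ (sym (det-inv₂ B)))) 1≉0) (affine-nonzero u)
            z : Fin (n Γ)
            z = inv σ (vertex (inv₂ B · affine-vector u) target≉0)
            Wz : W z ~ affine-vector u
            Wz = ~-trans
              (·-~ B (subst (λ w → V w ~ inv₂ B · affine-vector u) (sym (fun-inv σ (vertex (inv₂ B · affine-vector u) target≉0))) (V-vertex (inv₂ B · affine-vector u) target≉0)))
              (~-sym (scaled (det B) (Sq-resp (≋-sym dB) Sq-one) (·inv₂· B (affine-vector u))))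
            near-∞ : Sq (D (W ∞) (W z))
            near-∞ = Sq-D-resp (≐⇒~ (≐-sym W∞)) (~-sym Wz) (Sq-resp (lin₀ (sym (D-e₁ (affine-vector u)))) Sq-one)
            finish : (∃ λ y → affine-vector y ~ V z) → ∃ λ y → f y ≋ u
            finish (y , h) = y , affine~⇒≋ (~-trans (f-spec y)
                (subst (λ w → W w ~ affine-vector u) (sym aff-y≡z) Wz))
              where
              aff-y≡z : aff y ≡ z
              aff-y≡z = V-injective (~-trans (V-aff y) h)

          f-Sq : ∀ x y → Sq (x - y) → Sq (f x - f y)
          f-Sq x y S = Sq-resp (lin₀ (D-affine (f x) (f y))) (Sq-D-resp (~-sym (f-spec x)) (~-sym (f-spec y))
            (W⇒ (Sq-D-resp (~-sym (V-aff x)) (~-sym (V-aff y)) (Sq-resp (lin₀ (sym (D-affine x y))) S))))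

          f-power : ∀ x y → (f x - f y) ^ half ≋ (x - y) ^ half
          f-power x y = half-power-by-class {x - y} {f x - f y} zero⇒ zero⇐ (f-Sq x y) Sq⇐
            where
            ≋-diff : ∀ {a b} → a - b ≋ + 0 → a ≋ b
            ≋-diff {a} {b} h = lin₁ (+ 1) h (lem a b)
              where lem : ∀ a b → a - b ≡ + 1 * (a - b - + 0)
                    lem = solve-∀
            diff-≋ : ∀ {a b} → a ≋ b → a - b ≋ + 0
            diff-≋ {a} {b} h = lin₁ (+ 1) h (lem a b)
              where lem : ∀ a b → a - b - + 0 ≡ + 1 * (a - b)
                    lem = solve-∀
            zero⇒ : x - y ≋ + 0 → f x - f y ≋ + 0
            zero⇒ h = diff-≋ {f x} {f y} (affine~⇒≋ (~-trans (f-spec x)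
                (subst (λ w → W w ~ affine-vector (f y)) (sym same-vertex) (~-sym (f-spec y)))))
              where
              same-vertex : aff x ≡ aff y
              same-vertex = V-injective (~-trans (V-aff x)
                (~-trans (≐⇒~ (≋-diff {x} {y} h ,, ≋-refl)) (~-sym (V-aff y))))
            zero⇐ : f x - f y ≋ + 0 → x - y ≋ + 0
            zero⇐ h = diff-≋ {x} {y} (affine~⇒≋ (~-trans (~-sym (V-aff x))
                (subst (λ w → V w ~ affine-vector y) (sym same-vertex) (V-aff y))))
              where
              same-vertex : aff x ≡ aff y
              same-vertex = W-injective (~-trans (~-sym (f-spec x))
                (~-trans (≐⇒~ (≋-diff {f x} {f y} h ,, ≋-refl)) (f-spec y)))
            Sq⇐ : Sq (f x - f y) → Sq (x - y)
            Sq⇐ S = Sq-resp (lin₀ (D-affine x y)) (Sq-D-resp (V-aff x) (V-aff y)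
              (W⇐ (Sq-D-resp (f-spec x) (f-spec y) (Sq-resp (lin₀ (sym (D-affine (f x) (f y)))) S))))

          f-affine : ∃ λ a → ∃ λ b → ∀ x → f x ≋ a * x + b
          f-affine = carlitz half half≥1 half+half<p f f-onto f-power

        a b : ℤ
        a = proj₁ f-affine
        b = proj₁ (proj₂ f-affine)

        abstract
          -- The slope is f 1 - f 0, and σ preserves the squareness of 1 - 0. This makes `upper a b`
          -- a matrix of square determinant.
          a-square : Sq a
          a-square = Sq-resp a≋ (f-Sq (+ 1) (+ 0) Sq-one)
            where
            a≋ : f (+ 1) - f (+ 0) ≋ a
            a≋ = lin₂ (+ 1) (proj₂ (proj₂ f-affine) (+ 1)) (- + 1) (proj₂ (proj₂ f-affine) (+ 0)) (lem (f (+ 1)) (f (+ 0)) a b)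
              where lem : ∀ f₁ f₀ a b → f₁ - f₀ - a ≡ + 1 * (f₁ - (a * + 1 + b)) + (- + 1) * (f₀ - (a * + 0 + b))
                    lem = solve-∀

          W-base : ∀ u → (V u ~ e₁ ⊎ ∃ λ x → V u ~ affine-vector x) → W u ~ upper a b · V u
          W-base u (inj₁ h) = subst (λ w → W w ~ upper a b · V u) ∞≡u
              (~-trans (≐⇒~ W∞) (~-trans (Sq-∙ a-square)
                (~-trans (≐⇒~ (≐-sym (upper-e₁ a b))) (·-~ (upper a b) (~-sym h)))))
            where
            ∞≡u : ∞ ≡ u
            ∞≡u = V-injective (~-trans V∞ (~-sym h))
          W-base u (inj₂ (x , h)) = subst (λ w → W w ~ upper a b · V u) aff≡u
              (~-trans (~-sym (f-spec x))
                (~-trans (≐⇒~ (proj₂ (proj₂ f-affine) x ,, ≋-refl))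
                  (~-trans (≐⇒~ (≐-sym (upper-affine a b x))) (·-~ (upper a b) (~-sym h)))))
            where
            aff≡u : aff x ≡ u
            aff≡u = V-injective (~-trans (V-aff x) (~-sym h))

          base-or-antipode : ∀ u → (V u ~ e₁ ⊎ ∃ λ x → V u ~ affine-vector x) ⊎ (ν ∙ V u ~ e₁ ⊎ ∃ λ x → ν ∙ V u ~ affine-vector x)
          base-or-antipode u = split (line-normal-form (V u))
            where
            split : D (V u) e₁ ≋ + 0 ⊎ (∃ λ x → D (V u) (affine-vector x) ≋ + 0) →
              (V u ~ e₁ ⊎ ∃ λ x → V u ~ affine-vector x) ⊎ (ν ∙ V u ~ e₁ ⊎ ∃ λ x → ν ∙ V u ~ affine-vector x)
            split (inj₁ h) = Sum.map inj₁ inj₁ (line-classes (V-nonzero u) e₁-nonzero h)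
            split (inj₂ (x , h)) = Sum.map (λ r → inj₂ (x , r)) (λ r → inj₂ (x , r)) (line-classes (V-nonzero u) (affine-nonzero x) h)

          -- The point ∞ and the points ⟨x, 1⟩ represent every fibre, and σ respects antipodes, so
          -- agreement on these representatives extends to all vertices.
          W-linear : ∀ u → W u ~ upper a b · V u
          W-linear u = combine (base-or-antipode u)
            where
            u′ : Fin (n Γ)
            u′ = antipode u
            Wu : W u ~ ν ∙ W u′
            Wu = ~-sym (~-trans (≐⇒~ (≐-sym (·-∙ B ν (V (fun σ u′)))))
                   (·-~ B {ν ∙ V (fun σ u′)} {V (fun σ u)} (antipodes-sym (map-antipodes σ {u} {u′} (antipode-spec u)))))
            move : (ν ∙ V u ~ e₁ ⊎ ∃ λ x → ν ∙ V u ~ affine-vector x) → (V u′ ~ e₁ ⊎ ∃ λ x → V u′ ~ affine-vector x)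
            move (inj₁ r) = inj₁ (~-trans (~-sym (antipode-spec u)) r)
            move (inj₂ (x , r)) = inj₂ (x , ~-trans (~-sym (antipode-spec u)) r)
            combine : (V u ~ e₁ ⊎ ∃ λ x → V u ~ affine-vector x) ⊎ (ν ∙ V u ~ e₁ ⊎ ∃ λ x → ν ∙ V u ~ affine-vector x) → W u ~ upper a b · V u
            combine (inj₁ h) = W-base u h
            combine (inj₂ h) = ~-trans Wu
                (~-trans (∙-~ ν (W-base u′ (move h)))
                  (~-trans (≐⇒~ (≐-sym (·-∙ (upper a b) ν (V u′))))
                    (·-~ (upper a b) {ν ∙ V u′} {V u} (antipodes-sym (antipode-spec u)))))

      abstract
        det-square : Sq (det (inv₂ B ⊗ upper a b))
        det-square = Sq-resp {a} {det (inv₂ B ⊗ upper a b)} (≋-sym (≋-trans (lin₀ product) (lin₁ a dB (lem (det B) a)))) a-square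
          where
          lem : ∀ b a → b * a - a ≡ a * (b - + 1)
          lem = solve-∀
          product : det (inv₂ B ⊗ upper a b) ≡ det B * a
          product = trans {j = det (inv₂ B) * det (upper a b)} (det-⊗ (inv₂ B) (upper a b))
            (trans {j = det B * det (upper a b)} (cong (λ d → d * det (upper a b)) (det-inv₂ B)) (cong (λ d → det B * d) (det-upper a b)))

        representation-exists : ∃ λ A → ∃ λ e → Representation σ A e
        representation-exists = normalise {σ} {inv₂ B ⊗ upper a b} det-square
          λ u → ~-trans (inv₂B (V (fun σ u)))
            (~-trans (·-~ (inv₂ B) (W-linear u)) (≐⇒~ (≐-sym (·-⊗ (inv₂ B) (upper a b) (V u)))))

    -- The map picks one representation for each automorphism; that it respects pointwise equality
    -- and composition follows from the uniqueness of representations up to sign.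
    automorphism-group : AutIsoPSL×Z2 p Γ
    automorphism-group = φ , (λ σ → congruence (unimodular (R σ))) ,
        (λ σ τ eq → let h , k = representation-unique eq (R σ) (R τ) in ≃⇒≈ h , k) ,
        (λ σ τ ρ eq → let h , k = representation-unique {ρ} {ρ} (λ _ → refl) (R ρ) (representation-∘ eq (R σ) (R τ)) in ≃⇒≈ h , k) ,
        (λ σ τ h k → representation-faithful (≈⇒≃ (proj₁ (φ σ)) (proj₁ (φ τ)) h) (R σ) (subst (Representation τ (proj₁ (φ τ))) (sym k) (R τ))) ,
        λ x e h → let σ , S = representation-onto x e (congruent h)
                      q , k = representation-unique (λ _ → refl) (R σ) S in σ , ≃⇒≈ q , k
      where
      φ : Aut Γ → M2 × Bool
      φ σ = proj₁ (representation-exists σ) , proj₁ (proj₂ (representation-exists σ))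
      R : ∀ σ → Representation σ (proj₁ (φ σ)) (proj₂ (φ σ))
      R σ = proj₂ (proj₂ (representation-exists σ))

-- Pigeonhole for an injection that misses one point.

module FinLemmas where

  open import Data.Fin.Properties using (all?; <⇒≢)

  -- Meant for an orbit of `p` elements among the p + 1 fibres or lines: exactly one is left over,
  -- and it must be fixed.
  missed-point : ∀ {n} (g : Fin n → Fin (suc n)) → (∀ {i j} → g i ≡ g j → i ≡ j) →
    ∃ λ x → (∀ j → g j ≢ x) × (∀ y → y ≢ x → ∃ λ j → g j ≡ y)
  missed-point {n} g g-inj = find (any? λ x → all? λ j → ¬? (g j ≟ x))
    where
    find : Dec (∃ λ x → ∀ j → ¬ (g j ≡ x)) → ∃ λ x → (∀ j → g j ≢ x) × (∀ y → y ≢ x → ∃ λ j → g j ≡ y)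
    find (no all-hit) = ⊥-elim (clash (pigeonhole ℕₚ.≤-refl (λ x → proj₁ (hit x))))
      where
      hit : ∀ x → ∃ λ j → g j ≡ x
      hit x with any? (λ j → g j ≟ x)
      ... | yes h = h
      ... | no none = contradiction (x , λ j e → none (j , e)) all-hit
      clash : (∃ λ i → ∃ λ j → i Fin.< j × proj₁ (hit i) ≡ proj₁ (hit j)) → ⊥
      clash (i , j , i<j , e) = <⇒≢ i<j (trans (sym (proj₂ (hit i))) (trans (cong g e) (proj₂ (hit j))))
    find (yes (x , miss)) = x , miss , λ y y≢x → other y y≢x (any? λ j → g j ≟ y)
      where
      other : ∀ y → y ≢ x → Dec (∃ λ j → g j ≡ y) → ∃ λ j → g j ≡ y
      other y y≢x (yes h) = h
      other y y≢x (no none) = ⊥-elim (clash (pigeonhole ℕₚ.≤-refl h))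
        where
        h : Fin (suc (suc n)) → Fin (suc n)
        h zero = x
        h (suc zero) = y
        h (suc (suc j)) = g j
        h-inj : ∀ i j → h i ≡ h j → i ≡ j
        h-inj zero zero e = refl
        h-inj zero (suc zero) e = contradiction (sym e) y≢x
        h-inj zero (suc (suc j)) e = contradiction (sym e) (miss j)
        h-inj (suc zero) zero e = contradiction e y≢x
        h-inj (suc zero) (suc zero) e = refl
        h-inj (suc zero) (suc (suc j)) e = contradiction (j , sym e) none
        h-inj (suc (suc i)) zero e = contradiction e (miss i)
        h-inj (suc (suc i)) (suc zero) e = contradiction (i , e) none
        h-inj (suc (suc i)) (suc (suc j)) e = cong (λ k → suc (suc k)) (g-inj e)
        clash : (∃ λ i → ∃ λ j → i Fin.< j × h i ≡ h j) → ⊥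
        clash (i , j , i<j , e) = <⇒≢ i<j (h-inj i j e)

-- Antipodal double covers of a complete graph as signed graphs.

module DoubleCovers where

  open import Defs hiding (_^_; sym)
  open GraphAutomorphisms
  open import Data.Bool.Base using (not)
  open import Function.Bundles using (module Equivalence)

  -- The fibres are defined through distances, so automorphisms permute them. The field `aut-π`
  -- records this consequence and the diameter is forgotten.
  record DoubleCover (Γ : Graph) (m : ℕ) : Set where
    field
      π         : Fin (n Γ) → Fin m
      opp       : Fin (n Γ) → Fin (n Γ)
      opp-≢     : ∀ u → opp u ≢ u
      π-opp     : ∀ u → π (opp u) ≡ π u
      fibre     : ∀ {u v} → π v ≡ π u → v ≡ u ⊎ v ≡ opp u
      π-onto    : ∀ x → ∃ λ u → π u ≡ x
      adj⇒π≢    : ∀ {u v} → Adj Γ u v → π u ≢ π v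
      one-adj   : ∀ {u v} → π u ≢ π v → Adj Γ u v ⊎ Adj Γ u (opp v)
      only-adj  : ∀ {u v} → Adj Γ u v → ¬ Adj Γ u (opp v)
      aut-π     : ∀ (σ : Aut Γ) {u v} → π u ≡ π v → π (fun σ u) ≡ π (fun σ v)

    flip : Bool → Fin (n Γ) → Fin (n Γ)
    flip false u = u
    flip true u = opp u

    abstract
      opp-unique : ∀ {u v} → π v ≡ π u → v ≢ u → v ≡ opp u
      opp-unique e v≢u with fibre e
      ... | inj₁ f = contradiction f v≢u
      ... | inj₂ f = f

      opp-opp : ∀ u → opp (opp u) ≡ u
      opp-opp u = sym (opp-unique {opp u} {u} (sym (π-opp u)) λ e → opp-≢ u (sym e))

      aut-opp : ∀ (σ : Aut Γ) u → fun σ (opp u) ≡ opp (fun σ u)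
      aut-opp σ u = opp-unique (aut-π σ (π-opp u)) λ e → opp-≢ u (fun-injective σ e)

      π-flip : ∀ e u → π (flip e u) ≡ π u
      π-flip false u = refl
      π-flip true u = π-opp u

      aut-flip : ∀ (σ : Aut Γ) e u → fun σ (flip e u) ≡ flip e (fun σ u)
      aut-flip σ false u = refl
      aut-flip σ true u = aut-opp σ u

      flip-flip : ∀ e u → flip e (flip e u) ≡ u
      flip-flip false u = refl
      flip-flip true u = opp-opp u

      flip-fibre : ∀ {u v} → π v ≡ π u → ∃ λ e → v ≡ flip e u
      flip-fibre e with fibre e
      ... | inj₁ f = false , f
      ... | inj₂ f = true , f

      flip-injective : ∀ e f u → flip e u ≡ flip f u → e ≡ f
      flip-injective false false u h = refl
      flip-injective false true u h = contradiction (sym h) (opp-≢ u)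
      flip-injective true false u h = contradiction h (opp-≢ u)
      flip-injective true true u h = refl

      adj-oppʳ : ∀ {u v} → π u ≢ π v → adj Γ u (opp v) ≡ not (adj Γ u v)
      adj-oppʳ {u} {v} ne = go (adj Γ u v) (adj Γ u (opp v)) refl refl
        where
        go : ∀ b c → adj Γ u v ≡ b → adj Γ u (opp v) ≡ c → c ≡ not b
        go true true e f = contradiction f (only-adj e)
        go true false e f = refl
        go false true e f = refl
        go false false e f with one-adj ne
        ... | inj₁ a = contradiction (trans (sym a) e) λ ()
        ... | inj₂ a = contradiction (trans (sym a) f) λ ()

      adj-oppˡ : ∀ {u v} → π u ≢ π v → adj Γ (opp u) v ≡ not (adj Γ u v)
      adj-oppˡ {u} {v} ne = trans (Graph.sym Γ (opp u) v) (trans (adj-oppʳ λ e → ne (sym e)) (cong not (Graph.sym Γ v u)))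

      adj-flipʳ : ∀ e {u v} → π u ≢ π v → adj Γ u (flip e v) ≡ adj Γ u v xor e
      adj-flipʳ false {u} {v} ne = go (adj Γ u v)
        where go : ∀ b → b ≡ b xor false
              go true = refl
              go false = refl
      adj-flipʳ true {u} {v} ne = trans (adj-oppʳ ne) (go (adj Γ u v))
        where go : ∀ b → not b ≡ b xor true
              go true = refl
              go false = refl

      -- Between two fibres adjacency is a sign, changed by flipping either end; the graph is
      -- therefore determined by the signs between chosen representatives of the fibres.
      adj-flip : ∀ e f {u v} → π u ≢ π v → adj Γ (flip e u) (flip f v) ≡ adj Γ u v xor (e xor f)
      adj-flip false f ne = adj-flipʳ f ne
      adj-flip true f {u} {v} ne = trans (adj-flipʳ f λ e → ne (trans (sym (π-opp u)) e)) (trans (cong (_xor f) (adj-oppˡ ne)) (go (adj Γ u v) f))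
        where go : ∀ b f → not b xor f ≡ b xor (true xor f)
              go true true = refl
              go true false = refl
              go false f = refl

      adj-flip-both : ∀ e {u v} → Adj Γ u v → Adj Γ (flip e u) (flip e v)
      adj-flip-both e {u} {v} a = trans (adj-flip e e (adj⇒π≢ a)) (trans (cong (adj Γ u v xor_) (xor-self e)) (trans (xor-false (adj Γ u v)) a))
        where
        xor-self : ∀ b → b xor b ≡ false
        xor-self true = refl
        xor-self false = refl
        xor-false : ∀ b → b xor false ≡ b
        xor-false true = refl
        xor-false false = refl

  doubleCover : ∀ {Γ m} → AntipodalDoubleCoverOfK Γ m → DoubleCover Γ m
  doubleCover {Γ} {m} (d , diam , 2≤d , _ , π , π⇔ , fibres , edges , lift) = record
    { π = π
    ; opp = opp
    ; opp-≢ = opp-≢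
    ; π-opp = π-opp
    ; fibre = λ {u} {v} → fibre u v
    ; π-onto = λ x → let u , v , ne , πu , _ = fibres x in u , πu
    ; adj⇒π≢ = adj⇒π≢
    ; one-adj = λ {u} {v} → one-adj u v
    ; only-adj = λ {u} {v} → only-adj u v
    ; aut-π = λ σ {u} {v} e → Equivalence.from (π⇔ (fun σ u) (fun σ v)) (map-anti σ (Equivalence.to (π⇔ u v) e))
    }
    where
    mate : ∀ u → ∃ λ v → v ≢ u × π v ≡ π u × (∀ w → π w ≡ π u → w ≡ u ⊎ w ≡ v)
    mate u with fibres (π u)
    ... | a , b , a≢b , πa , πb , all with all u refl
    ... | inj₁ refl = b , (λ e → a≢b (sym e)) , πb , all
    ... | inj₂ refl = a , a≢b , πa , λ w e → swap (all w e)
      where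
      swap : ∀ {A B : Set} → A ⊎ B → B ⊎ A
      swap (inj₁ x) = inj₂ x
      swap (inj₂ y) = inj₁ y
    opp : Fin (n Γ) → Fin (n Γ)
    opp u = proj₁ (mate u)
    opp-≢ : ∀ u → opp u ≢ u
    opp-≢ u = proj₁ (proj₂ (mate u))
    π-opp : ∀ u → π (opp u) ≡ π u
    π-opp u = proj₁ (proj₂ (proj₂ (mate u)))
    fibre : ∀ u v → π v ≡ π u → v ≡ u ⊎ v ≡ opp u
    fibre u v = proj₂ (proj₂ (proj₂ (mate u))) v
    adj⇒π≢ : ∀ {u v} → Adj Γ u v → π u ≢ π v
    adj⇒π≢ {u} {v} a = Equivalence.from (edges (π u) (π v)) (u , v , refl , refl , a)
    one-adj : ∀ u v → π u ≢ π v → Adj Γ u v ⊎ Adj Γ u (opp v)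
    one-adj u v ne with lift u (π v) (Equivalence.to (edges (π u) (π v)) ne)
    ... | w , a , πw , _ with fibre v w πw
    ... | inj₁ refl = inj₁ a
    ... | inj₂ refl = inj₂ a
    only-adj : ∀ u v → Adj Γ u v → ¬ Adj Γ u (opp v)
    only-adj u v a b with lift u (π v) (u , v , refl , refl , a)
    ... | w , _ , _ , unique = opp-≢ v (trans (unique (opp v) b (π-opp v)) (sym (unique v a refl)))
    map-anti : (σ : Aut Γ) → ∀ {u v} → AntiRel Γ d u v → AntiRel Γ d (fun σ u) (fun σ v)
    map-anti σ (inj₁ refl) = inj₁ refl
    map-anti σ (inj₂ x) = inj₂ (map-dist σ x)

-- The action of unimodular matrices on a graph with the prescribed automorphism group.

module PSLAction (p : ℕ) (prime : Prime p) (p%4≡1 : p % 4 ≡ 1) where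

  open import Defs hiding (_^_; sym; inv; pres)
  open GraphAutomorphisms
  open PrimeField p prime
  open Squares p prime p%4≡1
  open Plane p prime p%4≡1
  open PSL p prime p%4≡1

  ≐ᴹ⇒≃ : ∀ {A B} → A ≐ᴹ B → A ≃ B
  ≐ᴹ⇒≃ {A} {B} h = upto (+ 1) sign+ λ v → ≐-trans (·-congᴹ v h) (≐-sym (1∙ (B · v)))

  abstract
    det-⊗-unimodular : ∀ {A B} → det A ≋ + 1 → det B ≋ + 1 → det (A ⊗ B) ≋ + 1
    det-⊗-unimodular {A} {B} h k = ≋-trans (lin₀ (det-⊗ A B))
      (lin₂ (det B) h (+ 1) k (lem (det A) (det B)))
      where lem : ∀ a b → a * b - + 1 ≡ b * (a - + 1) + + 1 * (b - + 1)
            lem = solve-∀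

    ⊗-I : ∀ A → A ⊗ I₂ ≃ A
    ⊗-I A = upto (+ 1) sign+ λ v → ≐-trans
      (≐-trans (·-⊗ A I₂ v) (·-cong A (I₂· v))) (≐-sym (1∙ (A · v)))

  unipotent : ℤ → M2
  unipotent j = mat (+ 1) j (+ 0) (+ 1)

  diagonal : ℤ → ℤ → M2
  diagonal t i = mat t (+ 0) (+ 0) i

  abstract
    det-unipotent : ∀ j → det (unipotent j) ≋ + 1
    det-unipotent j = lin₀ (lem j)
      where lem : ∀ j → + 1 * + 1 - j * + 0 ≡ + 1
            lem = solve-∀

    det-diagonal : ∀ t i → t * i ≋ + 1 → det (diagonal t i) ≋ + 1
    det-diagonal t i h = lin₁ (+ 1) h (lem t i)
      where lem : ∀ t i → t * i - + 0 * + 0 - + 1 ≡ + 1 * (t * i - + 1)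
            lem = solve-∀

    unipotent-cong : ∀ {i j} → i ≋ j → unipotent i ≐ᴹ unipotent j
    unipotent-cong h = entries ≋-refl h ≋-refl ≋-refl

    unipotent-+ : ∀ i j → unipotent i ⊗ unipotent j ≐ᴹ unipotent (i + j)
    unipotent-+ i j = entries (lin₀ (lem₁ i)) (lin₀ (lem₂ i j)) ≋-refl (lin₀ (lem₃ j))
      where lem₁ : ∀ i → + 1 * + 1 + i * + 0 ≡ + 1
            lem₁ = solve-∀
            lem₂ : ∀ i j → + 1 * j + i * + 1 ≡ i + j
            lem₂ = solve-∀
            lem₃ : ∀ j → + 0 * j + + 1 * + 1 ≡ + 1
            lem₃ = solve-∀

    diagonal-unipotent : ∀ t i j → t * i ≋ + 1 → diagonal t i ⊗ unipotent j ≐ᴹ unipotent (t * t * j) ⊗ diagonal t i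
    diagonal-unipotent t i j h = entries (lin₀ (lem₁ t j)) (lin₁ (- (t * j)) h (lem₂ t i j)) (lin₀ (lem₃ t i)) (lin₀ (lem₄ j i))
      where lem₁ : ∀ t j → t * + 1 + + 0 * + 0 ≡ + 1 * t + t * t * j * + 0
            lem₁ = solve-∀
            lem₂ : ∀ t i j → t * j + + 0 * + 1 - (+ 1 * + 0 + t * t * j * i) ≡ (- (t * j)) * (t * i - + 1)
            lem₂ = solve-∀
            lem₃ : ∀ t i → + 0 * + 1 + i * + 0 ≡ + 0 * t + + 1 * + 0
            lem₃ = solve-∀
            lem₄ : ∀ j i → + 0 * j + i * + 1 ≡ + 0 * + 0 + + 1 * i
            lem₄ = solve-∀

  module _ {Γ : Graph} (iso : AutIsoPSL×Z2 p Γ) where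
    private
      φ : Aut Γ → M2
      φ σ = proj₁ (proj₁ iso σ)

    -- The copy of PSL(2,p) whose Z₂ coordinate is `false`.
    act : ∀ A → det A ≋ + 1 → Aut Γ
    act A h = proj₁ (proj₂ (proj₂ (proj₂ (proj₂ (proj₂ iso)))) A false (congruence h))

    abstract
      φ-act : ∀ A h → φ (act A h) ≃ A
      φ-act A h = ≈⇒≃ (φ (act A h)) A (proj₁ (proj₂ (proj₂ (proj₂ (proj₂ (proj₂ (proj₂ iso)))) A false (congruence h))))

      φ₂-act : ∀ A h → proj₂ (proj₁ iso (act A h)) ≡ false
      φ₂-act A h = proj₂ (proj₂ (proj₂ (proj₂ (proj₂ (proj₂ (proj₂ iso)))) A false (congruence h)))

      -- Injectivity of the group isomorphism makes the action multiplicative pointwise. Allowing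
      -- any `C` equal to the product up to sign lets relations between matrices pass directly to
      -- the vertices.
      act-⊗ : ∀ {A B C} hA hB hC → A ⊗ B ≃ C → ∀ u → fun (act C hC) u ≡ fun (act A hA) (fun (act B hB) u)
      act-⊗ {A} {B} {C} hA hB hC e u = faithful (act C hC) ρ (≃⇒≈ C≃ρ) (trans (φ₂-act C hC) (sym second)) u
        where
        ρ : Aut Γ
        ρ = act A hA ∘ᴬ act B hB
        hom : (φ ρ ≈[ p ] (φ (act A hA) ⊗ φ (act B hB))) × proj₂ (proj₁ iso ρ) ≡ (proj₂ (proj₁ iso (act A hA)) xor proj₂ (proj₁ iso (act B hB)))
        hom = proj₁ (proj₂ (proj₂ (proj₂ iso))) (act A hA) (act B hB) ρ (λ _ → refl)
        faithful : ∀ σ τ → φ σ ≈[ p ] φ τ → proj₂ (proj₁ iso σ) ≡ proj₂ (proj₁ iso τ) → ∀ u → fun σ u ≡ fun τ u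
        faithful = proj₁ (proj₂ (proj₂ (proj₂ (proj₂ iso))))
        C≃ρ : φ (act C hC) ≃ φ ρ
        C≃ρ = ≃-trans (φ-act C hC) (≃-trans (≃-sym e) (≃-sym (≃-trans (≈⇒≃ (φ ρ) (φ (act A hA) ⊗ φ (act B hB)) (proj₁ hom)) (⊗-cong (φ-act A hA) (φ-act B hB)))))
        second : proj₂ (proj₁ iso ρ) ≡ false
        second = trans (proj₂ hom) (cong₂ _xor_ (φ₂-act A hA) (φ₂-act B hB))

      act-I : ∀ {A} hA → A ≃ I₂ → ∀ u → fun (act A hA) u ≡ u
      act-I {A} hA e u = fun-injective (act A hA) (sym (act-⊗ hA hA hA (≃-trans (⊗-cong (≃-refl {A}) e) (⊗-I A)) u))

      act-cong : ∀ {A B} hA hB → A ≃ B → ∀ u → fun (act A hA) u ≡ fun (act B hB) u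
      act-cong {A} {B} hA hB e u = trans (act-⊗ {A} {I₂} {A} hA ≋-refl hA (⊗-I A) u)
        (trans (cong (fun (act A hA)) (act-I {I₂} ≋-refl ≃-refl u))
          (trans (sym (act-I {I₂} ≋-refl ≃-refl (fun (act A hA) u))) (absorb u)))
        where
        I⊗ : I₂ ⊗ A ≃ B
        I⊗ = ≃-trans (upto (+ 1) sign+ λ v → ≐-trans
                (≐-trans (·-⊗ I₂ A v) (I₂· (A · v))) (≐-sym (1∙ (A · v)))) e
        absorb : ∀ u → fun (act I₂ ≋-refl) (fun (act A hA) u) ≡ fun (act B hB) u
        absorb u = sym (act-⊗ {I₂} {A} {B} ≋-refl hA hB I⊗ u)

      act-faithful : ∀ {A} hA → (∀ u → fun (act A hA) u ≡ u) → A ≃ I₂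
      act-faithful {A} hA e = ≃-trans (≃-sym (φ-act A hA)) (≃-trans
        (≈⇒≃ (φ (act A hA)) (φ (act I₂ ≋-refl)) (proj₁ (proj₁ (proj₂ (proj₂ iso)) (act A hA) (act I₂ ≋-refl) λ u → trans (e u) (sym (act-I {I₂} ≋-refl ≃-refl u)))))
        (φ-act I₂ ≋-refl))

-- Reconstruction of Γ(p) from a double cover with this automorphism group.

module Covers (p : ℕ) (prime : Prime p) (p%4≡1 : p % 4 ≡ 1) where

  open import Defs hiding (_^_; sym; inv; pres; vert)
  open FinLemmas
  open GraphAutomorphisms
  open DoubleCovers
  open PrimeField p prime
  open Squares p prime p%4≡1
  open Plane p prime p%4≡1
  open SquareClassModels p prime p%4≡1
  open PSL p prime p%4≡1
  open PSLAction p prime p%4≡1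
  open Automorphisms p prime p%4≡1
  open import Data.Bool.Properties using (xor-assoc; xor-comm)
  open import Relation.Binary.PropositionalEquality using (subst₂)

  opaque
    unfolding _·_ _∙_

    unipotent≄I : ∀ {j} → j ≉ + 0 → ¬ (unipotent j ≃ I₂)
    unipotent≄I {j} j≉0 (upto ε s h) = j≉0 (lin₁ (+ 1) (eq₁ (h e₂)) (lem j ε))
      where lem : ∀ j e → j - + 0 ≡ + 1 * (+ 1 * + 0 + j * + 1 - e * (+ 1 * + 0 + + 0 * + 1))
            lem = solve-∀

  module _ {Γ : Graph} (cover : DoubleCover Γ (suc p)) (iso : AutIsoPSL×Z2 p Γ) where
    open DoubleCover cover

    translation : ℤ → Aut Γ
    translation j = act iso (unipotent j) (det-unipotent j)

    τ : ℤ → Fin (n Γ) → Fin (n Γ)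
    τ j = fun (translation j)

    abstract
      τ-+ : ∀ i j u → τ (i + j) u ≡ τ i (τ j u)
      τ-+ i j u = act-⊗ iso (det-unipotent i) (det-unipotent j) (det-unipotent (i + j)) (≐ᴹ⇒≃ (unipotent-+ i j)) u

      τ-cong : ∀ {i j} u → i ≋ j → τ i u ≡ τ j u
      τ-cong {i} {j} u h = act-cong iso (det-unipotent i) (det-unipotent j) (≐ᴹ⇒≃ (unipotent-cong h)) u

      τ-0 : ∀ u → τ (+ 0) u ≡ u
      τ-0 u = act-I iso (det-unipotent (+ 0)) ≃-refl u

      τ-π : ∀ j {u v} → π u ≡ π v → π (τ j u) ≡ π (τ j v)
      τ-π j = aut-π (translation j)

      τ-inverse : ∀ j u → τ (- j) (τ j u) ≡ u
      τ-inverse j u = trans (sym (τ-+ (- j) j u)) (trans (τ-cong u (lin₀ (ℤₚ.+-inverseˡ j))) (τ-0 u))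

      τ-π-cancel : ∀ i j u → π (τ i u) ≡ π (τ j u) → π (τ (i - j) u) ≡ π u
      τ-π-cancel i j u e = trans (cong π (trans (τ-cong u (lin₀ (ℤₚ.+-comm i (- j)))) (τ-+ (- j) i u)))
        (trans (τ-π (- j) e) (cong π (τ-inverse j u)))

      -- A nonzero k generates the additive group: `τ j` is `τ k` iterated j / k times.
      stabiliser : ∀ k u → k ≉ + 0 → π (τ k u) ≡ π u → ∀ j → π (τ j u) ≡ π u
      stabiliser k u k≉0 e j =
        let i , ki≋1 = inverse k≉0
            r = residue (j * i)
        in trans (cong π (τ-cong u (lin₂ (- k) (residue-≋ (j * i)) (- j) ki≋1 (lem j k i (+ toℕ r))))) (multiple (toℕ r))
        where
        lem : ∀ j k i r → j - r * k ≡ (- k) * (r - j * i) + (- j) * (k * i - + 1)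
        lem = solve-∀
        multiple : ∀ m → π (τ (+ m * k) u) ≡ π u
        multiple zero = cong π (τ-0 u)
        multiple (suc m) = trans (cong π (trans (τ-cong u (lin₀ (ℤₚ.suc-* (+ m) k))) (τ-+ k (+ m * k) u))) (trans (τ-π k (multiple m)) e)

      -- Otherwise `τ (+ 1)` would preserve each fibre of size two, so its square `τ (+ 2)` would be
      -- the identity, against faithfulness.
      moved : ∃ λ u → π (τ (+ 1) u) ≢ π u
      moved = decide (any? λ u → ¬? (π (τ (+ 1) u) ≟ π u))
        where
        decide : Dec (∃ λ u → ¬ (π (τ (+ 1) u) ≡ π u)) → ∃ λ u → π (τ (+ 1) u) ≢ π u
        decide (yes h) = h
        decide (no none) = ⊥-elim (unipotent≄I 2≉0 (act-faithful iso (det-unipotent (+ 2)) two))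
          where
          two : ∀ u → τ (+ 2) u ≡ u
          two u =
            let e , h = flip-fibre (decidable-stable (π (τ (+ 1) u) ≟ π u) λ ne → none (u , ne))
            in trans (τ-+ (+ 1) (+ 1) u) (trans (cong (τ (+ 1)) h) (trans (aut-flip (translation (+ 1)) e u) (trans (cong (flip e) h) (flip-flip e u))))

    -- The translations fix exactly one fibre, pointwise, and permute the others regularly.
    record Frame : Set where
      field
        u∞ w₀     : Fin (n Γ)
        joined    : Adj Γ u∞ w₀
        fixed     : ∀ j → τ j u∞ ≡ u∞
        distinct  : ∀ i j → π (τ i w₀) ≡ π (τ j w₀) → i ≋ j
        apart     : ∀ j → π (τ j w₀) ≢ π u∞
        covers    : ∀ v → π v ≢ π u∞ → ∃ λ j → π v ≡ π (τ j w₀)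

    abstract
      frame : Frame
      frame = build (moved)
        where
        build : (∃ λ u → π (τ (+ 1) u) ≢ π u) → Frame
        build (u₀ , mv) = from-missed (missed-point g (λ {i} {j} e → toℕ-≋-injective (distinct₀ (+ toℕ i) (+ toℕ j) e)))
          where
          g : Fin p → Fin (suc p)
          g j = π (τ (+ toℕ j) u₀)
          distinct₀ : ∀ i j → π (τ i u₀) ≡ π (τ j u₀) → i ≋ j
          distinct₀ i j e = decidable-stable (i ≋? j) λ i≉j →
            mv (stabiliser (i - j) u₀ (λ h → i≉j (lin₁ (+ 1) h (lem i j))) (τ-π-cancel i j u₀ e) (+ 1))
            where lem : ∀ i j → i - j ≡ + 1 * (i - j - + 0)
                  lem = solve-∀
          from-missed : (∃ λ x → (∀ j → g j ≢ x) × (∀ y → y ≢ x → ∃ λ j → g j ≡ y)) → Frame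
          from-missed (x , miss , hit) = record
              { u∞ = u∞ ; w₀ = w₀ ; joined = joined ; fixed = fixed
              ; distinct = λ i j e → distinct₀ i j (trans (sym (same-fibre i)) (trans e (same-fibre j)))
              ; apart = λ j e → miss′ j (trans (sym (same-fibre j)) (trans e πu∞))
              ; covers = λ v ne → let j , e = hit (π v) (λ q → ne (trans q (sym πu∞))) in + toℕ j , trans (sym e) (sym (same-fibre (+ toℕ j))) }
            where
            u∞ : Fin (n Γ)
            u∞ = proj₁ (π-onto x)
            πu∞ : π u∞ ≡ x
            πu∞ = proj₂ (π-onto x)
            miss′ : ∀ j → π (τ j u₀) ≢ x
            miss′ j e = miss (residue j) (trans (cong π (τ-cong u₀ (residue-≋ j))) e)
            -- If `τ k` carried `u∞` into a fibre met by the orbit of `u₀`, translating back would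
            -- place the missed fibre in that orbit.
            fixed-fibre : ∀ k → π (τ k u∞) ≡ π u∞
            fixed-fibre k = decidable-stable (π (τ k u∞) ≟ π u∞) λ ne → contra (hit (π (τ k u∞)) (λ e → ne (trans e (sym πu∞))))
              where
              contra : ¬ (∃ λ j → g j ≡ π (τ k u∞))
              contra (j , e) = miss′ (- k + + toℕ j) (trans (cong π (τ-+ (- k) (+ toℕ j) u₀)) (trans (τ-π (- k) e) (trans (cong π (τ-inverse k u∞)) πu∞)))
            double : ∀ m → τ m (τ m u∞) ≡ u∞
            double m =
              let e , h = flip-fibre (fixed-fibre m)
              in trans (cong (τ m) h) (trans (aut-flip (translation m) e u∞) (trans (cong (flip e) h) (flip-flip e u∞)))
            -- The translation by j is the square of the translation by j / 2, and the square of a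
            -- permutation of two points is trivial.
            fixed : ∀ j → τ j u∞ ≡ u∞
            fixed j =
              let i , 2i≋1 = inverse 2≉0
              in trans (trans (τ-cong u∞ (lin₁ (- j) 2i≋1 (lem i j))) (τ-+ (i * j) (i * j) u∞)) (double (i * j))
              where lem : ∀ i j → j - (i * j + i * j) ≡ (- j) * (+ 2 * i - + 1)
                    lem = solve-∀
            u∞≢u₀ : π u∞ ≢ π u₀
            u∞≢u₀ e = miss′ (+ 0) (trans (cong π (τ-0 u₀)) (trans (sym e) πu∞))
            pick : Adj Γ u∞ u₀ ⊎ Adj Γ u∞ (opp u₀) → ∃ λ w → Adj Γ u∞ w × π w ≡ π u₀
            pick (inj₁ a) = u₀ , a , refl
            pick (inj₂ a) = opp u₀ , a , π-opp u₀
            w₀ : Fin (n Γ)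
            w₀ = proj₁ (pick (one-adj u∞≢u₀))
            joined : Adj Γ u∞ w₀
            joined = proj₁ (proj₂ (pick (one-adj u∞≢u₀)))
            same-fibre : ∀ j → π (τ j w₀) ≡ π (τ j u₀)
            same-fibre j = τ-π j (proj₂ (proj₂ (pick (one-adj u∞≢u₀))))

    data Base : Set where
      ∞   : Base
      aff : ℤ → Base

    module _ (F : Frame) where
      open Frame F

      w : ℤ → Fin (n Γ)
      w j = τ j w₀

      vert : Base → Fin (n Γ)
      vert ∞ = u∞
      vert (aff j) = w j

      S : ℤ → Set
      S j = Adj Γ w₀ (w j)

      abstract
        S-cong : ∀ {i j} → i ≋ j → S i → S j
        S-cong h s = subst (Adj Γ w₀) (τ-cong w₀ h) s

        joined-w : ∀ j → Adj Γ u∞ (w j)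
        joined-w j = subst (λ u → Adj Γ u (w j)) (fixed j) (map-adj (translation j) joined)

        adj-w : ∀ i j → adj Γ (w i) (w j) ≡ adj Γ w₀ (w (j - i))
        adj-w i j = trans (cong (adj Γ (w i)) (trans (τ-cong w₀ (lin₀ (lem i j))) (τ-+ i (j - i) w₀))) (Aut.pres (translation i) w₀ (w (j - i)))
          where lem : ∀ i j → j ≡ i + (j - i)
                lem = solve-∀

        kind : ∀ v → ∃ λ b → ∃ λ e → v ≡ flip e (vert b)
        kind v = decide (π v ≟ π u∞)
          where
          decide : Dec (π v ≡ π u∞) → ∃ λ b → ∃ λ e → v ≡ flip e (vert b)
          decide (yes h) = ∞ , flip-fibre h
          decide (no ne) = let j , h = covers v ne in aff j , flip-fibre h

        neighbour-of-∞ : ∀ v → Adj Γ u∞ v → ∃ λ j → v ≡ w j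
        neighbour-of-∞ v a = decide (covers v λ e → adj⇒π≢ a (sym e))
          where
          decide : (∃ λ j → π v ≡ π (w j)) → ∃ λ j → v ≡ w j
          decide (j , h) = j , Sum.[ (λ e → e) , (λ { refl → contradiction a (only-adj (joined-w j)) }) ]′ (fibre h)

      -- Conjugation by diag(t,1/t) multiplies translations by t²; composing with opp if necessary it fixes u∞.
      module _ (t i : ℤ) (ti≋1 : t * i ≋ + 1) where
        private
          dβ : det (diagonal t i) ≋ + 1
          dβ = det-diagonal t i ti≋1

          β : Aut Γ
          β = act iso (diagonal t i) dβ

          abstract
            t≉0 : t ≉ + 0
            t≉0 z = 1≉0 (≋-trans (≋-sym ti≋1) (lin₁ i z (lem t i)))
              where lem : ∀ t i → t * i - + 0 ≡ i * (t - + 0)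
                    lem = solve-∀

            β-τ : ∀ j u → fun β (τ j u) ≡ τ (t * t * j) (fun β u)
            β-τ j u = trans (sym (act-⊗ iso {diagonal t i} {unipotent j} {diagonal t i ⊗ unipotent j} dβ (det-unipotent j) dC ≃-refl u))
                (act-⊗ iso {unipotent (t * t * j)} {diagonal t i} {diagonal t i ⊗ unipotent j} (det-unipotent (t * t * j)) dβ dC
                  (≃-sym (≐ᴹ⇒≃ (diagonal-unipotent t i j ti≋1))) u)
              where
              dC : det (diagonal t i ⊗ unipotent j) ≋ + 1
              dC = det-⊗-unimodular {diagonal t i} {unipotent j} dβ (det-unipotent j)

            βu∞-fixed : ∀ j → τ (t * t * j) (fun β u∞) ≡ fun β u∞
            βu∞-fixed j = trans (sym (β-τ j u∞)) (cong (fun β) (fixed j))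

            -- The vertex `fun β u∞` is fixed by the nontrivial translation by t², whereas
            -- translations act freely on the fibres other than that of `u∞`.
            β-fibre : π (fun β u∞) ≡ π u∞
            β-fibre = decidable-stable (π (fun β u∞) ≟ π u∞) λ ne → contra (covers (fun β u∞) ne)
              where
              tt≉0 : t * t * + 1 ≉ + 0
              tt≉0 = *-≉0 (*-≉0 t≉0 t≉0) 1≉0
              contra : ¬ (∃ λ j → π (fun β u∞) ≡ π (τ j w₀))
              contra (j , h) = tt≉0 (lin₁ (+ 1) (distinct (t * t * + 1 + j) j
                  (trans (cong π (τ-+ (t * t * + 1) j w₀)) (trans (sym (τ-π (t * t * + 1) h)) (trans (cong π (βu∞-fixed (+ 1))) h))))
                  (lem (t * t * + 1) j))
                where lem : ∀ s j → s - + 0 ≡ + 1 * (s + j - j)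
                      lem = solve-∀

          e : Bool
          e = proj₁ (flip-fibre β-fibre)

          γ : Fin (n Γ) → Fin (n Γ)
          γ v = flip e (fun β v)

          abstract
            γu∞ : γ u∞ ≡ u∞
            γu∞ = trans (cong (flip e) (proj₂ (flip-fibre β-fibre))) (flip-flip e u∞)

            γ-adj : ∀ {u v} → Adj Γ u v → Adj Γ (γ u) (γ v)
            γ-adj a = adj-flip-both e (map-adj β a)

            γ-τ : ∀ j v → γ (τ j v) ≡ τ (t * t * j) (γ v)
            γ-τ j v = trans (cong (flip e) (β-τ j v)) (sym (aut-flip (translation (t * t * j)) e (fun β v)))

        abstract
          -- As `γ` fixes `u∞`, it sends the neighbour `w₀` to some `w k`, and then `w j` to
          -- `w (t * t * j + k)`; the shift by k cancels in the difference.
          S-scale : ∀ j → S j → S (t * t * j)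
          S-scale j s = use (neighbour-of-∞ (γ w₀) (subst (λ u → Adj Γ u (γ w₀)) γu∞ (γ-adj joined)))
            where
            use : (∃ λ k → γ w₀ ≡ w k) → S (t * t * j)
            use (k , h) = S-cong (lin₀ (lem (t * t * j) k)) (trans (sym (adj-w k (t * t * j + k)))
              (subst₂ (Adj Γ) h (trans (γ-τ j w₀) (trans (cong (τ (t * t * j)) h) (sym (τ-+ (t * t * j) k w₀)))) (γ-adj s)))
              where lem : ∀ s k → s + k - k ≡ s
                    lem = solve-∀

      abstract
        S-square : ∀ {r} j → Sq r → S j → S (r * j)
        S-square {r} j (square t t≉0 r≋tt) s =
          let i , ti≋1 = inverse t≉0
          in S-cong (*-congʳ j (≋-sym r≋tt)) (S-scale t i ti≋1 j s)

        S-same-class : ∀ {i j} → Sq (i * j) → S i → S j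
        S-same-class {i} {j} S-ij s =
          let i≉0 = λ (z : i ≋ + 0) → Sq⇒≉0 S-ij (lin₁ j z (lem₀ i j))
              k , ik≋1 = inverse {i} i≉0
          in S-cong (lin₂ (j * (i * k + + 1)) ik≋1 (+ 0) (≋-refl {+ 0}) (lem i j k)) (S-square {i * j * (k * k)} i (Sq-* S-ij (square k (k≉0 k ik≋1) ≋-refl)) s)
          where
          lem₀ : ∀ i j → i * j - + 0 ≡ j * (i - + 0)
          lem₀ = solve-∀
          lem : ∀ i j k → i * j * (k * k) * i - j ≡ j * (i * k + + 1) * (i * k - + 1) + + 0 * (+ 0 - + 0)
          lem = solve-∀
          k≉0 : ∀ k → i * k ≋ + 1 → k ≉ + 0
          k≉0 k h z = 1≉0 (≋-trans (≋-sym h) (lin₁ i z (lem₁ i k)))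
            where lem₁ : ∀ i k → i * k - + 0 ≡ i * (k - + 0)
                  lem₁ = solve-∀

      base-adj : Base → Base → Bool
      base-adj b c = adj Γ (vert b) (vert c)

      abstract
        -- If every w i is joined to every w j, then {u∞} ∪ {w j} is a component.
        all-joined : (∀ j → j ≉ + 0 → S j) → ¬ Connected Γ
        all-joined allS conn = let k , wk = conn u∞ (opp u∞) in impossible (closed wk (∞ , refl))
          where
          base-joined : ∀ b c → π (vert b) ≢ π (vert c) → base-adj b c ≡ true
          base-joined ∞ ∞ ne = contradiction refl ne
          base-joined ∞ (aff j) ne = joined-w j
          base-joined (aff j) ∞ ne = trans (Graph.sym Γ (w j) u∞) (joined-w j)
          base-joined (aff i) (aff j) ne = trans (adj-w i j) (allS (j - i) λ h → ne (cong π (τ-cong w₀ (lin₁ (- + 1) h (lem i j)))))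
            where lem : ∀ i j → i - j ≡ (- + 1) * (j - i - + 0)
                  lem = solve-∀
          step-closed : ∀ {u v} → Adj Γ u v → (∃ λ b → u ≡ vert b) → ∃ λ b → v ≡ vert b
          step-closed {u} {v} a (b , refl) = go (kind v)
            where
            go : (∃ λ c → ∃ λ e → v ≡ flip e (vert c)) → ∃ λ b → v ≡ vert b
            go (c , false , h) = c , h
            go (c , true , refl) = contradiction a (only-adj (base-joined b c λ e → adj⇒π≢ a (trans e (sym (π-opp (vert c))))))
          closed : ∀ {u v k} → Walk Γ u v k → (∃ λ b → u ≡ vert b) → ∃ λ b → v ≡ vert b
          closed here h = h
          closed (step a wk) h = closed wk (step-closed a h)
          impossible : ¬ (∃ λ b → opp u∞ ≡ vert b)
          impossible (∞ , h) = opp-≢ u∞ h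
          impossible (aff j , h) = apart j (trans (cong π (sym h)) (π-opp u∞))

        -- On the representatives the graph is a star with centre `u∞`, so between different fibres
        -- adjacency is the sum modulo 2 of the two shades. Flipping an end changes its colour
        -- together with the adjacency.
        none-joined : (∀ j → j ≉ + 0 → ¬ S j) → Bipartite Γ
        none-joined noneS = colour , proper
          where
          shade : Base → Bool
          shade ∞ = false
          shade (aff _) = true
          colour : Fin (n Γ) → Bool
          colour v = let b , e , _ = kind v in shade b xor e
          base-adj≡ : ∀ b c → π (vert b) ≢ π (vert c) → base-adj b c ≡ shade b xor shade c
          base-adj≡ ∞ ∞ ne = contradiction refl ne
          base-adj≡ ∞ (aff j) ne = joined-w j
          base-adj≡ (aff j) ∞ ne = trans (Graph.sym Γ (w j) u∞) (joined-w j)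
          base-adj≡ (aff i) (aff j) ne = trans (adj-w i j) (not-true (noneS (j - i) λ h → ne (cong π (τ-cong w₀ (lin₁ (- + 1) h (lem i j))))))
            where lem : ∀ i j → i - j ≡ (- + 1) * (j - i - + 0)
                  lem = solve-∀
                  not-true : ∀ {b} → ¬ (b ≡ true) → b ≡ false
                  not-true {true} h = contradiction refl h
                  not-true {false} h = refl
          clash : ∀ x y e f → (x xor y) xor (e xor f) ≡ true → x xor e ≡ y xor f → ⊥
          clash true true true true () h
          clash true true true false g ()
          clash true true false true g ()
          clash true true false false () h
          clash true false true true g ()
          clash true false true false () h
          clash true false false true () h
          clash true false false false g ()
          clash false true true true g ()
          clash false true true false () h
          clash false true false true () h
          clash false true false false g ()
          clash false false true true () h
          clash false false true false g ()
          clash false false false true g ()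
          clash false false false false () h
          proper : ∀ u v → Adj Γ u v → colour u ≢ colour v
          proper u v a = go (kind u) (kind v)
            where
            go : (k : ∃ λ b → ∃ λ e → u ≡ flip e (vert b)) (l : ∃ λ b → ∃ λ e → v ≡ flip e (vert b)) →
              shade (proj₁ k) xor proj₁ (proj₂ k) ≢ shade (proj₁ l) xor proj₁ (proj₂ l)
            go (b , e , refl) (c , f , refl) h = clash (shade b) (shade c) e f
                (trans (cong (_xor (e xor f)) (sym (base-adj≡ b c ne))) (trans (sym (adj-flip e f ne)) a)) h
              where
              ne : π (vert b) ≢ π (vert c)
              ne q = adj⇒π≢ a (trans (π-flip e (vert b)) (trans q (sym (π-flip f (vert c)))))

      -- Two cases in one: `κ` is 1 if the connection set consists of the squares and ν if it
      -- consists of the nonsquares. Labelling `w j` by the coordinate κj turns adjacency into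
      -- squareness of a difference.
      module _ (κ : ℤ) (κ≉0 : κ ≉ + 0) (S⇒ : ∀ j → j ≉ + 0 → S j → Sq (κ * j)) (S⇐ : ∀ j → Sq (κ * j) → S j) where
        private
          vec : Base → V2
          vec ∞ = e₁
          vec (aff j) = affine-vector (κ * j)

          record Same (b c : Base) : Set where
            constructor coincide
            field
              vert-≡ : vert b ≡ vert c
              vec-~  : vec b ~ vec c

          record Different (b c : Base) : Set where
            constructor differ
            field
              D≉0  : D (vec b) (vec c) ≉ + 0
              π-≢  : π (vert b) ≢ π (vert c)
              adj⇒Sq : base-adj b c ≡ true → Sq (D (vec b) (vec c))
              Sq⇒adj : Sq (D (vec b) (vec c)) → base-adj b c ≡ true

          abstract
            D-e₁-affine : ∀ x → D e₁ (affine-vector x) ≡ + 1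
            D-e₁-affine x = D-e₁ (affine-vector x)

            compare-aff : ∀ i j → Dec (i ≋ j) → Same (aff i) (aff j) ⊎ Different (aff i) (aff j)
            compare-aff i j (yes h) = inj₁ (coincide (τ-cong w₀ h) (≐⇒~ (*-congˡ κ h ,, ≋-refl)))
            compare-aff i j (no i≉j) = inj₂ (differ
                (λ z → i≉j (*-cancelˡ κ κ≉0 (lin₁ (+ 1) (≋-trans (lin₀ (sym (D-affine (κ * i) (κ * j)))) z) (lem₀ (κ * i) (κ * j)))))
                (λ e → i≉j (distinct i j e))
                (λ a → Sq-resp (≋-trans (lin₀ (lem κ i j)) (lin₀ (sym (D-affine (κ * i) (κ * j)))))
                         (Sq-neg (S⇒ (j - i) (λ h → i≉j (lin₁ (- + 1) h (lem₁ i j))) (trans (sym (adj-w i j)) a))))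
                (λ s → trans (adj-w i j) (S⇐ (j - i) (Sq-resp (lin₀ (lem₂ κ i j)) (Sq-neg (Sq-resp (lin₀ (D-affine (κ * i) (κ * j))) s))))))
              where
              lem₀ : ∀ x y → x - y ≡ + 1 * (x - y - + 0)
              lem₀ = solve-∀
              lem : ∀ k i j → - (k * (j - i)) ≡ k * i - k * j
              lem = solve-∀
              lem₁ : ∀ i j → i - j ≡ (- + 1) * (j - i - + 0)
              lem₁ = solve-∀
              lem₂ : ∀ k i j → - (k * i - k * j) ≡ k * (j - i)
              lem₂ = solve-∀

            -- Labels are integers, not residues, so different labels may name one vertex. Either
            -- vertex and class both coincide, or the fibres differ and the determinant decides
            -- adjacency.
            compare : ∀ b c → Same b c ⊎ Different b c
            compare ∞ ∞ = inj₁ (coincide refl (~-refl))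
            compare ∞ (aff j) = inj₂ (differ (≉0-resp (lin₀ (sym (D-e₁-affine (κ * j)))) 1≉0) (λ e → apart j (sym e))
              (λ _ → Sq-resp (lin₀ (sym (D-e₁-affine (κ * j)))) Sq-one) (λ _ → joined-w j))
            compare (aff j) ∞ = inj₂ (differ (Sq⇒≉0 SD) (apart j) (λ _ → SD) (λ _ → trans (Graph.sym Γ (w j) u∞) (joined-w j)))
              where
              SD : Sq (D (affine-vector (κ * j)) e₁)
              SD = Sq-D-sym (Sq-resp (lin₀ (sym (D-e₁-affine (κ * j)))) Sq-one)
            compare (aff i) (aff j) = compare-aff i j (i ≋? j)

            vec-nonzero : ∀ b → NonZeroVector (vec b)
            vec-nonzero ∞ = e₁-nonzero
            vec-nonzero (aff j) = affine-nonzero (κ * j)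

            -- Flipping a vertex negates adjacency on the graph side and multiplies the determinant
            -- by ν on the vector side; the two changes match.
            sq-twist : ∀ e {d β} → d ≉ + 0 → (β ≡ true → Sq d) → (Sq d → β ≡ true) →
              (β xor e ≡ true → Sq (twist e * d)) × (Sq (twist e * d) → β xor e ≡ true)
            sq-twist false {d} {β} d≉0 f g = (λ h → Sq-resp (lin₀ (sym (ℤₚ.*-identityˡ d))) (f (trans (sym (xor-false β)) h))) ,
                (λ s → trans (xor-false β) (g (Sq-resp (lin₀ (ℤₚ.*-identityˡ d)) s)))
              where xor-false : ∀ b → b xor false ≡ b
                    xor-false true = refl
                    xor-false false = refl
            sq-twist true {d} {true} d≉0 f g = (λ ()) , (λ s → contradiction s (Sq-ν-exclusive (f refl)))
            sq-twist true {d} {false} d≉0 f g = (λ _ → Sq-ν d≉0 λ s → contradiction (g s) λ ()) , (λ _ → refl)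

          Kind : Fin (n Γ) → Set
          Kind v = ∃ λ b → ∃ λ e → v ≡ flip e (vert b)

          ⟦_⟧ : ∀ {v} → Kind v → V2
          ⟦ b , e , _ ⟧ = twist e ∙ vec b

          abstract
            D-⟦⟧ : ∀ b c e f → D (twist e ∙ vec b) (twist f ∙ vec c) ≡ twist e * (twist f * D (vec b) (vec c))
            D-⟦⟧ b c e f = trans (D-scaleˡ (twist e) (vec b) (twist f ∙ vec c)) (cong (twist e *_) (D-scaleʳ (twist f) (vec b) (vec c)))

            ⟦⟧-nonzero : ∀ {v} (k : Kind v) → NonZeroVector ⟦ k ⟧
            ⟦⟧-nonzero (b , e , _) = ∙-nonzero (twist≉0 e) (vec-nonzero b)

            ⟦⟧-injective : ∀ {u v} (k : Kind u) (l : Kind v) → ⟦ k ⟧ ~ ⟦ l ⟧ → u ≡ v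
            ⟦⟧-injective {u} {v} (b , e , p) (c , f , q) h = go (compare b c)
              where
              go : Same b c ⊎ Different b c → u ≡ v
              go (inj₁ (coincide x y)) = trans p (trans (cong₂ flip (twist-injective {e} {f} {vec c} (vec-nonzero c)
                (~-trans {twist e ∙ vec c} {twist e ∙ vec b} {twist f ∙ vec c} (∙-~ (twist e) (~-sym y)) h)) x) (sym q))
              go (inj₂ (differ D≉0 _ _ _)) = contradiction
                (≋-trans (lin₀ (sym (D-⟦⟧ b c e f))) (D≋0-resp
                  (~-refl) h (lin₀ (D-self (twist e ∙ vec b)))))
                (*-≉0 (twist≉0 e) (*-≉0 (twist≉0 f) D≉0))

            ⟦⟧-well-defined : ∀ {v} (k l : Kind v) → ⟦ k ⟧ ~ ⟦ l ⟧
            ⟦⟧-well-defined {v} (b , e , p) (c , f , q) = go (compare b c)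
              where
              go : Same b c ⊎ Different b c → twist e ∙ vec b ~ twist f ∙ vec c
              go (inj₁ (coincide x y)) = subst (λ g → twist e ∙ vec b ~ twist g ∙ vec c)
                (flip-injective e f (vert c) (trans (cong (flip e) (sym x)) (trans (sym p) q))) (∙-~ (twist e) y)
              go (inj₂ (differ _ ne _ _)) = contradiction (trans (sym (π-flip e (vert b))) (trans (cong π (trans (sym p) q)) (π-flip f (vert c)))) ne

            ⟦⟧-adj : ∀ {u v} (k : Kind u) (l : Kind v) → (Adj Γ u v → Sq (D ⟦ k ⟧ ⟦ l ⟧)) × (Sq (D ⟦ k ⟧ ⟦ l ⟧) → Adj Γ u v)
            ⟦⟧-adj (b , e , refl) (c , f , refl) = go (compare b c)
              where
              result : Set
              result = (Adj Γ (flip e (vert b)) (flip f (vert c)) → Sq (D (twist e ∙ vec b) (twist f ∙ vec c))) ×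
                       (Sq (D (twist e ∙ vec b) (twist f ∙ vec c)) → Adj Γ (flip e (vert b)) (flip f (vert c)))
              go : Same b c ⊎ Different b c → result
              go (inj₁ (coincide x y)) =
                (λ a → contradiction (trans (π-flip e (vert b)) (trans (cong π x) (sym (π-flip f (vert c))))) (adj⇒π≢ a)) ,
                (λ s → contradiction (≋-trans (lin₀ (D-⟦⟧ b c e f)) (zero-twist (D≋0-resp (~-refl) y (lin₀ (D-self (vec b)))))) (Sq⇒≉0 s))
                where
                zero-twist : D (vec b) (vec c) ≋ + 0 → twist e * (twist f * D (vec b) (vec c)) ≋ + 0
                zero-twist h = lin₁ (twist e * twist f) h (lem (twist e) (twist f) (D (vec b) (vec c)))
                  where lem : ∀ s t x → s * (t * x) - + 0 ≡ s * t * (x - + 0)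
                        lem = solve-∀
              go (inj₂ (differ D≉0 ne to from)) =
                  (λ a → Sq-resp (lin₀ (sym (D-⟦⟧ b c e f))) (proj₁ outer (trans (sym bool) a))) ,
                  (λ s → trans bool (proj₂ outer (Sq-resp (lin₀ (D-⟦⟧ b c e f)) s)))
                where
                inner : (base-adj b c xor f ≡ true → Sq (twist f * D (vec b) (vec c))) × (Sq (twist f * D (vec b) (vec c)) → base-adj b c xor f ≡ true)
                inner = sq-twist f D≉0 to from
                outer : ((base-adj b c xor f) xor e ≡ true → Sq (twist e * (twist f * D (vec b) (vec c)))) ×
                        (Sq (twist e * (twist f * D (vec b) (vec c))) → (base-adj b c xor f) xor e ≡ true)
                outer = sq-twist e (*-≉0 (twist≉0 f) D≉0) (proj₁ inner) (proj₂ inner)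
                bool : adj Γ (flip e (vert b)) (flip f (vert c)) ≡ (base-adj b c xor f) xor e
                bool = trans (adj-flip e f ne) (trans (cong (base-adj b c xor_) (xor-comm e f)) (sym (xor-assoc (base-adj b c) f e)))

            vector-kind : ∀ x → NonZeroVector x → ∃ λ b → ∃ λ e → twist e ∙ vec b ~ x
            vector-kind x x≉0 = split (line-normal-form x)
              where
              from-line : ∀ b → D (vec b) x ≋ + 0 → ∃ λ b → ∃ λ e → twist e ∙ vec b ~ x
              from-line b h = Sum.[ (λ r → b , false , ~-trans (≐⇒~ (1∙ (vec b))) r) , (λ r → b , true , r) ]′
                (line-classes (vec-nonzero b) x≉0 h)
              split : D x e₁ ≋ + 0 ⊎ (∃ λ y → D x (affine-vector y) ≋ + 0) → ∃ λ b → ∃ λ e → twist e ∙ vec b ~ x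
              split (inj₁ h) = from-line ∞ (D≋0-sym h)
              split (inj₂ (y , h)) =
                let k , κk≋1 = inverse κ≉0
                in from-line (aff (k * y)) (D≋0-sym
                  (D≋0-resp (~-refl) (≐⇒~ (lin₁ (- y) κk≋1 (lem κ k y) ,, ≋-refl)) h))
                where lem : ∀ s k y → y - s * (k * y) ≡ (- y) * (s * k - + 1)
                      lem = solve-∀

        cover-model : Model Γ
        cover-model = record
          { V = λ v → ⟦ kind v ⟧
          ; V-nonzero = λ v → ⟦⟧-nonzero (kind v)
          ; V-injective = λ {u} {v} → ⟦⟧-injective (kind u) (kind v)
          ; vertex = λ x x≉0 → let b , e , _ = vector-kind x x≉0 in flip e (vert b)
          ; V-vertex = λ x x≉0 → let b , e , h = vector-kind x x≉0 in
              ~-trans (⟦⟧-well-defined (kind (flip e (vert b))) (b , e , refl)) h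
          ; adj⇒ = λ {u} {v} → proj₁ (⟦⟧-adj (kind u) (kind v))
          ; adj⇐ = λ {u} {v} → proj₂ (⟦⟧-adj (kind u) (kind v))
          }

      model-from-frame : Connected Γ → ¬ Bipartite Γ → Model Γ
      model-from-frame conn ¬bip = decide (adj Γ w₀ (w (+ 1))) refl (adj Γ w₀ (w ν)) refl
        where
        class : ∀ j → j ≉ + 0 → Sq j ⊎ Sq (ν * j)
        class j j≉0 with Sq? j
        ... | yes s = inj₁ s
        ... | no ¬s = inj₂ (Sq-ν j≉0 ¬s)
        one* : ∀ j → Sq j → Sq (+ 1 * j)
        one* j s = Sq-resp (lin₀ (sym (ℤₚ.*-identityˡ j))) s
        decide : ∀ b → adj Γ w₀ (w (+ 1)) ≡ b → ∀ c → adj Γ w₀ (w ν) ≡ c → Model Γ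
        decide true s₁ true sν = contradiction conn (all-joined λ j j≉0 → Sum.[ (λ s → S-same-class {+ 1} {j} (one* j s) s₁) , (λ s → S-same-class {ν} {j} s sν) ]′ (class j j≉0))
        decide true s₁ false nν = cover-model (+ 1) 1≉0
          (λ j j≉0 s → Sum.[ one* j , (λ q → contradiction (trans (sym nν) (S-same-class {j} {ν} (Sq-resp (lin₀ (ℤₚ.*-comm ν j)) q) s)) λ ()) ]′ (class j j≉0))
          (λ j q → S-same-class {+ 1} {j} q s₁)
        decide false n₁ true sν = cover-model ν ν≉0
          (λ j j≉0 s → Sum.[ (λ q → contradiction (trans (sym n₁) (S-same-class {j} {+ 1} (Sq-resp (lin₀ (sym (ℤₚ.*-identityʳ j))) q) s)) λ ()) , (λ q → q) ]′ (class j j≉0))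
          (λ j q → S-same-class {ν} {j} q sν)
        decide false n₁ false nν = contradiction (none-joined λ j j≉0 s → Sum.[
            (λ q → contradiction (trans (sym n₁) (S-same-class {j} {+ 1} (Sq-resp (lin₀ (sym (ℤₚ.*-identityʳ j))) q) s)) λ ()) ,
            (λ q → contradiction (trans (sym nν) (S-same-class {j} {ν} (Sq-resp (lin₀ (ℤₚ.*-comm ν j)) q) s)) λ ()) ]′ (class j j≉0)) ¬bip

    cover⇒model : Connected Γ → ¬ Bipartite Γ → Model Γ
    cover⇒model = model-from-frame frame

-- Transvections, the subgroup H as a stabiliser, and its double cosets.

module Stabilisers (p : ℕ) (prime : Prime p) (p%4≡1 : p % 4 ≡ 1) where

  open import Defs hiding (sym; inv; pres) renaming (_^_ to _^ᴹ_)
  open PrimeField p prime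
  open PrimitiveRoot p prime using (Order)
  open Squares p prime p%4≡1
  open Plane p prime p%4≡1
  open PSL p prime p%4≡1
  open PSLAction p prime p%4≡1 using (≐ᴹ⇒≃; det-⊗-unimodular)

  abstract
    det-≃ : ∀ {A B} → A ≃ B → det A ≋ det B
    det-≃ {A} {B} (upto ε s h) = ≋-trans (lin₀ (det-D A))
      (≋-trans (D-cong (h e₁) (h e₂))
        (≋-trans
          (lin₀ (trans (D-scaleˡ ε (B · e₁) (ε ∙ (B · e₂))) (trans (cong (ε *_) (D-scaleʳ ε (B · e₁) (B · e₂)))
            (trans (sym (ℤₚ.*-assoc ε ε (D (B · e₁) (B · e₂)))) (cong (ε * ε *_) (sym (det-D B)))))))
          (lin₁ (det B) (squared-one s) (lem ε (det B)))))
      where lem : ∀ e d → e * e * d - d ≡ d * (e * e - + 1)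
            lem = solve-∀

    inv₂-unimodular : ∀ {A} → det A ≋ + 1 → det (inv₂ A) ≋ + 1
    inv₂-unimodular {A} h = ≋-trans (lin₀ (det-inv₂ A)) h

    unscale : ∀ {s} v → s ≋ + 1 → s ∙ v ≐ v
    unscale {s} v h = ≐-trans (∙-congˢ v h) (1∙ v)

    inv₂-cancelˡ : ∀ {A} v → det A ≋ + 1 → inv₂ A · (A · v) ≐ v
    inv₂-cancelˡ {A} v h = ≐-trans (inv₂·· A v) (unscale v h)

    inv₂-cancelʳ : ∀ {A} v → det A ≋ + 1 → A · (inv₂ A · v) ≐ v
    inv₂-cancelʳ {A} v h = ≐-trans (·inv₂· A v) (unscale v h)

    ≃-by : ∀ {A B} → (∀ v → A · v ≐ B · v) → A ≃ B
    ≃-by {A} {B} h = upto (+ 1) sign+ λ v → ≐-trans (h v) (≐-sym (1∙ (B · v)))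

    ^ᴹ-unimodular : ∀ {A} k → det A ≋ + 1 → det (A ^ᴹ k) ≋ + 1
    ^ᴹ-unimodular zero h = ≋-refl
    ^ᴹ-unimodular {A} (suc k) h = det-⊗-unimodular {A} {A ^ᴹ k} h (^ᴹ-unimodular {A} k h)

    ^ᴹ-cong : ∀ {A B} k → A ≃ B → A ^ᴹ k ≃ B ^ᴹ k
    ^ᴹ-cong zero h = ≃-refl
    ^ᴹ-cong (suc k) h = ⊗-cong h (^ᴹ-cong k h)

    ^ᴹ-eigen : ∀ {A v s} k → A · v ≐ s ∙ v → (A ^ᴹ k) · v ≐ (s ^ k) ∙ v
    ^ᴹ-eigen {A} {v} {s} zero h = ≐-trans (I₂· v) (≐-sym (1∙ v))
    ^ᴹ-eigen {A} {v} {s} (suc k) h = ≐-trans (·-⊗ A (A ^ᴹ k) v)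
      (≐-trans (·-cong A (^ᴹ-eigen {A} {v} {s} k h))
        (≐-trans (·-∙ A (s ^ k) v)
          (≐-trans (∙-cong (s ^ k) h)
            (≐-trans (∙-∙ (s ^ k) s v) (∙-congˢ v (lin₀ (ℤₚ.*-comm (s ^ k) s)))))))

  opaque
    unfolding _·_ _∙_ _⊕_ D scaleᴹ

    -- The transvection u ↦ u + q D(v,u) v, written as a matrix.
    shear : V2 → ℤ → M2
    shear ⟨ x , y ⟩ q = mat (+ 1 - q * (x * y)) (q * (x * x)) (- (q * (y * y))) (+ 1 + q * (x * y))

    shear-· : ∀ v q u → shear v q · u ≐ u ⊕ (q * D v u) ∙ v
    shear-· ⟨ x , y ⟩ q ⟨ z , w ⟩ = ≡⇒≐ (lem x y q z w) (lem′ x y q z w)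
      where lem : ∀ x y q z w → (+ 1 - q * (x * y)) * z + q * (x * x) * w ≡ z + q * (x * w - y * z) * x
            lem = solve-∀
            lem′ : ∀ x y q z w → - (q * (y * y)) * z + (+ 1 + q * (x * y)) * w ≡ w + q * (x * w - y * z) * y
            lem′ = solve-∀

    det-shear : ∀ v q → det (shear v q) ≋ + 1
    det-shear ⟨ x , y ⟩ q = lin₀ (lem x y q)
      where lem : ∀ x y q → (+ 1 - q * (x * y)) * (+ 1 + q * (x * y)) - q * (x * x) * (- (q * (y * y))) ≡ + 1
            lem = solve-∀

    shear-fix : ∀ v q → shear v q · v ≐ v
    shear-fix ⟨ x , y ⟩ q = ≡⇒≐ (lem x y q) (lem′ x y q)
      where lem : ∀ x y q → (+ 1 - q * (x * y)) * x + q * (x * x) * y ≡ x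
            lem = solve-∀
            lem′ : ∀ x y q → - (q * (y * y)) * x + (+ 1 + q * (x * y)) * y ≡ y
            lem′ = solve-∀

    shear-+ : ∀ v q r u → shear v q · (shear v r · u) ≐ shear v (q + r) · u
    shear-+ ⟨ x , y ⟩ q r ⟨ z , w ⟩ = ≡⇒≐ (lem x y q r z w) (lem′ x y q r z w)
      where lem : ∀ x y q r z w → (+ 1 - q * (x * y)) * ((+ 1 - r * (x * y)) * z + r * (x * x) * w) + q * (x * x) * (- (r * (y * y)) * z + (+ 1 + r * (x * y)) * w)
                  ≡ (+ 1 - (q + r) * (x * y)) * z + (q + r) * (x * x) * w
            lem = solve-∀
            lem′ : ∀ x y q r z w → - (q * (y * y)) * ((+ 1 - r * (x * y)) * z + r * (x * x) * w) + (+ 1 + q * (x * y)) * (- (r * (y * y)) * z + (+ 1 + r * (x * y)) * w)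
                  ≡ - ((q + r) * (y * y)) * z + (+ 1 + (q + r) * (x * y)) * w
            lem′ = solve-∀

    shear-cong : ∀ v {q r} → q ≋ r → shear v q ≃ shear v r
    shear-cong ⟨ x , y ⟩ {q} {r} h = ≐ᴹ⇒≃ (entries (lin₁ (- (x * y)) h (lem₁ x y q r)) (lin₁ (x * x) h (lem₂ x q r)) (lin₁ (- (y * y)) h (lem₃ y q r)) (lin₁ (x * y) h (lem₄ x y q r)))
      where lem₁ : ∀ x y q r → (+ 1 - q * (x * y)) - (+ 1 - r * (x * y)) ≡ (- (x * y)) * (q - r)
            lem₁ = solve-∀
            lem₂ : ∀ x q r → q * (x * x) - r * (x * x) ≡ x * x * (q - r)
            lem₂ = solve-∀
            lem₃ : ∀ y q r → - (q * (y * y)) - - (r * (y * y)) ≡ (- (y * y)) * (q - r)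
            lem₃ = solve-∀
            lem₄ : ∀ x y q r → (+ 1 + q * (x * y)) - (+ 1 + r * (x * y)) ≡ (x * y) * (q - r)
            lem₄ = solve-∀

    shear-0 : ∀ v {q} → q ≋ + 0 → shear v q ≃ I₂
    shear-0 ⟨ x , y ⟩ {q} h = ≐ᴹ⇒≃ (entries (lin₁ (- (x * y)) h (lem₁ x y q)) (lin₁ (x * x) h (lem₂ x q)) (lin₁ (- (y * y)) h (lem₃ y q)) (lin₁ (x * y) h (lem₄ x y q)))
      where lem₁ : ∀ x y q → (+ 1 - q * (x * y)) - + 1 ≡ (- (x * y)) * (q - + 0)
            lem₁ = solve-∀
            lem₂ : ∀ x q → q * (x * x) - + 0 ≡ x * x * (q - + 0)
            lem₂ = solve-∀
            lem₃ : ∀ y q → - (q * (y * y)) - + 0 ≡ (- (y * y)) * (q - + 0)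
            lem₃ = solve-∀
            lem₄ : ∀ x y q → (+ 1 + q * (x * y)) - + 1 ≡ (x * y) * (q - + 0)
            lem₄ = solve-∀

    D-shear : ∀ v q u → D u (shear v q · u) ≡ - (q * (D v u * D v u))
    D-shear ⟨ x , y ⟩ q ⟨ z , w ⟩ = lem x y q z w
      where lem : ∀ x y q z w → z * (- (q * (y * y)) * z + (+ 1 + q * (x * y)) * w) - w * ((+ 1 - q * (x * y)) * z + q * (x * x) * w)
                  ≡ - (q * ((x * w - y * z) * (x * w - y * z)))
            lem = solve-∀

    -- The factor `D v w`, congruent to 1, is kept so that the right side has the form produced by
    -- `shear-·`.
    along : ∀ {v w u} → D v w ≋ + 1 → D v u ≋ + 1 → u ≐ w ⊕ (D u w * D v w) ∙ v
    along {⟨ a , b ⟩} {⟨ c , d ⟩} {⟨ x , y ⟩} h k =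
        lin₂ ((x * d - y * c) * a + x) (≋-sym h) c k′ (lem a b c d x y) ,, lin₂ ((x * d - y * c) * b + y) (≋-sym h) d k′ (lem′ a b c d x y)
      where
      k′ : a * y - b * x ≋ + 1
      k′ = k
      lem : ∀ a b c d x y → x - (c + (x * d - y * c) * (a * d - b * c) * a)
            ≡ ((x * d - y * c) * a + x) * (+ 1 - (a * d - b * c)) + c * (a * y - b * x - + 1)
      lem = solve-∀
      lem′ : ∀ a b c d x y → y - (d + (x * d - y * c) * (a * d - b * c) * b)
            ≡ ((x * d - y * c) * b + y) * (+ 1 - (a * d - b * c)) + d * (a * y - b * x - + 1)
      lem′ = solve-∀

  abstract
    -- For a partner w of `v`, the image of w again has determinant one against `v`, so it differs
    -- from w by a multiple of `v`; a matrix is determined on the basis v, w.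
    fix⇒shear : ∀ {v A} → NonZeroVector v → det A ≋ + 1 → A · v ≐ v → ∃ λ q → A ≃ shear v q
    fix⇒shear {v} {A} v≉0 dA h =
      let w , e = partner v≉0 in D (A · w) w , result w e
      where
      result : ∀ w → D v w ≋ + 1 → A ≃ shear v (D (A · w) w)
      result w e = ≐ᴹ⇒≃ (matrix-ext {A} {shear v (D (A · w) w)} {v} {w} (≉0-resp (≋-sym e) 1≉0)
          (≐-trans h (≐-sym (shear-fix v (D (A · w) w))))
          (≐-trans (along {v} {w} {A · w} e DvAw) (≐-sym (shear-· v (D (A · w) w) w))))
        where
        DvAw : D v (A · w) ≋ + 1
        DvAw = ≋-trans {D v (A · w)} {D (A · v) (A · w)} {+ 1} (D-cong (≐-sym h) ≐-refl)
          (≋-trans {D (A · v) (A · w)} {det A * D v w} {+ 1} (lin₀ (D-· A v w)) (lin₂ {a = det A} {+ 1} {D v w} {+ 1} (D v w) dA (+ 1) e (lem (det A) (D v w))))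
          where lem : ∀ a d → a * d - + 1 ≡ d * (a - + 1) + + 1 * (d - + 1)
                lem = solve-∀

    shear-power : ∀ v q k → shear v q ^ᴹ k ≃ shear v (+ k * q)
    shear-power v q zero = ≃-sym (shear-0 v {+ 0 * q} (lin₀ refl))
    shear-power v q (suc k) = ≃-trans (⊗-cong (≃-refl {shear v q}) (shear-power v q k))
      (≃-trans (≃-by λ u → ≐-trans
          (·-⊗ (shear v q) (shear v (+ k * q)) u) (shear-+ v q (+ k * q) u))
        (shear-cong v {q + + k * q} {+ suc k * q} (lin₀ (sym (ℤₚ.suc-* (+ k) q)))))

  -- The subgroup H = ⟨a⟩:⟨b²⟩ when a is a transvection along v and v an eigenvector of b.
  record Borel (a b : M2) : Set where
    field
      v         : V2
      v-nonzero : NonZeroVector v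
      β         : ℤ
      β≉0       : β ≉ + 0
      a≃shear   : a ≃ shear v β
      t         : ℤ
      b-eigen   : b · v ≐ t ∙ v
      det-b     : det b ≋ + 1
      t²-order  : Order (t * t) half

  module BorelSubgroup {a b : M2} (B : Borel a b) where
    open Borel B

    H : M2 → Set
    H = InProd p a (b ⊗ b)

    abstract
      private
        tt : Sq (t * t)
        tt = square t t≉0 ≋-refl
          where
          t≉0 : t ≉ + 0
          t≉0 z = ·-nonzero (≉0-resp (≋-sym det-b) 1≉0) v-nonzero (≐-trans b-eigen (∙-zero {t} {v} z))

        bb-eigen : (b ⊗ b) · v ≐ (t * t) ∙ v
        bb-eigen = ≐-trans (·-⊗ b b v) (≐-trans (·-cong b b-eigen)
          (≐-trans (·-∙ b t v) (≐-trans (∙-cong t b-eigen) (∙-∙ t t v))))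

        Sq-power : ∀ k → Sq ((t * t) ^ k)
        Sq-power zero = Sq-one
        Sq-power (suc k) = Sq-* {t * t} {(t * t) ^ k} tt (Sq-power k)

        a-power : ∀ j → a ^ᴹ j ≃ shear v (+ j * β)
        a-power j = ≃-trans (^ᴹ-cong j a≃shear) (shear-power v β j)

      det-H : ∀ y → H y → det y ≋ + 1
      det-H y (j , k , h) = ≋-trans {det y} {det ((a ^ᴹ j) ⊗ ((b ⊗ b) ^ᴹ k))} {+ 1} (det-≃ (≈⇒≃ y ((a ^ᴹ j) ⊗ ((b ⊗ b) ^ᴹ k)) h))
        (det-⊗-unimodular {a ^ᴹ j} {(b ⊗ b) ^ᴹ k} (^ᴹ-unimodular {a} j det-a) (^ᴹ-unimodular {b ⊗ b} k (det-⊗-unimodular {b} {b} det-b det-b)))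
        where
        det-a : det a ≋ + 1
        det-a = ≋-trans {det a} {det (shear v β)} {+ 1} (det-≃ a≃shear) (det-shear v β)

      H⇒ : ∀ y → H y → y · v ~ v
      H⇒ y (j , k , h) = ~-trans
        (≃-~ (≃-trans (≈⇒≃ y ((a ^ᴹ j) ⊗ ((b ⊗ b) ^ᴹ k)) h) (⊗-cong (a-power j) (≃-refl {(b ⊗ b) ^ᴹ k}))) v)
        (~-trans (≐⇒~ act) (~-sym (Sq-∙ {(t * t) ^ k} {v} (Sq-power k))))
        where
        act : (shear v (+ j * β) ⊗ ((b ⊗ b) ^ᴹ k)) · v ≐ ((t * t) ^ k) ∙ v
        act = ≐-trans (·-⊗ (shear v (+ j * β)) ((b ⊗ b) ^ᴹ k) v)
          (≐-trans (·-cong (shear v (+ j * β)) (^ᴹ-eigen {b ⊗ b} {v} {t * t} k bb-eigen))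
            (≐-trans (·-∙ (shear v (+ j * β)) ((t * t) ^ k) v)
              (∙-cong ((t * t) ^ k) (shear-fix v (+ j * β)))))

      -- The factor s by which `y` scales `v` is a square, hence a power of t², so some power of b²
      -- scales `v` by s too. Dividing it off leaves a matrix fixing `v`, that is a transvection
      -- along `v`, and these are the powers of `a`.
      H⇐ : ∀ y → det y ≋ + 1 → y · v ~ v → H y
      H⇐ y dy h = from-scale (~-sym h)
        where
        from-scale : v ~ y · v → H y
        from-scale (scaled s Ss e) = let k , tk≋s = square-powers tt t²-order s Ss in from-power k tk≋s
          where
          from-power : ∀ k → (t * t) ^ k ≋ s → H y
          from-power k tk≋s = finish (fix⇒shear v-nonzero (det-⊗-unimodular {y} {inv₂ c} dy (inv₂-unimodular {c} dc)) fixes)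
            where
            c : M2
            c = (b ⊗ b) ^ᴹ k
            dc : det c ≋ + 1
            dc = ^ᴹ-unimodular {b ⊗ b} k (det-⊗-unimodular {b} {b} det-b det-b)
            cv : c · v ≐ s ∙ v
            cv = ≐-trans (^ᴹ-eigen {b ⊗ b} {v} {t * t} k bb-eigen) (∙-congˢ v tk≋s)
            fixes : (y ⊗ inv₂ c) · v ≐ v
            fixes = ∙-cancel s (Sq⇒≉0 Ss) (≐-trans (≐-sym (·-∙ (y ⊗ inv₂ c) s v))
              (≐-trans (·-cong (y ⊗ inv₂ c) (≐-sym cv))
                (≐-trans (·-⊗ y (inv₂ c) (c · v))
                  (≐-trans (·-cong y (inv₂-cancelˡ {c} v dc)) e))))
            finish : (∃ λ q → y ⊗ inv₂ c ≃ shear v q) → H y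
            finish (q , sh) =
              let i , βi≋1 = inverse β≉0
                  r = residue (q * i)
              in toℕ r , k , ≃⇒≈ (≃-trans back (⊗-cong (≃-trans sh (≃-trans (shear-cong v {q} {+ toℕ r * β} (lin₂ (- q) βi≋1 (- β) (residue-≋ (q * i)) (lem q β i (+ toℕ r)))) (≃-sym (a-power (toℕ r))))) (≃-refl {c})))
              where
              lem : ∀ q b i r → q - r * b ≡ (- q) * (b * i - + 1) + (- b) * (r - q * i)
              lem = solve-∀
              back : y ≃ (y ⊗ inv₂ c) ⊗ c
              back = ≃-by λ u → ≐-sym (≐-trans (·-⊗ (y ⊗ inv₂ c) c u)
                (≐-trans (·-⊗ y (inv₂ c) (c · u)) (·-cong y (inv₂-cancelˡ {c} u dc))))

    DoubleCoset : M2 → M2 → Set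
    DoubleCoset g x = Σ M2 λ h₁ → Σ M2 λ h₂ → H h₁ × H h₂ × x ≈[ p ] (h₁ ⊗ g ⊗ h₂)

    module _ {g : M2} (dg : det g ≋ + 1) (δ≉0 : D v (g · v) ≉ + 0) where
      δ : ℤ
      δ = D v (g · v)

      abstract
        -- Up to squares x v is h₁ g v and v is h₁ v, and h₁ preserves determinants; so D(v, xv)
        -- lies in the square class of δ.
        double-coset⇒ : ∀ x → DoubleCoset g x → Sq (δ * D v (x · v))
        double-coset⇒ x (h₁ , h₂ , H₁ , H₂ , e) = Sq-resp {D v (δ ∙ (x · v))} {δ * D v (x · v)} (lin₀ (D-scaleʳ δ v (x · v)))
          (Sq-D-resp (H⇒ h₁ H₁) (∙-~ δ (~-sym xv))
            (Sq-resp (≋-sym value) (square δ δ≉0 ≋-refl)))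
          where
          xv : x · v ~ h₁ · (g · v)
          xv = ~-trans (≃-~ (≈⇒≃ x (h₁ ⊗ g ⊗ h₂) e) v)
            (~-trans (≐⇒~ (·-⊗ (h₁ ⊗ g) h₂ v))
              (~-trans (·-~ (h₁ ⊗ g) (H⇒ h₂ H₂)) (≐⇒~ (·-⊗ h₁ g v))))
          value : D (h₁ · v) (δ ∙ (h₁ · (g · v))) ≋ δ * δ
          value = ≋-trans {D (h₁ · v) (δ ∙ (h₁ · (g · v)))} {δ * (det h₁ * δ)} {δ * δ}
            (lin₀ (trans (D-scaleʳ δ (h₁ · v) (h₁ · (g · v))) (cong (δ *_) (D-· h₁ v (g · v)))))
            (lin₁ {a = det h₁} {+ 1} (δ * δ) (det-H h₁ H₁) (lem δ (det h₁)))
            where lem : ∀ d a → d * (a * d) - d * d ≡ d * d * (a - + 1)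
                  lem = solve-∀

        -- With d = D(v, xv), the basis v, gv goes to v, (δ / d) xv by a matrix h₁ of determinant
        -- one, because both bases have determinant δ. Then h₂ = g⁻¹ h₁⁻¹ x scales `v` by d / δ, a
        -- square.
        double-coset⇐ : ∀ x → det x ≋ + 1 → Sq (δ * D v (x · v)) → DoubleCoset g x
        double-coset⇐ x dx S =
          let i , di≋1 = inverse d≉0
              h₁ , h₁v , h₁gv , e = transition v (g · v) v ((δ * i) ∙ (x · v)) δ≉0
          in build i di≋1 h₁ h₁v h₁gv e
          where
          d : ℤ
          d = D v (x · v)
          d≉0 : d ≉ + 0
          d≉0 z = Sq⇒≉0 S (lin₁ {a = d} {+ 0} δ z (lem δ d))
            where lem : ∀ s x → s * x - + 0 ≡ s * (x - + 0)
                  lem = solve-∀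
          build : ∀ i → d * i ≋ + 1 → ∀ h₁ → h₁ · v ≐ v → h₁ · (g · v) ≐ (δ * i) ∙ (x · v) → det h₁ * δ ≋ D v ((δ * i) ∙ (x · v)) → DoubleCoset g x
          build i di≋1 h₁ h₁v h₁gv e = h₁ , h₂ , H⇐ h₁ dh₁ (≐⇒~ h₁v) , H⇐ h₂ dh₂ h₂v , ≃⇒≈ x≃
            where
            dh₁ : det h₁ ≋ + 1
            dh₁ = *-cancelˡ δ δ≉0 (≋-trans {δ * det h₁} {D v ((δ * i) ∙ (x · v))} {δ * + 1} (≋-trans {δ * det h₁} {det h₁ * δ} {D v ((δ * i) ∙ (x · v))} (lin₀ (ℤₚ.*-comm δ (det h₁))) e)
              (≋-trans {D v ((δ * i) ∙ (x · v))} {δ * i * d} {δ * + 1} (lin₀ (D-scaleʳ (δ * i) v (x · v))) (lin₁ {a = d * i} {+ 1} δ di≋1 (lem δ i d))))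
              where lem : ∀ s i d → s * i * d - s * + 1 ≡ s * (d * i - + 1)
                    lem = solve-∀
            i≉0 : i ≉ + 0
            i≉0 z = 1≉0 (≋-trans {+ 1} {d * i} {+ 0} (≋-sym di≋1) (lin₁ {a = i} {+ 0} d z (lem d i)))
              where lem : ∀ s x → s * x - + 0 ≡ s * (x - + 0)
                    lem = solve-∀
            Sδi : Sq (δ * i)
            Sδi = Sq-resp {δ * d * (i * i)} {δ * i} (lin₁ {a = d * i} {+ 1} (δ * i) di≋1 (lem δ i d)) (Sq-* S (square i i≉0 ≋-refl))
              where lem : ∀ s i d → s * d * (i * i) - s * i ≡ s * i * (d * i - + 1)
                    lem = solve-∀
            h₂ : M2
            h₂ = inv₂ g ⊗ (inv₂ h₁ ⊗ x)
            dh₂ : det h₂ ≋ + 1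
            dh₂ = det-⊗-unimodular {inv₂ g} {inv₂ h₁ ⊗ x} (inv₂-unimodular {g} dg) (det-⊗-unimodular {inv₂ h₁} {x} (inv₂-unimodular {h₁} dh₁) dx)
            h₂· : ∀ u → h₂ · u ≐ inv₂ g · (inv₂ h₁ · (x · u))
            h₂· u = ≐-trans (·-⊗ (inv₂ g) (inv₂ h₁ ⊗ x) u) (·-cong (inv₂ g) (·-⊗ (inv₂ h₁) x u))
            h₂v : h₂ · v ~ v
            h₂v = ~-trans (≐⇒~ (h₂· v))
              (~-trans (·-~ (inv₂ g) (·-~ (inv₂ h₁) (scaled (δ * i) Sδi h₁gv)))
                (≐⇒~ (≐-trans (·-cong (inv₂ g) (inv₂-cancelˡ (g · v) dh₁)) (inv₂-cancelˡ v dg))))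
            x≃ : x ≃ h₁ ⊗ g ⊗ h₂
            x≃ = ≃-by λ u → ≐-sym (≐-trans (·-⊗ (h₁ ⊗ g) h₂ u)
              (≐-trans (·-⊗ h₁ g (h₂ · u))
                (≐-trans
                  (·-cong h₁ (≐-trans (·-cong g (h₂· u)) (inv₂-cancelʳ (inv₂ h₁ · (x · u)) dg)))
                  (inv₂-cancelʳ (x · u) dh₁))))

-- Every coset graph of the family is Γ(p).

module CosetModel (p : ℕ) (prime : Prime p) (p%4≡1 : p % 4 ≡ 1) where

  open import Defs hiding (sym; inv; pres) renaming (_^_ to _^ᴹ_)
  open FinLemmas
  open PrimeField p prime
  open PrimitiveRoot p prime using (Order; order; fermat; ^-*)
  open Squares p prime p%4≡1
  open Plane p prime p%4≡1
  open SquareClassModels p prime p%4≡1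
  open PSL p prime p%4≡1
  open PSLAction p prime p%4≡1 using (det-⊗-unimodular; ⊗-I)
  open Stabilisers p prime p%4≡1
  open import Data.Nat.Divisibility using (divides)
  open import Data.Nat.Coprimality as Coprimality using (prime⇒coprime; coprime-Bézout; coprime-divisor)
  open import Data.Nat.GCD using (module Bézout)
  open import Function.Bundles using (module Equivalence)

  abstract
    scalar-cancel : ∀ {v s t} → NonZeroVector v → s ∙ v ≐ t ∙ v → s ≋ t
    scalar-cancel {v} {s} {t} v≉0 h =
      let w , e = partner v≉0 in result w e
      where
      result : ∀ w → D v w ≋ + 1 → s ≋ t
      result w e = lin₂ (+ 1)
          (≋-trans (lin₀ (sym (D-scaleˡ s v w))) (≋-trans (D-cong h ≐-refl) (lin₀ (D-scaleˡ t v w))))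
          (t - s) e (lem s t (D v w))
        where lem : ∀ s t d → s - t ≡ + 1 * (s * d - t * d) + (t - s) * (d - + 1)
              lem = solve-∀

    sign-fix⇒shear : ∀ {v A η} → NonZeroVector v → det A ≋ + 1 → Sign η → A · v ≐ η ∙ v → ∃ λ q → A ≃ shear v q
    sign-fix⇒shear {v} {A} {η} v≉0 dA s h =
      let q , e = fix⇒shear v≉0 dηA fixes in q , ≃-trans A≃ e
      where
      dηA : det (scaleᴹ η A) ≋ + 1
      dηA = ≋-trans (lin₀ (det-scaleᴹ η A)) (lin₂ (det A) (squared-one s) (+ 1) dA (lem (η * η) (det A)))
        where lem : ∀ a d → a * d - + 1 ≡ d * (a - + 1) + + 1 * (d - + 1)
              lem = solve-∀
      fixes : scaleᴹ η A · v ≐ v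
      fixes = ≐-trans (scaleᴹ-· η A v) (≐-trans (∙-cong η h)
        (≐-trans (∙-∙ η η v) (unscale v (squared-one s))))
      A≃ : A ≃ scaleᴹ η A
      A≃ = upto η s λ u → ≐-sym (≐-trans (∙-cong η (scaleᴹ-· η A u))
        (≐-trans (∙-∙ η η (A · u)) (unscale (A · u) (squared-one s))))

    -- A shear along v has no other eigenline, so conjugating a matrix fixing ⟨v⟩ into it must preserve ⟨v⟩.
    conjugate-line : ∀ {a b z v β} → a ≃ shear v β → β ≉ + 0 → det b ≋ + 1 → a ≃ b ⊗ z ⊗ inv₂ b → z · v ~ v → D v (b · v) ≋ + 0
    conjugate-line {a} {b} {z} {v} {β} (upto σ isSign acts) β≉0 db a≃ zv =
        square-zero (zero-product σ (- (β * (d * d))) (≋-trans (≋-sym value) on-line))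
      where
      d : ℤ
      d = D v (b · v)
      value : D (b · v) (a · (b · v)) ≋ σ * - (β * (d * d))
      value = ≋-trans (D-cong ≐-refl (acts (b · v)))
        (lin₀ (trans (D-scaleʳ σ (b · v) (shear v β · (b · v))) (cong (σ *_) (D-shear v β (b · v)))))
      abv : a · (b · v) ~ b · v
      abv = ~-trans (≃-~ a≃ (b · v))
        (~-trans
          (≐⇒~ (≐-trans (·-⊗ (b ⊗ z) (inv₂ b) (b · v)) (·-cong (b ⊗ z) (inv₂-cancelˡ v db))))
          (~-trans (≐⇒~ (·-⊗ b z v)) (·-~ b zv)))
      on-line : D (b · v) (a · (b · v)) ≋ + 0
      on-line = D≋0-resp (~-refl) (~-sym abv) (lin₀ (D-self (b · v)))
      square-zero : σ ≋ + 0 ⊎ - (β * (d * d)) ≋ + 0 → d ≋ + 0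
      square-zero (inj₁ h) = contradiction h (Sq⇒≉0 (Sign-Sq isSign))
      square-zero (inj₂ h) = decidable-stable (d ≋? + 0) λ d≉0 → *-≉0 β≉0 (*-≉0 d≉0 d≉0)
        (lin₁ (- + 1) h (lem (β * (d * d))))
        where lem : ∀ x → x - + 0 ≡ (- + 1) * (- x - + 0)
              lem = solve-∀

    ≃I-eigen : ∀ {A} → A ≃ I₂ → ∀ v → ∃ λ ε → Sign ε × A · v ≐ ε ∙ v
    ≃I-eigen {A} (upto ε s h) v = ε , s , ≐-trans (h v) (∙-cong ε (I₂· v))

    I-⊗ : ∀ A → I₂ ⊗ A ≃ A
    I-⊗ A = ≃-by λ v → ≐-trans (·-⊗ I₂ A v) (I₂· (A · v))

    ⊗-assoc : ∀ A B C → (A ⊗ B) ⊗ C ≃ A ⊗ (B ⊗ C)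
    ⊗-assoc A B C = ≃-by λ v → ≐-trans (·-⊗ (A ⊗ B) C v)
      (≐-trans (·-⊗ A B (C · v))
        (≐-sym (≐-trans (·-⊗ A (B ⊗ C) v) (·-cong A (·-⊗ B C v)))))

    ^ᴹ-+ : ∀ A m n → A ^ᴹ (m ℕ.+ n) ≃ (A ^ᴹ m) ⊗ (A ^ᴹ n)
    ^ᴹ-+ A zero n = ≃-sym (I-⊗ (A ^ᴹ n))
    ^ᴹ-+ A (suc m) n = ≃-trans (⊗-cong (≃-refl {A}) (^ᴹ-+ A m n)) (≃-sym (⊗-assoc A (A ^ᴹ m) (A ^ᴹ n)))

    ^ᴹ-* : ∀ A m n → A ^ᴹ (n ℕ.* m) ≃ (A ^ᴹ m) ^ᴹ n
    ^ᴹ-* A m zero = ≃-refl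
    ^ᴹ-* A m (suc n) = ≃-trans (^ᴹ-+ A m (n ℕ.* m)) (⊗-cong (≃-refl {A ^ᴹ m}) (^ᴹ-* A m n))

    I^ᴹ : ∀ n → I₂ ^ᴹ n ≃ I₂
    I^ᴹ zero = ≃-refl
    I^ᴹ (suc n) = ≃-trans (I-⊗ (I₂ ^ᴹ n)) (I^ᴹ n)

    order-divides : ∀ {A n} → HasOrder p A n → ∀ N → A ^ᴹ N ≃ I₂ → n ∣ N
    order-divides {A} {suc n} (1≤n , e , least) N h = go (N % suc n) refl
      where
      k : ℕ
      k = N / suc n
      N≡ : N ≡ N % suc n ℕ.+ k ℕ.* suc n
      N≡ = m≡m%n+[m/n]*n N (suc n)
      go : ∀ r → N % suc n ≡ r → suc n ∣ N
      go zero r≡ = divides k (trans N≡ (cong (ℕ._+ k ℕ.* suc n) r≡))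
      go (suc r) r≡ = contradiction (≃⇒≈ small) (least (suc r) (ℕ.s≤s ℕ.z≤n) (subst (ℕ._< suc n) r≡ (m%n<n N (suc n))))
        where
        full : A ^ᴹ (k ℕ.* suc n) ≃ I₂
        full = ≃-trans (^ᴹ-* A (suc n) k) (≃-trans (^ᴹ-cong k (≈⇒≃ (A ^ᴹ suc n) I₂ e)) (I^ᴹ k))
        small : A ^ᴹ suc r ≃ I₂
        small = ≃-trans (≃-sym (⊗-I (A ^ᴹ suc r))) (≃-trans (⊗-cong (≃-refl {A ^ᴹ suc r}) (≃-sym full))
          (≃-trans (≃-sym (^ᴹ-+ A (suc r) (k ℕ.* suc n))) (subst (λ m → A ^ᴹ m ≃ I₂) (trans N≡ (cong (ℕ._+ k ℕ.* suc n) r≡)) h)))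

  -- On the p + 1 points of the projective line an element of order p has a fixed point.
  module Eigenline (a : M2) (da : det a ≋ + 1) (aᵖ : a ^ᴹ p ≃ I₂) where
    private
      e : ℕ → V2
      e k = (a ^ᴹ k) · e₁

      L : ℕ → Set
      L k = D (e 0) (e k) ≋ + 0

      abstract
        D-a : ∀ u v → D (a · u) (a · v) ≋ D u v
        D-a u v = ≋-trans {D (a · u) (a · v)} {det a * D u v} {D u v} (lin₀ (D-· a u v)) (lin₁ {a = det a} {+ 1} (D u v) da (lem (det a) (D u v)))
          where lem : ∀ a d → a * d - d ≡ d * (a - + 1)
                lem = solve-∀

        e-nonzero : ∀ k → NonZeroVector (e k)
        e-nonzero k = ·-nonzero (≉0-resp (≋-sym (^ᴹ-unimodular {a} k da)) 1≉0) e₁-nonzero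

        D-e-suc : ∀ i j → D (e (suc i)) (e (suc j)) ≋ D (e i) (e j)
        D-e-suc i j = ≋-trans {D (e (suc i)) (e (suc j))} {D (a · e i) (a · e j)} {D (e i) (e j)} (D-cong (·-⊗ a (a ^ᴹ i) e₁) (·-⊗ a (a ^ᴹ j) e₁)) (D-a (e i) (e j))

        D-shift : ∀ m k → D (e m) (e (m ℕ.+ k)) ≋ D (e 0) (e k)
        D-shift zero k = ≋-refl
        D-shift (suc m) k = ≋-trans {D (e (suc m)) (e (suc (m ℕ.+ k)))} {D (e m) (e (m ℕ.+ k))} {D (e 0) (e k)} (D-e-suc m (m ℕ.+ k)) (D-shift m k)

        L-multiple : ∀ k m → L k → L (m ℕ.* k)
        L-multiple k zero h = lin₀ (D-self (e 0))
        L-multiple k (suc m) h = D≋0-trans (e-nonzero k) h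
          (≋-trans {D (e k) (e (k ℕ.+ m ℕ.* k))} {D (e 0) (e (m ℕ.* k))} {+ 0} (D-shift k (m ℕ.* k)) (L-multiple k m h))

        L-p : L p
        L-p = D≋0-resp (~-refl) (≃-~ (≃-sym aᵖ) e₁) (lin₀ (D-self (e 0)))

        L-consecutive : ∀ m → L m → L (1 ℕ.+ m) → L 1
        L-consecutive m h k = D≋0-trans (e-nonzero (1 ℕ.+ m)) k
          (D≋0-sym (≋-trans {D (e 1) (e (1 ℕ.+ m))} {D (e 0) (e m)} {+ 0} (D-shift 1 m) h))

        -- The exponents k for which the k-th power of `a` fixes the line of `e₁` are closed under
        -- multiples and include `p`. Bézout makes two multiples consecutive, so `a` itself fixes
        -- the line.
        L-coprime : ∀ k .{{_ : NonZero k}} → k ℕ.< p → L k → L 1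
        L-coprime k k<p h = go (coprime-Bézout (prime⇒coprime prime k<p))
          where
          go : Bézout.Identity 1 p k → L 1
          go (Bézout.+- x y eq) = L-consecutive (y ℕ.* k) (L-multiple k y h) (subst L (sym eq) (L-multiple p x L-p))
          go (Bézout.-+ x y eq) = L-consecutive (x ℕ.* p) (L-multiple p x L-p) (subst L (sym eq) (L-multiple k y h))

    abstract
      eigenline : ∃ λ v → NonZeroVector v × D v (a · v) ≋ + 0
      eigenline = decide (D (e 0) (e 1) ≋? + 0)
        where
        decide : Dec (L 1) → ∃ λ v → NonZeroVector v × D v (a · v) ≋ + 0
        decide (yes h) = e 0 , e-nonzero 0 , ≋-trans {D (e 0) (a · e 0)} {D (e 0) (e 1)} {+ 0} (D-cong ≐-refl (≐-sym (·-⊗ a I₂ e₁))) h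
        -- The lines of e 0 to e (p - 1) are then distinct and permuted cyclically by `a`, which
        -- must fix the single line left over.
        decide (no ¬L1) = from-missed (missed-point g g-inj)
          where
          g : Fin p → Fin (suc p)
          g j = slope (e (toℕ j))
          ordered : ∀ i j → i ℕ.≤ j → j ℕ.< p → D (e i) (e j) ≋ + 0 → i ≡ j
          ordered i j i≤j j<p h = go (j ℕ.∸ i) refl
            where
            go : ∀ k → j ℕ.∸ i ≡ k → i ≡ j
            go zero eq = ℕₚ.≤-antisym i≤j (ℕₚ.m∸n≡0⇒m≤n eq)
            go k@(suc _) eq = contradiction (L-coprime k (ℕₚ.≤-<-trans (subst (ℕ._≤ j) eq (ℕₚ.m∸n≤m j i)) j<p)
              (≋-trans {D (e 0) (e k)} {D (e i) (e (i ℕ.+ k))} {+ 0} (≋-sym (D-shift i k)) (subst (λ m → D (e i) (e m) ≋ + 0) (trans (sym (ℕₚ.m+[n∸m]≡n i≤j)) (cong (i ℕ.+_) eq)) h))) ¬L1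
          g-inj : ∀ {i j} → g i ≡ g j → i ≡ j
          g-inj {i} {j} q = compare (ℕₚ.≤-total (toℕ i) (toℕ j))
            where
            zero-D : D (e (toℕ i)) (e (toℕ j)) ≋ + 0
            zero-D = slope⇒ q
            compare : toℕ i ℕ.≤ toℕ j ⊎ toℕ j ℕ.≤ toℕ i → i ≡ j
            compare (inj₁ le) = toℕ-injective (ordered (toℕ i) (toℕ j) le (toℕ<n j) zero-D)
            compare (inj₂ le) = toℕ-injective (sym (ordered (toℕ j) (toℕ i) le (toℕ<n i) (D≋0-sym zero-D)))
          from-missed : (∃ λ x → (∀ j → g j ≢ x) × (∀ y → y ≢ x → ∃ λ j → g j ≡ y)) → ∃ λ v → NonZeroVector v × D v (a · v) ≋ + 0
          from-missed (x , miss , hit) = v , point-nonzero x , D≋0-sym (subst (λ y → D (a · v) (point y) ≋ + 0) fixed (slope-point (a · v)))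
            where
            v : V2
            v = point x
            no-predecessor : ∀ i → i ℕ.< p → ¬ (D (e (suc i)) (a · v) ≋ + 0)
            no-predecessor i i<p h = miss (fromℕ< i<p) (slope-unique (e-nonzero (toℕ (fromℕ< i<p)))
              (subst (λ m → D (e m) v ≋ + 0) (sym (toℕ-fromℕ< i<p))
                (≋-trans {D (e i) v} {D (e (suc i)) (a · v)} {+ 0} (≋-sym (≋-trans {D (e (suc i)) (a · v)} {D (a · e i) (a · v)} {D (e i) v} (D-cong (·-⊗ a (a ^ᴹ i) e₁) ≐-refl) (D-a (e i) v))) h)))
            fixed : slope (a · v) ≡ x
            fixed = decidable-stable (slope (a · v) ≟ x) λ ne → contra (hit (slope (a · v)) ne)
              where
              contra : ¬ (∃ λ j → g j ≡ slope (a · v))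
              contra (j , q) = back (toℕ j) (toℕ<n j) (slope⇒ q)
                where
                back : ∀ k → k ℕ.< p → ¬ (D (e k) (a · v) ≋ + 0)
                back (suc i) i<p h = no-predecessor i (ℕₚ.<-trans ℕₚ.≤-refl i<p) h
                back zero _ h = no-predecessor (p ℕ.∸ 1) (subst (p ℕ.∸ 1 ℕ.<_) suc-p∸1 ℕₚ.≤-refl)
                  (subst (λ m → D (e m) (a · v) ≋ + 0) (sym suc-p∸1) (D≋0-trans (e-nonzero 0) (D≋0-sym L-p) h))

  module _ {a b : M2} (da : det a ≋ + 1) (db : det b ≋ + 1) (oa : HasOrder p a p) (ob : HasOrder p b half) (N : NormaliserIs p a a b) where
    private
      aᵖ : a ^ᴹ p ≃ I₂
      aᵖ = ≈⇒≃ (a ^ᴹ p) I₂ (proj₁ (proj₂ oa))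

      abstract
        v : V2
        v = proj₁ (Eigenline.eigenline a da aᵖ)

        v-nonzero : NonZeroVector v
        v-nonzero = proj₁ (proj₂ (Eigenline.eigenline a da aᵖ))

        a-line : D v (a · v) ≋ + 0
        a-line = proj₂ (proj₂ (Eigenline.eigenline a da aᵖ))

        -- The eigenvalue s of `a` on its fixed line satisfies s^p = s by Fermat and s^p = ±1
        -- because a^p = ±I. Hence s = ±1, and up to sign `a` fixes a vector.
        a-shear : ∃ λ β → a ≃ shear v β
        a-shear =
          let s , h = proportional v-nonzero a-line
              ε , sg , k = ≃I-eigen aᵖ v
          in result s h ε sg k
          where
          result : ∀ s → a · v ≐ s ∙ v → ∀ ε → Sign ε → (a ^ᴹ p) · v ≐ ε ∙ v → ∃ λ β → a ≃ shear v β
          result s h ε sg k = sign-fix⇒shear v-nonzero da sg (≐-trans h (∙-congˢ v s≋ε))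
            where
            s≉0 : s ≉ + 0
            s≉0 = proportional≉0 {v} {a · v} {s} (·-nonzero (≉0-resp (≋-sym da) 1≉0) v-nonzero) h
            sᵖ≋ε : s ^ p ≋ ε
            sᵖ≋ε = scalar-cancel v-nonzero (≐-trans (≐-sym (^ᴹ-eigen {a} {v} {s} p h)) k)
            sᵖ≋s : s ^ p ≋ s
            sᵖ≋s = subst (λ m → s ^ m ≋ s) suc-p∸1 (lin₁ {a = s ^ (p ℕ.∸ 1)} {+ 1} s (fermat s s≉0) (lem s (s ^ (p ℕ.∸ 1))))
              where lem : ∀ s x → s * x - s ≡ s * (x - + 1)
                    lem = solve-∀
            s≋ε : s ≋ ε
            s≋ε = ≋-trans {s} {s ^ p} {ε} (≋-sym sᵖ≋s) sᵖ≋ε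

        β : ℤ
        β = proj₁ a-shear

        a≃shear : a ≃ shear v β
        a≃shear = proj₂ a-shear

        β≉0 : β ≉ + 0
        β≉0 z = proj₂ (proj₂ oa) 1 ℕₚ.≤-refl p>1 (≃⇒≈ (≃-trans (⊗-I a) (≃-trans a≃shear (shear-0 v z))))

        -- The exponents 0 and 1 put `b` into ⟨a⟩⟨b⟩, so `b` normalises ⟨a⟩ and `a` is a
        -- `b`-conjugate of some power of `a`, which fixes the class of `v`.
        b-line : D v (b · v) ≋ + 0
        b-line = use (proj₂ (Equivalence.from (N b (congruence db)) (0 , 1 , ≃⇒≈ {b} {I₂ ⊗ (b ⊗ I₂)} (≃-sym (≃-trans (I-⊗ (b ⊗ I₂)) (⊗-I b))))) a (congruence da) (1 , ≃⇒≈ {a} {a ⊗ I₂} (≃-sym (⊗-I a))))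
          where
          use : (Σ M2 λ z → InSL p z × InCyc p a z × (a ≈[ p ] (b ⊗ z ⊗ inv₂ b))) → D v (b · v) ≋ + 0
          use (z , _ , (j , z≈) , a≈) = conjugate-line {a} {b} {z} a≃shear β≉0 db (≈⇒≃ a (b ⊗ z ⊗ inv₂ b) a≈)
            (~-trans (≃-~ (≃-trans (≈⇒≃ z (a ^ᴹ j) z≈) (≃-trans (^ᴹ-cong j a≃shear) (shear-power v β j))) v) (≐⇒~ (shear-fix v (+ j * β))))

        b-eigen : ∃ λ t → b · v ≐ t ∙ v
        b-eigen = proportional v-nonzero b-line

        -- If t^(2k) = 1, then t^k = ±1 and b^k is a transvection up to sign, so b^(kp) is trivial.
        -- Hence `half` divides pk, and being coprime to `p`, it divides k.
        t²-order : Order (proj₁ b-eigen * proj₁ b-eigen) half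
        t²-order = order half≥1 power-one least
          where
          t : ℤ
          t = proj₁ b-eigen
          bv : b · v ≐ t ∙ v
          bv = proj₂ b-eigen
          power-one : (t * t) ^ half ≋ + 1
          power-one =
            let ε , s , h = ≃I-eigen (≈⇒≃ (b ^ᴹ half) I₂ (proj₁ (proj₂ ob))) v
                t^≋ε = scalar-cancel v-nonzero (≐-trans (≐-sym (^ᴹ-eigen {b} {v} {t} half bv)) h)
            in ≋-trans {(t * t) ^ half} {t ^ half * t ^ half} {+ 1} (lin₀ (^-* t t half)) (≋-trans {t ^ half * t ^ half} {ε * ε} {+ 1} (*-cong {t ^ half} {ε} {t ^ half} {ε} t^≋ε t^≋ε) (squared-one s))
          least : ∀ k → (t * t) ^ k ≋ + 1 → half ∣ k
          least k h = coprime-divisor (Coprimality.sym (prime⇒coprime prime {{ℕ.>-nonZero half≥1}} half<p)) (order-divides {b} {half} ob (p ℕ.* k) bᵏᵖ)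
            where
            sg : Sign (t ^ k)
            sg = root-of-one (≋-trans {t ^ k * t ^ k} {(t * t) ^ k} {+ 1} (lin₀ (sym (^-* t t k))) h)
            bᵏᵖ : b ^ᴹ (p ℕ.* k) ≃ I₂
            bᵏᵖ =
              let q , e = sign-fix⇒shear v-nonzero (^ᴹ-unimodular {b} k db) sg (^ᴹ-eigen {b} {v} {t} k bv)
              in ≃-trans (^ᴹ-* b k p) (≃-trans (^ᴹ-cong p e) (≃-trans (shear-power v q p) (shear-0 v (lin₁ {a = + p} {+ 0} q p≋0 (lem (+ p) q)))))
              where lem : ∀ p q → p * q - + 0 ≡ q * (p - + 0)
                    lem = solve-∀

    borel : Borel a b
    borel = record
      { v = v ; v-nonzero = v-nonzero ; β = β ; β≉0 = β≉0 ; a≃shear = a≃shear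
      ; t = proj₁ b-eigen ; b-eigen = proj₂ b-eigen ; det-b = db ; t²-order = t²-order }

  module _ {a b g : M2} (B : Borel a b) (dg : det g ≋ + 1) where
    open Borel B
    open BorelSubgroup B

    abstract
      -- Otherwise the group generated by H and g would fix the line of v.
      generates⇒moves : (∀ x → InSL p x → InGen p (λ s → H s ⊎ s ≈[ p ] g) x) → D v (g · v) ≉ + 0
      generates⇒moves gen δ≋0 =
        let w , e = partner v-nonzero
            -- The quarter turn v ↦ w, w ↦ -v has determinant one and moves the line of `v`, so it
            -- is not a product of matrices preserving that line.
            x , xv , xw , dx = transition v w w (- + 1 ∙ v) (≉0-resp (≋-sym e) 1≉0)
        in impossible w e x xv dx
        where
        preserves : M2 → Set
        preserves s = det s ≋ + 1 × D v (s · v) ≋ + 0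
        generator : ∀ {s} → H s ⊎ s ≈[ p ] g → preserves s
        generator {s} (inj₁ h) = det-H s h , D≋0-resp (~-refl) (~-sym (H⇒ s h)) (lin₀ (D-self v))
        generator {s} (inj₂ h) = ≋-trans {det s} {det g} {+ 1} (det-≃ (≈⇒≃ s g h)) dg ,
          D≋0-resp (~-refl) (≃-~ (≃-sym (≈⇒≃ s g h)) v) δ≋0
        product : ∀ {s w} → preserves s → preserves w → preserves (s ⊗ w)
        product {s} {w} (ds , hs) (dw , hw) = det-⊗-unimodular {s} {w} ds dw ,
          ≋-trans {D v ((s ⊗ w) · v)} {D v (s · (w · v))} {+ 0} (D-cong ≐-refl (·-⊗ s w v))
            (D≋0-trans (·-nonzero (≉0-resp (≋-sym ds) 1≉0) v-nonzero) hs
              (≋-trans {D (s · v) (s · (w · v))} {det s * D v (w · v)} {+ 0} (lin₀ (D-· s v (w · v))) (lin₁ {a = D v (w · v)} {+ 0} (det s) hw (lem (det s) (D v (w · v))))))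
          where lem : ∀ s x → s * x - + 0 ≡ s * (x - + 0)
                lem = solve-∀
        inverse-preserves : ∀ {s} → preserves s → preserves (inv₂ s)
        inverse-preserves {s} (ds , hs) = inv₂-unimodular {s} ds , D≋0-sym
          (≋-trans {D (inv₂ s · v) v} {D (inv₂ s · v) (inv₂ s · (s · v))} {+ 0} (D-cong ≐-refl (≐-sym (inv₂-cancelˡ {s} v ds)))
            (≋-trans {D (inv₂ s · v) (inv₂ s · (s · v))} {det (inv₂ s) * D v (s · v)} {+ 0} (lin₀ (D-· (inv₂ s) v (s · v))) (lin₁ {a = D v (s · v)} {+ 0} (det (inv₂ s)) hs (lem (det (inv₂ s)) (D v (s · v))))))
          where lem : ∀ s x → s * x - + 0 ≡ s * (x - + 0)
                lem = solve-∀
        word : ∀ {w} → Word p (λ s → H s ⊎ s ≈[ p ] g) w → preserves w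
        word empty = ≋-refl , D≋0-resp (~-refl) (≐⇒~ (≐-sym (I₂· v))) (lin₀ (D-self v))
        word (consS {s} {w} h W) = product {s} {w} (generator h) (word W)
        word (consI {s} {w} h W) = product {inv₂ s} {w} (inverse-preserves {s} (generator h)) (word W)
        impossible : ∀ w → D v w ≋ + 1 → ∀ x → x · v ≐ w → det x * D v w ≋ D w (- + 1 ∙ v) → ⊥
        impossible w e x xv dx = use (gen x (congruence det-x))
          where
          det-x : det x ≋ + 1
          det-x = lin₂ {a = det x * D v w} {D w (- + 1 ∙ v)} {D v w} {+ 1} (+ 1) dx (+ 1 - det x) e
              (trans (lem (det x) (D v w)) (cong (λ z → + 1 * (det x * D v w - z) + (+ 1 - det x) * (D v w - + 1)) (sym (trans (D-scaleʳ (- + 1) w v) (cong (- + 1 *_) (D-antisym v w))))))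
            where lem : ∀ x d → x - + 1 ≡ + 1 * (x * d - (- + 1 * - d)) + (+ 1 - x) * (d - + 1)
                  lem = solve-∀
          use : InGen p (λ s → H s ⊎ s ≈[ p ] g) x → ⊥
          use (y , W , x≈y) = 1≉0 (≋-trans {+ 1} {D v w} {+ 0} (≋-sym e) (D≋0-resp (~-refl)
            (~-trans (≃-~ (≃-sym (≈⇒≃ x y x≈y)) v) (≐⇒~ xv)) (proj₂ (word W))))

    -- The vertex Hx is modelled by x⁻¹v, the coordinates being changed so that the double coset becomes adjacency.
    module _ {Γ : Graph} (δ≉0 : D v (g · v) ≉ + 0) (ψ : Fin (n Γ) → M2) (dψ : ∀ u → InSL p (ψ u))
             (coset : ∀ x → InSL p x → ∃ λ u → H (x ⊗ inv₂ (ψ u)))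
             (coset-inj : ∀ u w → H (ψ u ⊗ inv₂ (ψ w)) → u ≡ w)
             (coset-adj : ∀ u w → Adj Γ u w ⇔ DoubleCoset g (ψ w ⊗ inv₂ (ψ u))) where
      private
        δ′ : ℤ
        δ′ = D v (g · v)

        -- A matrix of determinant `δ′`, which absorbs the factor δ of the double coset criterion
        -- into the determinant of the transformed vectors.
        C : M2
        C = mat δ′ (+ 0) (+ 0) (+ 1)

        det-C : det C ≋ δ′
        det-C = lin₀ (lem δ′)
          where lem : ∀ d → d * + 1 - + 0 * + 0 ≡ d
                lem = solve-∀

        detψ : ∀ u → det (ψ u) ≋ + 1
        detψ u = congruent (dψ u)

        U : Fin (n Γ) → V2
        U u = inv₂ (ψ u) · v

        det-quotient : ∀ x u → det x ≋ + 1 → det (x ⊗ inv₂ (ψ u)) ≋ + 1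
        det-quotient x u dx = det-⊗-unimodular {x} {inv₂ (ψ u)} dx (inv₂-unimodular {ψ u} (detψ u))

        abstract
          U-nonzero : ∀ u → NonZeroVector (U u)
          U-nonzero u = ·-nonzero (≉0-resp (≋-sym (inv₂-unimodular {ψ u} (detψ u))) 1≉0) v-nonzero

          U-injective : ∀ {u w} → U u ~ U w → u ≡ w
          U-injective {u} {w} h = coset-inj u w (H⇐ (ψ u ⊗ inv₂ (ψ w)) (det-quotient (ψ u) w (detψ u))
            (~-trans (≐⇒~ (·-⊗ (ψ u) (inv₂ (ψ w)) v))
              (~-trans (·-~ (ψ u) (~-sym h)) (≐⇒~ (inv₂-cancelʳ {ψ u} v (detψ u))))))

          U-onto : ∀ x → NonZeroVector x → ∃ λ u → U u ~ x
          U-onto x x≉0 =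
            let w , e = partner v-nonzero
                y , f = partner x≉0
                A , Av , _ , dA = transition v w x y (≉0-resp (≋-sym e) 1≉0)
            in find A Av (lin₃ {a = det A * D v w} {D x y} {D v w} {+ 1} {D x y} {+ 1} (+ 1) dA (- det A) e (+ 1) f (lem (det A) (D v w) (D x y)))
            where
            lem : ∀ a d d′ → a - + 1 ≡ + 1 * (a * d - d′) + (- a) * (d - + 1) + + 1 * (d′ - + 1)
            lem = solve-∀
            find : ∀ A → A · v ≐ x → det A ≋ + 1 → ∃ λ u → U u ~ x
            find A Av dA = let u , h = coset (inv₂ A) (congruence (inv₂-unimodular {A} dA)) in u , result u (H⇒ (inv₂ A ⊗ inv₂ (ψ u)) h)
              where
              result : ∀ u → (inv₂ A ⊗ inv₂ (ψ u)) · v ~ v → U u ~ x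
              result u h = ~-trans (≐⇒~ (≐-sym (inv₂-cancelʳ {A} (U u) dA)))
                (~-trans (·-~ A (~-trans (≐⇒~ (≐-sym (·-⊗ (inv₂ A) (inv₂ (ψ u)) v))) h)) (≐⇒~ Av))

          D-CU : ∀ u w → D (C · U u) (C · U w) ≋ δ′ * D v ((ψ u ⊗ inv₂ (ψ w)) · v)
          D-CU u w = ≋-trans {D (C · U u) (C · U w)} {det C * D (U u) (U w)} {δ′ * D v ((ψ u ⊗ inv₂ (ψ w)) · v)} (lin₀ (D-· C (U u) (U w)))
              (*-cong {det C} {δ′} {D (U u) (U w)} {D v ((ψ u ⊗ inv₂ (ψ w)) · v)} det-C
                (≋-trans {D (U u) (U w)} {D (ψ u · U u) (ψ u · U w)} {D v ((ψ u ⊗ inv₂ (ψ w)) · v)}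
                  (≋-sym (≋-trans {D (ψ u · U u) (ψ u · U w)} {det (ψ u) * D (U u) (U w)} {D (U u) (U w)} (lin₀ (D-· (ψ u) (U u) (U w)))
                    (lin₁ {a = det (ψ u)} {+ 1} (D (U u) (U w)) (detψ u) (lem (det (ψ u)) (D (U u) (U w))))))
                  (D-cong (inv₂-cancelʳ {ψ u} v (detψ u)) (≐-sym (·-⊗ (ψ u) (inv₂ (ψ w)) v)))))
            where lem : ∀ a d → a * d - d ≡ d * (a - + 1)
                  lem = solve-∀

          C-nonzero : det C ≉ + 0
          C-nonzero = ≉0-resp (≋-sym det-C) δ≉0

          C-injective : ∀ {x y} → C · x ~ C · y → x ~ y
          C-injective {x} {y} (scaled s S h) = scaled s S (∙-cancel (det C) C-nonzero
            (≐-trans (≐-sym (inv₂·· C y))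
              (≐-trans (·-cong (inv₂ C) h)
                (≐-trans (·-∙ (inv₂ C) s (C · x))
                  (≐-trans (∙-cong s (inv₂·· C x))
                    (≐-trans (∙-∙ s (det C) x)
                      (≐-trans (∙-congˢ x (lin₀ (ℤₚ.*-comm s (det C)))) (≐-sym (∙-∙ (det C) s x)))))))))

          C-onto : ∀ x → NonZeroVector x → ∃ λ u → C · U u ~ x
          C-onto x x≉0 =
            let i , di≋1 = inverse C-nonzero
            in go i di≋1
            where
            go : ∀ i → det C * i ≋ + 1 → ∃ λ u → C · U u ~ x
            go i di≋1 = let u , h = U-onto y y≉0 in u , ~-trans (·-~ C h) (≐⇒~ Cy)
              where
              y : V2
              y = inv₂ C · (i ∙ x)
              Cy : C · y ≐ x
              Cy = ≐-trans (·inv₂· C (i ∙ x)) (≐-trans (∙-∙ (det C) i x) (unscale x di≋1))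
              i≉0 : i ≉ + 0
              i≉0 z = 1≉0 (≋-trans {+ 1} {det C * i} {+ 0} (≋-sym di≋1) (lin₁ {a = i} {+ 0} (det C) z (lem (det C) i)))
                where lem : ∀ s x → s * x - + 0 ≡ s * (x - + 0)
                      lem = solve-∀
              y≉0 : NonZeroVector y
              y≉0 = ·-nonzero (≉0-resp {det C} {det (inv₂ C)} (lin₀ (sym (det-inv₂ C))) C-nonzero) (∙-nonzero i≉0 x≉0)

          adj⇒′ : ∀ {u w} → Adj Γ u w → Sq (D (C · U u) (C · U w))
          adj⇒′ {u} {w} h = Sq-D-sym (Sq-resp (≋-sym (D-CU w u)) (double-coset⇒ dg δ≉0 (ψ w ⊗ inv₂ (ψ u)) (Equivalence.to (coset-adj u w) h)))

          adj⇐′ : ∀ {u w} → Sq (D (C · U u) (C · U w)) → Adj Γ u w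
          adj⇐′ {u} {w} s = Equivalence.from (coset-adj u w) (double-coset⇐ dg δ≉0 (ψ w ⊗ inv₂ (ψ u)) (det-quotient (ψ w) u (detψ w))
            (Sq-resp (D-CU w u) (Sq-D-sym s)))

      coset-model : Model Γ
      coset-model = record
        { V = λ u → C · U u
        ; V-nonzero = λ u → ·-nonzero C-nonzero (U-nonzero u)
        ; V-injective = λ {u} {w} h → U-injective (C-injective h)
        ; vertex = λ x x≉0 → proj₁ (C-onto x x≉0)
        ; V-vertex = λ x x≉0 → proj₂ (C-onto x x≉0)
        ; adj⇒ = λ {u} {w} → adj⇒′ {u} {w}
        ; adj⇐ = λ {u} {w} → adj⇐′ {u} {w}
        }

  coset-graph⇒model : ∀ {Γ} → IsCosetGraphC p Γ → Model Γ
  coset-graph⇒model {Γ} (a , b , c , i , da , db , dc , oa , ob , N , _ , _ , _ , gen , _ , ψ , dψ , cov , inj , ad) =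
    coset-model B dg {Γ} (generates⇒moves B dg gen) ψ dψ cov inj ad
    where
    B : Borel a b
    B = borel {a} {b} (congruent da) (congruent db) oa ob N
    dg : det (c ⊗ ((b ⊗ b) ^ᴹ i)) ≋ + 1
    dg = det-⊗-unimodular {c} {(b ⊗ b) ^ᴹ i} (congruent dc) (^ᴹ-unimodular {b ⊗ b} i (det-⊗-unimodular {b} {b} (congruent db) (congruent db)))

-- For p > 5, Γ(p) is a coset graph of the family.

module ModelCoset (p : ℕ) (prime : Prime p) (p%4≡1 : p % 4 ≡ 1) where

  open import Defs hiding (sym; inv; pres) renaming (_^_ to _^ᴹ_)
  open PrimeField p prime
  open PrimitiveRoot p prime using (Order; ^-*; order-power; minimal)
  open Squares p prime p%4≡1
  open Plane p prime p%4≡1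
  open SquareClassModels p prime p%4≡1
  open PSL p prime p%4≡1
  open PSLAction p prime p%4≡1 using (≐ᴹ⇒≃; det-⊗-unimodular; ⊗-I; unipotent; diagonal; det-unipotent; det-diagonal)
  open Stabilisers p prime p%4≡1
  open CosetModel p prime p%4≡1
  open import Data.Nat.Divisibility using ()

  private
    t i : ℤ
    t = ν
    i = proj₁ (inverse ν≉0)

    abstract
      ti≋1 : t * i ≋ + 1
      ti≋1 = proj₂ (inverse ν≉0)

      i≉0 : i ≉ + 0
      i≉0 z = 1≉0 (≋-trans (≋-sym ti≋1) (lin₁ t z (lem t i)))
        where lem : ∀ s x → s * x - + 0 ≡ s * (x - + 0)
              lem = solve-∀

      power-inverse : ∀ k → t ^ k * i ^ k ≋ + 1
      power-inverse k = ≋-trans (lin₀ (sym (^-* t i k)))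
        (≋-trans (^-cong k ti≋1) (lin₀ (1^ k)))

  -- The standard choice: an upper unipotent matrix, the generator diag(ν, 1/ν) of the diagonal
  -- torus, and the Weyl element. The integer i of the family is taken to be 0, so `g` is
  -- essentially `c`.
  a b c g : M2
  a = unipotent (+ 1)
  b = diagonal t i
  c = mat (+ 0) (+ 1) (- + 1) (+ 0)
  g = c ⊗ ((b ⊗ b) ^ᴹ 0)

  opaque
    unfolding _·_ _∙_ D shear

    b-e₁ : b · e₁ ≐ t ∙ e₁
    b-e₁ = ≡⇒≐ (lem t) (lem′ i t)
      where lem : ∀ t → t * + 1 + + 0 * + 0 ≡ t * + 1
            lem = solve-∀
            lem′ : ∀ i t → + 0 * + 1 + i * + 0 ≡ t * + 0
            lem′ = solve-∀

    b-e₂ : b · e₂ ≐ i ∙ e₂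
    b-e₂ = ≡⇒≐ (lem i t) (lem′ i)
      where lem : ∀ i t → t * + 0 + + 0 * + 1 ≡ i * + 0
            lem = solve-∀
            lem′ : ∀ i → + 0 * + 0 + i * + 1 ≡ i * + 1
            lem′ = solve-∀

    c-e₁ : c · e₁ ≐ (- + 1) ∙ e₂
    c-e₁ = ≋-refl ,, ≋-refl

    c-e₂ : c · e₂ ≐ e₁
    c-e₂ = ≋-refl ,, ≋-refl

    a≃shear : a ≃ shear e₁ (+ 1)
    a≃shear = ≐ᴹ⇒≃ (entries ≋-refl ≋-refl ≋-refl ≋-refl)

    D-e₂ : ∀ v → D e₂ v ≡ - v₁ v
    D-e₂ ⟨ x , y ⟩ = lem x y
      where lem : ∀ x y → + 0 * y - + 1 * x ≡ - x
            lem = solve-∀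

    bb-expand : ∀ x → D x ((b ⊗ b) · x) ≡ v₁ x * v₂ x * (i * i - t * t)
    bb-expand ⟨ x , y ⟩ = lem x y t i
      where lem : ∀ x y t i → x * ((+ 0 * t + i * + 0) * x + (+ 0 * + 0 + i * i) * y) - y * ((t * t + + 0 * + 0) * x + (t * + 0 + + 0 * i) * y) ≡ x * y * (i * i - t * t)
            lem = solve-∀

    D-e₁e₁ : ∀ s r → D (s ∙ e₁) (r ∙ e₂) ≡ s * r
    D-e₁e₁ s r = lem s r
      where lem : ∀ s r → s * + 1 * (r * + 1) - s * + 0 * (r * + 0) ≡ s * r
            lem = solve-∀

    D-e₂e₁ : ∀ s r → D (s ∙ e₂) (r ∙ e₁) ≡ - (s * r)
    D-e₂e₁ s r = lem s r
      where lem : ∀ s r → s * + 0 * (r * + 0) - s * + 1 * (r * + 1) ≡ - (s * r)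
            lem = solve-∀

  abstract
    det-a : det a ≋ + 1
    det-a = det-unipotent (+ 1)

    det-b : det b ≋ + 1
    det-b = det-diagonal t i ti≋1

    det-c : det c ≋ + 1
    det-c = ≋-refl

    det-bb : det (b ⊗ b) ≋ + 1
    det-bb = det-⊗-unimodular {b} {b} det-b det-b

    det-g : det g ≋ + 1
    det-g = ≋-refl

    bb-e₁ : (b ⊗ b) · e₁ ≐ (t * t) ∙ e₁
    bb-e₁ = ≐-trans (·-⊗ b b e₁) (≐-trans (·-cong b b-e₁)
      (≐-trans (·-∙ b t e₁) (≐-trans (∙-cong t b-e₁) (∙-∙ t t e₁))))

    bb-e₂ : (b ⊗ b) · e₂ ≐ (i * i) ∙ e₂
    bb-e₂ = ≐-trans (·-⊗ b b e₂) (≐-trans (·-cong b b-e₂)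
      (≐-trans (·-∙ b i e₂) (≐-trans (∙-cong i b-e₂) (∙-∙ i i e₂))))

    t²-order : Order (t * t) half
    t²-order = subst (λ x → Order x half) (cong (t *_) (ℤₚ.*-identityʳ t)) (order-power 2 half (subst (Order t) (trans (sym half*2) (ℕₚ.*-comm half 2)) ν-order))

  standard-borel : Borel a b
  standard-borel = record
    { v = e₁ ; v-nonzero = e₁-nonzero ; β = + 1 ; β≉0 = 1≉0 ; a≃shear = a≃shear
    ; t = t ; b-eigen = b-e₁ ; det-b = det-b ; t²-order = t²-order }

  open BorelSubgroup standard-borel using (H; H⇒; H⇐; det-H; DoubleCoset; double-coset⇒; double-coset⇐)

  abstract
    shear-trivial : ∀ {q} → shear e₁ q ≃ I₂ → q ≋ + 0
    shear-trivial {q} h =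
      let ε , _ , k = ≃I-eigen h e₂
      in lin₁ {a = - (q * (+ 1 * + 1))} {+ 0} (- + 1)
           (≋-trans { - (q * (+ 1 * + 1))} {D e₂ (shear e₁ q · e₂)} {+ 0} (lin₀ (sym (trans (D-shear e₁ q e₂) (cong (λ d → - (q * (d * d))) D-e₁e₂)))) (D-proportional k))
           (lem q)
      where lem : ∀ q → q - + 0 ≡ (- + 1) * (- (q * (+ 1 * + 1)) - + 0)
            lem = solve-∀

    a-power : ∀ k → a ^ᴹ k ≃ shear e₁ (+ k * + 1)
    a-power k = ≃-trans (^ᴹ-cong k a≃shear) (shear-power e₁ (+ 1) k)

    order-a : HasOrder p a p
    order-a = ℕₚ.<⇒≤ p>1 , ≃⇒≈ (≃-trans (a-power p) (shear-0 e₁ (≋-trans {+ p * + 1} {+ p} {+ 0} (lin₀ (ℤₚ.*-identityʳ (+ p))) p≋0))) ,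
      λ j 1≤j j<p h → small≉0 1≤j j<p (≋-trans {+ j} {+ j * + 1} {+ 0} (lin₀ (sym (ℤₚ.*-identityʳ (+ j)))) (shear-trivial (≃-trans (≃-sym (a-power j)) (≈⇒≃ (a ^ᴹ j) I₂ h))))

    b-power : ∀ {ε} k → Sign ε → t ^ k ≋ ε → (b ^ᴹ k) ≈[ p ] I₂
    b-power {ε} k s h = ≃⇒≈-bases {b ^ᴹ k} {I₂} {ε} s
      (≐-trans (^ᴹ-eigen {b} {e₁} {t} k b-e₁) (≐-trans (∙-congˢ e₁ h) (∙-cong ε (≐-sym (I₂· e₁)))))
      (≐-trans (^ᴹ-eigen {b} {e₂} {i} k b-e₂) (≐-trans (∙-congˢ e₂ ik≋ε) (∙-cong ε (≐-sym (I₂· e₂)))))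
      where
      ik≋ε : i ^ k ≋ ε
      ik≋ε = lin₃ {a = t ^ k * i ^ k} {+ 1} {t ^ k} {ε} {ε * ε} {+ 1} ε (power-inverse k) (- (ε * i ^ k)) h (- (i ^ k)) (squared-one s) (lem ε (i ^ k) (t ^ k))
        where lem : ∀ e i t → i - e ≡ e * (t * i - + 1) + (- (e * i)) * (t - e) + (- i) * (e * e - + 1)
              lem = solve-∀

    -- Since ν is a nonsquare, ν^half = -1, so b^half = -I is trivial modulo the centre. An earlier
    -- trivial power would contradict the order of ν².
    order-b : HasOrder p b half
    order-b = half≥1 , b-power { - + 1} half sign- (nonsquare-power ν≉0 ν-nonsquare) , λ j 1≤j j<half h → least j 1≤j j<half (≈⇒≃ (b ^ᴹ j) I₂ h)
      where
      least : ∀ j → 1 ℕ.≤ j → j ℕ.< half → ¬ (b ^ᴹ j ≃ I₂)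
      least j 1≤j j<half h =
        let ε , s , k = ≃I-eigen h e₁
            tʲ≋ε = scalar-cancel e₁-nonzero (≐-trans (≐-sym (^ᴹ-eigen {b} {e₁} {t} j b-e₁)) k)
            t²ʲ≋1 = ≋-trans {(t * t) ^ j} {t ^ j * t ^ j} {+ 1} (lin₀ (^-* t t j)) (≋-trans {t ^ j * t ^ j} {ε * ε} {+ 1} (*-cong {t ^ j} {ε} {t ^ j} {ε} tʲ≋ε tʲ≋ε) (squared-one s))
        in contradiction (ℕ∣.∣⇒≤ {{ℕ.>-nonZero 1≤j}} (minimal t²-order j t²ʲ≋1)) (ℕₚ.<⇒≱ j<half)

    order-c : HasOrder p c 2
    order-c = ℕ.s≤s ℕ.z≤n , inj₂ (congruence (≋-refl { - + 1}) , congruence (≋-refl {+ 0}) , congruence (≋-refl {+ 0}) , congruence (≋-refl { - + 1})) , least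
      where
      least : ∀ j → 1 ℕ.≤ j → j ℕ.< 2 → ¬ ((c ^ᴹ j) ≈[ p ] I₂)
      least 1 _ _ h =
        let ε , _ , k = ≃I-eigen {c} (≃-trans (≃-sym (⊗-I c)) (≈⇒≃ (c ^ᴹ 1) I₂ h)) e₁
        in 1≉0 (≋-trans {+ 1} {D (- + 1 ∙ e₂) (+ 1 ∙ e₁)} {+ 0} (lin₀ (sym (D-e₂e₁ (- + 1) (+ 1))))
             (≋-trans {D (- + 1 ∙ e₂) (+ 1 ∙ e₁)} {D (c · e₁) e₁} {+ 0} (D-cong (≐-sym c-e₁) (1∙ e₁)) (D≋0-sym (D-proportional k))))
      least (suc (suc _)) _ (ℕ.s≤s (ℕ.s≤s ())) h

    conjugate-eigen : ∀ {w y x s} → det w ≋ + 1 → y · x ≐ s ∙ x → (w ⊗ y ⊗ inv₂ w) · (w · x) ≐ s ∙ (w · x)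
    conjugate-eigen {w} {y} {x} {s} dw h = ≐-trans (·-⊗ (w ⊗ y) (inv₂ w) (w · x))
      (≐-trans (·-cong (w ⊗ y) (inv₂-cancelˡ {w} x dw))
        (≐-trans (·-⊗ w y x) (≐-trans (·-cong w h) (·-∙ w s x))))

    eigen-on-line : ∀ {y x x′ s} → NonZeroVector x → D x x′ ≋ + 0 → y · x ≐ s ∙ x → y · x′ ≐ s ∙ x′
    eigen-on-line {y} {x} {x′} {s} x≉0 h k =
      let q , e = proportional x≉0 h
      in ≐-trans (·-cong y e) (≐-trans (·-∙ y q x) (≐-trans (∙-cong q k)
           (≐-trans (∙-∙ q s x) (≐-trans (∙-congˢ x (lin₀ (ℤₚ.*-comm q s))) (≐-trans (≐-sym (∙-∙ s q x)) (∙-cong s (≐-sym e)))))))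

    det-conjugate : ∀ {w y} → det w ≋ + 1 → det y ≋ + 1 → det (w ⊗ y ⊗ inv₂ w) ≋ + 1
    det-conjugate {w} {y} dw dy = det-⊗-unimodular {w ⊗ y} {inv₂ w} (det-⊗-unimodular {w} {y} dw dy) (inv₂-unimodular {w} dw)

    unconjugate : ∀ {w y} → det w ≋ + 1 → y ≃ w ⊗ (inv₂ w ⊗ y ⊗ inv₂ (inv₂ w)) ⊗ inv₂ w
    unconjugate {w} {y} dw = ≃-by λ u → ≐-sym (≐-trans (·-⊗ (w ⊗ z) (inv₂ w) u)
        (≐-trans (·-⊗ w z (inv₂ w · u))
          (≐-trans (·-cong w (z· u)) (inv₂-cancelʳ {w} (y · u) dw))))
      where
      z : M2
      z = inv₂ w ⊗ y ⊗ inv₂ (inv₂ w)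
      z· : ∀ u → z · (inv₂ w · u) ≐ inv₂ w · (y · u)
      z· u = ≐-trans (·-⊗ (inv₂ w ⊗ y) (inv₂ (inv₂ w)) (inv₂ w · u))
        (≐-trans (·-cong (inv₂ w ⊗ y) (inv₂-cancelˡ {inv₂ w} u (inv₂-unimodular {w} dw))) (·-⊗ (inv₂ w) y u))

    inverse-line : ∀ {w x x′} → det w ≋ + 1 → D x (w · x′) ≋ + 0 → D x′ (inv₂ w · x) ≋ + 0
    inverse-line {w} {x} {x′} dw h = ≋-trans {D x′ (inv₂ w · x)} {D (inv₂ w · (w · x′)) (inv₂ w · x)} {+ 0} (D-cong (≐-sym (inv₂-cancelˡ {w} x′ dw)) ≐-refl)
      (≋-trans {D (inv₂ w · (w · x′)) (inv₂ w · x)} {det (inv₂ w) * D (w · x′) x} {+ 0} (lin₀ (D-· (inv₂ w) (w · x′) x))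
        (lin₁ {a = D (w · x′) x} {+ 0} (det (inv₂ w)) (D≋0-sym h) (lem (det (inv₂ w)) (D (w · x′) x))))
      where lem : ∀ s x → s * x - + 0 ≡ s * (x - + 0)
            lem = solve-∀

    -- The normaliser of ⟨a⟩ is the stabiliser of the line of e₁.
    cyc-a⇒ : ∀ y → InCyc p a y → ∃ λ ε → Sign ε × y · e₁ ≐ ε ∙ e₁
    cyc-a⇒ y (k , h) = sg (≃-trans (≈⇒≃ y (a ^ᴹ k) h) (a-power k))
      where
      sg : y ≃ shear e₁ (+ k * + 1) → ∃ λ ε → Sign ε × y · e₁ ≐ ε ∙ e₁
      sg (upto ε s f) = ε , s , ≐-trans (f e₁) (∙-cong ε (shear-fix e₁ (+ k * + 1)))

    cyc-a⇐ : ∀ {y ε} → det y ≋ + 1 → Sign ε → y · e₁ ≐ ε ∙ e₁ → InCyc p a y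
    cyc-a⇐ {y} {ε} dy s h =
      let q , e = sign-fix⇒shear e₁-nonzero dy s h
      in toℕ (residue q) , ≃⇒≈ (≃-trans e (≃-trans (shear-cong e₁ {q} {+ toℕ (residue q) * + 1}
           (≋-trans {q} {+ toℕ (residue q)} {+ toℕ (residue q) * + 1} (≋-sym (residue-≋ q)) (lin₀ (sym (ℤₚ.*-identityʳ (+ toℕ (residue q))))))) (≃-sym (a-power (toℕ (residue q))))))

    cyc-a-conjugate : ∀ {w y} → det w ≋ + 1 → det y ≋ + 1 → D e₁ (w · e₁) ≋ + 0 → InCyc p a y → InCyc p a (w ⊗ y ⊗ inv₂ w)
    cyc-a-conjugate {w} {y} dw dy h k =
      let ε , s , e = cyc-a⇒ y k
      in cyc-a⇐ {w ⊗ y ⊗ inv₂ w} {ε} (det-conjugate {w} {y} dw dy) s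
           (eigen-on-line (·-nonzero (≉0-resp (≋-sym dw) 1≉0) e₁-nonzero) (D≋0-sym h) (conjugate-eigen dw e))

    prod-ab⇒ : ∀ w → InProd p a b w → D e₁ (w · e₁) ≋ + 0
    prod-ab⇒ w (j , k , h) = D≋0-resp (~-refl) (≃-~ (≃-sym (≈⇒≃ w ((a ^ᴹ j) ⊗ (b ^ᴹ k)) h)) e₁)
      (≋-trans {D e₁ (((a ^ᴹ j) ⊗ (b ^ᴹ k)) · e₁)} {D e₁ ((a ^ᴹ j) · ((b ^ᴹ k) · e₁))} {+ 0} (D-cong ≐-refl (·-⊗ (a ^ᴹ j) (b ^ᴹ k) e₁))
        (on-line (cyc-a⇒ (a ^ᴹ j) (j , ≃⇒≈ {a ^ᴹ j} {a ^ᴹ j} ≃-refl))))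
      where
      on-line : (∃ λ ε → Sign ε × (a ^ᴹ j) · e₁ ≐ ε ∙ e₁) → D e₁ ((a ^ᴹ j) · ((b ^ᴹ k) · e₁)) ≋ + 0
      on-line (ε , _ , f) = D-proportional
        (≐-trans (·-cong (a ^ᴹ j) (^ᴹ-eigen {b} {e₁} {t} k b-e₁))
          (≐-trans (·-∙ (a ^ᴹ j) (t ^ k) e₁) (≐-trans (∙-cong (t ^ k) f) (∙-∙ (t ^ k) ε e₁))))

    -- The eigenvalue of `w` at `e₁` is some ν^k; dividing by b^k leaves a unimodular matrix fixing
    -- `e₁`, a power of `a`.
    prod-ab⇐ : ∀ {w} → det w ≋ + 1 → D e₁ (w · e₁) ≋ + 0 → InProd p a b w
    prod-ab⇐ {w} dw h =
      let s , e = proportional e₁-nonzero h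
          k , tᵏ≋s = discrete-log s (proportional≉0 {e₁} {w · e₁} {s} (·-nonzero (≉0-resp (≋-sym dw) 1≉0) e₁-nonzero) e)
      in finish s e k tᵏ≋s
      where
      finish : ∀ s → w · e₁ ≐ s ∙ e₁ → ∀ k → t ^ k ≋ s → InProd p a b w
      finish s e k tᵏ≋s = use (cyc-a⇐ {w ⊗ inv₂ d} {+ 1} (det-⊗-unimodular {w} {inv₂ d} dw (inv₂-unimodular {d} dd)) sign+ (≐-trans fixes (≐-sym (1∙ e₁))))
        where
        d : M2
        d = b ^ᴹ k
        dd : det d ≋ + 1
        dd = ^ᴹ-unimodular {b} k det-b
        same-image : w · e₁ ≐ d · e₁
        same-image = ≐-trans e (≐-trans (∙-congˢ e₁ (≋-sym tᵏ≋s)) (≐-sym (^ᴹ-eigen {b} {e₁} {t} k b-e₁)))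
        s≉0 : t ^ k ≉ + 0
        s≉0 = ^-≉0 {t} k ν≉0
        fixes : (w ⊗ inv₂ d) · e₁ ≐ e₁
        fixes = ∙-cancel (t ^ k) s≉0 (≐-trans (≐-sym (·-∙ (w ⊗ inv₂ d) (t ^ k) e₁))
          (≐-trans (·-cong (w ⊗ inv₂ d) (≐-sym (^ᴹ-eigen {b} {e₁} {t} k b-e₁)))
            (≐-trans (·-⊗ w (inv₂ d) (d · e₁))
              (≐-trans (·-cong w (inv₂-cancelˡ {d} e₁ dd)) (≐-trans same-image (^ᴹ-eigen {b} {e₁} {t} k b-e₁))))))
        use : InCyc p a (w ⊗ inv₂ d) → InProd p a b w
        use (j , f) = j , k , ≃⇒≈ (≃-trans back (⊗-cong (≈⇒≃ (w ⊗ inv₂ d) (a ^ᴹ j) f) (≃-refl {d})))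
          where
          back : w ≃ (w ⊗ inv₂ d) ⊗ d
          back = ≃-by λ u → ≐-sym (≐-trans (·-⊗ (w ⊗ inv₂ d) d u)
            (≐-trans (·-⊗ w (inv₂ d) (d · u)) (·-cong w (inv₂-cancelˡ {d} u dd))))

    normaliser-a : NormaliserIs p a a b
    normaliser-a w dw = mk⇔ to from
      where
      dw′ : det w ≋ + 1
      dw′ = congruent dw
      to : Normalises p (InCyc p a) w → InProd p a b w
      to N = use (proj₂ N a (congruence det-a) (1 , ≃⇒≈ {a} {a ⊗ I₂} (≃-sym (⊗-I a))))
        where
        use : (Σ M2 λ z → InSL p z × InCyc p a z × (a ≈[ p ] (w ⊗ z ⊗ inv₂ w))) → InProd p a b w
        use (z , _ , k , e) =
          let ε , s , f = cyc-a⇒ z k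
          in prod-ab⇐ dw′ (conjugate-line {a} {w} {z} {e₁} a≃shear 1≉0 dw′ (≈⇒≃ a (w ⊗ z ⊗ inv₂ w) e) (~-sym (scaled ε (Sign-Sq s) f)))
      from : InProd p a b w → Normalises p (InCyc p a) w
      from P = (λ y dy k → cyc-a-conjugate {w} {y} dw′ (congruent dy) line k) ,
          λ y dy k → inv₂ w ⊗ y ⊗ inv₂ (inv₂ w) , congruence (det-conjugate {inv₂ w} {y} (inv₂-unimodular {w} dw′) (congruent dy)) ,
            cyc-a-conjugate {inv₂ w} {y} (inv₂-unimodular {w} dw′) (congruent dy) (inverse-line {w} {e₁} {e₁} dw′ line) k , ≃⇒≈ (unconjugate {w} {y} dw′)
        where
        line : D e₁ (w · e₁) ≋ + 0
        line = prod-ab⇒ w P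

    line-⊗ : ∀ {s w x x′ x″} → det s ≋ + 1 → NonZeroVector x′ → D x″ (s · x′) ≋ + 0 → D x′ (w · x) ≋ + 0 → D x″ ((s ⊗ w) · x) ≋ + 0
    line-⊗ {s} {w} {x} {x′} {x″} ds x′≉0 h k = ≋-trans {D x″ ((s ⊗ w) · x)} {D x″ (s · (w · x))} {+ 0} (D-cong ≐-refl (·-⊗ s w x))
      (D≋0-trans (·-nonzero (≉0-resp (≋-sym ds) 1≉0) x′≉0) h
        (≋-trans {D (s · x′) (s · (w · x))} {det s * D x′ (w · x)} {+ 0} (lin₀ (D-· s x′ (w · x))) (lin₁ {a = D x′ (w · x)} {+ 0} (det s) k (lem (det s) (D x′ (w · x))))))
      where lem : ∀ s x → s * x - + 0 ≡ s * (x - + 0)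
            lem = solve-∀

  -- Preservation or exchange of the two coordinate lines: the normaliser of the diagonal torus.
  Monomial : M2 → Set
  Monomial w = (D e₁ (w · e₁) ≋ + 0 × D e₂ (w · e₂) ≋ + 0) ⊎ (D e₂ (w · e₁) ≋ + 0 × D e₁ (w · e₂) ≋ + 0)

  -- The elements of ⟨b²⟩ by their shape ±diag(s, 1/s) with s a square, all of which occur because
  -- the powers of ν² exhaust the squares. In this shape conjugation by a monomial matrix at most
  -- exchanges `s` and `r`.
  record Torus (y : M2) : Set where
    constructor torus
    field
      ε s r  : ℤ
      isSign : Sign ε
      square-s : Sq s
      inverse-r : s * r ≋ + 1
      on-e₁  : y · e₁ ≐ (ε * s) ∙ e₁
      on-e₂  : y · e₂ ≐ (ε * r) ∙ e₂

  abstract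
    monomial-⊗ : ∀ {s w} → det s ≋ + 1 → Monomial s → Monomial w → Monomial (s ⊗ w)
    monomial-⊗ {s} {w} ds (inj₁ (h , k)) (inj₁ (h′ , k′)) = inj₁ (line-⊗ ds e₁-nonzero h h′ , line-⊗ ds e₂-nonzero k k′)
    monomial-⊗ {s} {w} ds (inj₁ (h , k)) (inj₂ (h′ , k′)) = inj₂ (line-⊗ ds e₂-nonzero k h′ , line-⊗ ds e₁-nonzero h k′)
    monomial-⊗ {s} {w} ds (inj₂ (h , k)) (inj₁ (h′ , k′)) = inj₂ (line-⊗ ds e₁-nonzero h h′ , line-⊗ ds e₂-nonzero k k′)
    monomial-⊗ {s} {w} ds (inj₂ (h , k)) (inj₂ (h′ , k′)) = inj₁ (line-⊗ ds e₂-nonzero k h′ , line-⊗ ds e₁-nonzero h k′)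

    monomial-I : Monomial I₂
    monomial-I = inj₁ (D-proportional (≐-trans (I₂· e₁) (≐-sym (1∙ e₁))) ,
                       D-proportional (≐-trans (I₂· e₂) (≐-sym (1∙ e₂))))

    monomial-^ : ∀ {w} k → det w ≋ + 1 → Monomial w → Monomial (w ^ᴹ k)
    monomial-^ zero dw m = monomial-I
    monomial-^ {w} (suc k) dw m = monomial-⊗ {w} {w ^ᴹ k} dw m (monomial-^ k dw m)

    monomial-≃ : ∀ {w w′} → w ≃ w′ → Monomial w → Monomial w′
    monomial-≃ {w} {w′} e = Sum.map (λ { (h , k) → move e₁ e₁ h , move e₂ e₂ k }) (λ { (h , k) → move e₂ e₁ h , move e₁ e₂ k })
      where
      move : ∀ x y → D x (w · y) ≋ + 0 → D x (w′ · y) ≋ + 0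
      move x y = D≋0-resp (~-refl) (≃-~ e y)

    monomial-inverse : ∀ {w} → det w ≋ + 1 → Monomial w → Monomial (inv₂ w)
    monomial-inverse {w} dw = Sum.map (λ { (h , k) → inverse-line {w} {e₁} {e₁} dw h , inverse-line {w} {e₂} {e₂} dw k })
                                      (λ { (h , k) → inverse-line {w} {e₁} {e₂} dw k , inverse-line {w} {e₂} {e₁} dw h })

    monomial-b : Monomial b
    monomial-b = inj₁ (D-proportional b-e₁ , D-proportional b-e₂)

    monomial-c : Monomial c
    monomial-c = inj₂ (D-proportional c-e₁ , D-proportional (≐-trans c-e₂ (≐-sym (1∙ e₁))))

    torus⇒ : ∀ y → InCyc p (b ⊗ b) y → Torus y
    torus⇒ y (k , h) = from (≈⇒≃ y ((b ⊗ b) ^ᴹ k) h)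
      where
      Sq-tt : Sq (t * t)
      Sq-tt = square t ν≉0 ≋-refl
      Sq-ttᵏ : ∀ k → Sq ((t * t) ^ k)
      Sq-ttᵏ zero = Sq-one
      Sq-ttᵏ (suc k) = Sq-* {t * t} {(t * t) ^ k} Sq-tt (Sq-ttᵏ k)
      from : y ≃ (b ⊗ b) ^ᴹ k → Torus y
      from (upto ε s f) = torus ε ((t * t) ^ k) ((i * i) ^ k) s (Sq-ttᵏ k) inverse-pair
          (≐-trans (f e₁) (≐-trans (∙-cong ε (^ᴹ-eigen {b ⊗ b} {e₁} {t * t} k bb-e₁)) (∙-∙ ε ((t * t) ^ k) e₁)))
          (≐-trans (f e₂) (≐-trans (∙-cong ε (^ᴹ-eigen {b ⊗ b} {e₂} {i * i} k bb-e₂)) (∙-∙ ε ((i * i) ^ k) e₂)))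
        where
        inverse-pair : (t * t) ^ k * (i * i) ^ k ≋ + 1
        inverse-pair = ≋-trans {(t * t) ^ k * (i * i) ^ k} {(t ^ k * i ^ k) * (t ^ k * i ^ k)} {+ 1}
          (lin₀ (trans (cong₂ _*_ (^-* t t k) (^-* i i k)) (lem (t ^ k) (i ^ k))))
          (*-cong {t ^ k * i ^ k} {+ 1} {t ^ k * i ^ k} {+ 1} (power-inverse k) (power-inverse k))
          where lem : ∀ t i → t * t * (i * i) ≡ t * i * (t * i)
                lem = solve-∀

    torus⇐ : ∀ {y} → Torus y → InCyc p (b ⊗ b) y
    torus⇐ {y} (torus ε s r sg Ss sr≋1 f₁ f₂) = let k , e = square-powers (square t ν≉0 ≋-refl) t²-order s Ss in k , result k e
      where
      result : ∀ k → (t * t) ^ k ≋ s → y ≈[ p ] ((b ⊗ b) ^ᴹ k)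
      result k e = ≃⇒≈-bases {y} {(b ⊗ b) ^ᴹ k} {ε} sg
          (≐-trans f₁ (≐-trans (≐-sym (∙-∙ ε s e₁))
            (∙-cong ε (≐-trans (∙-congˢ e₁ (≋-sym e)) (≐-sym (^ᴹ-eigen {b ⊗ b} {e₁} {t * t} k bb-e₁))))))
          (≐-trans f₂ (≐-trans (≐-sym (∙-∙ ε r e₂))
            (∙-cong ε (≐-trans (∙-congˢ e₂ r≋) (≐-sym (^ᴹ-eigen {b ⊗ b} {e₂} {i * i} k bb-e₂))))))
        where
        r≋ : r ≋ (i * i) ^ k
        r≋ = *-cancelˡ s (Sq⇒≉0 Ss) (≋-trans {s * r} {(t * t) ^ k * (i * i) ^ k} {s * (i * i) ^ k}
          (≋-trans {s * r} {+ 1} {(t * t) ^ k * (i * i) ^ k} sr≋1 (≋-sym (≋-trans {(t * t) ^ k * (i * i) ^ k} {(t ^ k * i ^ k) * (t ^ k * i ^ k)} {+ 1}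
            (lin₀ (trans (cong₂ _*_ (^-* t t k) (^-* i i k)) (lem (t ^ k) (i ^ k))))
            (*-cong {t ^ k * i ^ k} {+ 1} {t ^ k * i ^ k} {+ 1} (power-inverse k) (power-inverse k)))))
          (*-congʳ {(t * t) ^ k} {s} ((i * i) ^ k) e))
          where lem : ∀ t i → t * t * (i * i) ≡ t * i * (t * i)
                lem = solve-∀

    torus-conjugate : ∀ {w y} → det w ≋ + 1 → Monomial w → Torus y → Torus (w ⊗ y ⊗ inv₂ w)
    torus-conjugate {w} {y} dw m (torus ε s r sg Ss sr≋1 f₁ f₂) = go m
      where
      nonzero : ∀ x → NonZeroVector x → NonZeroVector (w · x)
      nonzero x = ·-nonzero (≉0-resp (≋-sym dw) 1≉0)
      carry : ∀ {x x′ q} → NonZeroVector x → D x′ (w · x) ≋ + 0 → y · x ≐ q ∙ x → (w ⊗ y ⊗ inv₂ w) · x′ ≐ q ∙ x′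
      carry {x} {x′} {q} x≉0 h f = eigen-on-line (nonzero x x≉0) (D≋0-sym h) (conjugate-eigen dw f)
      go : Monomial w → Torus (w ⊗ y ⊗ inv₂ w)
      go (inj₁ (h , k)) = torus ε s r sg Ss sr≋1 (carry {e₁} {e₁} e₁-nonzero h f₁) (carry {e₂} {e₂} e₂-nonzero k f₂)
      go (inj₂ (h , k)) = torus ε r s sg (Sq-cancel Ss (Sq-resp (≋-sym sr≋1) Sq-one)) (≋-trans {r * s} {s * r} {+ 1} (lin₀ (ℤₚ.*-comm r s)) sr≋1)
        (carry {e₂} {e₁} e₂-nonzero k f₂) (carry {e₁} {e₂} e₁-nonzero h f₁)

    prod-bc⇒ : ∀ w → InProd p b c w → Monomial w
    prod-bc⇒ w (j , k , h) = monomial-≃ {(b ^ᴹ j) ⊗ (c ^ᴹ k)} {w} (≃-sym (≈⇒≃ w ((b ^ᴹ j) ⊗ (c ^ᴹ k)) h))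
      (monomial-⊗ {b ^ᴹ j} {c ^ᴹ k} (^ᴹ-unimodular {b} j det-b) (monomial-^ {b} j det-b monomial-b) (monomial-^ {c} k det-c monomial-c))

    prod-bc⇐ : ∀ {w} → det w ≋ + 1 → Monomial w → InProd p b c w
    prod-bc⇐ {w} dw (inj₁ (h , k)) =
      let s , f = proportional e₁-nonzero h
          r , f′ = proportional e₂-nonzero k
          m , tᵐ≋s = discrete-log s (proportional≉0 {e₁} {w · e₁} {s} (·-nonzero (≉0-resp (≋-sym dw) 1≉0) e₁-nonzero) f)
      in m , 0 , result s r f f′ m tᵐ≋s
      where
      result : ∀ s r → w · e₁ ≐ s ∙ e₁ → w · e₂ ≐ r ∙ e₂ → ∀ m → t ^ m ≋ s → w ≈[ p ] ((b ^ᴹ m) ⊗ I₂)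
      result s r f f′ m tᵐ≋s = ≃⇒≈ {w} {(b ^ᴹ m) ⊗ I₂} (≃-trans (≈⇒≃ w (b ^ᴹ m) (≃⇒≈-bases {w} {b ^ᴹ m} {+ 1} sign+
          (≐-trans f (≐-trans (≐-trans (∙-congˢ e₁ (≋-sym tᵐ≋s)) (≐-sym (^ᴹ-eigen {b} {e₁} {t} m b-e₁))) (≐-sym (1∙ ((b ^ᴹ m) · e₁)))))
          (≐-trans f′ (≐-trans (≐-trans (∙-congˢ e₂ r≋) (≐-sym (^ᴹ-eigen {b} {e₂} {i} m b-e₂))) (≐-sym (1∙ ((b ^ᴹ m) · e₂)))))))
          (≃-sym (⊗-I (b ^ᴹ m))))
        where
        sr≋1 : s * r ≋ + 1
        sr≋1 = ≋-trans {s * r} {D (s ∙ e₁) (r ∙ e₂)} {+ 1} (lin₀ (sym (D-e₁e₁ s r))) (≋-trans {D (s ∙ e₁) (r ∙ e₂)} {D (w · e₁) (w · e₂)} {+ 1} (D-cong (≐-sym f) (≐-sym f′))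
          (≋-trans {D (w · e₁) (w · e₂)} {det w} {+ 1} (lin₀ (sym (det-D w))) dw))
        r≋ : r ≋ i ^ m
        r≋ = lin₃ {a = s * r} {+ 1} {t ^ m * i ^ m} {+ 1} {t ^ m} {s} (i ^ m) sr≋1 (- r) (power-inverse m) (r * i ^ m) tᵐ≋s (lem s r (t ^ m) (i ^ m))
          where lem : ∀ s r t i → r - i ≡ i * (s * r - + 1) + (- r) * (t * i - + 1) + (r * i) * (t - s)
                lem = solve-∀
    prod-bc⇐ {w} dw (inj₂ (h , k)) =
      let s , f = proportional e₂-nonzero h
          r , f′ = proportional e₁-nonzero k
          m , tᵐ≋r = discrete-log r (proportional≉0 {e₁} {w · e₂} {r} (·-nonzero (≉0-resp (≋-sym dw) 1≉0) e₂-nonzero) f′)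
      in m , 1 , result s r f f′ m tᵐ≋r
      where
      result : ∀ s r → w · e₁ ≐ s ∙ e₂ → w · e₂ ≐ r ∙ e₁ → ∀ m → t ^ m ≋ r → w ≈[ p ] ((b ^ᴹ m) ⊗ (c ⊗ I₂))
      result s r f f′ m tᵐ≋r = ≃⇒≈ {w} {(b ^ᴹ m) ⊗ (c ⊗ I₂)} (≃-trans (≈⇒≃ w ((b ^ᴹ m) ⊗ c) (≃⇒≈-bases {w} {(b ^ᴹ m) ⊗ c} {+ 1} sign+
          (≐-trans f (≐-trans (≐-sym image₁) (≐-sym (1∙ (((b ^ᴹ m) ⊗ c) · e₁)))))
          (≐-trans f′ (≐-trans (≐-sym image₂) (≐-sym (1∙ (((b ^ᴹ m) ⊗ c) · e₂)))))))
          (⊗-cong (≃-refl {b ^ᴹ m}) (≃-sym (⊗-I c))))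
        where
        sr≋-1 : - (s * r) ≋ + 1
        sr≋-1 = ≋-trans { - (s * r)} {D (s ∙ e₂) (r ∙ e₁)} {+ 1} (lin₀ (sym (D-e₂e₁ s r))) (≋-trans {D (s ∙ e₂) (r ∙ e₁)} {D (w · e₁) (w · e₂)} {+ 1} (D-cong (≐-sym f) (≐-sym f′))
          (≋-trans {D (w · e₁) (w · e₂)} {det w} {+ 1} (lin₀ (sym (det-D w))) dw))
        s≋ : - + 1 * i ^ m ≋ s
        s≋ = lin₃ {a = - (s * r)} {+ 1} {t ^ m * i ^ m} {+ 1} {t ^ m} {r} (i ^ m) sr≋-1 s (power-inverse m) (- (s * i ^ m)) tᵐ≋r (lem s r (t ^ m) (i ^ m))
          where lem : ∀ s r t i → - + 1 * i - s ≡ i * (- (s * r) - + 1) + s * (t * i - + 1) + (- (s * i)) * (t - r)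
                lem = solve-∀
        image₁ : ((b ^ᴹ m) ⊗ c) · e₁ ≐ s ∙ e₂
        image₁ = ≐-trans (·-⊗ (b ^ᴹ m) c e₁) (≐-trans (·-cong (b ^ᴹ m) c-e₁)
          (≐-trans (·-∙ (b ^ᴹ m) (- + 1) e₂) (≐-trans (∙-cong (- + 1) (^ᴹ-eigen {b} {e₂} {i} m b-e₂))
            (≐-trans (∙-∙ (- + 1) (i ^ m) e₂) (∙-congˢ e₂ s≋)))))
        image₂ : ((b ^ᴹ m) ⊗ c) · e₂ ≐ r ∙ e₁
        image₂ = ≐-trans (·-⊗ (b ^ᴹ m) c e₂) (≐-trans (·-cong (b ^ᴹ m) c-e₂)
          (≐-trans (^ᴹ-eigen {b} {e₁} {t} m b-e₁) (∙-congˢ e₁ tᵐ≋r)))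

    -- The eigenvalues ν² and ν⁻² of `b ⊗ b` are distinct because ν has order p - 1 > 4, which is
    -- where 5 < p enters. The coordinate lines are then its only eigenlines, and a normalising
    -- matrix must permute them.
    normaliser-b² : 5 ℕ.< p → NormaliserIs p (b ⊗ b) b c
    normaliser-b² 5<p w dw = mk⇔ to from
      where
      dw′ : det w ≋ + 1
      dw′ = congruent dw
      ii≉tt : i * i - t * t ≉ + 0
      ii≉tt h = contradiction (ℕ∣.∣⇒≤ (minimal ν-order 4 t⁴≋1)) (ℕₚ.<⇒≱ (ℕₚ.∸-monoˡ-< 5<p (ℕ.s≤s ℕ.z≤n)))
        where
        t⁴≋1 : t ^ 4 ≋ + 1
        t⁴≋1 = lin₂ {a = i * i - t * t} {+ 0} {t * i} {+ 1} (- (t * t)) h (t * i + + 1) ti≋1 (lem t i)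
          where lem : ∀ t i → t * (t * (t * (t * + 1))) - + 1 ≡ (- (t * t)) * (i * i - t * t - + 0) + (t * i + + 1) * (t * i - + 1)
                lem = solve-∀
      eigenlines : ∀ x → D x ((b ⊗ b) · x) ≋ + 0 → D e₂ x ≋ + 0 ⊎ D e₁ x ≋ + 0
      eigenlines x h = classify (zero-product (v₁ x * v₂ x) (i * i - t * t) (≋-trans {v₁ x * v₂ x * (i * i - t * t)} {D x ((b ⊗ b) · x)} {+ 0} (lin₀ (sym (bb-expand x))) h))
        where
        classify : v₁ x * v₂ x ≋ + 0 ⊎ i * i - t * t ≋ + 0 → D e₂ x ≋ + 0 ⊎ D e₁ x ≋ + 0
        classify (inj₂ z) = contradiction z ii≉tt
        classify (inj₁ z) = Sum.map (λ q → ≋-trans {D e₂ x} { - v₁ x} {+ 0} (lin₀ (D-e₂ x)) (neg-cong q)) (λ q → ≋-trans {D e₁ x} {v₂ x} {+ 0} (lin₀ (D-e₁ x)) q) (zero-product (v₁ x) (v₂ x) z)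
      independent : ∀ x → NonZeroVector x → D x (w · e₁) ≋ + 0 → D x (w · e₂) ≋ + 0 → ⊥
      independent x x≉0 h k = 1≉0 (≋-trans {+ 1} {det w} {+ 0} (≋-sym dw′) (≋-trans {det w} {D (w · e₁) (w · e₂)} {+ 0} (lin₀ (det-D w))
        (D≋0-trans x≉0 (D≋0-sym h) k)))
      to : Normalises p (InCyc p (b ⊗ b)) w → InProd p b c w
      to N = use (proj₂ N (b ⊗ b) (congruence det-bb) (1 , ≃⇒≈ {b ⊗ b} {(b ⊗ b) ⊗ I₂} (≃-sym (⊗-I (b ⊗ b)))))
        where
        use : (Σ M2 λ z → InSL p z × InCyc p (b ⊗ b) z × ((b ⊗ b) ≈[ p ] (w ⊗ z ⊗ inv₂ w))) → InProd p b c w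
        use (z , _ , k , e) = from-torus (torus⇒ z k)
          where
          on-axis : ∀ x q → z · x ≐ q ∙ x → D e₂ (w · x) ≋ + 0 ⊎ D e₁ (w · x) ≋ + 0
          on-axis x q f = eigenlines (w · x) (D≋0-resp (~-refl)
            (≃-~ (≃-sym (≈⇒≃ (b ⊗ b) (w ⊗ z ⊗ inv₂ w) e)) (w · x)) (D-proportional (conjugate-eigen dw′ f)))
          from-torus : Torus z → InProd p b c w
          from-torus (torus ε s r _ _ _ f₁ f₂) = prod-bc⇐ dw′ (combine (on-axis e₁ (ε * s) f₁) (on-axis e₂ (ε * r) f₂))
            where
            combine : D e₂ (w · e₁) ≋ + 0 ⊎ D e₁ (w · e₁) ≋ + 0 → D e₂ (w · e₂) ≋ + 0 ⊎ D e₁ (w · e₂) ≋ + 0 → Monomial w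
            combine (inj₁ h) (inj₁ k) = ⊥-elim (independent e₂ e₂-nonzero h k)
            combine (inj₁ h) (inj₂ k) = inj₂ (h , k)
            combine (inj₂ h) (inj₁ k) = inj₁ (h , k)
            combine (inj₂ h) (inj₂ k) = ⊥-elim (independent e₁ e₁-nonzero h k)
      from : InProd p b c w → Normalises p (InCyc p (b ⊗ b)) w
      from P = (λ y dy k → torus⇐ (torus-conjugate {w} {y} dw′ m (torus⇒ y k))) ,
          λ y dy k → inv₂ w ⊗ y ⊗ inv₂ (inv₂ w) , congruence (det-conjugate {inv₂ w} {y} (inv₂-unimodular {w} dw′) (congruent dy)) ,
            torus⇐ (torus-conjugate {inv₂ w} {y} (inv₂-unimodular {w} dw′) (monomial-inverse {w} dw′ m) (torus⇒ y k)) , ≃⇒≈ (unconjugate {w} {y} dw′)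
        where
        m : Monomial w
        m = prod-bc⇒ w P

    -- A matrix all of whose conjugates lie in H fixes every line.
    core-free : ∀ x → InSL p x → (∀ y → InSL p y → H (y ⊗ x ⊗ inv₂ y)) → x ≈[ p ] I₂
    core-free x dx h = ≃⇒≈ (same-lines {I₂} {x} ≋-refl (congruent dx) λ u u≉0 →
        ≋-trans {D (I₂ · u) (x · u)} {D u (x · u)} {+ 0} (D-cong (I₂· u) ≐-refl) (fixes u u≉0))
      where
      fixes : ∀ u → NonZeroVector u → D u (x · u) ≋ + 0
      fixes u u≉0 =
        let w , e = partner u≉0
            y , yu , _ , dy = transition u w e₁ e₂ (≉0-resp (≋-sym e) 1≉0)
        in go w e y yu dy
        where
        go : ∀ w → D u w ≋ + 1 → ∀ y → y · u ≐ e₁ → det y * D u w ≋ D e₁ e₂ → D u (x · u) ≋ + 0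
        go w e y yu dy = D≋0-resp (~-refl) (~-sym line) (lin₀ (D-self u))
          where
          det-y : det y ≋ + 1
          det-y = lin₂ {a = det y * D u w} {+ 1} {D u w} {+ 1} (+ 1) (≋-trans {det y * D u w} {D e₁ e₂} {+ 1} dy (lin₀ D-e₁e₂)) (- det y) e (lem (det y) (D u w))
            where lem : ∀ b d → b - + 1 ≡ + 1 * (b * d - + 1) + (- b) * (d - + 1)
                  lem = solve-∀
          yi : inv₂ y · e₁ ≐ u
          yi = ≐-trans (·-cong (inv₂ y) (≐-sym yu)) (inv₂-cancelˡ {y} u det-y)
          line : x · u ~ u
          line = ~-trans (≐⇒~ (≐-sym (inv₂-cancelˡ {y} (x · u) det-y)))
            (~-trans (·-~ (inv₂ y) (~-trans
              (≐⇒~ (≐-sym (≐-trans (·-⊗ (y ⊗ x) (inv₂ y) e₁) (≐-trans (·-cong (y ⊗ x) yi) (·-⊗ y x u)))))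
              (H⇒ (y ⊗ x ⊗ inv₂ y) (h y (congruence det-y))))) (≐⇒~ yi))

    δ≋-1 : D e₁ (g · e₁) ≋ - + 1
    δ≋-1 = ≋-trans {D e₁ (g · e₁)} {D e₁ (- + 1 ∙ e₂)} { - + 1} (D-cong ≐-refl (≐-trans (≐-trans (·-⊗ c I₂ e₁) (·-cong c (I₂· e₁))) c-e₁))
      (lin₀ (trans (D-scaleʳ (- + 1) e₁ e₂) (cong (- + 1 *_) D-e₁e₂)))

    δ≉0 : D e₁ (g · e₁) ≉ + 0
    δ≉0 = ≉0-resp (≋-sym δ≋-1) (Sq⇒≉0 Sq-minus-one)

    in-coset⇒ : ∀ x → DoubleCoset g x → Sq (D e₁ (x · e₁))
    in-coset⇒ x h = Sq-cancel (Sq-resp (≋-sym δ≋-1) Sq-minus-one) (double-coset⇒ {g} det-g δ≉0 x h)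

    in-coset⇐ : ∀ x → det x ≋ + 1 → Sq (D e₁ (x · e₁)) → DoubleCoset g x
    in-coset⇐ x dx h = double-coset⇐ {g} det-g δ≉0 x dx (Sq-* (Sq-resp (≋-sym δ≋-1) Sq-minus-one) h)

    δ⁻¹≋1 : D e₁ (inv₂ g · e₁) ≋ + 1
    δ⁻¹≋1 = ≋-trans {D e₁ (inv₂ g · e₁)} {D (inv₂ g · (g · e₁)) (inv₂ g · e₁)} {+ 1} (D-cong (≐-sym (inv₂-cancelˡ {g} e₁ det-g)) ≐-refl)
      (≋-trans {D (inv₂ g · (g · e₁)) (inv₂ g · e₁)} {det (inv₂ g) * - D e₁ (g · e₁)} {+ 1} (lin₀ (trans (D-· (inv₂ g) (g · e₁) e₁) (cong (det (inv₂ g) *_) (D-antisym e₁ (g · e₁)))))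
        (lin₂ {a = det (inv₂ g)} {+ 1} {D e₁ (g · e₁)} { - + 1} (- D e₁ (g · e₁)) (inv₂-unimodular {g} det-g) (- + 1) δ≋-1 (lem (det (inv₂ g)) (D e₁ (g · e₁)))))
      where lem : ∀ a d → a * (- d) - + 1 ≡ (- d) * (a - + 1) + (- + 1) * (d - (- + 1))
            lem = solve-∀

    -- The values of δ for `g` and for its inverse are -1 and 1, both squares, so both double cosets
    -- are described by squareness of D(e₁, x e₁).
    inverse-coset : ∀ x → InSL p x → DoubleCoset g x ⇔ DoubleCoset (inv₂ g) x
    inverse-coset x dx = mk⇔
        (λ h → double-coset⇐ {inv₂ g} (inv₂-unimodular {g} det-g) δ⁻¹≉0 x (congruent dx) (Sq-* (Sq-resp (≋-sym δ⁻¹≋1) Sq-one) (in-coset⇒ x h)))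
        (λ h → in-coset⇐ x (congruent dx) (Sq-cancel (Sq-resp (≋-sym δ⁻¹≋1) Sq-one) (double-coset⇒ {inv₂ g} (inv₂-unimodular {g} det-g) δ⁻¹≉0 x h)))
      where
      δ⁻¹≉0 : D e₁ (inv₂ g · e₁) ≉ + 0
      δ⁻¹≉0 = ≉0-resp (≋-sym δ⁻¹≋1) 1≉0

  Generator : M2 → Set
  Generator s = H s ⊎ s ≈[ p ] g

  abstract
    word-++ : ∀ {x y} → Word p Generator x → Word p Generator y → ∃ λ z → Word p Generator z × z ≃ x ⊗ y
    word-++ {y = y} empty W = y , W , ≃-sym (I-⊗ y)
    word-++ {y = y} (consS {s} {w} h V) W = let z , Z , e = word-++ V W in s ⊗ z , consS {s = s} h Z , ≃-trans (⊗-cong (≃-refl {s}) e) (≃-sym (⊗-assoc s w y))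
    word-++ {y = y} (consI {s} {w} h V) W = let z , Z , e = word-++ V W in inv₂ s ⊗ z , consI {s = s} h Z , ≃-trans (⊗-cong (≃-refl {inv₂ s}) e) (≃-sym (⊗-assoc (inv₂ s) w y))

    gen-⊗ : ∀ {x y z} → z ≃ x ⊗ y → InGen p Generator x → InGen p Generator y → InGen p Generator z
    gen-⊗ {x} {y} {z} e (u , U , x≈u) (v , V , y≈v) =
      let w , W , f = word-++ U V in w , W , ≃⇒≈ (≃-trans e (≃-trans (⊗-cong (≈⇒≃ x u x≈u) (≈⇒≃ y v y≈v)) (≃-sym f)))

    gen-coset : ∀ x → DoubleCoset g x → InGen p Generator x
    gen-coset x (h₁ , h₂ , H₁ , H₂ , e) = h₁ ⊗ (g ⊗ (h₂ ⊗ I₂)) , consS {s = h₁} (inj₁ H₁) (consS {s = g} (inj₂ (≃⇒≈ {g} {g} ≃-refl)) (consS {s = h₂} (inj₁ H₂) empty)) ,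
      ≃⇒≈ (≃-trans (≈⇒≃ x (h₁ ⊗ g ⊗ h₂) e) (≃-trans (⊗-assoc h₁ g h₂) (⊗-cong (≃-refl {h₁}) (⊗-cong (≃-refl {g}) (≃-sym (⊗-I h₂))))))

    -- Two double coset steps reach every x moving the line of e₁; the common neighbour is that of the distance-two case.
    gen-moving : ∀ x → det x ≋ + 1 → D e₁ (x · e₁) ≉ + 0 → InGen p Generator x
    gen-moving x dx d≉0 = decide (Sq? d)
      where
      d : ℤ
      d = D e₁ (x · e₁)
      y₁ : V2
      y₁ = d ∙ (e₁ ⊕ (x · e₁))
      Dy : D e₁ y₁ ≋ d * d
      Dy = lin₀ (trans (D-scaleʳ d e₁ (e₁ ⊕ (x · e₁))) (cong (d *_) (trans (D-⊕ʳ e₁ e₁ (x · e₁)) (trans (cong (_+ d) (D-self e₁)) (ℤₚ.+-identityˡ d)))))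
      Dyx : D (x · e₁) y₁ ≋ - (d * d)
      Dyx = lin₀ (trans (D-scaleʳ d (x · e₁) (e₁ ⊕ (x · e₁))) (trans (cong (d *_) (trans (D-⊕ʳ (x · e₁) e₁ (x · e₁)) (trans (cong₂ _+_ (D-antisym e₁ (x · e₁)) (D-self (x · e₁))) (ℤₚ.+-identityʳ (- d))))) (lem d)))
        where lem : ∀ d → d * - d ≡ - (d * d)
              lem = solve-∀
      dd : Sq (d * d)
      dd = square d d≉0 ≋-refl
      decide : Dec (Sq d) → InGen p Generator x
      decide (yes s) = gen-coset x (in-coset⇐ x dx s)
      decide (no _) =
        let w , e = partner (D-nonzeroʳ (≉0-resp (≋-sym Dy) (Sq⇒≉0 dd)))
            y , ye₁ , _ , dy = transition e₁ e₂ y₁ w (≉0-resp (≋-sym (lin₀ D-e₁e₂)) 1≉0)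
        in build y ye₁ (≋-trans {det y} {det y * D e₁ e₂} {+ 1} (lin₀ (trans (sym (ℤₚ.*-identityʳ (det y))) (cong (det y *_) (sym D-e₁e₂)))) (≋-trans {det y * D e₁ e₂} {D y₁ w} {+ 1} dy e))
        where
        build : ∀ y → y · e₁ ≐ y₁ → det y ≋ + 1 → InGen p Generator x
        build y ye₁ dy = gen-⊗ {y} {z} {x} x≃ (gen-coset y (in-coset⇐ y dy (Sq-resp (≋-sym (≋-trans {D e₁ (y · e₁)} {D e₁ y₁} {d * d} (D-cong ≐-refl ye₁) Dy)) dd)))
            (gen-coset z (in-coset⇐ z dz (Sq-resp (≋-sym Dz) dd)))
          where
          z : M2
          z = inv₂ y ⊗ x
          dz : det z ≋ + 1
          dz = det-⊗-unimodular {inv₂ y} {x} (inv₂-unimodular {y} dy) dx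
          x≃ : x ≃ y ⊗ z
          x≃ = ≃-by λ u → ≐-sym (≐-trans (·-⊗ y z u)
            (≐-trans (·-cong y (·-⊗ (inv₂ y) x u)) (inv₂-cancelʳ {y} (x · u) dy)))
          Dz : D e₁ (z · e₁) ≋ d * d
          Dz = ≋-trans {D e₁ (z · e₁)} {D (inv₂ y · (y · e₁)) (inv₂ y · (x · e₁))} {d * d} (D-cong (≐-sym (inv₂-cancelˡ {y} e₁ dy)) (·-⊗ (inv₂ y) x e₁))
            (≋-trans {D (inv₂ y · (y · e₁)) (inv₂ y · (x · e₁))} {det (inv₂ y) * D (y · e₁) (x · e₁)} {d * d} (lin₀ (D-· (inv₂ y) (y · e₁) (x · e₁)))
              (lin₂ {a = det (inv₂ y)} {+ 1} {D (y · e₁) (x · e₁)} {d * d} (D (y · e₁) (x · e₁)) (inv₂-unimodular {y} dy) (+ 1)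
                (≋-trans {D (y · e₁) (x · e₁)} {D y₁ (x · e₁)} {d * d} (D-cong ye₁ ≐-refl) (≋-trans {D y₁ (x · e₁)} { - D (x · e₁) y₁} {d * d} (lin₀ (D-antisym (x · e₁) y₁))
                  (≋-trans { - D (x · e₁) y₁} { - - (d * d)} {d * d} (neg-cong Dyx) (lin₀ (ℤₚ.neg-involutive (d * d))))))
                (lem (det (inv₂ y)) (D (y · e₁) (x · e₁)) (d * d))))
            where lem : ∀ a u s → a * u - s ≡ u * (a - + 1) + + 1 * (u - s)
                  lem = solve-∀

    -- A matrix that fixes the line of `e₁` becomes one that moves it after multiplication by `g`,
    -- which reduces to `gen-moving`.
    generates : ∀ x → InSL p x → InGen p Generator x
    generates x dx = decide (D e₁ (x · e₁) ≋? + 0)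
      where
      dx′ : det x ≋ + 1
      dx′ = congruent dx
      decide : Dec (D e₁ (x · e₁) ≋ + 0) → InGen p Generator x
      decide (no ne) = gen-moving x dx′ ne
      decide (yes h) = gen-⊗ {x ⊗ g} {inv₂ g ⊗ I₂} {x} x≃ (gen-moving (x ⊗ g) (det-⊗-unimodular {x} {g} dx′ det-g) moves)
          (inv₂ g ⊗ I₂ , consI {s = g} (inj₂ (≃⇒≈ {g} {g} ≃-refl)) empty , ≃⇒≈ {inv₂ g ⊗ I₂} {inv₂ g ⊗ I₂} ≃-refl)
        where
        moves : D e₁ ((x ⊗ g) · e₁) ≉ + 0
        moves z = δ≉0 (≋-trans {D e₁ (g · e₁)} {det x * D e₁ (g · e₁)} {+ 0} (lin₁ {a = det x} {+ 1} (- D e₁ (g · e₁)) dx′ (lem (det x) (D e₁ (g · e₁))))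
          (≋-trans {det x * D e₁ (g · e₁)} {D (x · e₁) (x · (g · e₁))} {+ 0} (lin₀ (sym (D-· x e₁ (g · e₁))))
            (D≋0-trans e₁-nonzero (D≋0-sym h) (≋-trans {D e₁ (x · (g · e₁))} {D e₁ ((x ⊗ g) · e₁)} {+ 0} (D-cong ≐-refl (≐-sym (·-⊗ x g e₁))) z))))
          where lem : ∀ a d → d - a * d ≡ (- d) * (a - + 1)
                lem = solve-∀
        x≃ : x ≃ (x ⊗ g) ⊗ (inv₂ g ⊗ I₂)
        x≃ = ≃-by λ u → ≐-sym (≐-trans (·-⊗ (x ⊗ g) (inv₂ g ⊗ I₂) u)
          (≐-trans (·-⊗ x g ((inv₂ g ⊗ I₂) · u)) (·-cong x
            (≐-trans (·-cong g (≐-trans (·-⊗ (inv₂ g) I₂ u) (·-cong (inv₂ g) (I₂· u)))) (inv₂-cancelʳ {g} u det-g)))))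

  module _ {Γ : Graph} (M : Model Γ) where
    open Model M

    private
      abstract
        frame : ∀ u → ∃ λ A → det A ≋ + 1 × A · e₁ ≐ V u
        frame u =
          let w , e = partner (V-nonzero u)
              A , Ae₁ , _ , dA = transition e₁ e₂ (V u) w (≉0-resp (≋-sym (lin₀ D-e₁e₂)) 1≉0)
          in A , ≋-trans {det A} {det A * D e₁ e₂} {+ 1} (lin₀ (trans (sym (ℤₚ.*-identityʳ (det A))) (cong (det A *_) (sym D-e₁e₂)))) (≋-trans {det A * D e₁ e₂} {D (V u) w} {+ 1} dA e) , Ae₁

      -- Since H is the stabiliser of the class of `e₁`, the coset of `ψ u` consists of the elements
      -- taking the class of `V u` to that of `e₁`.
      ψ : Fin (n Γ) → M2
      ψ u = inv₂ (proj₁ (frame u))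

      abstract
        detψ : ∀ u → det (ψ u) ≋ + 1
        detψ u = inv₂-unimodular {proj₁ (frame u)} (proj₁ (proj₂ (frame u)))

        ψ-V : ∀ u → ψ u · V u ≐ e₁
        ψ-V u = ≐-trans (·-cong (ψ u) (≐-sym (proj₂ (proj₂ (frame u))))) (inv₂-cancelˡ {proj₁ (frame u)} e₁ (proj₁ (proj₂ (frame u))))

        ψ⁻¹-e₁ : ∀ u → inv₂ (ψ u) · e₁ ≐ V u
        ψ⁻¹-e₁ u = ≐-trans (·-cong (inv₂ (ψ u)) (≐-sym (ψ-V u))) (inv₂-cancelˡ {ψ u} (V u) (detψ u))

        quotient-e₁ : ∀ x u → (x ⊗ inv₂ (ψ u)) · e₁ ≐ x · V u
        quotient-e₁ x u = ≐-trans (·-⊗ x (inv₂ (ψ u)) e₁) (·-cong x (ψ⁻¹-e₁ u))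

        det-quotient : ∀ x u → det x ≋ + 1 → det (x ⊗ inv₂ (ψ u)) ≋ + 1
        det-quotient x u dx = det-⊗-unimodular {x} {inv₂ (ψ u)} dx (inv₂-unimodular {ψ u} (detψ u))

        covers : ∀ x → InSL p x → ∃ λ u → H (x ⊗ inv₂ (ψ u))
        covers x dx = u , H⇐ (x ⊗ inv₂ (ψ u)) (det-quotient x u dx′)
            (~-trans (≐⇒~ (quotient-e₁ x u))
              (~-trans (·-~ x (V-vertex (inv₂ x · e₁) nz)) (≐⇒~ (inv₂-cancelʳ {x} e₁ dx′))))
          where
          dx′ : det x ≋ + 1
          dx′ = congruent dx
          nz : NonZeroVector (inv₂ x · e₁)
          nz = ·-nonzero (≉0-resp (≋-sym (inv₂-unimodular {x} dx′)) 1≉0) e₁-nonzero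
          u : Fin (n Γ)
          u = vertex (inv₂ x · e₁) nz

        injective : ∀ u w → H (ψ u ⊗ inv₂ (ψ w)) → u ≡ w
        injective u w h = V-injective (~-trans (≐⇒~ (≐-sym (ψ⁻¹-e₁ u)))
          (~-trans
            (·-~ (inv₂ (ψ u)) (~-sym (~-trans (≐⇒~ (≐-sym (quotient-e₁ (ψ u) w))) (H⇒ (ψ u ⊗ inv₂ (ψ w)) h))))
            (≐⇒~ (inv₂-cancelˡ (V w) (detψ u)))))

        D-quotient : ∀ u w → D e₁ ((ψ w ⊗ inv₂ (ψ u)) · e₁) ≋ D (V w) (V u)
        D-quotient u w = ≋-trans (D-cong (≐-sym (ψ-V w)) (quotient-e₁ (ψ w) u))
          (≋-trans {D (ψ w · V w) (ψ w · V u)} {det (ψ w) * D (V w) (V u)} {D (V w) (V u)} (lin₀ (D-· (ψ w) (V w) (V u))) (lin₁ (D (V w) (V u)) (detψ w) (lem (det (ψ w)) (D (V w) (V u)))))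
          where lem : ∀ a d → a * d - d ≡ d * (a - + 1)
                lem = solve-∀

        adjacency : ∀ u w → Adj Γ u w ⇔ DoubleCoset g (ψ w ⊗ inv₂ (ψ u))
        adjacency u w = mk⇔
          (λ h → in-coset⇐ (ψ w ⊗ inv₂ (ψ u)) (det-quotient (ψ w) u (detψ w)) (Sq-resp (≋-sym (D-quotient u w)) (Sq-D-sym (adj⇒ h))))
          (λ h → adj⇐ (Sq-D-sym (Sq-resp (D-quotient u w) (in-coset⇒ (ψ w ⊗ inv₂ (ψ u)) h))))

    model⇒coset-graph : 5 ℕ.< p → IsCosetGraphC p Γ
    model⇒coset-graph 5<p = a , b , c , 0 , congruence det-a , congruence det-b , congruence det-c , order-a , order-b , normaliser-a , order-c , normaliser-b² 5<p ,
      core-free , generates , inverse-coset , ψ , (λ u → congruence (detψ u)) , covers , injective , adjacency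

open import Data.Nat.Base using (_≡ᵇ_)

-- The icosahedron as Γ(5), by finite tables.

module Icosahedron (prime : Prime 5) (5%4≡1 : 5 % 4 ≡ 1) where

  open import Defs hiding (_^_; sym; inv; pres)
  open PrimeField 5 prime
  open Squares 5 prime 5%4≡1
  open Plane 5 prime 5%4≡1
  open SquareClassModels 5 prime 5%4≡1
  open import Data.Integer.DivMod using (_%ℕ_; _/ℕ_; n%ℕd<d; a≡a%ℕn+[a/ℕn]*n)
  open import Data.Bool.Base using (_∧_; _∨_)
  import Data.Bool.Properties as Boolₚ
  open import Data.Fin.Properties using (all?)
  open import Data.Vec.Base using ([]; _∷_; lookup)
  open import Relation.Nullary using (does; _⊎-dec_)
  open import Relation.Nullary.Decidable using (from-yes)

  -- A labelling of the vertices by the nonzero vectors modulo ±1, found by a computer search.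
  coordinate₁ coordinate₂ : Fin 12 → ℤ
  coordinate₁ = lookup (+ 1 ∷ + 0 ∷ + 1 ∷ + 2 ∷ + 2 ∷ + 1 ∷ + 1 ∷ + 1 ∷ + 2 ∷ + 0 ∷ + 2 ∷ + 2 ∷ [])
  coordinate₂ = lookup (+ 0 ∷ + 1 ∷ + 1 ∷ + 1 ∷ + 4 ∷ + 4 ∷ + 3 ∷ + 2 ∷ + 3 ∷ + 2 ∷ + 2 ∷ + 0 ∷ [])

  isZero isSquare5 : ℤ → Bool
  isZero z = (z %ℕ 5) ≡ᵇ 0
  isSquare5 z = ((z %ℕ 5) ≡ᵇ 1) ∨ ((z %ℕ 5) ≡ᵇ 4)

  -- Modulo 5 the nonzero squares are ±1, so being in one class means being equal up to sign, which
  -- a table can decide.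
  parallel : ℤ → ℤ → ℤ → ℤ → Bool
  parallel x y z w = (isZero (z - x) ∧ isZero (w - y)) ∨ (isZero (z + x) ∧ isZero (w + y))

  adj-table : ∀ u v → adj icosahedron u v ≡ isSquare5 (coordinate₁ u * coordinate₂ v - coordinate₂ u * coordinate₁ v)
  adj-table = from-yes (all? λ u → all? λ v → adj icosahedron u v Boolₚ.≟ isSquare5 (coordinate₁ u * coordinate₂ v - coordinate₂ u * coordinate₁ v))

  parallel-table : ∀ u v → parallel (coordinate₁ u) (coordinate₂ u) (coordinate₁ v) (coordinate₂ v) ≡ does (u ≟ v)
  parallel-table = from-yes (all? λ u → all? λ v → parallel (coordinate₁ u) (coordinate₂ u) (coordinate₁ v) (coordinate₂ v) Boolₚ.≟ does (u ≟ v))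

  nonzero-table : ∀ u → isZero (coordinate₁ u) ∧ isZero (coordinate₂ u) ≡ false
  nonzero-table = from-yes (all? λ u → (isZero (coordinate₁ u) ∧ isZero (coordinate₂ u)) Boolₚ.≟ false)

  Covered : Fin 5 → Fin 5 → Set
  Covered i j = (isZero (+ toℕ i) ∧ isZero (+ toℕ j) ≡ true) ⊎
    (∃ λ u → parallel (coordinate₁ u) (coordinate₂ u) (+ toℕ i) (+ toℕ j) ≡ true)

  covered? : ∀ i j → Dec (Covered i j)
  covered? i j = ((isZero (+ toℕ i) ∧ isZero (+ toℕ j)) Boolₚ.≟ true) ⊎-dec
    any? λ u → parallel (coordinate₁ u) (coordinate₂ u) (+ toℕ i) (+ toℕ j) Boolₚ.≟ true

  all-covered? : Dec (∀ i j → Covered i j)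
  all-covered? = all? λ i → all? λ j → covered? i j

  onto-table : ∀ i j → Covered i j
  onto-table = from-yes all-covered?

  abstract
    rem-≋ : ∀ z → + (z %ℕ 5) ≋ z
    rem-≋ z = mod-intro (- (z /ℕ 5)) (trans (cong (λ x → + (z %ℕ 5) - x) (a≡a%ℕn+[a/ℕn]*n z 5)) (lem (+ (z %ℕ 5)) (z /ℕ 5) (+ 5)))
      where lem : ∀ r q n → r - (r + q * n) ≡ (- q) * n
            lem = solve-∀

    isZero⇒ : ∀ {z} → isZero z ≡ true → z ≋ + 0
    isZero⇒ {z} h = go (z %ℕ 5) refl h
      where
      go : ∀ r → z %ℕ 5 ≡ r → (r ≡ᵇ 0) ≡ true → z ≋ + 0
      go zero e _ = ≋-trans (≋-sym (rem-≋ z)) (lin₀ (cong +_ e))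
      go (suc _) e ()

    isZero⇐ : ∀ {z} → z ≋ + 0 → isZero z ≡ true
    isZero⇐ {z} h = go (z %ℕ 5) refl (n%ℕd<d z 5)
      where
      go : ∀ r → z %ℕ 5 ≡ r → r ℕ.< 5 → (r ≡ᵇ 0) ≡ true
      go zero e _ = refl
      go (suc r) e r<5 = contradiction (≋-trans (lin₀ (cong +_ (sym e))) (≋-trans (rem-≋ z) h)) (small≉0 (ℕ.s≤s ℕ.z≤n) r<5)

    Sq-4 : Sq (+ 4)
    Sq-4 = square (+ 2) 2≉0 ≋-refl

    -- If 2 were a square, so would be 3 = -2, and together with 1 and 4 every nonzero residue, the
    -- nonsquare ν included.
    ¬Sq-2 : ¬ Sq (+ 2)
    ¬Sq-2 s = ν-nonsquare (Sq-resp (residue-≋ ν) (go (residue ν) (≉0-resp (≋-sym (residue-≋ ν)) ν≉0)))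
      where
      go : ∀ (r : Fin 5) → + toℕ r ≉ + 0 → Sq (+ toℕ r)
      go zero r≉0 = contradiction ≋-refl r≉0
      go (suc zero) _ = Sq-one
      go (suc (suc zero)) _ = s
      go (suc (suc (suc zero))) _ = Sq-resp (mod-intro (- + 1) refl) (Sq-neg s)
      go (suc (suc (suc (suc zero)))) _ = Sq-4

    isSquare5⇒ : ∀ {z} → isSquare5 z ≡ true → Sq z
    isSquare5⇒ {z} h = go (z %ℕ 5) refl h
      where
      go : ∀ r → z %ℕ 5 ≡ r → ((r ≡ᵇ 1) ∨ (r ≡ᵇ 4)) ≡ true → Sq z
      go 1 e _ = Sq-resp (≋-trans (lin₀ (cong +_ (sym e))) (rem-≋ z)) Sq-one
      go 4 e _ = Sq-resp (≋-trans (lin₀ (cong +_ (sym e))) (rem-≋ z)) Sq-4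
      go 0 e ()
      go 2 e ()
      go 3 e ()
      go (suc (suc (suc (suc (suc _))))) e ()

    Sq⇒rem : ∀ {z} → Sq z → (z %ℕ 5 ≡ 1) ⊎ (z %ℕ 5 ≡ 4)
    Sq⇒rem {z} s = go (z %ℕ 5) refl (n%ℕd<d z 5)
      where
      at : ∀ {r} → z %ℕ 5 ≡ r → Sq (+ r)
      at e = Sq-resp (≋-trans (≋-sym (rem-≋ z)) (lin₀ (cong +_ e))) s
      go : ∀ r → z %ℕ 5 ≡ r → r ℕ.< 5 → (z %ℕ 5 ≡ 1) ⊎ (z %ℕ 5 ≡ 4)
      go 0 e _ = contradiction ≋-refl (Sq⇒≉0 (at e))
      go 1 e _ = inj₁ e
      go 2 e _ = contradiction (at e) ¬Sq-2
      go 3 e _ = contradiction (Sq-resp (mod-intro (- + 1) refl) (Sq-neg (at e))) ¬Sq-2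
      go 4 e _ = inj₂ e
      go (suc (suc (suc (suc (suc _))))) e (ℕ.s≤s (ℕ.s≤s (ℕ.s≤s (ℕ.s≤s (ℕ.s≤s ())))))

    isSquare5⇐ : ∀ {z} → Sq z → isSquare5 z ≡ true
    isSquare5⇐ {z} s with Sq⇒rem s
    ... | inj₁ e = cong (λ r → (r ≡ᵇ 1) ∨ (r ≡ᵇ 4)) e
    ... | inj₂ e = cong (λ r → (r ≡ᵇ 1) ∨ (r ≡ᵇ 4)) e

    Sq⇒sign : ∀ {z} → Sq z → z ≋ + 1 ⊎ z ≋ - + 1
    Sq⇒sign {z} s with Sq⇒rem s
    ... | inj₁ e = inj₁ (≋-trans (≋-sym (rem-≋ z)) (lin₀ (cong +_ e)))
    ... | inj₂ e = inj₂ (≋-trans (≋-sym (rem-≋ z)) (≋-trans (lin₀ (cong +_ e)) (mod-intro (+ 1) refl)))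

    ∧-split : ∀ {x y} → x ∧ y ≡ true → x ≡ true × y ≡ true
    ∧-split {true} {true} h = refl , refl
    ∧-split {true} {false} ()
    ∧-split {false} ()

    ∨-split : ∀ {x y} → x ∨ y ≡ true → x ≡ true ⊎ y ≡ true
    ∨-split {true} h = inj₁ refl
    ∨-split {false} h = inj₂ h

    ∨-right : ∀ x {y} → y ≡ true → x ∨ y ≡ true
    ∨-right true h = refl
    ∨-right false h = h

  opaque
    unfolding _∙_ D

    parallel⇒~ : ∀ x y z w → parallel x y z w ≡ true → ⟨ x , y ⟩ ~ ⟨ z , w ⟩
    parallel⇒~ x y z w h = go (∨-split {isZero (z - x) ∧ isZero (w - y)} h)
      where
      go : isZero (z - x) ∧ isZero (w - y) ≡ true ⊎ isZero (z + x) ∧ isZero (w + y) ≡ true → ⟨ x , y ⟩ ~ ⟨ z , w ⟩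
      go (inj₁ e) = let e₁′ , e₂′ = ∧-split {isZero (z - x)} {isZero (w - y)} e in
        scaled (+ 1) Sq-one (lin₁ {a = z - x} {+ 0} (+ 1) (isZero⇒ {z - x} e₁′) (lem z x) ,, lin₁ {a = w - y} {+ 0} (+ 1) (isZero⇒ {w - y} e₂′) (lem w y))
        where lem : ∀ z x → z - + 1 * x ≡ + 1 * (z - x - + 0)
              lem = solve-∀
      go (inj₂ e) = let e₁′ , e₂′ = ∧-split {isZero (z + x)} {isZero (w + y)} e in
        scaled (- + 1) Sq-minus-one (lin₁ {a = z + x} {+ 0} (+ 1) (isZero⇒ {z + x} e₁′) (lem z x) ,, lin₁ {a = w + y} {+ 0} (+ 1) (isZero⇒ {w + y} e₂′) (lem w y))
        where lem : ∀ z x → z - (- + 1) * x ≡ + 1 * (z + x - + 0)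
              lem = solve-∀

    ~⇒parallel : ∀ x y z w → ⟨ x , y ⟩ ~ ⟨ z , w ⟩ → parallel x y z w ≡ true
    ~⇒parallel x y z w (scaled f S (e ,, e′)) = go (Sq⇒sign S)
      where
      both : ∀ {a b} → a ≡ true → b ≡ true → a ∧ b ≡ true
      both refl refl = refl
      left : ∀ {a b} → a ≡ true → a ∨ b ≡ true
      left refl = refl
      go : f ≋ + 1 ⊎ f ≋ - + 1 → parallel x y z w ≡ true
      go (inj₁ h) = left (both (isZero⇐ {z - x} (lin₂ (+ 1) e x h (lem z x f))) (isZero⇐ {w - y} (lin₂ (+ 1) e′ y h (lem w y f))))
        where lem : ∀ z x f → z - x - + 0 ≡ + 1 * (z - f * x) + x * (f - + 1)
              lem = solve-∀
      go (inj₂ h) = ∨-right (isZero (z - x) ∧ isZero (w - y)) (both (isZero⇐ {z + x} (lin₂ (+ 1) e x h (lem z x f))) (isZero⇐ {w + y} (lin₂ (+ 1) e′ y h (lem w y f))))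
        where lem : ∀ z x f → z + x - + 0 ≡ + 1 * (z - f * x) + x * (f - - + 1)
              lem = solve-∀

    does-≡ : ∀ (u v : Fin 12) → does (u ≟ v) ≡ true → u ≡ v
    does-≡ u v h with u ≟ v
    ... | Relation.Nullary.yes e = e
    does-≡ u v () | Relation.Nullary.no _

    vec : Fin 12 → V2
    vec u = ⟨ coordinate₁ u , coordinate₂ u ⟩

    vec-nonzero : ∀ u → NonZeroVector (vec u)
    vec-nonzero u (e ,, e′) = contradiction (trans (sym (cong₂ _∧_ (isZero⇐ {coordinate₁ u} e) (isZero⇐ {coordinate₂ u} e′))) (nonzero-table u)) λ ()

    vec-injective : ∀ {u v} → vec u ~ vec v → u ≡ v
    vec-injective {u} {v} h = does-≡ u v (trans (sym (parallel-table u v)) (~⇒parallel (coordinate₁ u) (coordinate₂ u) (coordinate₁ v) (coordinate₂ v) h))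

    vec-onto : ∀ x → NonZeroVector x → ∃ λ u → vec u ~ x
    vec-onto ⟨ x , y ⟩ nz = go (onto-table (residue x) (residue y))
      where
      go : (isZero (+ toℕ (residue x)) ∧ isZero (+ toℕ (residue y)) ≡ true) ⊎
           (∃ λ u → parallel (coordinate₁ u) (coordinate₂ u) (+ toℕ (residue x)) (+ toℕ (residue y)) ≡ true) → ∃ λ u → vec u ~ ⟨ x , y ⟩
      go (inj₁ e) = let e₁′ , e₂′ = ∧-split {isZero (+ toℕ (residue x))} {isZero (+ toℕ (residue y))} e in
        contradiction (≋-trans (≋-sym (residue-≋ x)) (isZero⇒ {+ toℕ (residue x)} e₁′) ,, ≋-trans (≋-sym (residue-≋ y)) (isZero⇒ {+ toℕ (residue y)} e₂′)) nz
      go (inj₂ (u , e)) = u , ~-trans {vec u} {⟨ + toℕ (residue x) , + toℕ (residue y) ⟩} {⟨ x , y ⟩}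
        (parallel⇒~ (coordinate₁ u) (coordinate₂ u) (+ toℕ (residue x)) (+ toℕ (residue y)) e) (≐⇒~ (residue-≋ x ,, residue-≋ y))

    vec-adj⇒ : ∀ {u v} → Adj icosahedron u v → Sq (D (vec u) (vec v))
    vec-adj⇒ {u} {v} h = isSquare5⇒ (trans (sym (adj-table u v)) h)

    vec-adj⇐ : ∀ {u v} → Sq (D (vec u) (vec v)) → Adj icosahedron u v
    vec-adj⇐ {u} {v} s = trans (adj-table u v) (isSquare5⇐ s)

  icosahedron-model : Model icosahedron
  icosahedron-model = record
    { V = vec
    ; V-nonzero = vec-nonzero
    ; V-injective = vec-injective
    ; vertex = λ x x≉0 → proj₁ (vec-onto x x≉0)
    ; V-vertex = λ x x≉0 → proj₂ (vec-onto x x≉0)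
    ; adj⇒ = vec-adj⇒
    ; adj⇐ = vec-adj⇐
    }

-- Assembly of the two characterisations through Γ(p).

open import Defs hiding (sym)
open import Data.Nat.Properties using (m≤n⇒m<n∨m≡n)

icosahedron-five : ∀ {p} (pr : Prime p) (p%4≡1 : p % 4 ≡ 1) → p ≡ 5 → SquareClassModels.Model p pr p%4≡1 icosahedron
icosahedron-five pr 5%4≡1 refl = Icosahedron.icosahedron-model pr 5%4≡1

module _ (p : ℕ) (prime : Prime p) (p%4≡1 : p % 4 ≡ 1) where
  open SquareClassModels p prime p%4≡1 using (Model; models-isomorphic; transport-model; module Metric)

  InC⇒model : ∀ {Γ} → InC p Γ → Model Γ
  InC⇒model (inj₁ (p≡5 , f)) = transport-model f (icosahedron-five prime p%4≡1 p≡5)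
  InC⇒model (inj₂ (_ , C)) = CosetModel.coset-graph⇒model p prime p%4≡1 C

  model⇒InC : ∀ {Γ} → Model Γ → InC p Γ
  model⇒InC {Γ} M = split (m≤n⇒m<n∨m≡n (Squares.p≥5 p prime p%4≡1))
    where
    split : 5 ℕ.< p ⊎ 5 ≡ p → InC p Γ
    split (inj₁ 5<p) = inj₂ (5<p , ModelCoset.model⇒coset-graph p prime p%4≡1 M 5<p)
    split (inj₂ 5≡p) = inj₁ (sym 5≡p , models-isomorphic M (icosahedron-five prime p%4≡1 (sym 5≡p)))

  model⇒cover : ∀ {Γ} → Model Γ →
    Connected Γ × ¬ Bipartite Γ × AntipodalDoubleCoverOfK Γ (suc p) × AutIsoPSL×Z2 p Γ
  model⇒cover M = Metric.connected M , Metric.not-bipartite M , Metric.antipodal-cover M ,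
    Automorphisms.automorphism-group p prime p%4≡1 M

  cover⇒InC : ∀ {Γ} → Connected Γ × ¬ Bipartite Γ × AntipodalDoubleCoverOfK Γ (suc p) × AutIsoPSL×Z2 p Γ → InC p Γ
  cover⇒InC (conn , ¬bip , cover , iso) =
    model⇒InC (Covers.cover⇒model p prime p%4≡1 (DoubleCovers.doubleCover cover) iso conn ¬bip)

  model⇒geodesic : ∀ {Γ} → Model Γ → GeodesicTransitive Γ × Diameter Γ 3
  model⇒geodesic M = Geodesics.geodesic-transitive p prime p%4≡1 M , Metric.diameter-3 M

theorem1p2 : (p : ℕ) → Prime p → p % 4 ≡ 1 →
    ((Γ : Graph) → InC p Γ ⇔
      (Connected Γ × ¬ Bipartite Γ × AntipodalDoubleCoverOfK Γ (suc p) × AutIsoPSL×Z2 p Γ))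
    ×
    ((Γ Δ : Graph) → InC p Γ → InC p Δ → Iso Γ Δ)
    ×
    ((Γ : Graph) → InC p Γ → GeodesicTransitive Γ × Diameter Γ 3)
theorem1p2 p pr p%4≡1 =
  (λ Γ → mk⇔ (λ C → model⇒cover p pr p%4≡1 {Γ} (InC⇒model p pr p%4≡1 {Γ} C)) (cover⇒InC p pr p%4≡1 {Γ})) ,
  (λ Γ Δ C C′ → SquareClassModels.models-isomorphic p pr p%4≡1 {Γ} {Δ} (InC⇒model p pr p%4≡1 {Γ} C) (InC⇒model p pr p%4≡1 {Δ} C′)) ,
  (λ Γ C → model⇒geodesic p pr p%4≡1 {Γ} (InC⇒model p pr p%4≡1 {Γ} C))
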